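{- Let $n\ge 2$ be an integer, let $\varepsilon$ be a positive real number and let $a_1,\ldots ,a_n$ be non-zero rational numbers. There exists a positive number $s_0$, which is effectively computable in terms of $\varepsilon$ and $a_1,\ldots ,a_n$, with the property that for every integer $s\geq s_0$ there is a set of primes $S$ of cardinality $s$ such that the equation $$a_1x_1+a_2x_2+\cdots +a_nx_n=1\quad\text{in $S$-units } x_1,\ldots ,x_n$$ has at least $$\exp\Big\{(1-\varepsilon )\frac{n^2}{n-1}\, s^{1-1/n}(\log s)^{ -1/n}\Big\}$$ non-degenerate solutions $(x_1,\ldots ,x_n)$.
   Context: For a set $S$ of (rational) prime numbers, an $S$-unit is a non-zero rational number (of either sign) such that both the denominator and the numerator of its simplified representation are composed of primes from $S$. A solution $(x_1,\ldots ,x_n)$ of $a_1x_1+\cdots +a_nx_n=1$ is called degenerate if there is some non-empty proper subset $\{i_1,\ldots ,i_k\}$ of $\{1,\ldots ,n\}$ such that $a_{i_1}x_{i_1}+\cdots +a_{i_k}x_{i_k}=0$, and non-degenerate otherwise. -}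

module Defs where

open import Data.Bool.Base using (true; false; if_then_else_)
open import Data.Fin.Subset using (Subset; Nonempty; _⊂_; ⊤)
open import Data.Integer.Base as ℤ using (+_)
import Data.Integer.Properties as ℤₚ
open import Data.List.Base using (List; length)
open import Data.List.Membership.Propositional using (_∈_)
open import Data.List.Relation.Unary.All using (All)
open import Data.List.Relation.Unary.Unique.Propositional using (Unique)
open import Data.Nat.Base as ℕ using (ℕ; zero; suc; _!; s≤s; z≤n)
open import Data.Nat.Coprimality as Coprimality using (1-coprimeTo)
import Data.Nat.Divisibility as ℕ∣
open import Data.Nat.Primality using (Prime)
import Data.Nat.Properties as ℕₚ
open import Data.Product using (∃-syntax; _×_; _,_; proj₁; proj₂)
open import Data.Rational using (ℚ; mkℚ; _+_; _*_; _-_; -_; _/_; 1/_; ∣_∣; _≤_; _<_; 0ℚ; 1ℚ; ½; ↥_; ↧_; ↧ₙ_; _⊓_; _⊔_; *≤*; *<*; nonNegative; positive; toℚᵘ; ≢-nonZero; >-nonZero; +-*-rawSemiring)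
open import Data.Rational.Properties renaming (_≟_ to _≟ℚ_)
open import Data.Rational.Solver using (module +-*-Solver)
import Data.Rational.Unnormalised.Base as ℚᵘ
import Data.Rational.Unnormalised.Properties as ℚᵘₚ
open import Data.Sum.Base using (_⊎_; inj₁; inj₂)
open import Data.Vec.Base using (Vec; lookup)
open import Relation.Binary.PropositionalEquality using (_≡_; _≢_; refl; sym; trans; cong; cong₂; subst; subst₂)
open import Relation.Nullary using (¬_; yes; no; does; contradiction)

open import Algebra.Definitions.RawSemiring +-*-rawSemiring using (_^_)
open import Algebra.Properties.CommutativeMonoid.Sum +-0-commutativeMonoid using (sum)

open +-*-Solver using (solve; _:=_; _:+_; _:*_; _:-_; :-_; con)

private

  by : ∀ {p q r} → 0ℚ ≤ r → r ≡ q - p → p ≤ q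
  by {p} {q} 0≤r r≡ = subst₂ _≤_ (+-identityˡ p)
    (solve 2 (λ p q → (q :- p) :+ p := q) refl p q)
    (+-monoˡ-≤ p (subst (0ℚ ≤_) r≡ 0≤r))

  diff : ∀ {p q} → p ≤ q → 0ℚ ≤ q - p
  diff {p} {q} p≤q = subst (_≤ q - p) (+-inverseʳ p) (+-monoˡ-≤ (- p) p≤q)

  diff< : ∀ {p q} → p < q → 0ℚ < q - p
  diff< {p} {q} p<q = subst (_< q - p) (+-inverseʳ p) (+-monoˡ-< (- p) p<q)

  0≤+ : ∀ {p q} → 0ℚ ≤ p → 0ℚ ≤ q → 0ℚ ≤ p + q
  0≤+ = +-mono-≤

  0<+ : ∀ {p q} → 0ℚ < p → 0ℚ ≤ q → 0ℚ < p + q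
  0<+ = +-mono-<-≤

  0≤* : ∀ {p q} → 0ℚ ≤ p → 0ℚ ≤ q → 0ℚ ≤ p * q
  0≤* {p} {q} 0≤p 0≤q = nonNegative⁻¹ (p * q)
    {{nonNeg*nonNeg⇒nonNeg p {{nonNegative 0≤p}} q {{nonNegative 0≤q}}}}

  0<* : ∀ {p q} → 0ℚ < p → 0ℚ < q → 0ℚ < p * q
  0<* {p} {q} 0<p 0<q = positive⁻¹ (p * q) {{pos*pos⇒pos p {{positive 0<p}} q {{positive 0<q}}}}

  *-monoˡ : ∀ {p q} r → 0ℚ ≤ r → p ≤ q → r * p ≤ r * q
  *-monoˡ r 0≤r = *-monoˡ-≤-nonNeg r {{nonNegative 0≤r}}

  *-monoʳ : ∀ {p q} r → 0ℚ ≤ r → p ≤ q → p * r ≤ q * r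
  *-monoʳ r 0≤r = *-monoʳ-≤-nonNeg r {{nonNegative 0≤r}}

  *-mono : ∀ {p q r s} → 0ℚ ≤ p → 0ℚ ≤ r → p ≤ q → r ≤ s → p * r ≤ q * s
  *-mono {p} {q} {r} {s} 0≤p 0≤r p≤q r≤s =
    ≤-trans (*-monoʳ r 0≤r p≤q) (*-monoˡ q (≤-trans 0≤p p≤q) r≤s)

  0<1 : 0ℚ < 1ℚ
  0<1 = *<* (ℤ.+<+ (s≤s z≤n))

  0<½ : 0ℚ < ½
  0<½ = *<* (ℤ.+<+ (s≤s z≤n))

  ½<1 : ½ < 1ℚ
  ½<1 = *<* (ℤ.+<+ (s≤s (s≤s z≤n)))

  0≤1 : 0ℚ ≤ 1ℚ
  0≤1 = <⇒≤ 0<1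

  halves : ∀ p → ½ * p + ½ * p ≡ p
  halves p = trans (sym (*-distribʳ-+ p ½ ½)) (*-identityˡ p)

  p≤∣p∣ : ∀ p → p ≤ ∣ p ∣
  p≤∣p∣ p with ≤-total 0ℚ p
  ... | inj₁ 0≤p = ≤-reflexive (sym (0≤p⇒∣p∣≡p 0≤p))
  ... | inj₂ p≤0 = ≤-trans p≤0 (0≤∣p∣ p)

  ∣∣≤ : ∀ {p r} → p ≤ r → - p ≤ r → ∣ p ∣ ≤ r
  ∣∣≤ {p} {r} p≤r -p≤r with ∣p∣≡p∨∣p∣≡-p p
  ... | inj₁ eq = subst (_≤ r) (sym eq) p≤r
  ... | inj₂ eq = subst (_≤ r) (sym eq) -p≤r

  ∣-∣-sym : ∀ p q → ∣ p - q ∣ ≡ ∣ q - p ∣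
  ∣-∣-sym p q = trans (sym (∣-p∣≡∣p∣ (p - q)))
    (cong ∣_∣ (solve 2 (λ p q → :- (p :- q) := q :- p) refl p q))

  ∣-∣-triangle : ∀ p q r → ∣ p - r ∣ ≤ ∣ p - q ∣ + ∣ q - r ∣
  ∣-∣-triangle p q r = subst (λ z → ∣ z ∣ ≤ ∣ p - q ∣ + ∣ q - r ∣)
    (solve 3 (λ p q r → (p :- q) :+ (q :- r) := p :- r) refl p q r)
    (∣p+q∣≤∣p∣+∣q∣ (p - q) (q - r))

  recip⁺ : ∀ {p} → 0ℚ < p → ∃[ r ] 0ℚ < r × r * p ≡ 1ℚ
  recip⁺ {p} 0<p = r , positive⁻¹ r {{1/pos⇒pos p {{positive 0<p}}}} ,
                   *-inverseˡ p {{>-nonZero 0<p}}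
    where r = (1/ p) {{>-nonZero 0<p}}

  ^-nonNeg : ∀ {p} → 0ℚ ≤ p → ∀ k → 0ℚ ≤ p ^ k
  ^-nonNeg 0≤p zero    = 0≤1
  ^-nonNeg 0≤p (suc k) = 0≤* 0≤p (^-nonNeg 0≤p k)

  ^-mono : ∀ {p q} → 0ℚ ≤ p → p ≤ q → ∀ k → p ^ k ≤ q ^ k
  ^-mono 0≤p p≤q zero    = ≤-refl
  ^-mono 0≤p p≤q (suc k) = *-mono 0≤p (^-nonNeg 0≤p k) p≤q (^-mono 0≤p p≤q k)

  ∣^∣ : ∀ p k → ∣ p ^ k ∣ ≡ ∣ p ∣ ^ k
  ∣^∣ p zero    = refl
  ∣^∣ p (suc k) = trans (∣p*q∣≡∣p∣*∣q∣ p (p ^ k)) (cong (∣ p ∣ *_) (∣^∣ p k))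

  ^-distrib : ∀ p q k → (p * q) ^ k ≡ p ^ k * q ^ k
  ^-distrib p q zero    = refl
  ^-distrib p q (suc k) = trans (cong ((p * q) *_) (^-distrib p q k))
    (solve 4 (λ p q a b → (p :* q) :* (a :* b) := (p :* a) :* (q :* b)) refl p q (p ^ k) (q ^ k))

fromℕ : ℕ → ℚ
fromℕ n = + n / 1

private

  fromℕ-nf : ∀ n → fromℕ n ≡ mkℚ (+ n) 0 (Coprimality.sym (1-coprimeTo n))
  fromℕ-nf n = ↥p/↧p≡p (mkℚ (+ n) 0 (Coprimality.sym (1-coprimeTo n)))

  fromℕ-suc : ∀ n → fromℕ (suc n) ≡ 1ℚ + fromℕ n
  fromℕ-suc n = sym (trans (cong (λ z → 1ℚ + z) (fromℕ-nf n))
    (cong (_/ 1) (cong₂ ℤ._+_ (refl {x = + 1}) (ℤₚ.*-identityʳ (+ n)))))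

  fromℕ-mono : ∀ {m n} → m ℕ.≤ n → fromℕ m ≤ fromℕ n
  fromℕ-mono {m} {n} m≤n = subst₂ _≤_ (sym (fromℕ-nf m)) (sym (fromℕ-nf n))
    (*≤* (ℤₚ.*-monoʳ-≤-nonNeg (+ 1) (ℤ.+≤+ m≤n)))

  fromℕ-nonNeg : ∀ n → 0ℚ ≤ fromℕ n
  fromℕ-nonNeg n = fromℕ-mono {0} {n} z≤n

  ≤fromℕ : ∀ p → ∃[ n ] p ≤ fromℕ n
  ≤fromℕ p@(mkℚ (+ k) d _) = k , subst (p ≤_) (sym (fromℕ-nf k))
    (*≤* (ℤₚ.*-monoˡ-≤-nonNeg (+ k) (ℤ.+≤+ (s≤s z≤n))))
  ≤fromℕ p@(mkℚ ℤ.-[1+ k ] d _) = 0 , nonPositive⁻¹ p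

  archimedean : ∀ {p} → 0ℚ < p → ∃[ n ] 1ℚ ≤ fromℕ n * p
  archimedean {p} 0<p with recip⁺ 0<p
  ... | r , 0<r , rp≡1 with ≤fromℕ r
  ... | n , r≤n = n , subst (_≤ fromℕ n * p) rp≡1 (*-monoʳ p (<⇒≤ 0<p) r≤n)

  fromℕ-* : ∀ m n → fromℕ (m ℕ.* n) ≡ fromℕ m * fromℕ n
  fromℕ-* m n = sym (trans (cong₂ _*_ (fromℕ-nf m) (fromℕ-nf n))
    (cong (_/ 1) (sym (ℤₚ.pos-* m n))))

  1/n*n≡1 : ∀ n .{{_ : ℕ.NonZero n}} → (+ 1 / n) * fromℕ n ≡ 1ℚ
  1/n*n≡1 n@(suc m) = toℚᵘ-injective (ℚᵘₚ.≃-trans (toℚᵘ-homo-* (+ 1 / n) (fromℕ n))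
    (ℚᵘₚ.≃-trans (ℚᵘₚ.*-cong (toℚᵘ-fromℚᵘ (ℚᵘ.mkℚᵘ (+ 1) m)) (toℚᵘ-fromℚᵘ (ℚᵘ.mkℚᵘ (+ n) 0)))
      (ℚᵘ.*≡* (cong +_ (trans (ℕₚ.*-identityʳ (n ℕ.+ 0))
        (cong (ℕ._+ 0) (sym (ℕₚ.*-identityʳ n))))))))

  1/n-nonNeg : ∀ n .{{_ : ℕ.NonZero n}} → 0ℚ ≤ + 1 / n
  1/n-nonNeg n = nonNegative⁻¹ (+ 1 / n) {{normalize-nonNeg 1 n}}

infix 4 _<ᴿ_ _≤ᴿ_
infixl 6 _+ᴿ_ _-ᴿ_
infixl 7 _*ᴿ_

IsCauchy : (ℕ → ℚ) → Set
IsCauchy x = ∀ ε → 0ℚ < ε → ∃[ N ] ∀ m n → N ℕ.≤ m → N ℕ.≤ n → ∣ x m - x n ∣ ≤ ε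

record ℝ : Set where
  constructor mkℝ
  field
    seq    : ℕ → ℚ
    cauchy : IsCauchy seq

open ℝ public

Eventually : (ℕ → Set) → Set
Eventually P = ∃[ N ] ∀ m → N ℕ.≤ m → P m

_<ᴿ_ : ℝ → ℝ → Set
x <ᴿ y = ∃[ δ ] 0ℚ < δ × Eventually (λ m → seq x m + δ ≤ seq y m)

_≤ᴿ_ : ℝ → ℝ → Set
x ≤ᴿ y = ¬ (y <ᴿ x)

private

  Vanishing : (ℕ → ℕ → ℚ) → Set
  Vanishing e = ∀ ε → 0ℚ < ε → ∃[ N ] ∀ m n → N ℕ.≤ m → N ℕ.≤ n → e m n ≤ ε

  vanish-+ : ∀ {e f} → Vanishing e → Vanishing f → Vanishing (λ m n → e m n + f m n)
  vanish-+ ve vf ε 0<ε with ve (½ * ε) (0<* 0<½ 0<ε) | vf (½ * ε) (0<* 0<½ 0<ε)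
  ... | N , p | M , q = N ℕ.⊔ M , λ m n hm hn → ≤-trans
    (+-mono-≤ (p m n (ℕₚ.m⊔n≤o⇒m≤o N M hm) (ℕₚ.m⊔n≤o⇒m≤o N M hn))
              (q m n (ℕₚ.m⊔n≤o⇒n≤o N M hm) (ℕₚ.m⊔n≤o⇒n≤o N M hn)))
    (≤-reflexive (halves ε))

  vanish-* : ∀ {e} c → 0ℚ ≤ c → Vanishing e → Vanishing (λ m n → c * e m n)
  vanish-* {e} c 0≤c ve ε 0<ε = bound (recip⁺ 0<c+1)
    where
    0<c+1 : 0ℚ < 1ℚ + c
    0<c+1 = 0<+ 0<1 0≤c
    bound : ∃[ r ] 0ℚ < r × r * (1ℚ + c) ≡ 1ℚ →
            ∃[ N ] ∀ m n → N ℕ.≤ m → N ℕ.≤ n → c * e m n ≤ ε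
    bound (r , 0<r , r≡) with ve (r * ε) (0<* 0<r 0<ε)
    ... | N , p = N , λ m n hm hn → ≤-trans (*-monoˡ c 0≤c (p m n hm hn))
      (by (<⇒≤ (0<* 0<r 0<ε)) (trans
        (solve 3 (λ r c ε → r :* ε := (r :* (con 1ℚ :+ c)) :* ε :- c :* (r :* ε)) refl r c ε)
        (cong (_- c * (r * ε)) (trans (cong (_* ε) r≡) (*-identityˡ ε)))))

  vanish-swap : ∀ {e} → Vanishing e → Vanishing (λ m n → e n m)
  vanish-swap ve ε 0<ε with ve ε 0<ε
  ... | N , p = N , λ m n hm hn → p n m hn hm

  vanish-mono : ∀ {e f} → Vanishing e →
                (∃[ N ] ∀ m n → N ℕ.≤ m → N ℕ.≤ n → f m n ≤ e m n) → Vanishing f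
  vanish-mono ve (M , q) ε 0<ε with ve ε 0<ε
  ... | N , p = N ℕ.⊔ M , λ m n hm hn → ≤-trans
    (q m n (ℕₚ.m⊔n≤o⇒n≤o N M hm) (ℕₚ.m⊔n≤o⇒n≤o N M hn))
    (p m n (ℕₚ.m⊔n≤o⇒m≤o N M hm) (ℕₚ.m⊔n≤o⇒m≤o N M hn))

  bounded : ∀ (x : ℝ) → ∃[ B ] 0ℚ ≤ B × Eventually (λ m → ∣ seq x m ∣ ≤ B)
  bounded x with cauchy x 1ℚ 0<1
  ... | N , p = ∣ seq x N ∣ + 1ℚ , 0≤+ (0≤∣p∣ (seq x N)) 0≤1 , N , λ m hm → ≤-trans
    (subst (λ z → ∣ z ∣ ≤ ∣ seq x N ∣ + ∣ seq x m - seq x N ∣)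
      (solve 2 (λ a b → b :+ (a :- b) := a) refl (seq x m) (seq x N))
      (∣p+q∣≤∣p∣+∣q∣ (seq x N) (seq x m - seq x N)))
    (+-monoʳ-≤ ∣ seq x N ∣ (p m N hm ℕₚ.≤-refl))

  bernoulli : ∀ q → 0ℚ ≤ q → q ≤ 1ℚ → ∀ k → q ^ k * (1ℚ + fromℕ k * (1ℚ - q)) ≤ 1ℚ
  bernoulli q 0≤q q≤1 zero = ≤-reflexive
    (solve 1 (λ q → con 1ℚ :* (con 1ℚ :+ con 0ℚ :* (con 1ℚ :- q)) := con 1ℚ) refl q)
  bernoulli q 0≤q q≤1 (suc k) = ≤-trans
    (by (0≤* (^-nonNeg 0≤q k) (0≤* (0≤+ 0≤1 (fromℕ-nonNeg k))
          (0≤* (diff q≤1) (diff q≤1))))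
        (trans
          (solve 3 (λ q a n → a :* ((con 1ℚ :+ n) :* ((con 1ℚ :- q) :* (con 1ℚ :- q))) :=
             a :* (con 1ℚ :+ n :* (con 1ℚ :- q))
               :- (q :* a) :* (con 1ℚ :+ (con 1ℚ :+ n) :* (con 1ℚ :- q)))
             refl q (q ^ k) (fromℕ k))
          (cong (λ z → q ^ k * (1ℚ + fromℕ k * (1ℚ - q)) - q ^ suc k * (1ℚ + z * (1ℚ - q)))
            (sym (fromℕ-suc k)))))
    (bernoulli q 0≤q q≤1 k)

  small : ∀ {a e ε n} → 0ℚ ≤ a → 0ℚ ≤ ε → 1ℚ ≤ n * (e * ε) →
          a * (1ℚ + n * e) ≤ 1ℚ → a ≤ ε
  small {a} {e} {ε} {n} 0≤a 0≤ε 1≤ b = ≤-trans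
    (by (0≤* 0≤a (0≤+ (diff 1≤) 0≤ε))
      (solve 4 (λ a e ε n → a :* ((n :* (e :* ε) :- con 1ℚ) :+ ε) :=
          ε :* (a :* (con 1ℚ :+ n :* e)) :- a) refl a e ε n))
    (subst (ε * (a * (1ℚ + n * e)) ≤_) (*-identityʳ ε) (*-monoˡ ε 0≤ε b))

  ^-vanish : ∀ q → 0ℚ ≤ q → q < 1ℚ → Vanishing (λ m _ → q ^ m)
  ^-vanish q 0≤q q<1 ε 0<ε = go (archimedean 0<d)
    where
    0<d : 0ℚ < (1ℚ - q) * ε
    0<d = 0<* (diff< q<1) 0<ε
    go : ∃[ n ] 1ℚ ≤ fromℕ n * ((1ℚ - q) * ε) →
         ∃[ N ] ∀ m k → N ℕ.≤ m → N ℕ.≤ k → q ^ m ≤ ε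
    go (N , 1≤) = N , λ m _ hm _ → small {q ^ m} {1ℚ - q} {ε} {fromℕ m} (^-nonNeg 0≤q m) (<⇒≤ 0<ε)
      (≤-trans 1≤ (*-monoʳ ((1ℚ - q) * ε) (<⇒≤ 0<d) (fromℕ-mono hm)))
      (bernoulli q 0≤q (<⇒≤ q<1) m)

fromℚ : ℚ → ℝ
fromℚ p = mkℝ (λ _ → p) λ ε 0<ε → 0 , λ _ _ _ _ →
  subst (λ z → ∣ z ∣ ≤ ε) (sym (+-inverseʳ p)) (<⇒≤ 0<ε)

_+ᴿ_ : ℝ → ℝ → ℝ
x +ᴿ y = mkℝ (λ m → seq x m + seq y m)
  (vanish-mono (vanish-+ (cauchy x) (cauchy y)) (0 , λ m n _ _ →
    subst (λ z → ∣ z ∣ ≤ ∣ seq x m - seq x n ∣ + ∣ seq y m - seq y n ∣)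
      (solve 4 (λ a b c d → (a :- b) :+ (c :- d) := (a :+ c) :- (b :+ d)) refl
        (seq x m) (seq x n) (seq y m) (seq y n))
      (∣p+q∣≤∣p∣+∣q∣ (seq x m - seq x n) (seq y m - seq y n))))

-ᴿ_ : ℝ → ℝ
-ᴿ x = mkℝ (λ m → - seq x m) (vanish-mono (cauchy x) (0 , λ m n _ _ → ≤-reflexive (trans
  (cong ∣_∣ (solve 2 (λ a b → (:- a) :- (:- b) := :- (a :- b)) refl (seq x m) (seq x n)))
  (∣-p∣≡∣p∣ (seq x m - seq x n)))))

_-ᴿ_ : ℝ → ℝ → ℝ
x -ᴿ y = x +ᴿ (-ᴿ y)

_*ᴿ_ : ℝ → ℝ → ℝ
x *ᴿ y = mkℝ (λ m → seq x m * seq y m) (go (bounded x) (bounded y))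
  where
  go : ∃[ B ] 0ℚ ≤ B × Eventually (λ m → ∣ seq x m ∣ ≤ B) →
       ∃[ C ] 0ℚ ≤ C × Eventually (λ m → ∣ seq y m ∣ ≤ C) →
       IsCauchy (λ m → seq x m * seq y m)
  go (B , 0≤B , N , p) (C , 0≤C , M , q) =
    vanish-mono (vanish-+ (vanish-* B 0≤B (cauchy y)) (vanish-* C 0≤C (cauchy x)))
      (N ℕ.⊔ M , λ m n hm hn →
        let a = seq x m
            b = seq x n
            c = seq y m
            d = seq y n
        in ≤-trans
          (subst (λ z → ∣ z ∣ ≤ ∣ a * (c - d) ∣ + ∣ d * (a - b) ∣)
            (solve 4 (λ a b c d → a :* (c :- d) :+ d :* (a :- b) := a :* c :- b :* d) refl a b c d)
            (∣p+q∣≤∣p∣+∣q∣ (a * (c - d)) (d * (a - b))))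
          (+-mono-≤
            (subst (_≤ B * ∣ c - d ∣) (sym (∣p*q∣≡∣p∣*∣q∣ a (c - d)))
              (*-monoʳ ∣ c - d ∣ (0≤∣p∣ (c - d)) (p m (ℕₚ.m⊔n≤o⇒m≤o N M hm))))
            (subst (_≤ C * ∣ a - b ∣) (sym (∣p*q∣≡∣p∣*∣q∣ d (a - b)))
              (*-monoʳ ∣ a - b ∣ (0≤∣p∣ (a - b)) (q n (ℕₚ.m⊔n≤o⇒n≤o N M hn))))))

-- The value at 0 is a convention; it is only used in entries of a sequence
-- that do not affect its limit.
invℚ : ℚ → ℚ
invℚ p with p ≟ℚ 0ℚ
... | yes _  = 0ℚ
... | no p≢0 = (1/ p) {{≢-nonZero p≢0}}

private

  invℚ-inverse : ∀ {p} → 0ℚ < p → invℚ p * p ≡ 1ℚ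
  invℚ-inverse {p} 0<p with p ≟ℚ 0ℚ
  ... | yes p≡0 = contradiction (sym p≡0) (<⇒≢ 0<p)
  ... | no p≢0  = *-inverseˡ p {{≢-nonZero p≢0}}

  inverse-pos : ∀ {p i} → 0ℚ < p → i * p ≡ 1ℚ → 0ℚ < i
  inverse-pos {p} {i} 0<p eq = *-cancelʳ-<-nonNeg p {{nonNegative (<⇒≤ 0<p)}}
    (subst₂ _<_ (sym (*-zeroˡ p)) (sym eq) 0<1)

  inverse-antimono : ∀ {p q i j} → 0ℚ ≤ i → 0ℚ ≤ j → i * p ≡ 1ℚ → j * q ≡ 1ℚ → p ≤ q → j ≤ i
  inverse-antimono {p} {q} {i} {j} 0≤i 0≤j ip jq p≤q = by
    (0≤* (0≤* 0≤i 0≤j) (diff p≤q))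
    (trans (solve 4 (λ p q i j → (i :* j) :* (q :- p) := i :* (j :* q) :- j :* (i :* p)) refl p q i j)
      (cong₂ _-_ (trans (cong (i *_) jq) (*-identityʳ i)) (trans (cong (j *_) ip) (*-identityʳ j))))

  inverse-diff : ∀ {p q i j} → i * p ≡ 1ℚ → j * q ≡ 1ℚ → i - j ≡ (i * j) * (q - p)
  inverse-diff {p} {q} {i} {j} ip jq = sym
    (trans (solve 4 (λ p q i j → (i :* j) :* (q :- p) := i :* (j :* q) :- j :* (i :* p)) refl p q i j)
      (cong₂ _-_ (trans (cong (i *_) jq) (*-identityʳ i)) (trans (cong (j *_) ip) (*-identityʳ j))))

  inverse-lipschitz : ∀ {d a b r i j} → 0ℚ < d → 0ℚ ≤ r → d ≤ a → d ≤ b →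
                      r * d ≡ 1ℚ → i * a ≡ 1ℚ → j * b ≡ 1ℚ → ∣ i - j ∣ ≤ (r * r) * ∣ a - b ∣
  inverse-lipschitz {d} {a} {b} {r} {i} {j} 0<d 0≤r d≤a d≤b rd ia jb = subst (_≤ (r * r) * ∣ a - b ∣)
    (sym (trans (cong ∣_∣ (inverse-diff {a} {b} {i} {j} ia jb))
      (trans (∣p*q∣≡∣p∣*∣q∣ (i * j) (b - a))
        (cong₂ _*_ (0≤p⇒∣p∣≡p (0≤* 0≤i 0≤j)) (∣-∣-sym b a)))))
    (*-monoʳ ∣ a - b ∣ (0≤∣p∣ (a - b)) (*-mono 0≤i 0≤j
      (inverse-antimono {d} {a} {r} {i} 0≤r 0≤i rd ia d≤a)
      (inverse-antimono {d} {b} {r} {j} 0≤r 0≤j rd jb d≤b)))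
    where
    0≤i = <⇒≤ (inverse-pos {a} {i} (<-≤-trans 0<d d≤a) ia)
    0≤j = <⇒≤ (inverse-pos {b} {j} (<-≤-trans 0<d d≤b) jb)

0ᴿ 1ᴿ : ℝ
0ᴿ = fromℚ 0ℚ
1ᴿ = fromℚ 1ℚ

inv : (x : ℝ) → 0ᴿ <ᴿ x → ℝ
inv x (δ , 0<δ , N , p) = mkℝ (λ m → invℚ (seq x m)) (go (recip⁺ 0<δ))
  where
  go : ∃[ r ] 0ℚ < r × r * δ ≡ 1ℚ → IsCauchy (λ m → invℚ (seq x m))
  go (r , 0<r , rδ≡1) = vanish-mono (vanish-* (r * r) (0≤* (<⇒≤ 0<r) (<⇒≤ 0<r)) (cauchy x))
    (N , λ m n hm hn → close (large m hm) (large n hn))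
    where
    large : ∀ m → N ℕ.≤ m → δ ≤ seq x m
    large m hm = subst (_≤ seq x m) (+-identityˡ δ) (p m hm)
    close : ∀ {a b} → δ ≤ a → δ ≤ b → ∣ invℚ a - invℚ b ∣ ≤ (r * r) * ∣ a - b ∣
    close {a} {b} δ≤a δ≤b = inverse-lipschitz {δ} {a} {b} {r} {invℚ a} {invℚ b} 0<δ (<⇒≤ 0<r) δ≤a δ≤b rδ≡1
      (invℚ-inverse (<-≤-trans 0<δ δ≤a)) (invℚ-inverse (<-≤-trans 0<δ δ≤b))

partialSum : (ℕ → ℚ) → ℚ → ℕ → ℚ
partialSum c t zero    = 0ℚ
partialSum c t (suc m) = partialSum c t m + c m * t ^ m

-- A sufficient condition for Σ c k t ^ k to converge uniformly on ∣ t ∣ ≤ r.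
record Summable (c : ℕ → ℚ) (r : ℚ) : Set where
  field
    radius bound ratio : ℚ
    r<radius  : r < radius
    0≤ratio   : 0ℚ ≤ ratio
    ratio<1   : ratio < 1ℚ
    dominated : ∀ k → ∣ c k ∣ * radius ^ k ≤ bound * ratio ^ k

private

  module _ {c r} (0≤r : 0ℚ ≤ r) (S : Summable c r) where
    open Summable S

    0≤radius : 0ℚ ≤ radius
    0≤radius = ≤-trans 0≤r (<⇒≤ r<radius)

    0≤bound : 0ℚ ≤ bound
    0≤bound = subst (0ℚ ≤_) (*-identityʳ bound)
      (≤-trans (0≤* (0≤∣p∣ (c 0)) 0≤1) (dominated 0))

    0≤gap : 0ℚ ≤ radius - r
    0≤gap = diff (<⇒≤ r<radius)

    power-lipschitz : ∀ {t u} → ∣ t ∣ ≤ r → ∣ u ∣ ≤ r → ∀ k →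
                      (radius - r) * ∣ t ^ k - u ^ k ∣ ≤ ∣ t - u ∣ * radius ^ k
    power-lipschitz {t} {u} ht hu zero = ≤-trans
      (≤-reflexive (*-zeroʳ (radius - r))) (0≤* (0≤∣p∣ (t - u)) 0≤1)
    power-lipschitz {t} {u} ht hu (suc k) = ≤-trans
      (*-monoˡ (radius - r) 0≤gap
        (subst (λ z → ∣ z ∣ ≤ ∣ t ∣ * ∣ a - b ∣ + ∣ t - u ∣ * ∣ b ∣)
          (solve 4 (λ t u a b → t :* (a :- b) :+ (t :- u) :* b := t :* a :- u :* b) refl t u a b)
          (≤-trans (∣p+q∣≤∣p∣+∣q∣ (t * (a - b)) ((t - u) * b))
            (≤-reflexive (cong₂ _+_ (∣p*q∣≡∣p∣*∣q∣ t (a - b)) (∣p*q∣≡∣p∣*∣q∣ (t - u) b))))))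
      (step {∣ t ∣} {∣ a - b ∣} {∣ t - u ∣} {∣ b ∣} {radius ^ k} {r} {radius}
        0≤gap (0≤∣p∣ (t - u)) 0≤r (0≤∣p∣ (a - b)) ht
        (subst (_≤ radius ^ k) (sym (∣^∣ u k))
          (≤-trans (^-mono (0≤∣p∣ u) hu k) (^-mono 0≤r (<⇒≤ r<radius) k)))
        (power-lipschitz ht hu k))
      where
      a = t ^ k
      b = u ^ k
      step : ∀ {t d e b s r R} → 0ℚ ≤ R - r → 0ℚ ≤ e → 0ℚ ≤ r → 0ℚ ≤ d → t ≤ r → b ≤ s →
             (R - r) * d ≤ e * s → (R - r) * (t * d + e * b) ≤ e * (R * s)
      step {t} {d} {e} {b} {s} {r} {R} 0≤g 0≤e 0≤r 0≤d t≤r b≤s ih = by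
        (0≤+ (0≤+ (0≤* (0≤* 0≤g (diff t≤r)) 0≤d) (0≤* 0≤r (diff ih)))
             (0≤* (0≤* 0≤g 0≤e) (diff b≤s)))
        (solve 7 (λ t d e b s r R →
            ((R :- r) :* (r :- t)) :* d :+ r :* (e :* s :- (R :- r) :* d)
              :+ ((R :- r) :* e) :* (s :- b)
            := e :* (R :* s) :- (R :- r) :* (t :* d :+ e :* b)) refl t d e b s r R)

    lipschitz : ∀ {t u} → ∣ t ∣ ≤ r → ∣ u ∣ ≤ r → ∀ m →
                ((radius - r) * (1ℚ - ratio)) * ∣ partialSum c t m - partialSum c u m ∣
                  ≤ ∣ t - u ∣ * (bound * (1ℚ - ratio ^ m))
    lipschitz {t} {u} ht hu zero = ≤-reflexive
      (trans (*-zeroʳ ((radius - r) * (1ℚ - ratio)))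
        (solve 2 (λ e A → con 0ℚ := e :* (A :* (con 1ℚ :- con 1ℚ))) refl ∣ t - u ∣ bound))
    lipschitz {t} {u} ht hu (suc m) = ≤-trans
      (*-monoˡ ((radius - r) * (1ℚ - ratio)) (0≤* 0≤gap (diff (<⇒≤ ratio<1)))
        (subst (λ z → ∣ z ∣ ≤ ∣ P - Q ∣ + ∣ c m ∣ * ∣ t ^ m - u ^ m ∣)
          (solve 5 (λ P Q c a b → (P :- Q) :+ c :* (a :- b) := (P :+ c :* a) :- (Q :+ c :* b))
            refl P Q (c m) (t ^ m) (u ^ m))
          (≤-trans (∣p+q∣≤∣p∣+∣q∣ (P - Q) (c m * (t ^ m - u ^ m)))
            (≤-reflexive (cong (λ z → ∣ P - Q ∣ + z) (∣p*q∣≡∣p∣*∣q∣ (c m) (t ^ m - u ^ m)))))))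
      (step {radius - r} {ratio} {∣ P - Q ∣} {∣ c m ∣} {∣ t ^ m - u ^ m ∣} {∣ t - u ∣}
            {radius ^ m} {bound} {ratio ^ m}
        (diff (<⇒≤ ratio<1)) (0≤∣p∣ (t - u)) (0≤∣p∣ (c m))
        (power-lipschitz ht hu m) (dominated m) (lipschitz ht hu m))
      where
      P = partialSum c t m
      Q = partialSum c u m
      step : ∀ {g q D k d e s A a} → 0ℚ ≤ 1ℚ - q → 0ℚ ≤ e → 0ℚ ≤ k →
             g * d ≤ e * s → k * s ≤ A * a → (g * (1ℚ - q)) * D ≤ e * (A * (1ℚ - a)) →
             (g * (1ℚ - q)) * (D + k * d) ≤ e * (A * (1ℚ - q * a))
      step {g} {q} {D} {k} {d} {e} {s} {A} {a} 0≤1-q 0≤e 0≤k h₁ h₂ ih = by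
        (0≤+ (0≤+ (diff ih) (0≤* (0≤* 0≤1-q 0≤k) (diff h₁))) (0≤* (0≤* 0≤1-q 0≤e) (diff h₂)))
        (solve 9 (λ g q D k d e s A a →
            (e :* (A :* (con 1ℚ :- a)) :- (g :* (con 1ℚ :- q)) :* D)
              :+ ((con 1ℚ :- q) :* k) :* (e :* s :- g :* d)
              :+ ((con 1ℚ :- q) :* e) :* (A :* a :- k :* s)
            := e :* (A :* (con 1ℚ :- q :* a)) :- (g :* (con 1ℚ :- q)) :* (D :+ k :* d))
          refl g q D k d e s A a)

    tail : ∀ {t} → ∣ t ∣ ≤ r → ∀ m j →
           (1ℚ - ratio) * ∣ partialSum c t (j ℕ.+ m) - partialSum c t m ∣
             ≤ bound * (ratio ^ m - ratio ^ (j ℕ.+ m))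
    tail {t} ht m zero = ≤-reflexive (trans
      (cong (λ z → (1ℚ - ratio) * ∣ z ∣) (+-inverseʳ (partialSum c t m)))
      (trans (*-zeroʳ (1ℚ - ratio))
        (solve 2 (λ A a → con 0ℚ := A :* (a :- a)) refl bound (ratio ^ m))))
    tail {t} ht m (suc j) = ≤-trans
      (*-monoˡ (1ℚ - ratio) (diff (<⇒≤ ratio<1))
        (subst (λ z → ∣ z ∣ ≤ ∣ P - Q ∣ + ∣ c i ∣ * ∣ t ^ i ∣)
          (solve 3 (λ P Q d → (P :- Q) :+ d := (P :+ d) :- Q) refl P Q (c i * t ^ i))
          (≤-trans (∣p+q∣≤∣p∣+∣q∣ (P - Q) (c i * t ^ i))
            (≤-reflexive (cong (λ z → ∣ P - Q ∣ + z) (∣p*q∣≡∣p∣*∣q∣ (c i) (t ^ i)))))))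
      (step {ratio} {∣ P - Q ∣} {∣ c i ∣} {∣ t ^ i ∣} {radius ^ i} {bound} {ratio ^ i} {ratio ^ m}
        (diff (<⇒≤ ratio<1)) (0≤∣p∣ (c i))
        (subst (_≤ radius ^ i) (sym (∣^∣ t i))
          (^-mono (0≤∣p∣ t) (≤-trans ht (<⇒≤ r<radius)) i))
        (dominated i) (tail ht m j))
      where
      i = j ℕ.+ m
      P = partialSum c t i
      Q = partialSum c t m
      step : ∀ {q D k d s A a b} → 0ℚ ≤ 1ℚ - q → 0ℚ ≤ k → d ≤ s → k * s ≤ A * a →
             (1ℚ - q) * D ≤ A * (b - a) → (1ℚ - q) * (D + k * d) ≤ A * (b - q * a)
      step {q} {D} {k} {d} {s} {A} {a} {b} 0≤1-q 0≤k h₁ h₂ ih = by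
        (0≤+ (0≤+ (diff ih) (0≤* 0≤1-q (diff h₂))) (0≤* (0≤* 0≤1-q 0≤k) (diff h₁)))
        (solve 8 (λ q D k d s A a b →
            (A :* (b :- a) :- (con 1ℚ :- q) :* D) :+ (con 1ℚ :- q) :* (A :* a :- k :* s)
              :+ ((con 1ℚ :- q) :* k) :* (s :- d)
            := A :* (b :- q :* a) :- (con 1ℚ :- q) :* (D :+ k :* d)) refl q D k d s A a b)

powerSeries : (c : ℕ → ℚ) (x : ℝ) (r : ℚ) → Summable c r → Eventually (λ m → ∣ seq x m ∣ ≤ r) → ℝ
powerSeries c x r S (N , small-x) =
  mkℝ (λ m → partialSum c (seq x m) m) (go (recip⁺ 0<1-q) (recip⁺ 0<d))
  where
  open Summable S
  0≤r : 0ℚ ≤ r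
  0≤r = ≤-trans (0≤∣p∣ (seq x N)) (small-x N ℕₚ.≤-refl)
  d : ℚ
  d = (radius - r) * (1ℚ - ratio)
  0<1-q : 0ℚ < 1ℚ - ratio
  0<1-q = diff< ratio<1
  0<d : 0ℚ < d
  0<d = 0<* (diff< r<radius) 0<1-q
  P : ℕ → ℕ → ℚ
  P m n = partialSum c (seq x n) m

  shrink : ∀ A a → 0ℚ ≤ A → 0ℚ ≤ a → A * (1ℚ - a) ≤ A
  shrink A a 0≤A 0≤a = by (0≤* 0≤A 0≤a)
    (solve 2 (λ A a → A :* a := A :- A :* (con 1ℚ :- a)) refl A a)

  divide : ∀ {g i a b} → 0ℚ ≤ i → i * g ≡ 1ℚ → g * a ≤ b → a ≤ i * b
  divide {g} {i} {a} {b} 0≤i ig h = subst (_≤ i * b)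
    (trans (sym (*-assoc i g a)) (trans (cong (_* a) ig) (*-identityˡ a))) (*-monoˡ i 0≤i h)

  drop : ∀ A a b → 0ℚ ≤ A → 0ℚ ≤ a → 0ℚ ≤ b → A * (a - b) ≤ A * (a + b)
  drop A a b 0≤A 0≤a 0≤b = by (0≤* 0≤A (0≤+ 0≤b 0≤b))
    (solve 3 (λ A a b → A :* (b :+ b) := A :* (a :+ b) :- A :* (a :- b)) refl A a b)

  module _ {e} (0≤e : 0ℚ ≤ e) (e≡ : e * (1ℚ - ratio) ≡ 1ℚ) {t} (ht : ∣ t ∣ ≤ r) where

    tail≤ : ∀ {m n} → m ℕ.≤ n →
            ∣ partialSum c t n - partialSum c t m ∣ ≤ e * (bound * (ratio ^ m + ratio ^ n))
    tail≤ {m} {n} m≤n = subst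
      (λ k → ∣ partialSum c t k - partialSum c t m ∣ ≤ e * (bound * (ratio ^ m + ratio ^ k)))
      (ℕₚ.m∸n+n≡m m≤n)
      (divide {1ℚ - ratio} {e} {∣ partialSum c t (n ℕ.∸ m ℕ.+ m) - partialSum c t m ∣}
        {bound * (ratio ^ m + ratio ^ (n ℕ.∸ m ℕ.+ m))} 0≤e e≡ (≤-trans (tail 0≤r S ht m (n ℕ.∸ m))
        (drop bound (ratio ^ m) (ratio ^ (n ℕ.∸ m ℕ.+ m)) (0≤bound 0≤r S)
          (^-nonNeg 0≤ratio m) (^-nonNeg 0≤ratio (n ℕ.∸ m ℕ.+ m)))))

    tail-sym : ∀ m n → ∣ partialSum c t m - partialSum c t n ∣
                         ≤ (e * bound) * (ratio ^ m + ratio ^ n)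
    tail-sym m n = subst (∣ partialSum c t m - partialSum c t n ∣ ≤_)
      (sym (*-assoc e bound (ratio ^ m + ratio ^ n))) (choose (ℕₚ.≤-total m n))
      where
      choose : m ℕ.≤ n ⊎ n ℕ.≤ m → ∣ partialSum c t m - partialSum c t n ∣
                                     ≤ e * (bound * (ratio ^ m + ratio ^ n))
      choose (inj₁ m≤n) = subst (_≤ e * (bound * (ratio ^ m + ratio ^ n)))
        (∣-∣-sym (partialSum c t n) (partialSum c t m)) (tail≤ m≤n)
      choose (inj₂ n≤m) = subst (λ z → ∣ partialSum c t m - partialSum c t n ∣ ≤ e * (bound * z))
        (+-comm (ratio ^ n) (ratio ^ m)) (tail≤ n≤m)

  go : ∃[ e ] 0ℚ < e × e * (1ℚ - ratio) ≡ 1ℚ → ∃[ i ] 0ℚ < i × i * d ≡ 1ℚ →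
       IsCauchy (λ m → P m m)
  go (e , 0<e , e≡) (i , 0<i , i≡) = vanish-mono
    (vanish-+ (vanish-* (i * bound) (0≤* (<⇒≤ 0<i) (0≤bound 0≤r S)) (cauchy x))
              (vanish-* (e * bound) (0≤* (<⇒≤ 0<e) (0≤bound 0≤r S))
                (vanish-+ {λ m n → ratio ^ m} {λ m n → ratio ^ n}
                  (^-vanish ratio 0≤ratio ratio<1) (vanish-swap (^-vanish ratio 0≤ratio ratio<1)))))
    (N , λ m n hm hn → ≤-trans (∣-∣-triangle (P m m) (P m n) (P n n))
      (+-mono-≤ (first m n hm hn) (tail-sym {e} (<⇒≤ 0<e) e≡ {seq x n} (small-x n hn) m n)))
    where
    first : ∀ m n → N ℕ.≤ m → N ℕ.≤ n →
            ∣ P m m - P m n ∣ ≤ (i * bound) * ∣ seq x m - seq x n ∣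
    first m n hm hn = subst (∣ P m m - P m n ∣ ≤_)
      (solve 3 (λ i t A → i :* (t :* A) := (i :* A) :* t) refl i ∣ seq x m - seq x n ∣ bound)
      (divide {d} {i} {∣ P m m - P m n ∣} {∣ seq x m - seq x n ∣ * bound} (<⇒≤ 0<i) i≡
        (≤-trans (lipschitz 0≤r S {seq x m} {seq x n} (small-x m hm) (small-x n hn) m)
          (*-monoˡ {bound * (1ℚ - ratio ^ m)} {bound} ∣ seq x m - seq x n ∣
            (0≤∣p∣ (seq x m - seq x n)) (shrink bound (ratio ^ m) (0≤bound 0≤r S) (^-nonNeg 0≤ratio m)))))

invFactorial : ℕ → ℚ
invFactorial k = (+ 1 / (k !)) {{ℕₚ._!≢0 k}}

private

  invFactorial-nonNeg : ∀ k → 0ℚ ≤ invFactorial k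
  invFactorial-nonNeg k = 1/n-nonNeg (k !) {{ℕₚ._!≢0 k}}

  invFactorial-suc : ∀ k → invFactorial (suc k) * fromℕ (suc k) ≡ invFactorial k
  invFactorial-suc k = go (invFactorial (suc k)) (fromℕ (suc k)) (fromℕ (k !)) (invFactorial k)
    (trans (cong (invFactorial (suc k) *_) (sym (fromℕ-* (suc k) (k !))))
      (1/n*n≡1 (suc k !) {{ℕₚ._!≢0 (suc k)}}))
    (1/n*n≡1 (k !) {{ℕₚ._!≢0 k}})
    where
    go : ∀ x n f y → x * (n * f) ≡ 1ℚ → y * f ≡ 1ℚ → x * n ≡ y
    go x n f y h₁ h₂ = trans (sym (*-identityʳ (x * n))) (trans (cong ((x * n) *_) (sym h₂))
      (trans (solve 4 (λ x n f y → (x :* n) :* (y :* f) := (x :* (n :* f)) :* y) refl x n f y)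
        (trans (cong (_* y) h₁) (*-identityˡ y))))

  eventually-antitone⇒bounded : ∀ K (e : ℕ → ℚ) → (∀ k → K ℕ.≤ k → e (suc k) ≤ e k) →
                                ∃[ A ] ∀ k → e k ≤ A
  eventually-antitone⇒bounded zero e anti = e 0 , go
    where
    go : ∀ k → e k ≤ e 0
    go zero    = ≤-refl
    go (suc k) = ≤-trans (anti k z≤n) (go k)
  eventually-antitone⇒bounded (suc K) e anti
    with eventually-antitone⇒bounded K (λ k → e (suc k)) (λ k h → anti (suc k) (s≤s h))
  ... | A , p = e 0 ⊔ A , λ { zero → p≤p⊔q (e 0) A ; (suc k) → ≤-trans (p k) (p≤q⊔p (e 0) A) }

  invFactorial-growth : ∀ M → 0ℚ ≤ M → ∃[ A ] ∀ k → invFactorial k * M ^ k ≤ A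
  invFactorial-growth M 0≤M with ≤fromℕ M
  ... | K , M≤K = eventually-antitone⇒bounded K (λ k → invFactorial k * M ^ k) λ k K≤k →
    subst (λ z → invFactorial (suc k) * (M * M ^ k) ≤ z * M ^ k) (invFactorial-suc k)
      (step (invFactorial (suc k)) M (fromℕ (suc k)) (M ^ k) (invFactorial-nonNeg (suc k))
        (^-nonNeg 0≤M k) (≤-trans M≤K (fromℕ-mono (ℕₚ.m≤n⇒m≤1+n K≤k))))
    where
    step : ∀ x M n a → 0ℚ ≤ x → 0ℚ ≤ a → M ≤ n → x * (M * a) ≤ (x * n) * a
    step x M n a 0≤x 0≤a M≤n = by (0≤* (0≤* 0≤x 0≤a) (diff M≤n))
      (solve 4 (λ x M n a → (x :* a) :* (n :- M) := (x :* n) :* a :- x :* (M :* a)) refl x M n a)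

  p<p+1 : ∀ p → p < p + 1ℚ
  p<p+1 p = subst (_< p + 1ℚ) (+-identityʳ p) (+-monoʳ-< p 0<1)

  expSummable : ∀ r → 0ℚ ≤ r → Summable invFactorial r
  expSummable r 0≤r = go (invFactorial-growth (R + R) (0≤+ 0≤R 0≤R))
    where
    R = r + 1ℚ
    0≤R : 0ℚ ≤ R
    0≤R = 0≤+ 0≤r 0≤1
    go : ∃[ A ] (∀ k → invFactorial k * (R + R) ^ k ≤ A) → Summable invFactorial r
    go (A , p) = record
      { radius = R ; bound = A ; ratio = ½ ; r<radius = p<p+1 r ; 0≤ratio = <⇒≤ 0<½ ; ratio<1 = ½<1
      ; dominated = λ k → subst (_≤ A * ½ ^ k)
          (trans (*-assoc (invFactorial k) ((R + R) ^ k) (½ ^ k))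
            (cong₂ _*_ (sym (0≤p⇒∣p∣≡p (invFactorial-nonNeg k)))
              (trans (sym (^-distrib (R + R) ½ k))
                (cong (_^ k) (solve 1 (λ R → (R :+ R) :* con ½ := R) refl R)))))
          (*-monoʳ (½ ^ k) (^-nonNeg (<⇒≤ 0<½) k) (p k)) }

-- exp x = Σ xᵏ / k!
exp : ℝ → ℝ
exp x = powerSeries invFactorial x B (expSummable B 0≤B) x≤B
  where
  B   = proj₁ (bounded x)
  0≤B = proj₁ (proj₂ (bounded x))
  x≤B = proj₂ (proj₂ (bounded x))

artanhCoeff : ℕ → ℚ
artanhCoeff zero    = 0ℚ
artanhCoeff (suc k) = if does (2 ℕ∣.∣? k) then + 1 / suc k else 0ℚ

private

  artanhCoeff-nonNeg : ∀ k → 0ℚ ≤ artanhCoeff k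
  artanhCoeff-nonNeg zero = ≤-refl
  artanhCoeff-nonNeg (suc k) with does (2 ℕ∣.∣? k)
  ... | true  = 1/n-nonNeg (suc k)
  ... | false = ≤-refl

  artanhCoeff≤1 : ∀ k → artanhCoeff k ≤ 1ℚ
  artanhCoeff≤1 zero = 0≤1
  artanhCoeff≤1 (suc k) with does (2 ℕ∣.∣? k)
  ... | false = 0≤1
  ... | true  = subst₂ _≤_ (*-identityʳ (+ 1 / suc k)) (1/n*n≡1 (suc k))
    (*-monoˡ (+ 1 / suc k) (1/n-nonNeg (suc k)) (fromℕ-mono {1} {suc k} (s≤s z≤n)))

  artanhSummable : ∀ r → 0ℚ ≤ r → r < 1ℚ → Summable artanhCoeff r
  artanhSummable r 0≤r r<1 = go (<-dense r<1)
    where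
    go : ∃[ q ] r < q × q < 1ℚ → Summable artanhCoeff r
    go (q , r<q , q<1) = record
      { radius = q ; bound = 1ℚ ; ratio = q ; r<radius = r<q
      ; 0≤ratio = ≤-trans 0≤r (<⇒≤ r<q) ; ratio<1 = q<1
      ; dominated = λ k → *-monoʳ (q ^ k) (^-nonNeg (≤-trans 0≤r (<⇒≤ r<q)) k)
          (subst (_≤ 1ℚ) (sym (0≤p⇒∣p∣≡p (artanhCoeff-nonNeg k))) (artanhCoeff≤1 k)) }

  0<x+1 : ∀ x → 0ᴿ <ᴿ x → 0ᴿ <ᴿ x +ᴿ 1ᴿ
  0<x+1 x (δ , 0<δ , N , p) = δ , 0<δ , N , λ m hm →
    ≤-trans (p m hm) (<⇒≤ (p<p+1 (seq x m)))

-- (x - 1) / (x + 1)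
möbius : (x : ℝ) → 0ᴿ <ᴿ x → ℝ
möbius x 0<x = (x -ᴿ 1ᴿ) *ᴿ inv (x +ᴿ 1ᴿ) (0<x+1 x 0<x)

private

  möbius-bound : ∀ {a i j η} → 0ℚ ≤ i → 0ℚ ≤ j → 0ℚ ≤ η → j ≤ i → η ≤ a → η ≤ 1ℚ →
                 i * (a + 1ℚ) ≡ 1ℚ →
                 ∣ (a - 1ℚ) * i ∣ ≤ 1ℚ - (η * j + η * j)
  möbius-bound {a} {i} {j} {η} 0≤i 0≤j 0≤η j≤i η≤a η≤1 i≡ =
    subst (λ z → ∣ (a - 1ℚ) * i ∣ ≤ z - (η * j + η * j)) i≡ (∣∣≤
      (by (0≤+ u u) (solve 4 (λ a i j η →
          let u = (i :- j) :+ j :* (con 1ℚ :- η) in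
          u :+ u := (i :* (a :+ con 1ℚ) :- (η :* j :+ η :* j)) :- (a :- con 1ℚ) :* i)
        refl a i j η))
      (by (0≤+ v v) (solve 4 (λ a i j η →
          let v = η :* (i :- j) :+ i :* (a :- η) in
          v :+ v := (i :* (a :+ con 1ℚ) :- (η :* j :+ η :* j)) :- (:- ((a :- con 1ℚ) :* i)))
        refl a i j η)))
    where
    u : 0ℚ ≤ (i - j) + j * (1ℚ - η)
    u = 0≤+ (diff j≤i) (0≤* 0≤j (diff η≤1))
    v : 0ℚ ≤ η * (i - j) + i * (a - η)
    v = 0≤+ (0≤* 0≤η (diff j≤i)) (0≤* 0≤i (diff η≤a))

  möbius-small : ∀ x (0<x : 0ᴿ <ᴿ x) →
                 ∃[ r ] r < 1ℚ × Eventually (λ m → ∣ seq (möbius x 0<x) m ∣ ≤ r)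
  möbius-small x (δ , 0<δ , N , p) = go (bounded x)
    where
    η : ℚ
    η = δ ⊓ 1ℚ
    0<η : 0ℚ < η
    0<η with ⊓-sel δ 1ℚ
    ... | inj₁ eq = subst (0ℚ <_) (sym eq) 0<δ
    ... | inj₂ eq = subst (0ℚ <_) (sym eq) 0<1
    go : ∃[ B ] 0ℚ ≤ B × Eventually (λ m → ∣ seq x m ∣ ≤ B) →
         ∃[ r ] r < 1ℚ × Eventually (λ m → ∣ seq (möbius x (δ , 0<δ , N , p)) m ∣ ≤ r)
    go (B , 0≤B , M , q) = go′ (recip⁺ 0<B+1)
      where
      0<B+1 : 0ℚ < B + 1ℚ
      0<B+1 = ≤-<-trans 0≤B (p<p+1 B)
      go′ : ∃[ j ] 0ℚ < j × j * (B + 1ℚ) ≡ 1ℚ →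
            ∃[ r ] r < 1ℚ × Eventually (λ m → ∣ seq (möbius x (δ , 0<δ , N , p)) m ∣ ≤ r)
      go′ (j , 0<j , j≡) = 1ℚ - (η * j + η * j) ,
        subst (1ℚ - (η * j + η * j) <_) (+-identityʳ 1ℚ)
          (+-monoʳ-< 1ℚ (neg-antimono-< (0<+ 0<ηj (<⇒≤ 0<ηj)))) ,
        N ℕ.⊔ M , λ m hm → at (seq x m)
          (subst (_≤ seq x m) (+-identityˡ δ) (p m (ℕₚ.m⊔n≤o⇒m≤o N M hm)))
          (≤-trans (p≤∣p∣ (seq x m)) (q m (ℕₚ.m⊔n≤o⇒n≤o N M hm)))
        where
        0<ηj : 0ℚ < η * j
        0<ηj = 0<* 0<η 0<j
        at : ∀ a → δ ≤ a → a ≤ B → ∣ (a - 1ℚ) * invℚ (a + 1ℚ) ∣ ≤ 1ℚ - (η * j + η * j)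
        at a δ≤a a≤B = möbius-bound {a} {invℚ (a + 1ℚ)} {j} {η} 0≤i (<⇒≤ 0<j) (<⇒≤ 0<η)
          (inverse-antimono {a + 1ℚ} {B + 1ℚ} {invℚ (a + 1ℚ)} {j} 0≤i (<⇒≤ 0<j) i≡ j≡
            (+-monoˡ-≤ 1ℚ a≤B))
          (≤-trans (p⊓q≤p δ 1ℚ) δ≤a) (p⊓q≤q δ 1ℚ) i≡
          where
          0<a+1 : 0ℚ < a + 1ℚ
          0<a+1 = <-trans (<-≤-trans 0<δ δ≤a) (p<p+1 a)
          i≡ : invℚ (a + 1ℚ) * (a + 1ℚ) ≡ 1ℚ
          i≡ = invℚ-inverse 0<a+1
          0≤i : 0ℚ ≤ invℚ (a + 1ℚ)
          0≤i = <⇒≤ (inverse-pos {a + 1ℚ} {invℚ (a + 1ℚ)} 0<a+1 i≡)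

-- log x = 2 artanh ((x - 1) / (x + 1)), where artanh t = Σ tᵏ / k over odd k.
-- Different proofs of 0ᴿ <ᴿ x yield the same real number.
log : (x : ℝ) → 0ᴿ <ᴿ x → ℝ
log x 0<x = fromℚ (fromℕ 2) *ᴿ powerSeries artanhCoeff t r (artanhSummable r 0≤r r<1) t≤r
  where
  t   = möbius x 0<x
  r   = proj₁ (möbius-small x 0<x)
  r<1 = proj₁ (proj₂ (möbius-small x 0<x))
  t≤r = proj₂ (proj₂ (möbius-small x 0<x))
  0≤r : 0ℚ ≤ r
  0≤r = ≤-trans (0≤∣p∣ (seq t (proj₁ t≤r))) (proj₂ t≤r (proj₁ t≤r) ℕₚ.≤-refl)

pow : (x : ℝ) → 0ᴿ <ᴿ x → ℝ → ℝ
pow x 0<x y = exp (y *ᴿ log x 0<x)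

fromNat : ℕ → ℝ
fromNat n = fromℚ (fromℕ n)

fromNat-pos : ∀ n → 1 ℕ.≤ n → 0ᴿ <ᴿ fromNat n
fromNat-pos n 1≤n = 1ℚ , 0<1 , 0 , λ _ _ →
  subst (_≤ fromℕ n) (sym (+-identityˡ 1ℚ)) (fromℕ-mono {1} {n} 1≤n)

private

  partialSum-mono : ∀ {c t} → (∀ k → 0ℚ ≤ c k) → 0ℚ ≤ t →
                    ∀ j m → partialSum c t m ≤ partialSum c t (j ℕ.+ m)
  partialSum-mono 0≤c 0≤t zero m = ≤-refl
  partialSum-mono {c} {t} 0≤c 0≤t (suc j) m = ≤-trans (partialSum-mono 0≤c 0≤t j m)
    (subst (_≤ partialSum c t i + c i * t ^ i) (+-identityʳ (partialSum c t i))
      (+-monoʳ-≤ (partialSum c t i) (0≤* (0≤c i) (^-nonNeg 0≤t i))))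
    where i = j ℕ.+ m

  artanh-partialSum-pos : ∀ {t} → 0ℚ < t → 0ℚ < partialSum artanhCoeff t 2
  artanh-partialSum-pos {t} 0<t = subst (0ℚ <_)
    (solve 1 (λ t → t := (con 0ℚ :+ con 0ℚ :* con 1ℚ) :+ con 1ℚ :* (t :* con 1ℚ)) refl t) 0<t

  log-arg-pos : ∀ p → 1ℚ < p → 0ℚ < (p - 1ℚ) * invℚ (p + 1ℚ)
  log-arg-pos p 1<p = 0<* (diff< 1<p)
    (inverse-pos {p + 1ℚ} {invℚ (p + 1ℚ)} 0<p+1 (invℚ-inverse 0<p+1))
    where
    0<p+1 : 0ℚ < p + 1ℚ
    0<p+1 = <-trans (<-trans 0<1 1<p) (p<p+1 p)

log-pos : ∀ n → 2 ℕ.≤ n → (0<n : 0ᴿ <ᴿ fromNat n) → 0ᴿ <ᴿ log (fromNat n) 0<n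
log-pos n 2≤n _ = fromℕ 2 * P 2 , 0<* 0<2 (artanh-partialSum-pos 0<t) , 2 , λ m 2≤m →
  subst (_≤ fromℕ 2 * P m) (sym (+-identityˡ (fromℕ 2 * P 2)))
    (*-monoˡ (fromℕ 2) (<⇒≤ 0<2) (subst (λ k → P 2 ≤ P k) (ℕₚ.m∸n+n≡m 2≤m)
      (partialSum-mono artanhCoeff-nonNeg (<⇒≤ 0<t) (m ℕ.∸ 2) 2)))
  where
  t : ℚ
  t = (fromℕ n - 1ℚ) * invℚ (fromℕ n + 1ℚ)
  P : ℕ → ℚ
  P = partialSum artanhCoeff t
  0<2 : 0ℚ < fromℕ 2
  0<2 = *<* (ℤ.+<+ (s≤s z≤n))
  0<t : 0ℚ < t
  0<t = log-arg-pos (fromℕ n) (<-≤-trans (*<* (ℤ.+<+ (s≤s (s≤s z≤n)))) (fromℕ-mono {2} {n} 2≤n))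

-- exp ((1 - ε) · n² / (n - 1) · s ^ (1 - 1/n) · (log s) ^ (- 1/n))
solutionBound : (n s : ℕ) → 2 ℕ.≤ n → 2 ℕ.≤ s → ℝ → ℝ
solutionBound n s 2≤n 2≤s ε =
  exp ((1ᴿ -ᴿ ε) *ᴿ fromℚ (+ (n ℕ.* n) / (n ℕ.∸ 1))
        *ᴿ pow (fromNat s) 0<s (fromℚ (1ℚ - + 1 / n))
        *ᴿ pow (log (fromNat s) 0<s) (log-pos s 2≤s 0<s) (fromℚ (- (+ 1 / n))))
  where
  instance
    n≢0 : ℕ.NonZero n
    n≢0 = ℕ.>-nonZero (ℕₚ.<⇒≤ 2≤n)
    n-1≢0 : ℕ.NonZero (n ℕ.∸ 1)
    n-1≢0 = ℕ.>-nonZero (ℕₚ.∸-monoˡ-≤ 1 2≤n)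
  0<s : 0ᴿ <ᴿ fromNat s
  0<s = fromNat-pos s (ℕₚ.<⇒≤ 2≤s)

-- A finite set of primes is represented by a duplicate-free list.
IsPrimeSetOfSize : ℕ → List ℕ → Set
IsPrimeSetOfSize s S = All Prime S × Unique S × length S ≡ s

IsSUnit : List ℕ → ℚ → Set
IsSUnit S q = q ≢ 0ℚ × (∀ p → Prime p → p ℕ∣.∣ ℤ.∣ ↥ q ∣ ⊎ p ℕ∣.∣ ↧ₙ q → p ∈ S)

module _ {n : ℕ} (a x : Vec ℚ n) where

  linearForm : ℚ
  linearForm = sum (λ i → lookup a i * lookup x i)

  subsum : Subset n → ℚ
  subsum T = sum (λ i → if lookup T i then lookup a i * lookup x i else 0ℚ)

  Degenerate : Set
  Degenerate = ∃[ T ] Nonempty T × T ⊂ ⊤ × subsum T ≡ 0ℚ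

  IsNonDegenerateSolution : List ℕ → Set
  IsNonDegenerateSolution S = (∀ i → IsSUnit S (lookup x i)) × linearForm ≡ 1ℚ × ¬ Degenerate

{-# OPTIONS --safe #-}
-- The primes of a₁, …, aₙ may be put into S, so it suffices to treat aᵢ = 1.  The prime number
-- theorem can be avoided because smooth moduli give a better exponent (after Konyagin and
-- Soundararajan): exp(s^β) solutions with β > 1 - 1/n, so that a Chebyshev-type count of the
-- primes and crude bounds for exp and log are enough.
--
-- Let x range over the products of k primes, one from each of k blocks of primes, and q over
-- such products of l primes.  If n = 2J, the Cauchy–Schwarz inequality yields, for every q, many
-- vectors with x₁ + … + x_J - x₁′ - … - x_J′ = q m.  The pigeonhole principle fixes m ≠ 0, and
-- dividing by q m gives solutions.  Vectors with a vanishing subsum lie on few hyperplanes and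
-- are discarded.
--
-- If n = 2J + 1, coincidences among the numbers x₁ + … + x_J + q₁ s + q₂ t with (s, t) in a grid
-- yield x₁ + … + x_J - x₁′ - … - x_J′ = q₁ m₁ + q₂ m₂.  If there are many solutions with m₁ = 0
-- or m₂ = 0, then the equation in n - 1 unknowns has many solutions, and each is padded by one
-- more unknown; otherwise some pair (m₁, m₂) with m₁ m₂ ≠ 0 is popular.
module Submission where

module Counting where

  open import Data.List.Base using (List; []; _∷_; _++_; length; map; filter; cartesianProduct)
  open import Data.List.Membership.Propositional using (_∈_; find; lose)
  open import Data.List.Membership.Propositional.Properties
  open import Data.List.Properties using (length-map; length-++; filter-++)
  open import Data.List.Relation.Unary.All as All using (All; []; _∷_)
  open import Data.List.Relation.Unary.AllPairs using ([]; _∷_)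
  open import Data.List.Relation.Unary.Any using (here; there; any?)
  open import Data.List.Relation.Unary.Unique.Propositional using (Unique)
  open import Data.Nat.Base
  open import Data.Nat.Properties
  open import Data.Nat.Solver using (module +-*-Solver)
  open import Data.Product.Base using (_×_; _,_; ∃-syntax; proj₁; proj₂)
  open import Function.Base using (_∘_)
  open import Relation.Binary.PropositionalEquality
  open import Relation.Nullary using (Dec; yes; no; does; contradiction)
  open import Relation.Nullary.Decidable using (¬?; dec-true; dec-false)
  open import Data.Bool.Base using (true; false; if_then_else_)
  open import Data.Sum.Base using (inj₁; inj₂)

  length-filter-mono : ∀ {A : Set} {P Q : A → Set} (P? : ∀ x → Dec (P x)) (Q? : ∀ x → Dec (Q x)) xs →
                       (∀ {x} → x ∈ xs → P x → Q x) → length (filter P? xs) ≤ length (filter Q? xs)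
  length-filter-mono P? Q? [] h = z≤n
  length-filter-mono P? Q? (x ∷ xs) h with P? x | Q? x
  ... | yes p | yes q = s≤s (length-filter-mono P? Q? xs (h ∘ there))
  ... | yes p | no ¬q = contradiction (h (here refl) p) ¬q
  ... | no ¬p | yes q = m≤n⇒m≤1+n (length-filter-mono P? Q? xs (h ∘ there))
  ... | no ¬p | no ¬q = length-filter-mono P? Q? xs (h ∘ there)

  length-filter-¬ : ∀ {A : Set} {P : A → Set} (P? : ∀ x → Dec (P x)) xs →
                    length xs ≡ length (filter P? xs) + length (filter (¬? ∘ P?) xs)
  length-filter-¬ P? [] = refl
  length-filter-¬ P? (x ∷ xs) with P? x
  ... | yes _ = cong suc (length-filter-¬ P? xs)
  ... | no _  = trans (cong suc (length-filter-¬ P? xs)) (sym (+-suc _ _))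

  length-filter-map : ∀ {A B : Set} {P : B → Set} (P? : ∀ x → Dec (P x)) (f : A → B) xs →
                      length (filter P? (map f xs)) ≡ length (filter (P? ∘ f) xs)
  length-filter-map P? f [] = refl
  length-filter-map P? f (x ∷ xs) with does (P? (f x))
  ... | true  = cong suc (length-filter-map P? f xs)
  ... | false = length-filter-map P? f xs

  length-filter-++ : ∀ {A : Set} {P : A → Set} (P? : ∀ x → Dec (P x)) xs ys →
                     length (filter P? (xs ++ ys)) ≡ length (filter P? xs) + length (filter P? ys)
  length-filter-++ P? xs ys = trans (cong length (filter-++ P? xs ys)) (length-++ (filter P? xs))

  length-cartesianProduct : ∀ {A B : Set} (xs : List A) (ys : List B) →
                            length (cartesianProduct xs ys) ≡ length xs * length ys
  length-cartesianProduct [] ys = refl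
  length-cartesianProduct (x ∷ xs) ys = trans (length-++ (map (x ,_) ys))
    (cong₂ _+_ (length-map (x ,_) ys) (length-cartesianProduct xs ys))

  length-filter-filter : ∀ {A : Set} {P Q : A → Set} (P? : ∀ x → Dec (P x)) (Q? : ∀ x → Dec (Q x)) xs →
                         length (filter P? (filter Q? xs)) ≤ length (filter P? xs)
  length-filter-filter P? Q? [] = z≤n
  length-filter-filter P? Q? (x ∷ xs) with ih ← length-filter-filter P? Q? xs | does (Q? x)
  ... | true with does (P? x)
  ...   | true  = s≤s ih
  ...   | false = ih
  length-filter-filter P? Q? (x ∷ xs) | false with does (P? x)
  ...   | true  = m≤n⇒m≤1+n ih
  ...   | false = ih

  covering : ∀ {A K : Set} {R : A → K → Set} (R? : ∀ x k → Dec (R x k)) (xs : List A) (ks : List K) c →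
             (∀ {x} → x ∈ xs → ∃[ k ] k ∈ ks × R x k) →
             (∀ {k} → k ∈ ks → length (filter (λ x → R? x k) xs) ≤ c) →
             length xs ≤ length ks * c
  covering R? [] ks c cov fib = z≤n
  covering R? (x ∷ xs) [] c cov fib with () ← proj₁ (proj₂ (cov (here refl)))
  covering {R = R} R? xs@(_ ∷ _) (k ∷ ks) c cov fib = begin
    length xs ≡⟨ length-filter-¬ (λ x → R? x k) xs ⟩
    length (filter (λ x → R? x k) xs) + length rest
      ≤⟨ +-mono-≤ (fib (here refl)) (covering R? rest ks c cov′
           (λ {k′} k′∈ → ≤-trans (length-filter-filter (λ x → R? x k′) (λ x → ¬? (R? x k)) xs) (fib (there k′∈)))) ⟩
    c + length ks * c ∎
    where
    open ≤-Reasoning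
    rest = filter (λ x → ¬? (R? x k)) xs
    cov′ : ∀ {x} → x ∈ rest → ∃[ k′ ] k′ ∈ ks × R x k′
    cov′ x∈ with ∈-filter⁻ (λ x → ¬? (R? x k)) x∈
    ... | x∈xs , ¬Rxk with cov x∈xs
    ...   | k′ , here refl , r = contradiction r ¬Rxk
    ...   | k′ , there k′∈ , r = k′ , k′∈ , r

  pigeonhole : ∀ {A K : Set} {R : A → K → Set} (R? : ∀ x k → Dec (R x k)) (xs : List A) (ks : List K) c →
               (∀ {x} → x ∈ xs → ∃[ k ] k ∈ ks × R x k) → length ks * c < length xs →
               ∃[ k ] k ∈ ks × c < length (filter (λ x → R? x k) xs)
  pigeonhole R? xs ks c cov big with any? (λ k → c <? length (filter (λ x → R? x k) xs)) ks
  ... | yes a = find a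
  ... | no ¬a = contradiction (covering R? xs ks c cov (λ k∈ → ≮⇒≥ (λ lt → ¬a (lose k∈ lt)))) (<⇒≱ big)

  unique-⊆⇒length-≤ : ∀ {A : Set} {xs ys : List A} → Unique xs → (∀ {x} → x ∈ xs → x ∈ ys) →
                      length xs ≤ length ys
  unique-⊆⇒length-≤ [] h = z≤n
  unique-⊆⇒length-≤ {xs = x ∷ xs} (x∉ ∷ u) h with ∈-∃++ (h (here refl))
  ... | as , bs , refl = begin
    suc (length xs)           ≤⟨ s≤s (unique-⊆⇒length-≤ u (λ z∈ → drop as (All.lookup x∉ z∈ ∘ sym) (h (there z∈)))) ⟩
    suc (length (as ++ bs))   ≡⟨ cong suc (length-++ as) ⟩
    suc (length as + length bs) ≡⟨ +-suc (length as) (length bs) ⟨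
    length as + suc (length bs) ≡⟨ length-++ as ⟨
    length (as ++ x ∷ bs) ∎
    where
    open ≤-Reasoning
    drop : ∀ as {z} → z ≢ x → z ∈ as ++ x ∷ bs → z ∈ as ++ bs
    drop [] z≢ (here eq) = contradiction eq z≢
    drop [] z≢ (there z∈) = z∈
    drop (a ∷ as) z≢ (here eq) = here eq
    drop (a ∷ as) z≢ (there z∈) = there (drop as z≢ z∈)

  map-unique : ∀ {A B : Set} {xs : List A} (f : A → B) → Unique xs →
               (∀ {x y} → x ∈ xs → y ∈ xs → f x ≡ f y → x ≡ y) → Unique (map f xs)
  map-unique f [] inj = []
  map-unique {xs = x ∷ xs} f (x∉ ∷ u) inj =
    All.tabulate (λ z∈ eq → let y , y∈ , z≡ = ∈-map⁻ f z∈ in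
      All.lookup x∉ y∈ (inj (here refl) (there y∈) (trans eq z≡)))
    ∷ map-unique f u (λ x∈ y∈ → inj (there x∈) (there y∈))

  injection⇒length-≤ : ∀ {A B : Set} {xs : List A} {ys : List B} (f : A → B) → Unique xs →
                       (∀ {x} → x ∈ xs → f x ∈ ys) →
                       (∀ {x y} → x ∈ xs → y ∈ xs → f x ≡ f y → x ≡ y) → length xs ≤ length ys
  injection⇒length-≤ {xs = xs} f u into inj = subst (_≤ _) (length-map f xs)
    (unique-⊆⇒length-≤ (map-unique f u inj)
      (λ y∈ → let x , x∈ , eq = ∈-map⁻ f y∈ in subst (_∈ _) (sym eq) (into x∈)))

  length-filter-product : ∀ {A B : Set} {P : A × B → Set} (P? : ∀ x → Dec (P x)) (xs : List A) (ys : List B) r c →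
                          (∀ {x} → x ∈ xs → c ≤ r * length (filter (λ y → P? (x , y)) ys)) →
                          length xs * c ≤ r * length (filter P? (cartesianProduct xs ys))
  length-filter-product P? [] ys r c h = z≤n
  length-filter-product P? (x ∷ xs) ys r c h = begin
    c + length xs * c ≤⟨ +-mono-≤ (h (here refl)) (length-filter-product P? xs ys r c (h ∘ there)) ⟩
    r * length (filter (λ y → P? (x , y)) ys) + r * length rest
      ≡⟨ *-distribˡ-+ r (length (filter (λ y → P? (x , y)) ys)) (length rest) ⟨
    r * (length (filter (λ y → P? (x , y)) ys) + length rest)
      ≡⟨ cong (λ z → r * (z + length rest)) (length-filter-map P? (x ,_) ys) ⟨
    r * (length (filter P? (map (x ,_) ys)) + length rest)
      ≡⟨ cong (r *_) (length-filter-++ P? (map (x ,_) ys) (cartesianProduct xs ys)) ⟨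
    r * length (filter P? (cartesianProduct (x ∷ xs) ys)) ∎
    where
    open ≤-Reasoning
    rest = filter P? (cartesianProduct xs ys)

  private

    fiber : ∀ {A : Set} → (A → ℕ) → List A → ℕ → ℕ
    fiber f xs r = length (filter (λ x → f x ≟ r) xs)

    Σ< : ℕ → (ℕ → ℕ) → ℕ
    Σ< zero g = 0
    Σ< (suc R) g = g R + Σ< R g

    Σ<-cong : ∀ R {g h} → (∀ r → r < R → g r ≡ h r) → Σ< R g ≡ Σ< R h
    Σ<-cong zero eq = refl
    Σ<-cong (suc R) eq = cong₂ _+_ (eq R ≤-refl) (Σ<-cong R (λ r r<R → eq r (m<n⇒m<1+n r<R)))

    Σ<-+ : ∀ R g h → Σ< R (λ r → g r + h r) ≡ Σ< R g + Σ< R h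
    Σ<-+ zero g h = refl
    Σ<-+ (suc R) g h rewrite Σ<-+ R g h = solve 4 (λ a b c d → a :+ b :+ (c :+ d) := a :+ c :+ (b :+ d)) refl
      (g R) (h R) (Σ< R g) (Σ< R h)
      where open +-*-Solver

    two-product-≤ : ∀ {a b} → a ≤ b → 2 * (a * b) ≤ a * a + b * b
    two-product-≤ {a} {b} a≤b = subst (λ b → 2 * (a * b) ≤ a * a + b * b) (m+[n∸m]≡n a≤b) (ordered (b ∸ a))
      where
      open +-*-Solver
      ordered : ∀ e → 2 * (a * (a + e)) ≤ a * a + (a + e) * (a + e)
      ordered e = subst (2 * (a * (a + e)) ≤_)
        (solve 2 (λ a e → con 2 :* (a :* (a :+ e)) :+ e :* e := a :* a :+ (a :+ e) :* (a :+ e)) refl a e)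
        (m≤m+n (2 * (a * (a + e))) (e * e))

    two-product : ∀ a b → 2 * (a * b) ≤ a * a + b * b
    two-product a b with ≤-total a b
    ... | inj₁ a≤b = two-product-≤ a≤b
    ... | inj₂ b≤a = subst₂ _≤_ (cong (2 *_) (*-comm b a)) (+-comm (b * b) (a * a)) (two-product-≤ b≤a)

    cross : ∀ R g c → 2 * (c * Σ< R g) ≤ R * (c * c) + Σ< R (λ r → g r * g r)
    cross zero g c = ≤-reflexive (cong (2 *_) (*-zeroʳ c))
    cross (suc R) g c = begin
      2 * (c * (g R + Σ< R g)) ≡⟨ solve 3 (λ c g S → con 2 :* (c :* (g :+ S)) := con 2 :* (c :* g) :+ con 2 :* (c :* S)) refl c (g R) (Σ< R g) ⟩
      2 * (c * g R) + 2 * (c * Σ< R g) ≤⟨ +-mono-≤ (two-product c (g R)) (cross R g c) ⟩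
      (c * c + g R * g R) + (R * (c * c) + Q)
        ≡⟨ solve 4 (λ c g R Q → (c :* c :+ g :* g) :+ (R :* (c :* c) :+ Q) := (c :* c :+ R :* (c :* c)) :+ (g :* g :+ Q)) refl c (g R) R Q ⟩
      suc R * (c * c) + Σ< (suc R) (λ r → g r * g r) ∎
      where
      open ≤-Reasoning
      open +-*-Solver
      Q = Σ< R (λ r → g r * g r)

    cauchy-schwarz : ∀ R g → Σ< R g * Σ< R g ≤ R * Σ< R (λ r → g r * g r)
    cauchy-schwarz zero g = z≤n
    cauchy-schwarz (suc R) g = begin
      (g R + S) * (g R + S) ≡⟨ solve 2 (λ c S → (c :+ S) :* (c :+ S) := c :* c :+ (con 2 :* (c :* S) :+ S :* S)) refl (g R) S ⟩
      g R * g R + (2 * (g R * S) + S * S) ≤⟨ +-monoʳ-≤ (g R * g R) (+-mono-≤ (cross R g (g R)) (cauchy-schwarz R g)) ⟩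
      g R * g R + ((R * (g R * g R) + Q) + R * Q)
        ≡⟨ solve 3 (λ c R Q → c :* c :+ ((R :* (c :* c) :+ Q) :+ R :* Q) := (con 1 :+ R) :* (c :* c :+ Q)) refl (g R) R Q ⟩
      suc R * Σ< (suc R) (λ r → g r * g r) ∎
      where
      open ≤-Reasoning
      open +-*-Solver
      S = Σ< R g
      Q = Σ< R (λ r → g r * g r)

    δ : ℕ → ℕ → ℕ
    δ a r = if does (a ≟ r) then 1 else 0

    δ-same : ∀ a → δ a a ≡ 1
    δ-same a = cong (if_then 1 else 0) (dec-true (a ≟ a) refl)

    δ-diff : ∀ {a r} → a ≢ r → δ a r ≡ 0
    δ-diff {a} {r} a≢r = cong (if_then 1 else 0) (dec-false (a ≟ r) a≢r)

    δ-sift : ∀ R a (g : ℕ → ℕ) → a < R → Σ< R (λ r → δ a r * g r) ≡ g a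
    δ-sift (suc R) a g a<R+1 with a ≟ R
    ... | yes refl = trans (cong₂ _+_ (trans (cong (_* g R) (δ-same R)) (*-identityˡ (g R))) (vanish R ≤-refl))
      (+-identityʳ (g R))
      where
      vanish : ∀ S → S ≤ R → Σ< S (λ r → δ R r * g r) ≡ 0
      vanish zero _ = refl
      vanish (suc S) S<R = cong₂ _+_ (cong (_* g S) (δ-diff (>⇒≢ S<R))) (vanish S (<⇒≤ S<R))
    ... | no a≢R = cong₂ _+_ (cong (_* g R) (δ-diff a≢R)) (δ-sift R a g (≤∧≢⇒< (s≤s⁻¹ a<R+1) a≢R))

    fiber-∷ : ∀ {A : Set} (f : A → ℕ) x xs r → fiber f (x ∷ xs) r ≡ δ (f x) r + fiber f xs r
    fiber-∷ f x xs r with does (f x ≟ r)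
    ... | true  = refl
    ... | false = refl

    fibers-total : ∀ {A : Set} (f : A → ℕ) R xs → (∀ {x} → x ∈ xs → f x < R) → Σ< R (fiber f xs) ≡ length xs
    fibers-total f R [] h = vanish R
      where
      vanish : ∀ R → Σ< R (fiber f []) ≡ 0
      vanish zero = refl
      vanish (suc R) = vanish R
    fibers-total f R (x ∷ xs) h = begin
      Σ< R (fiber f (x ∷ xs)) ≡⟨ Σ<-cong R (λ r _ → trans (fiber-∷ f x xs r) (cong (_+ fiber f xs r) (sym (*-identityʳ (δ (f x) r))))) ⟩
      Σ< R (λ r → δ (f x) r * 1 + fiber f xs r) ≡⟨ Σ<-+ R (λ r → δ (f x) r * 1) (fiber f xs) ⟩
      Σ< R (λ r → δ (f x) r * 1) + Σ< R (fiber f xs) ≡⟨ cong₂ _+_ (δ-sift R (f x) (λ _ → 1) (h (here refl))) (fibers-total f R xs (h ∘ there)) ⟩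
      suc (length xs) ∎
      where open ≡-Reasoning

    collisions≡ : ∀ {A : Set} (f : A → ℕ) R xs ys → (∀ {x} → x ∈ xs → f x < R) →
                  Σ< R (λ r → fiber f xs r * fiber f ys r)
                    ≡ length (filter (λ p → f (proj₂ p) ≟ f (proj₁ p)) (cartesianProduct xs ys))
    collisions≡ f R [] ys h = vanish R
      where
      vanish : ∀ R → Σ< R (λ _ → 0) ≡ 0
      vanish zero = refl
      vanish (suc R) = vanish R
    collisions≡ f R (x ∷ xs) ys h = begin
      Σ< R (λ r → fiber f (x ∷ xs) r * fiber f ys r)
        ≡⟨ Σ<-cong R (λ r _ → trans (cong (_* fiber f ys r) (fiber-∷ f x xs r)) (*-distribʳ-+ (fiber f ys r) (δ (f x) r) (fiber f xs r))) ⟩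
      Σ< R (λ r → δ (f x) r * fiber f ys r + fiber f xs r * fiber f ys r)
        ≡⟨ Σ<-+ R (λ r → δ (f x) r * fiber f ys r) (λ r → fiber f xs r * fiber f ys r) ⟩
      Σ< R (λ r → δ (f x) r * fiber f ys r) + Σ< R (λ r → fiber f xs r * fiber f ys r)
        ≡⟨ cong₂ _+_ (δ-sift R (f x) (fiber f ys) (h (here refl))) (collisions≡ f R xs ys (h ∘ there)) ⟩
      fiber f ys (f x) + length (filter same (cartesianProduct xs ys))
        ≡⟨ cong (_+ length (filter same (cartesianProduct xs ys))) (length-filter-map same (x ,_) ys) ⟨
      length (filter same (map (x ,_) ys)) + length (filter same (cartesianProduct xs ys))
        ≡⟨ length-filter-++ same (map (x ,_) ys) (cartesianProduct xs ys) ⟨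
      length (filter same (cartesianProduct (x ∷ xs) ys)) ∎
      where
      open ≡-Reasoning
      same = λ p → f (proj₂ p) ≟ f (proj₁ p)

  collisions-≥ : ∀ {A : Set} (f : A → ℕ) R xs → (∀ {x} → x ∈ xs → f x < R) →
                 length xs * length xs
                   ≤ R * length (filter (λ p → f (proj₂ p) ≟ f (proj₁ p)) (cartesianProduct xs xs))
  collisions-≥ f R xs h = subst₂ _≤_ (cong₂ _*_ (fibers-total f R xs h) (fibers-total f R xs h))
    (cong (R *_) (collisions≡ f R xs xs h)) (cauchy-schwarz R (fiber f xs))

module Chebyshev where

  open import Data.List.Base using (List; []; _∷_; length; map; filter; upTo; applyUpTo)
  open import Data.List.Membership.Propositional using (_∈_)
  open import Data.List.Membership.Propositional.Properties
  open import Data.List.Properties using (length-map; length-applyUpTo)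
  open import Data.List.Relation.Unary.All using (All; []; _∷_)
  open import Data.List.Relation.Unary.AllPairs using ([]; _∷_)
  open import Data.List.Relation.Unary.Any using (here; there)
  open import Data.List.Relation.Unary.Unique.Propositional using (Unique)
  import Data.List.Relation.Unary.Unique.Propositional.Properties as Uniq
  open import Data.Nat.Base
  open import Data.Nat.Combinatorics
  open import Data.Nat.Coprimality using (Coprime; coprime-divisor)
  open import Data.Nat.Divisibility
  open import Data.Nat.Induction using (<-rec)
  open import Data.Nat.ListAction using (product)
  open import Data.Nat.Primality
  open import Data.Nat.Primality.Factorisation using (factorise; PrimeFactorisation)
  open import Data.Nat.Properties
  open import Data.Nat.Solver using (module +-*-Solver)
  open import Data.Product.Base using (_×_; _,_; ∃-syntax; proj₁; proj₂)
  open import Data.Sum.Base using (inj₁; inj₂)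
  open import Relation.Binary.PropositionalEquality
  open import Relation.Nullary using (Dec; ¬_; yes; no; contradiction)
  open import Relation.Nullary.Decidable using (¬?)
  open Counting

  ∃-prime-divisor : ∀ n → 2 ≤ n → ∃[ p ] Prime p × p ∣ n
  ∃-prime-divisor n 2≤n = go (factorise n {{>-nonZero (<⇒≤ 2≤n)}})
    where
    go : PrimeFactorisation n → ∃[ p ] Prime p × p ∣ n
    go record { factors = [] ; isFactorisation = eq } = contradiction eq (>⇒≢ 2≤n)
    go record { factors = p ∷ ps ; isFactorisation = eq ; factorsPrime = pp ∷ _ } =
      p , pp , subst (p ∣_) (sym eq) (m∣m*n (product ps))

  prime∤1 : ∀ {p} → Prime p → ¬ p ∣ 1
  prime∤1 pp p∣1 = contradiction (∣1⇒≡1 p∣1) (λ { refl → ¬prime[1] pp })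

  prime∣prime⇒≡ : ∀ {p q} → Prime p → Prime q → p ∣ q → p ≡ q
  prime∣prime⇒≡ pp pq p∣q with prime⇒irreducible pq p∣q
  ... | inj₁ refl = contradiction pp ¬prime[1]
  ... | inj₂ eq = eq

  prime∣^⇒∣ : ∀ {p} m k → Prime p → p ∣ m ^ k → p ∣ m
  prime∣^⇒∣ m zero pp h = contradiction h (prime∤1 pp)
  prime∣^⇒∣ m (suc k) pp h with euclidsLemma m (m ^ k) pp h
  ... | inj₁ d = d
  ... | inj₂ d = prime∣^⇒∣ m k pp d

  no-common-prime⇒coprime : ∀ {m n} → 0 < n → (∀ p → Prime p → p ∣ m → ¬ p ∣ n) → Coprime m n
  no-common-prime⇒coprime {m} {n} 0<n h {zero} (_ , 0∣n) = contradiction (0∣⇒≡0 0∣n) (>⇒≢ 0<n)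
  no-common-prime⇒coprime {m} {n} 0<n h {1} _ = refl
  no-common-prime⇒coprime {m} {n} 0<n h {suc (suc d)} (d∣m , d∣n) with ∃-prime-divisor (2+ d) (s≤s (s≤s z≤n))
  ... | p , pp , p∣d = contradiction (∣-trans p∣d d∣n) (h p pp (∣-trans p∣d d∣m))

  prime-powers-∣⇒∣ : ∀ j L → 0 < j → (∀ p k → Prime p → p ^ k ∣ j → p ^ k ∣ L) → j ∣ L
  prime-powers-∣⇒∣ = <-rec _ step
    where
    step : ∀ j → (∀ {i} → i < j → ∀ L → 0 < i → (∀ p k → Prime p → p ^ k ∣ i → p ^ k ∣ L) → i ∣ L) →
           ∀ L → 0 < j → (∀ p k → Prime p → p ^ k ∣ j → p ^ k ∣ L) → j ∣ L
    step 1 rec L _ h = 1∣ L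
    step j@(2+ _) rec L 0<j h with ∃-prime-divisor j (s≤s (s≤s z≤n))
    ... | p , pp , divides i j≡ip = subst₂ _∣_ (sym j≡ip) (sym L≡)
        (*-monoˡ-∣ p (rec i<j L/p 0<i powers))
      where
      instance _ = prime⇒nonZero pp
      p∣L : p ∣ L
      p∣L = subst (_∣ L) (*-identityʳ p) (h p 1 pp (subst (_∣ j) (sym (*-identityʳ p)) (divides i j≡ip)))
      L/p = quotient p∣L
      L≡ : L ≡ L/p * p
      L≡ = m∣n⇒n≡quotient*m p∣L
      0<i : 0 < i
      0<i = n≢0⇒n>0 (λ i≡0 → >⇒≢ 0<j (trans j≡ip (cong (_* p) i≡0)))
      i<j : i < j
      i<j = subst (i <_) (sym j≡ip) (m<m*n i p {{>-nonZero 0<i}} (nonTrivial⇒n>1 p {{prime⇒nonTrivial pp}}))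
      powers : ∀ q k → Prime q → q ^ k ∣ i → q ^ k ∣ L/p
      powers q k pq d with q ≟ p
      ... | yes refl = *-cancelˡ-∣ p (subst (p * p ^ k ∣_) (trans L≡ (*-comm L/p p))
          (h p (suc k) pp (subst (p * p ^ k ∣_) (trans (*-comm p i) (sym j≡ip)) (*-monoʳ-∣ p d))))
      ... | no q≢p = coprime-divisor coprime (subst (q ^ k ∣_) (trans L≡ (*-comm L/p p))
          (h q k pq (∣-trans d (divides p (trans j≡ip (*-comm i p))))))
        where
        coprime : Coprime (q ^ k) p
        coprime = no-common-prime⇒coprime (>-nonZero⁻¹ p) λ r pr r∣qᵏ r∣p → q≢p
          (trans (sym (prime∣prime⇒≡ pr pq (prime∣^⇒∣ q k pr r∣qᵏ))) (prime∣prime⇒≡ pr pp r∣p))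

  n<2^n : ∀ n → n < 2 ^ n
  n<2^n zero = s≤s z≤n
  n<2^n (suc n) = begin-strict
    suc n ≤⟨ n<2^n n ⟩
    2 ^ n <⟨ m<m+n (2 ^ n) (≤-trans (m^n>0 2 n) (≤-reflexive (sym (+-identityʳ _)))) ⟩
    2 ^ suc n ∎
    where open ≤-Reasoning

  maximalPower : ∀ p n → 2 ≤ p → 1 ≤ n → ∃[ e ] p ^ e ≤ n × (∀ k → p ^ k ≤ n → k ≤ e)
  maximalPower p n 2≤p 1≤n = search n (λ k le → <⇒≤ (<-≤-trans (n<2^n k) (≤-trans (^-monoˡ-≤ k 2≤p) le)))
    where
    search : ∀ b → (∀ k → p ^ k ≤ n → k ≤ b) → ∃[ e ] p ^ e ≤ n × (∀ k → p ^ k ≤ n → k ≤ e)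
    search zero h = 0 , 1≤n , h
    search (suc b) h with p ^ suc b ≤? n
    ... | yes le = suc b , le , h
    ... | no ≰ = search b (λ k le → s≤s⁻¹ (≤∧≢⇒< (h k le) (λ { refl → ≰ le })))

  primesUpTo : ℕ → List ℕ
  primesUpTo n = filter prime? (upTo (suc n))

  ∈-product⇒∣ : ∀ {A : Set} (f : A → ℕ) {x xs} → x ∈ xs → f x ∣ product (map f xs)
  ∈-product⇒∣ f {xs = _ ∷ xs} (here refl) = m∣m*n (product (map f xs))
  ∈-product⇒∣ f {xs = y ∷ xs} (there x∈) = ∣n⇒∣m*n (f y) (∈-product⇒∣ f x∈)

  product-≤-^ : ∀ {b xs} → All (_≤ b) xs → product xs ≤ b ^ length xs
  product-≤-^ [] = ≤-refl
  product-≤-^ (h ∷ hs) = *-mono-≤ h (product-≤-^ hs)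

  commonMultiple : ∀ n → 1 ≤ n →
    ∃[ L ] L ≤ n ^ length (primesUpTo n) × 0 < L × (∀ j → 0 < j → j ≤ n → j ∣ L)
  commonMultiple n 1≤n = product (map mp ps)
    , subst (λ l → product (map mp ps) ≤ n ^ l) (length-map mp ps)
        (product-≤-^ (mapAll ps))
    , L>0 ps
    , λ j 0<j j≤n → prime-powers-∣⇒∣ j _ 0<j (powers j 0<j j≤n)
    where
    ps = primesUpTo n
    -- the default value for p < 2 never matters
    mp′ : ∀ p → Dec (2 ≤ p) → ℕ
    mp′ p (yes 2≤p) = p ^ proj₁ (maximalPower p n 2≤p 1≤n)
    mp′ p (no _) = 1
    mp : ℕ → ℕ
    mp p = mp′ p (2 ≤? p)
    mp≤ : ∀ p → mp p ≤ n
    mp≤ p with 2 ≤? p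
    ... | yes 2≤p = proj₁ (proj₂ (maximalPower p n 2≤p 1≤n))
    ... | no _ = 1≤n
    mp>0 : ∀ p → 0 < mp p
    mp>0 p with 2 ≤? p
    ... | yes 2≤p = m^n>0 p {{>-nonZero (<⇒≤ 2≤p)}} (proj₁ (maximalPower p n 2≤p 1≤n))
    ... | no _ = ≤-refl
    mapAll : ∀ ps → All (_≤ n) (map mp ps)
    mapAll [] = []
    mapAll (p ∷ ps) = mp≤ p ∷ mapAll ps
    L>0 : ∀ ps → 0 < product (map mp ps)
    L>0 [] = ≤-refl
    L>0 (p ∷ ps) = *-mono-≤ (mp>0 p) (L>0 ps)
    ^∣mp : ∀ p k → 2 ≤ p → p ^ k ≤ n → p ^ k ∣ mp p
    ^∣mp p k 2≤p le with 2 ≤? p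
    ... | yes _ = m≤n⇒m^o∣n^o p (proj₂ (proj₂ (maximalPower p n _ 1≤n)) k le)
      where
      m≤n⇒m^o∣n^o : ∀ p {j k} → j ≤ k → p ^ j ∣ p ^ k
      m≤n⇒m^o∣n^o p {j} {k} j≤k = divides (p ^ (k ∸ j))
        (trans (cong (p ^_) (sym (m∸n+n≡m j≤k))) (^-distribˡ-+-* p (k ∸ j) j))
    ... | no ≰ = contradiction 2≤p ≰
    powers : ∀ j → 0 < j → j ≤ n → ∀ p k → Prime p → p ^ k ∣ j → p ^ k ∣ product (map mp ps)
    powers j 0<j j≤n p zero pp d = 1∣ _
    powers j 0<j j≤n p k@(suc k′) pp d = ∣-trans (^∣mp p k 2≤p pᵏ≤n)
      (∈-product⇒∣ mp (∈-filter⁺ prime? (∈-upTo⁺ (s≤s (≤-trans p≤pᵏ pᵏ≤n))) pp))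
      where
      2≤p : 2 ≤ p
      2≤p = nonTrivial⇒n>1 p {{prime⇒nonTrivial pp}}
      pᵏ≤n : p ^ k ≤ n
      pᵏ≤n = ≤-trans (∣⇒≤ {{>-nonZero 0<j}} d) j≤n
      p≤pᵏ : p ≤ p ^ k
      p≤pᵏ = m≤m*n p (p ^ k′) {{>-nonZero (m^n>0 p {{>-nonZero (<⇒≤ 2≤p)}} k′)}}

  pascal : ∀ n k → suc n C suc k ≡ n C k + n C suc k
  pascal n k = sym (nCk+nC[k+1]≡[n+1]C[k+1] n k)

  absorption : ∀ n k → suc k * (suc n C suc k) ≡ suc n * (n C k)
  absorption zero zero = refl
  absorption zero (suc k) = trans (cong (2+ k *_) (k>n⇒nCk≡0 {1} {2+ k} (s≤s z<s)))
    (trans (*-zeroʳ (2+ k)) (sym (cong (1 *_) (k>n⇒nCk≡0 {0} {suc k} z<s))))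
  absorption (suc n) zero = begin
    1 * (2+ n C 1) ≡⟨ *-identityˡ _ ⟩
    2+ n C 1       ≡⟨ nC1≡n (2+ n) ⟩
    2+ n           ≡⟨ *-identityʳ (2+ n) ⟨
    2+ n * (suc n C 0) ∎
    where open ≡-Reasoning
  absorption (suc n) (suc k) = begin
    2+ k * (2+ n C 2+ k) ≡⟨ cong (2+ k *_) (pascal (suc n) (suc k)) ⟩
    2+ k * (x + y) ≡⟨ solve 3 (λ k x y → (con 2 :+ k) :* (x :+ y) := x :+ ((con 1 :+ k) :* x :+ (con 2 :+ k) :* y)) refl k x y ⟩
    x + (suc k * x + 2+ k * y) ≡⟨ cong (x +_) (cong₂ _+_ (absorption n k) (absorption n (suc k))) ⟩
    x + (suc n * (n C k) + suc n * (n C suc k)) ≡⟨ cong (x +_) (*-distribˡ-+ (suc n) (n C k) (n C suc k)) ⟨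
    x + suc n * (n C k + n C suc k) ≡⟨ cong (λ z → x + suc n * z) (pascal n k) ⟨
    2+ n * x ∎
    where
    open ≡-Reasoning
    open +-*-Solver
    x = suc n C suc k
    y = suc n C 2+ k

  -- 1/((k+2) C(n+1,k+2)) = 1/((k+1) C(n,k+1)) - 1/((k+1) C(n+1,k+1)) (Leibniz's harmonic
  -- triangle), so the denominators divide every common multiple of 1, …, n.
  leibniz : ∀ N L → (∀ j → 0 < j → j ≤ N → j ∣ L) → ∀ k n → n ≤ N → k < n → suc k * (n C suc k) ∣ L
  leibniz N L cm zero n n≤N 0<n = subst (_∣ L) (sym (trans (*-identityˡ (n C 1)) (nC1≡n n))) (cm n 0<n n≤N)
  leibniz N L cm (suc k) (suc n) n<N (s≤s k<n)
    with leibniz N L cm k n (<⇒≤ n<N) k<n | leibniz N L cm k (suc n) n<N (m<n⇒m<1+n k<n)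
  ... | divides α L≡α | divides β L≡β = subst (_∣ L) (sym (absorption n (suc k)))
    (∣m+n∣m⇒∣n (divides α (trans (*-cancelˡ-≡ _ _ (suc k) eq) (*-comm X α))) (m∣m*n β))
    where
    a = n C k
    b = n C suc k
    X = suc n * b
    L≡β′ : L ≡ β * (suc k * (a + b))
    L≡β′ = trans L≡β (cong (λ z → β * (suc k * z)) (pascal n k))
    absorbed : suc k * (a + b) ≡ suc n * a
    absorbed = trans (cong (suc k *_) (sym (pascal n k))) (absorption n k)
    eq : suc k * (X * β + L) ≡ suc k * (X * α)
    eq = begin
      suc k * (X * β + L)
        ≡⟨ cong (λ z → suc k * (X * β + z)) L≡β′ ⟩
      suc k * (X * β + β * (suc k * (a + b)))
        ≡⟨ cong (λ z → suc k * (X * β + β * z)) absorbed ⟩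
      suc k * (suc n * b * β + β * (suc n * a))
        ≡⟨ solve 5 (λ k n a b β → k :* (n :* b :* β :+ β :* (n :* a)) := n :* (β :* (k :* (a :+ b)))) refl (suc k) (suc n) a b β ⟩
      suc n * (β * (suc k * (a + b)))
        ≡⟨ cong (suc n *_) (trans (sym L≡β′) L≡α) ⟩
      suc n * (α * (suc k * b))
        ≡⟨ solve 4 (λ k n b α → n :* (α :* (k :* b)) := k :* (n :* b :* α)) refl (suc k) (suc n) b α ⟩
      suc k * (X * α) ∎
      where
      open ≡-Reasoning
      open +-*-Solver

  2^m≤central : ∀ m → 2 ^ m ≤ (m + m) C m
  2^m≤central zero = ≤-refl
  2^m≤central (suc m) = begin
    2 * 2 ^ m ≤⟨ *-monoʳ-≤ 2 (2^m≤central m) ⟩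
    2 * c     ≡⟨ cong (c +_) (+-identityʳ c) ⟩
    c + c     ≤⟨ +-mono-≤ (c≤ m) (subst (c ≤_) (sym (pascal (m + m) m)) (m≤m+n c _)) ⟩
    (suc (m + m) C m) + (suc (m + m) C suc m) ≡⟨ pascal (suc (m + m)) m ⟨
    2+ (m + m) C suc m ≡⟨ cong (λ z → suc z C suc m) (+-suc m m) ⟨
    (suc m + suc m) C suc m ∎
    where
    open ≤-Reasoning
    c = (m + m) C m
    c≤ : ∀ m → (m + m) C m ≤ suc (m + m) C m
    c≤ zero = ≤-refl
    c≤ (suc m) = subst ((suc m + suc m) C suc m ≤_) (sym (pascal (suc m + suc m) m)) (m≤n+m _ ((suc m + suc m) C m))

  chebyshev : ∀ m → 0 < m → 2 ^ m ≤ (m + m) ^ length (primesUpTo (m + m))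
  chebyshev m@(suc m′) 0<m with commonMultiple (m + m) (m≤n⇒m≤n+o m 0<m)
  ... | L , L≤ , 0<L , cm = begin
    2 ^ m             ≤⟨ 2^m≤central m ⟩
    (m + m) C m       ≤⟨ m≤n*m ((m + m) C m) m ⟩
    m * ((m + m) C m) ≤⟨ ∣⇒≤ {{>-nonZero 0<L}} (leibniz (m + m) L cm m′ (m + m) ≤-refl (m≤n⇒m≤n+o m ≤-refl)) ⟩
    L                 ≤⟨ L≤ ⟩
    (m + m) ^ length (primesUpTo (m + m)) ∎
    where open ≤-Reasoning

  c*n≤2^n : ∀ c n → c * c ≤ n → c * n ≤ 2 ^ n
  c*n≤2^n c n c²≤n = subst (λ n → c * n ≤ 2 ^ n) (m+[n∸m]≡n c²≤n) (at (n ∸ c * c))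
    where
    open ≤-Reasoning
    open +-*-Solver
    at : ∀ e → c * (c * c + e) ≤ 2 ^ (c * c + e)
    at e with m≤n⇒∃[o]m+o≡n (c≤c² c)
      where
      c≤c² : ∀ c → c ≤ c * c
      c≤c² zero = z≤n
      c≤c² c@(suc _) = m≤m*n c c
    ... | f , c+f≡c² = begin
      c * (c * c + e) ≤⟨ m≤m+n _ (suc e) ⟩
      c * (c * c + e) + suc e ≡⟨ cong (λ z → c * (z + e) + suc e) c+f≡c² ⟨
      c * (c + f + e) + suc e ≡⟨ solve 3 (λ c f e → c :* (c :+ f :+ e) :+ (con 1 :+ e) := c :* c :+ (c :* (f :+ e) :+ (con 1 :+ e))) refl c f e ⟩
      c * c + (c * (f + e) + suc e) ≡⟨ cong (_+ (c * (f + e) + suc e)) c+f≡c² ⟨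
      c + f + (c * (f + e) + suc e) ≡⟨ solve 3 (λ c f e → c :+ f :+ (c :* (f :+ e) :+ (con 1 :+ e)) := (con 1 :+ c) :* (con 1 :+ (f :+ e))) refl c f e ⟩
      suc c * suc (f + e) ≤⟨ *-mono-≤ (n<2^n c) (n<2^n (f + e)) ⟩
      2 ^ c * 2 ^ (f + e) ≡⟨ ^-distribˡ-+-* 2 c (f + e) ⟨
      2 ^ (c + (f + e)) ≡⟨ cong (2 ^_) (trans (sym (+-assoc c f e)) (cong (_+ e) c+f≡c²)) ⟩
      2 ^ (c * c + e) ∎

  primesBetween : ℕ → ℕ → List ℕ
  primesBetween lo hi = filter (lo <?_) (primesUpTo hi)

  primesUpTo-unique : ∀ n → Unique (primesUpTo n)
  primesUpTo-unique n = Uniq.filter⁺ prime? (Uniq.upTo⁺ (suc n))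

  primesBetween-unique : ∀ lo hi → Unique (primesBetween lo hi)
  primesBetween-unique lo hi = Uniq.filter⁺ (lo <?_) (primesUpTo-unique hi)

  ∈-primesBetween⁻ : ∀ {lo hi p} → p ∈ primesBetween lo hi → Prime p × lo < p × p ≤ hi
  ∈-primesBetween⁻ {lo} {hi} p∈ with ∈-filter⁻ (lo <?_) {xs = primesUpTo hi} p∈
  ... | p∈′ , lo<p with ∈-filter⁻ prime? {xs = upTo (suc hi)} p∈′
  ...   | p∈″ , pp = pp , lo<p , s≤s⁻¹ (∈-upTo⁻ p∈″)

  length-primesBetween : ∀ lo hi → length (primesUpTo hi) ≤ length (primesBetween lo hi) + lo
  length-primesBetween lo hi = begin
    length (primesUpTo hi) ≡⟨ length-filter-¬ (lo <?_) (primesUpTo hi) ⟩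
    length (primesBetween lo hi) + length small ≤⟨ +-monoʳ-≤ _ (unique-⊆⇒length-≤ {ys = applyUpTo suc lo}
      (Uniq.filter⁺ _ (primesUpTo-unique hi)) into) ⟩
    length (primesBetween lo hi) + length (applyUpTo suc lo) ≡⟨ cong (length (primesBetween lo hi) +_) (length-applyUpTo suc lo) ⟩
    length (primesBetween lo hi) + lo ∎
    where
    open ≤-Reasoning
    small = filter (λ p → ¬? (lo <? p)) (primesUpTo hi)
    into : ∀ {p} → p ∈ small → p ∈ applyUpTo suc lo
    into {zero} p∈ = contradiction
      (proj₂ (∈-filter⁻ prime? {xs = upTo (suc hi)} (proj₁ (∈-filter⁻ (λ p → ¬? (lo <? p)) p∈)))) ¬prime[0]
    into {suc p} p∈ = ∈-applyUpTo⁺ suc (≮⇒≥ (proj₂ (∈-filter⁻ (λ p → ¬? (lo <? p)) {xs = primesUpTo hi} p∈)))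

  2^-cancel-≤ : ∀ {m n} → 2 ^ m ≤ 2 ^ n → m ≤ n
  2^-cancel-≤ {m} {n} h = ≮⇒≥ (λ n<m → <⇒≱ (^-monoʳ-< 2 (s≤s (s≤s z≤n)) n<m) h)

  many-primes : ∀ a c τ → 0 < τ → 2 * ((τ + τ * a) * suc c) ≤ 2 ^ τ →
                c * 2 ^ (τ * a) ≤ length (primesBetween (2 ^ (τ * a)) (2 ^ (τ + τ * a)))
  many-primes a c τ@(suc t) _ h = *-cancelˡ-≤ e (+-cancelʳ-≤ (e * lo) _ _ (begin
    e * (c * lo) + e * lo ≡⟨ solve 3 (λ e c l → e :* (c :* l) :+ e :* l := e :* (con 1 :+ c) :* l) refl e c lo ⟩
    e * suc c * lo        ≤⟨ *-monoˡ-≤ lo (*-cancelˡ-≤ {e * suc c} {2 ^ t} 2 h) ⟩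
    2 ^ t * lo            ≡⟨ ^-distribˡ-+-* 2 t (τ * a) ⟨
    2 ^ (t + τ * a)       ≤⟨ 2^-cancel-≤ (subst (2 ^ 2 ^ (t + τ * a) ≤_) double (chebyshev (2 ^ (t + τ * a)) (m^n>0 2 (t + τ * a)))) ⟩
    e * length (primesUpTo hi) ≤⟨ *-monoʳ-≤ e (length-primesBetween lo hi) ⟩
    e * (length (primesBetween lo hi) + lo) ≡⟨ *-distribˡ-+ e (length (primesBetween lo hi)) lo ⟩
    e * length (primesBetween lo hi) + e * lo ∎))
    where
    open ≤-Reasoning
    open +-*-Solver
    e = τ + τ * a
    lo = 2 ^ (τ * a)
    hi = 2 ^ (τ + τ * a)
    m+m≡hi : 2 ^ (t + τ * a) + 2 ^ (t + τ * a) ≡ hi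
    m+m≡hi = cong (2 ^ (t + τ * a) +_) (sym (+-identityʳ _))
    double : (2 ^ (t + τ * a) + 2 ^ (t + τ * a)) ^ length (primesUpTo (2 ^ (t + τ * a) + 2 ^ (t + τ * a)))
               ≡ 2 ^ (e * length (primesUpTo hi))
    double = trans (cong (λ z → z ^ length (primesUpTo z)) m+m≡hi) (^-*-assoc 2 e (length (primesUpTo hi)))

module Smooth where

  open import Data.List.Base using (List; []; _∷_; _++_; length; map; filter; concat; cartesianProduct; take; drop; upTo)
  open import Data.List.Membership.Propositional using (_∈_; _∉_)
  open import Data.List.Membership.Propositional.Properties
  open import Data.List.Properties using (length-map; ++-assoc; take++drop≡id; length-take; length-drop; length-filter)
  open import Data.List.Relation.Unary.All as All using (All; []; _∷_)
  import Data.List.Relation.Unary.All.Properties as AllP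
  open import Data.List.Relation.Unary.AllPairs using ([]; _∷_)
  open import Data.List.Relation.Unary.Any using (here; there)
  open import Data.List.Relation.Unary.Unique.Propositional using (Unique)
  import Data.List.Relation.Unary.Unique.Propositional.Properties as Uniq
  open import Data.Nat.Base
  open import Data.Nat.Divisibility
  open import Data.Nat.ListAction using (product)
  open import Data.Nat.Primality
  open import Data.Nat.Primality.Factorisation using (factorisationHasAllPrimeFactors)
  open import Data.Nat.Properties
  open import Data.Product.Base using (Σ-syntax; _×_; _,_; proj₁; proj₂)
  open import Data.Sum.Base using (_⊎_; inj₁; inj₂)
  open import Relation.Binary.PropositionalEquality
  open import Relation.Nullary using (contradiction)
  open Counting
  open Chebyshev

  unique-++ˡ : ∀ {A : Set} (xs : List A) {ys} → Unique (xs ++ ys) → Unique xs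
  unique-++ˡ [] u = []
  unique-++ˡ (x ∷ xs) (x∉ ∷ u) = AllP.++⁻ˡ xs x∉ ∷ unique-++ˡ xs u

  unique-++ʳ : ∀ {A : Set} (xs : List A) {ys} → Unique (xs ++ ys) → Unique ys
  unique-++ʳ [] u = u
  unique-++ʳ (x ∷ xs) (_ ∷ u) = unique-++ʳ xs u

  unique-++-disjoint : ∀ {A : Set} (xs : List A) {ys z} → Unique (xs ++ ys) → z ∈ xs → z ∉ ys
  unique-++-disjoint (x ∷ xs) (x∉ ∷ u) (here refl) z∈ys = All.lookup x∉ (∈-++⁺ʳ xs z∈ys) refl
  unique-++-disjoint (x ∷ xs) (x∉ ∷ u) (there z∈) z∈ys = unique-++-disjoint xs u z∈ z∈ys

  chunks : ∀ {A : Set} b k (xs : List A) → k * b ≤ length xs →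
           Σ[ Bs ∈ List (List A) ] Σ[ rest ∈ List A ]
             length Bs ≡ k × All (λ B → length B ≡ b) Bs × concat Bs ++ rest ≡ xs × length xs ≡ k * b + length rest
  chunks b zero xs h = [] , xs , refl , [] , refl , refl
  chunks b (suc k) xs h with chunks b k (drop b xs) (begin
      k * b            ≡⟨ m+n∸m≡n b (k * b) ⟨
      b + k * b ∸ b    ≤⟨ ∸-monoˡ-≤ b h ⟩
      length xs ∸ b    ≡⟨ length-drop b xs ⟨
      length (drop b xs) ∎)
    where open ≤-Reasoning
  ... | Bs , rest , lenBs , all , eq , len = take b xs ∷ Bs , rest , cong suc lenBs
    , trans (length-take b xs) (m≤n⇒m⊓n≡m b≤) ∷ all
    , trans (++-assoc (take b xs) (concat Bs) rest) (trans (cong (take b xs ++_) eq) (take++drop≡id b xs))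
    , (begin
      length xs                          ≡⟨ m+[n∸m]≡n b≤ ⟨
      b + (length xs ∸ b)                ≡⟨ cong (b +_) (trans (sym (length-drop b xs)) len) ⟩
      b + (k * b + length rest)          ≡⟨ +-assoc b (k * b) (length rest) ⟨
      suc k * b + length rest ∎)
    where
    open ≡-Reasoning
    b≤ : b ≤ length xs
    b≤ = m+n≤o⇒m≤o b h

  smooth : List (List ℕ) → List ℕ
  smooth [] = 1 ∷ []
  smooth (B ∷ Bs) = map (λ (p , x) → p * x) (cartesianProduct B (smooth Bs))

  smooth-elim : ∀ (P : List (List ℕ) → ℕ → Set) → P [] 1 →
                (∀ {B Bs p x} → p ∈ B → x ∈ smooth Bs → P Bs x → P (B ∷ Bs) (p * x)) →
                ∀ Bs {x} → x ∈ smooth Bs → P Bs x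
  smooth-elim P base step [] (here refl) = base
  smooth-elim P base step (B ∷ Bs) x∈ with ∈-map⁻ _ x∈
  ... | (p , x) , px∈ , refl with ∈-cartesianProduct⁻ B (smooth Bs) px∈
  ...   | p∈ , x∈′ = step p∈ x∈′ (smooth-elim P base step Bs x∈′)

  length-smooth : ∀ b Bs → All (λ B → length B ≡ b) Bs → length (smooth Bs) ≡ b ^ length Bs
  length-smooth b [] [] = refl
  length-smooth b (B ∷ Bs) (h ∷ hs) = trans (length-map _ (cartesianProduct B (smooth Bs)))
    (trans (length-cartesianProduct B (smooth Bs)) (cong₂ _*_ h (length-smooth b Bs hs)))

  smooth-≤ : ∀ hi Bs → All (_≤ hi) (concat Bs) → ∀ {x} → x ∈ smooth Bs → x ≤ hi ^ length Bs
  smooth-≤ hi Bs all x∈ = smooth-elim (λ Bs x → All (_≤ hi) (concat Bs) → x ≤ hi ^ length Bs)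
    (λ _ → ≤-refl)
    (λ {B} p∈ _ ih all → *-mono-≤ (All.lookup (AllP.++⁻ˡ B all) p∈) (ih (AllP.++⁻ʳ B all)))
    Bs x∈ all

  smooth-≥ : ∀ lo Bs → All (lo ≤_) (concat Bs) → ∀ {x} → x ∈ smooth Bs → lo ^ length Bs ≤ x
  smooth-≥ lo Bs all x∈ = smooth-elim (λ Bs x → All (lo ≤_) (concat Bs) → lo ^ length Bs ≤ x)
    (λ _ → ≤-refl)
    (λ {B} p∈ _ ih all → *-mono-≤ (All.lookup (AllP.++⁻ˡ B all) p∈) (ih (AllP.++⁻ʳ B all)))
    Bs x∈ all

  smooth-prime : ∀ Bs → All Prime (concat Bs) → ∀ {x p} → x ∈ smooth Bs → Prime p → p ∣ x → p ∈ concat Bs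
  smooth-prime Bs all {p = p} x∈ pp p∣x = smooth-elim (λ Bs x → All Prime (concat Bs) → p ∣ x → p ∈ concat Bs)
    (λ _ p∣1 → contradiction p∣1 (prime∤1 pp))
    (λ {B} {Bs} → step {B} {Bs}) Bs x∈ all p∣x
    where
    step : ∀ {B Bs q x} → q ∈ B → x ∈ smooth Bs → (All Prime (concat Bs) → p ∣ x → p ∈ concat Bs) →
           All Prime (B ++ concat Bs) → p ∣ q * x → p ∈ B ++ concat Bs
    step {B} {Bs} {q} {x} q∈ _ ih all p∣qx with euclidsLemma q x pp p∣qx
    ... | inj₁ p∣q = ∈-++⁺ˡ (subst (_∈ B) (sym (prime∣prime⇒≡ pp (All.lookup (AllP.++⁻ˡ B all) q∈) p∣q)) q∈)
    ... | inj₂ p∣x = ∈-++⁺ʳ B (ih (AllP.++⁻ʳ B all) p∣x)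

  smooth-unique : ∀ Bs → All Prime (concat Bs) → Unique (concat Bs) → Unique (smooth Bs)
  smooth-unique [] _ _ = [] ∷ []
  smooth-unique (B ∷ Bs) all u = map-unique _
    (Uniq.cartesianProduct⁺ (unique-++ˡ B u) (smooth-unique Bs (AllP.++⁻ʳ B all) (unique-++ʳ B u))) inj
    where
    inj : ∀ {a b} → a ∈ cartesianProduct B (smooth Bs) → b ∈ cartesianProduct B (smooth Bs) →
          proj₁ a * proj₂ a ≡ proj₁ b * proj₂ b → a ≡ b
    inj {p , x} {q , y} a∈ b∈ eq with ∈-cartesianProduct⁻ B (smooth Bs) a∈ | ∈-cartesianProduct⁻ B (smooth Bs) b∈
    ... | p∈ , x∈ | q∈ , y∈ = conclude (euclidsLemma q y pp (subst (p ∣_) eq (m∣m*n x)))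
      where
      pp : Prime p
      pp = All.lookup (AllP.++⁻ˡ B all) p∈
      conclude : p ∣ q ⊎ p ∣ y → (p , x) ≡ (q , y)
      conclude (inj₂ p∣y) = contradiction (smooth-prime Bs (AllP.++⁻ʳ B all) y∈ pp p∣y) (unique-++-disjoint B u p∈)
      conclude (inj₁ p∣q) with prime∣prime⇒≡ pp (All.lookup (AllP.++⁻ˡ B all) q∈) p∣q
      ... | refl = cong (p ,_) (*-cancelˡ-≡ x y p {{prime⇒nonZero pp}} eq)

  product-distinct-primes-∣ : ∀ {ps} D → All Prime ps → Unique ps → All (_∣ D) ps → product ps ∣ D
  product-distinct-primes-∣ D [] [] [] = 1∣ D
  product-distinct-primes-∣ {p ∷ ps} D (pp ∷ pps) (p∉ ∷ u) (p∣D ∷ ps∣D)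
    with product-distinct-primes-∣ D pps u ps∣D
  ... | divides e D≡ with euclidsLemma e (product ps) pp (subst (p ∣_) D≡ p∣D)
  ...   | inj₁ p∣e = subst (p * product ps ∣_) (sym D≡) (*-monoˡ-∣ (product ps) p∣e)
  ...   | inj₂ p∣Π = contradiction refl (All.lookup p∉ (factorisationHasAllPrimeFactors pp p∣Π pps))

  ^-≤-product : ∀ {lo ps} → All (lo ≤_) ps → lo ^ length ps ≤ product ps
  ^-≤-product [] = ≤-refl
  ^-≤-product (h ∷ hs) = *-mono-≤ h (^-≤-product hs)

  few-prime-divisors : ∀ {lo ps} D → 0 < D → All Prime ps → Unique ps → All (lo ≤_) ps →
                       lo ^ length (filter (_∣? D) ps) ≤ D
  few-prime-divisors {lo} {ps} D 0<D pps u lo≤ = ≤-trans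
    (^-≤-product (AllP.filter⁺ (_∣? D) lo≤))
    (∣⇒≤ {{>-nonZero 0<D}} (product-distinct-primes-∣ D (AllP.filter⁺ (_∣? D) pps) (Uniq.filter⁺ (_∣? D) u)
      (AllP.all-filter (_∣? D) ps)))

  smooth-divisors : ∀ D Bs → All Prime (concat Bs) → Unique (concat Bs) →
                    length (filter (_∣? D) (smooth Bs)) ≤ 2 ^ length (filter (_∣? D) (concat Bs))
  smooth-divisors D [] _ _ = length-filter (_∣? D) (1 ∷ [])
  smooth-divisors D (B ∷ Bs) all u = begin
    length (filter (_∣? D) (smooth (B ∷ Bs)))
      ≡⟨ length-filter-map (_∣? D) _ (cartesianProduct B (smooth Bs)) ⟩
    length (filter (λ (p , x) → p * x ∣? D) (cartesianProduct B (smooth Bs)))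
      ≤⟨ unique-⊆⇒length-≤ (Uniq.filter⁺ _ (Uniq.cartesianProduct⁺ (unique-++ˡ B u)
           (smooth-unique Bs (AllP.++⁻ʳ B all) (unique-++ʳ B u)))) into ⟩
    length (cartesianProduct (filter (_∣? D) B) (filter (_∣? D) (smooth Bs)))
      ≡⟨ length-cartesianProduct (filter (_∣? D) B) (filter (_∣? D) (smooth Bs)) ⟩
    w * length (filter (_∣? D) (smooth Bs))
      ≤⟨ *-mono-≤ (<⇒≤ (n<2^n w)) (smooth-divisors D Bs (AllP.++⁻ʳ B all) (unique-++ʳ B u)) ⟩
    2 ^ w * 2 ^ w′ ≡⟨ ^-distribˡ-+-* 2 w w′ ⟨
    2 ^ (w + w′)   ≡⟨ cong (2 ^_) (length-filter-++ (_∣? D) B (concat Bs)) ⟨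
    2 ^ length (filter (_∣? D) (concat (B ∷ Bs))) ∎
    where
    open ≤-Reasoning
    w = length (filter (_∣? D) B)
    w′ = length (filter (_∣? D) (concat Bs))
    into : ∀ {a} → a ∈ filter (λ (p , x) → p * x ∣? D) (cartesianProduct B (smooth Bs)) →
           a ∈ cartesianProduct (filter (_∣? D) B) (filter (_∣? D) (smooth Bs))
    into {p , x} a∈ with ∈-filter⁻ (λ (p , x) → p * x ∣? D) {xs = cartesianProduct B (smooth Bs)} a∈
    ... | a∈′ , px∣D with ∈-cartesianProduct⁻ B (smooth Bs) a∈′
    ...   | p∈ , x∈ = ∈-cartesianProduct⁺ (∈-filter⁺ (_∣? D) p∈ (∣-trans (m∣m*n x) px∣D))
                                          (∈-filter⁺ (_∣? D) x∈ (∣-trans (n∣m*n p) px∣D))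

  primeDivisors : ℕ → List ℕ
  primeDivisors m = filter (_∣? m) (primesUpTo m)

  ∈-primeDivisors⁺ : ∀ {m p} → 0 < m → Prime p → p ∣ m → p ∈ primeDivisors m
  ∈-primeDivisors⁺ {m} 0<m pp p∣m = ∈-filter⁺ (_∣? m)
    (∈-filter⁺ prime? (∈-upTo⁺ (s≤s (∣⇒≤ {{>-nonZero 0<m}} p∣m))) pp) p∣m

  all-primesUpTo : ∀ n → All Prime (primesUpTo n)
  all-primesUpTo n = AllP.all-filter prime? (upTo (suc n))

  all-primeDivisors : ∀ m → All Prime (primeDivisors m)
  all-primeDivisors m = AllP.filter⁺ (_∣? m) (all-primesUpTo m)

  length-primeDivisors : ∀ {m e} → 0 < m → m ≤ 2 ^ e → length (primeDivisors m) ≤ e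
  length-primeDivisors {m} 0<m m≤ = 2^-cancel-≤ (≤-trans
    (few-prime-divisors m 0<m (all-primesUpTo m) (primesUpTo-unique m)
      (All.map (λ {p} pp → nonTrivial⇒n>1 p {{prime⇒nonTrivial pp}}) (all-primesUpTo m))) m≤)

module Vectors where

  open import Data.Bool.Base using (true; false; if_then_else_)
  open import Data.Fin.Base using (Fin; zero; suc)
  open import Data.Fin.Subset using (Subset; Nonempty; ⊤; ⊥; outside) renaming (_∈_ to _∈ₛ_)
  open import Data.Integer.Base as ℤ using (ℤ; +_; 0ℤ)
  import Data.Integer.Properties as ℤₚ
  open import Data.Integer.Solver using (module +-*-Solver)
  open import Data.List.Base using (List; []; _∷_; length; map; filter; cartesianProduct)
  open import Data.List.Membership.Propositional using (_∈_)
  open import Data.List.Membership.Propositional.Properties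
  open import Data.List.Properties using (length-map)
  import Data.List.Relation.Unary.All as ListAll
  open import Data.List.Relation.Unary.AllPairs using ([]; _∷_)
  open import Data.List.Relation.Unary.Any using (here; there)
  open import Data.List.Relation.Unary.Unique.Propositional using (Unique)
  import Data.List.Relation.Unary.Unique.Propositional.Properties as Uniq
  open import Data.Nat.Base as ℕ using (ℕ; zero; suc; _^_; _≤_)
  import Data.Nat.Properties as ℕₚ
  open import Data.Product.Base using (_×_; _,_; proj₁; proj₂)
  open import Data.Sum.Base using (_⊎_; inj₁; inj₂)
  open import Data.Vec.Base as Vec using (Vec; []; _∷_; _++_; replicate; here; there)
  import Data.Vec.Properties as Vecₚ
  open import Data.Vec.Relation.Binary.Pointwise.Inductive as Pointwise using (Pointwise; []; _∷_)
  open import Data.Vec.Relation.Unary.All as All using (All; []; _∷_)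
  open import Relation.Binary.PropositionalEquality
  open import Relation.Nullary using (Dec)
  open Counting

  open import Algebra.Properties.AbelianGroup ℤₚ.+-0-abelianGroup using (∙-cancelʳ)

  choices : ∀ {A : Set} {d} → Vec (List A) d → List (Vec A d)
  choices [] = [] ∷ []
  choices (Z ∷ Zs) = map (λ (z , y) → z ∷ y) (cartesianProduct Z (choices Zs))

  ∈-choices⁺ : ∀ {A : Set} {d} {Zs : Vec (List A) d} {y} → Pointwise _∈_ y Zs → y ∈ choices Zs
  ∈-choices⁺ [] = here refl
  ∈-choices⁺ (z∈ ∷ y∈) = ∈-map⁺ _ (∈-cartesianProduct⁺ z∈ (∈-choices⁺ y∈))

  ∈-choices⁻ : ∀ {A : Set} {d} (Zs : Vec (List A) d) {y} → y ∈ choices Zs → Pointwise _∈_ y Zs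
  ∈-choices⁻ [] {[]} _ = []
  ∈-choices⁻ (Z ∷ Zs) y∈ with ∈-map⁻ _ y∈
  ... | (z , y) , zy∈ , refl with ∈-cartesianProduct⁻ Z (choices Zs) zy∈
  ...   | z∈ , y∈′ = z∈ ∷ ∈-choices⁻ Zs y∈′

  choices-unique : ∀ {A : Set} {d} {Zs : Vec (List A) d} → All Unique Zs → Unique (choices Zs)
  choices-unique [] = ListAll.[] ∷ []
  choices-unique (u ∷ us) = Uniq.map⁺ (λ { {_ , _} {_ , _} refl → refl })
    (Uniq.cartesianProduct⁺ u (choices-unique us))

  length-choices : ∀ {A : Set} {d N} {Zs : Vec (List A) d} → All (λ Z → length Z ≡ N) Zs → length (choices Zs) ≡ N ^ d
  length-choices [] = refl
  length-choices {Zs = Z ∷ Zs} (h ∷ hs) = trans (length-map _ (cartesianProduct Z (choices Zs)))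
    (trans (length-cartesianProduct Z (choices Zs)) (cong₂ ℕ._*_ h (length-choices hs)))

  Σ∈ : ∀ {d} → Subset d → Vec ℤ d → ℤ
  Σ∈ [] [] = 0ℤ
  Σ∈ (b ∷ T) (z ∷ y) = (if b then z else 0ℤ) ℤ.+ Σ∈ T y

  drop-zero : ∀ {d} z (T : Subset d) y → Σ∈ (outside ∷ T) (z ∷ y) ≡ Σ∈ T y
  drop-zero z T y = ℤₚ.+-identityˡ (Σ∈ T y)

  few-on-hyperplane : ∀ {d} N (Zs : Vec (List ℤ) d) → All Unique Zs → All (λ Z → length Z ≡ N) Zs →
                      ∀ (T : Subset d) → Nonempty T → ∀ c →
                      N ℕ.* length (filter (λ y → Σ∈ T y ℤₚ.≟ c) (choices Zs)) ≤ N ^ d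
  few-on-hyperplane {suc d} N (Z ∷ Zs) (u ∷ us) (_ ∷ ls) (true ∷ T) _ c = ℕₚ.*-monoʳ-≤ N (begin
    length solutions        ≤⟨ injection⇒length-≤ {ys = choices Zs} Vec.tail
        (Uniq.filter⁺ hyper? (choices-unique (u ∷ us)))
        (λ y∈ → tail∈ (proj₁ (∈-filter⁻ hyper? {xs = choices (Z ∷ Zs)} y∈)))
        (λ x∈ y∈ → inj (proj₂ (∈-filter⁻ hyper? {xs = choices (Z ∷ Zs)} x∈))
                       (proj₂ (∈-filter⁻ hyper? {xs = choices (Z ∷ Zs)} y∈))) ⟩
    length (choices Zs)     ≡⟨ length-choices ls ⟩
    N ^ d ∎)
    where
    open ℕₚ.≤-Reasoning
    hyper? : ∀ y → Dec (Σ∈ (true ∷ T) y ≡ c)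
    hyper? y = Σ∈ (true ∷ T) y ℤₚ.≟ c
    solutions = filter hyper? (choices (Z ∷ Zs))
    tail∈ : ∀ {y} → y ∈ choices (Z ∷ Zs) → Vec.tail y ∈ choices Zs
    tail∈ {_ ∷ _} y∈ with ∈-choices⁻ (Z ∷ Zs) y∈
    ... | _ ∷ h = ∈-choices⁺ h
    inj : ∀ {x y} → Σ∈ (true ∷ T) x ≡ c → Σ∈ (true ∷ T) y ≡ c → Vec.tail x ≡ Vec.tail y → x ≡ y
    inj {a ∷ x} {b ∷ y} hx hy refl = cong (_∷ x) (∙-cancelʳ (Σ∈ T x) a b (trans hx (sym hy)))
  few-on-hyperplane N (Z ∷ Zs) (u ∷ us) (l ∷ ls) (false ∷ T) (zero , ()) c
  few-on-hyperplane {suc d} N (Z ∷ Zs) (u ∷ us) (l ∷ ls) (false ∷ T) (suc i , there i∈T) c = ℕₚ.*-monoʳ-≤ N (begin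
    length (filter (λ y → Σ∈ (false ∷ T) y ℤₚ.≟ c) (choices (Z ∷ Zs)))
      ≡⟨ length-filter-map (λ y → Σ∈ (false ∷ T) y ℤₚ.≟ c) _ (cartesianProduct Z (choices Zs)) ⟩
    length (filter hyper? (cartesianProduct Z (choices Zs)))
      ≤⟨ unique-⊆⇒length-≤ (Uniq.filter⁺ hyper? (Uniq.cartesianProduct⁺ u (choices-unique us))) into ⟩
    length (cartesianProduct Z (filter (λ y → Σ∈ T y ℤₚ.≟ c) (choices Zs)))
      ≡⟨ length-cartesianProduct Z _ ⟩
    length Z ℕ.* length (filter (λ y → Σ∈ T y ℤₚ.≟ c) (choices Zs))
      ≡⟨ cong (ℕ._* _) l ⟩
    N ℕ.* length (filter (λ y → Σ∈ T y ℤₚ.≟ c) (choices Zs))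
      ≤⟨ few-on-hyperplane N Zs us ls T (i , i∈T) c ⟩
    N ^ d ∎)
    where
    open ℕₚ.≤-Reasoning
    hyper? : ∀ (p : ℤ × Vec ℤ d) → Dec (Σ∈ (false ∷ T) (proj₁ p ∷ proj₂ p) ≡ c)
    hyper? p = Σ∈ (false ∷ T) (proj₁ p ∷ proj₂ p) ℤₚ.≟ c
    into : ∀ {p} → p ∈ filter hyper? (cartesianProduct Z (choices Zs)) →
           p ∈ cartesianProduct Z (filter (λ y → Σ∈ T y ℤₚ.≟ c) (choices Zs))
    into {z , y} p∈ with ∈-filter⁻ hyper? {xs = cartesianProduct Z (choices Zs)} p∈
    ... | p∈′ , h with ∈-cartesianProduct⁻ Z (choices Zs) p∈′
    ...   | z∈ , y∈ = ∈-cartesianProduct⁺ z∈ (∈-filter⁺ (λ y → Σ∈ T y ℤₚ.≟ c) y∈ (trans (sym (drop-zero z T y)) h))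

  Σ∈-++ : ∀ {d e} (S : Subset d) (T : Subset e) x y → Σ∈ (S ++ T) (x ++ y) ≡ Σ∈ S x ℤ.+ Σ∈ T y
  Σ∈-++ [] T [] y = sym (ℤₚ.+-identityˡ _)
  Σ∈-++ (b ∷ S) T (z ∷ x) y = trans (cong (λ w → (if b then z else 0ℤ) ℤ.+ w) (Σ∈-++ S T x y))
    (sym (ℤₚ.+-assoc (if b then z else 0ℤ) (Σ∈ S x) (Σ∈ T y)))

  total : ∀ {d} → Vec ℤ d → ℤ
  total = Σ∈ ⊤

  ⊤-++ : ∀ d {e} → ⊤ {d} ++ ⊤ {e} ≡ ⊤
  ⊤-++ zero = refl
  ⊤-++ (suc d) = cong (true ∷_) (⊤-++ d)

  total-++ : ∀ {d e} (x : Vec ℤ d) (y : Vec ℤ e) → total (x ++ y) ≡ total x ℤ.+ total y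
  total-++ {d} x y = trans (cong (λ T → Σ∈ T (x ++ y)) (sym (⊤-++ d))) (Σ∈-++ ⊤ ⊤ x y)

  ∁-sum : ∀ {d} (T : Subset d) y → total y ≡ Σ∈ T y ℤ.+ Σ∈ (Data.Fin.Subset.∁ T) y
  ∁-sum [] [] = refl
  ∁-sum (true ∷ T) (z ∷ y) = trans (cong (λ w → z ℤ.+ w) (∁-sum T y))
    (solve 3 (λ z a b → z :+ (a :+ b) := (z :+ a) :+ (con 0ℤ :+ b)) refl z (Σ∈ T y) (Σ∈ (Data.Fin.Subset.∁ T) y))
    where open +-*-Solver
  ∁-sum (false ∷ T) (z ∷ y) = trans (cong (λ w → z ℤ.+ w) (∁-sum T y))
    (solve 3 (λ z a b → z :+ (a :+ b) := (con 0ℤ :+ a) :+ (z :+ b)) refl z (Σ∈ T y) (Σ∈ (Data.Fin.Subset.∁ T) y))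
    where open +-*-Solver

  Σ∈-⊥ : ∀ {d} (y : Vec ℤ d) → Σ∈ ⊥ y ≡ 0ℤ
  Σ∈-⊥ [] = refl
  Σ∈-⊥ (z ∷ y) = trans (drop-zero z ⊥ y) (Σ∈-⊥ y)

  ∣Σ∈∣≤ : ∀ {d X} (T : Subset d) {y} → All (λ z → ℤ.∣ z ∣ ≤ X) y → ℤ.∣ Σ∈ T y ∣ ≤ d ℕ.* X
  ∣Σ∈∣≤ [] [] = ℕ.z≤n
  ∣Σ∈∣≤ {X = X} (b ∷ T) {z ∷ y} (h ∷ hs) = ℕₚ.≤-trans (ℤₚ.∣i+j∣≤∣i∣+∣j∣ (if b then z else 0ℤ) (Σ∈ T y))
    (ℕₚ.+-mono-≤ (head b) (∣Σ∈∣≤ T hs))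
    where
    head : ∀ b → ℤ.∣ if b then z else 0ℤ ∣ ≤ X
    head true = h
    head false = ℕ.z≤n

  allSubsets : ∀ d → List (Subset d)
  allSubsets d = choices (replicate d (true ∷ false ∷ []))

  ∈-allSubsets : ∀ {d} (T : Subset d) → T ∈ allSubsets d
  ∈-allSubsets T = ∈-choices⁺ (pointwise T)
    where
    pointwise : ∀ {d} (T : Subset d) → Pointwise _∈_ T (replicate d (true ∷ false ∷ []))
    pointwise [] = []
    pointwise (true ∷ T) = here refl ∷ pointwise T
    pointwise (false ∷ T) = there (here refl) ∷ pointwise T

  length-allSubsets : ∀ d → length (allSubsets d) ≡ 2 ^ d
  length-allSubsets d = length-choices (all d)
    where
    all : ∀ d → All (λ Z → length Z ≡ 2) (replicate d (true ∷ false ∷ []))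
    all zero = []
    all (suc d) = refl ∷ all d

  ≡⊥⊎nonempty : ∀ {d} (T : Subset d) → T ≡ ⊥ ⊎ Nonempty T
  ≡⊥⊎nonempty [] = inj₁ refl
  ≡⊥⊎nonempty (true ∷ T) = inj₂ (zero , here)
  ≡⊥⊎nonempty (false ∷ T) with ≡⊥⊎nonempty T
  ... | inj₁ eq = inj₁ (cong (false ∷_) eq)
  ... | inj₂ (i , i∈) = inj₂ (suc i , there i∈)

  ∁-⊥ : ∀ {d} (T : Subset d) → Data.Fin.Subset.∁ T ≡ ⊥ → T ≡ ⊤
  ∁-⊥ [] _ = refl
  ∁-⊥ (true ∷ T) eq = cong (true ∷_) (∁-⊥ T (Vecₚ.∷-injectiveʳ eq))
  ∁-⊥ (false ∷ T) ()

  neg : ℕ → ℤ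
  neg x = ℤ.- (+ x)

  signed : ∀ {J} → Vec ℕ J → Vec ℕ J → Vec ℤ (J ℕ.+ J)
  signed u v = Vec.map +_ u ++ Vec.map neg v

  signedChoices : List ℕ → ∀ J → Vec (List ℤ) (J ℕ.+ J)
  signedChoices A J = replicate J (map +_ A) ++ replicate J (map neg A)

  total-+ : ∀ {J} (u : Vec ℕ J) → total (Vec.map +_ u) ≡ + Vec.sum u
  total-+ [] = refl
  total-+ (x ∷ u) = cong (λ w → + x ℤ.+ w) (total-+ u)

  total-neg : ∀ {J} (u : Vec ℕ J) → total (Vec.map neg u) ≡ neg (Vec.sum u)
  total-neg [] = refl
  total-neg (x ∷ u) = trans (cong (λ w → neg x ℤ.+ w) (total-neg u)) (sym (ℤₚ.neg-distrib-+ (+ x) (+ Vec.sum u)))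

  total-signed : ∀ {J} (u v : Vec ℕ J) → total (signed u v) ≡ + Vec.sum u ℤ.- + Vec.sum v
  total-signed u v = trans (total-++ (Vec.map +_ u) (Vec.map neg v)) (cong₂ ℤ._+_ (total-+ u) (total-neg v))

  neg-injective : ∀ {x y} → neg x ≡ neg y → x ≡ y
  neg-injective eq = ℤₚ.+-injective (ℤₚ.neg-injective eq)

  signed-injective : ∀ {J} {u u′ v v′ : Vec ℕ J} → signed u v ≡ signed u′ v′ → u ≡ u′ × v ≡ v′
  signed-injective {u = u} {u′} eq with Vecₚ.++-injective (Vec.map +_ u) (Vec.map +_ u′) eq
  ... | p , q = map-inj ℤₚ.+-injective p , map-inj neg-injective q
    where
    map-inj : ∀ {A B : Set} {f : A → B} → (∀ {x y} → f x ≡ f y → x ≡ y) →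
              ∀ {n} {u v : Vec A n} → Vec.map f u ≡ Vec.map f v → u ≡ v
    map-inj inj {u = []} {[]} _ = refl
    map-inj inj {u = _ ∷ _} {_ ∷ _} eq = cong₂ _∷_ (inj (Vecₚ.∷-injectiveˡ eq)) (map-inj inj (Vecₚ.∷-injectiveʳ eq))

  signed∈ : ∀ {A J u v} → u ∈ choices (replicate J A) → v ∈ choices (replicate J A) →
            signed u v ∈ choices (signedChoices A J)
  signed∈ {A} {J} u∈ v∈ = ∈-choices⁺ (Pointwise.++⁺ (map∈ +_ (∈-choices⁻ _ u∈)) (map∈ neg (∈-choices⁻ _ v∈)))
    where
    map∈ : ∀ (f : ℕ → ℤ) {J} {u : Vec ℕ J} → Pointwise _∈_ u (replicate J A) →
           Pointwise _∈_ (Vec.map f u) (replicate J (map f A))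
    map∈ f {zero} [] = []
    map∈ f {suc J} (x∈ ∷ u∈) = ∈-map⁺ f x∈ ∷ map∈ f u∈

  all-replicate : ∀ {A : Set} {P : A → Set} n {x} → P x → All P (replicate n x)
  all-replicate zero p = []
  all-replicate (suc n) p = p ∷ all-replicate n p

  all-++ : ∀ {A : Set} {P : A → Set} {m n} {xs : Vec A m} {ys : Vec A n} → All P xs → All P ys → All P (xs ++ ys)
  all-++ [] qs = qs
  all-++ (p ∷ ps) qs = p ∷ all-++ ps qs

  signedChoices-unique : ∀ {A} J → Unique A → All Unique (signedChoices A J)
  signedChoices-unique J u = all-++ (all-replicate J (Uniq.map⁺ ℤₚ.+-injective u))
    (all-replicate J (Uniq.map⁺ neg-injective u))

  signedChoices-length : ∀ A J → All (λ Z → length Z ≡ length A) (signedChoices A J)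
  signedChoices-length A J = all-++ (all-replicate J (length-map +_ A)) (all-replicate J (length-map neg A))

  signedChoices-entries : ∀ {A J y} → y ∈ choices (signedChoices A J) → All (λ z → ℤ.∣ z ∣ ∈ A) y
  signedChoices-entries {A} {J} y∈ = go (all-++ (all-replicate J (entry +_ (λ _ → refl))) (all-replicate J (entry neg ∣neg∣)))
      (∈-choices⁻ (signedChoices A J) y∈)
    where
    ∣neg∣ : ∀ x → ℤ.∣ neg x ∣ ≡ x
    ∣neg∣ x = ℤₚ.∣-i∣≡∣i∣ (+ x)
    entry : ∀ (f : ℕ → ℤ) → (∀ x → ℤ.∣ f x ∣ ≡ x) → ∀ {z} → z ∈ map f A → ℤ.∣ z ∣ ∈ A
    entry f eq z∈ with ∈-map⁻ f z∈
    ... | x , x∈ , refl = subst (_∈ A) (sym (eq x)) x∈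
    go : ∀ {d} {Zs : Vec (List ℤ) d} {y : Vec ℤ d} → All (λ Z → ∀ {z} → z ∈ Z → ℤ.∣ z ∣ ∈ A) Zs → Pointwise _∈_ y Zs →
         All (λ z → ℤ.∣ z ∣ ∈ A) y
    go [] [] = []
    go (h ∷ hs) (z∈ ∷ y∈) = h z∈ ∷ go hs y∈

module Popular where

  open import Data.Fin.Subset using (Nonempty; ⊤)
  open import Data.Fin.Subset.Properties using (nonempty?; ∈⊤)
  open import Data.Integer.Base as ℤ using (ℤ; +_; -[1+_]; 0ℤ)
  import Data.Integer.Divisibility.Signed as ℤ∣
  import Data.Integer.Properties as ℤₚ
  open import Data.Integer.Solver using (module +-*-Solver)
  open import Data.List.Base using (List; []; _∷_; _++_; length; map; filter; cartesianProduct; upTo)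
  open import Data.List.Membership.Propositional using (_∈_; lose; find)
  open import Data.List.Membership.Propositional.Properties
  open import Data.List.Properties using (length-map; length-++; length-upTo)
  open import Data.List.Relation.Unary.Any using (Any; here; any?)
  open import Data.List.Relation.Unary.Unique.Propositional using (Unique)
  import Data.List.Relation.Unary.Unique.Propositional.Properties as Uniq
  open import Data.Nat.Base as ℕ using (ℕ; suc; _^_; _≤_; _<_; _%_; _/_; NonZero; s≤s)
  open import Data.Nat.Divisibility using (_∣_; _∣?_; divides)
  open import Data.Nat.DivMod using (m%n<n; m≡m%n+[m/n]*n)
  import Data.Nat.Properties as ℕₚ
  open import Data.Product.Base using (Σ-syntax; _×_; _,_; ∃-syntax; proj₁; proj₂)
  open import Data.Fin.Base using (zero)
  open import Data.Sum.Base using (inj₁; inj₂)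
  open import Data.Vec.Base as Vec using (Vec; replicate)
  open import Data.Vec.Relation.Unary.All as All using (All)
  open import Relation.Binary.PropositionalEquality
  open import Relation.Nullary using (Dec; ¬_; yes; no; contradiction)
  open import Relation.Nullary.Decidable using (¬?; _×-dec_)
  open Counting
  open Vectors

  length-cartesianProduct-≤ : ∀ {A B : Set} (xs : List A) (ys : List B) {c} → length ys ≤ c →
                              length (cartesianProduct xs ys) ≤ length xs ℕ.* c
  length-cartesianProduct-≤ xs ys h = ℕₚ.≤-trans (ℕₚ.≤-reflexive (length-cartesianProduct xs ys)) (ℕₚ.*-monoʳ-≤ (length xs) h)

  length-filter-cover : ∀ {A K : Set} {R : A → K → Set} (R? : ∀ x k → Dec (R x k)) (xs : List A) (ks : List K) c →
                        (∀ {k} → k ∈ ks → length (filter (λ x → R? x k) xs) ≤ c) →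
                        length xs ≤ length (filter (λ x → ¬? (any? (R? x) ks)) xs) ℕ.+ length ks ℕ.* c
  length-filter-cover R? xs ks c fib = begin
    length xs ≡⟨ length-filter-¬ bad? xs ⟩
    length (filter bad? xs) ℕ.+ length good ≡⟨ ℕₚ.+-comm _ (length good) ⟩
    length good ℕ.+ length (filter bad? xs) ≤⟨ ℕₚ.+-monoʳ-≤ (length good) (covering R? (filter bad? xs) ks c
        (λ x∈ → find (proj₂ (∈-filter⁻ bad? {xs = xs} x∈)))
        (λ {k} k∈ → ℕₚ.≤-trans (length-filter-filter (λ x → R? x k) bad? xs) (fib k∈))) ⟩
    length good ℕ.+ length ks ℕ.* c ∎
    where
    open ℕₚ.≤-Reasoning
    bad? = λ x → any? (R? x) ks
    good = filter (λ x → ¬? (any? (R? x) ks)) xs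

  integers : ℕ → List ℤ
  integers H = map +_ (upTo (suc H)) ++ map -[1+_] (upTo H)

  length-integers : ∀ H → length (integers H) ≡ suc H ℕ.+ H
  length-integers H = trans (length-++ (map +_ (upTo (suc H))))
    (cong₂ ℕ._+_ (trans (length-map +_ (upTo (suc H))) (length-upTo (suc H)))
                 (trans (length-map -[1+_] (upTo H)) (length-upTo H)))

  ∈-integers : ∀ {H} m → ℤ.∣ m ∣ ≤ H → m ∈ integers H
  ∈-integers (+ n) h = ∈-++⁺ˡ (∈-map⁺ +_ (∈-upTo⁺ (s≤s h)))
  ∈-integers {H} (-[1+ n ]) h = ∈-++⁺ʳ (map +_ (upTo (suc H))) (∈-map⁺ -[1+_] (∈-upTo⁺ h))

  ∈-integers⁻ : ∀ {H} m → m ∈ integers H → ℤ.∣ m ∣ ≤ H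
  ∈-integers⁻ {H} m m∈ with ∈-++⁻ (map +_ (upTo (suc H))) m∈
  ... | inj₁ m∈ˡ with ∈-map⁻ +_ m∈ˡ
  ...   | n , n∈ , refl = ℕ.s≤s⁻¹ (∈-upTo⁻ n∈)
  ∈-integers⁻ {H} m m∈ | inj₂ m∈ʳ with ∈-map⁻ -[1+_] m∈ʳ
  ...   | n , n∈ , refl = ∈-upTo⁻ n∈

  0<length⇒∈ : ∀ {A : Set} {xs : List A} → 0 < length xs → ∃[ x ] x ∈ xs
  0<length⇒∈ {xs = x ∷ _} _ = x , here refl

  Nondegenerate : ∀ {d} → Vec ℤ d → Set
  Nondegenerate y = ∀ T → Nonempty T → Σ∈ T y ≢ 0ℤ

  vectors : List ℕ → ∀ J → List (Vec ℤ (J ℕ.+ J))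
  vectors A J = choices (signedChoices A J)

  vectors-unique : ∀ {A} J → Unique A → Unique (vectors A J)
  vectors-unique J u = choices-unique (signedChoices-unique J u)

  length-vectors : ∀ A J → length (vectors A J) ≡ length A ^ (J ℕ.+ J)
  length-vectors A J = length-choices (signedChoices-length A J)

  degenerate-vectors : ∀ {A} j → Unique A → 0 < length A → ∀ T → Nonempty T →
    length (filter (λ y → Σ∈ T y ℤₚ.≟ 0ℤ) (vectors A (suc j))) ≤ length A ^ (j ℕ.+ suc j)
  degenerate-vectors {A} j u 0<N T ne = ℕₚ.*-cancelˡ-≤ (length A) {{ℕ.>-nonZero 0<N}}
    (few-on-hyperplane (length A) (signedChoices A (suc j)) (signedChoices-unique (suc j) u)
      (signedChoices-length A (suc j)) T ne 0ℤ)

  ≡-mod⇒∣-difference : ∀ a b q .{{_ : NonZero q}} → b % q ≡ a % q → q ∣ ℤ.∣ + a ℤ.- + b ∣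
  ≡-mod⇒∣-difference a b q eq = divides ℤ.∣ k ∣ (trans (cong ℤ.∣_∣ difference) (ℤₚ.abs-* k (+ q)))
    where
    open +-*-Solver
    k = + (a / q) ℤ.- + (b / q)
    expand : ∀ a → + a ≡ + (a % q) ℤ.+ + (a / q) ℤ.* + q
    expand a = trans (cong +_ (m≡m%n+[m/n]*n a q))
      (trans (ℤₚ.pos-+ (a % q) (a / q ℕ.* q)) (cong (λ z → + (a % q) ℤ.+ z) (ℤₚ.pos-* (a / q) q)))
    difference : + a ℤ.- + b ≡ k ℤ.* + q
    difference = trans (cong₂ ℤ._-_ (expand a) (trans (expand b) (cong (λ r → + r ℤ.+ + (b / q) ℤ.* + q) eq)))
      (solve 4 (λ r x y q → (r :+ x :* q) :- (r :+ y :* q) := (x :- y) :* q) refl (+ (a % q)) (+ (a / q)) (+ (b / q)) (+ q))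

  divisible-vectors : ∀ {A} J q Q → Unique A → 0 < q → q ≤ Q →
    (length A ^ J) ℕ.* (length A ^ J) ≤ Q ℕ.* length (filter (λ y → q ∣? ℤ.∣ total y ∣) (vectors A J))
  divisible-vectors {A} J q Q u 0<q q≤Q = begin
    (length A ^ J) ℕ.* (length A ^ J) ≡⟨ cong₂ ℕ._*_ lenU lenU ⟨
    length U ℕ.* length U ≤⟨ collisions-≥ f Q U (λ {x} _ → ℕₚ.<-≤-trans (m%n<n (Vec.sum x) q) q≤Q) ⟩
    Q ℕ.* length (filter same? (cartesianProduct U U)) ≤⟨ ℕₚ.*-monoʳ-≤ Q (injection⇒length-≤ (λ (u , v) → signed u v)
        (Uniq.filter⁺ same? (Uniq.cartesianProduct⁺ U-unique U-unique)) into
        (λ _ _ eq → let p , q = signed-injective eq in cong₂ _,_ p q)) ⟩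
    Q ℕ.* length (filter (λ y → q ∣? ℤ.∣ total y ∣) (vectors A J)) ∎
    where
    open ℕₚ.≤-Reasoning
    instance _ = ℕ.>-nonZero 0<q
    U = choices (replicate J A)
    U-unique : Unique U
    U-unique = choices-unique (all-replicate J u)
    lenU : length U ≡ length A ^ J
    lenU = length-choices (all-replicate J refl)
    f : Vec ℕ J → ℕ
    f x = Vec.sum x % q
    same? = λ (p : Vec ℕ J × Vec ℕ J) → f (proj₂ p) ℕₚ.≟ f (proj₁ p)
    into : ∀ {p} → p ∈ filter same? (cartesianProduct U U) →
           signed (proj₁ p) (proj₂ p) ∈ filter (λ y → q ∣? ℤ.∣ total y ∣) (vectors A J)
    into {x , y} p∈ with ∈-filter⁻ same? {xs = cartesianProduct U U} p∈
    ... | p∈′ , eq with ∈-cartesianProduct⁻ U U p∈′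
    ...   | x∈ , y∈ = ∈-filter⁺ (λ y → q ∣? ℤ.∣ total y ∣) (signed∈ x∈ y∈)
      (subst (λ z → q ∣ ℤ.∣ z ∣) (sym (total-signed x y)) (≡-mod⇒∣-difference (Vec.sum x) (Vec.sum y) q eq))

  divisible? : ∀ {d} (p : ℕ × Vec ℤ d) → Dec (proj₁ p ∣ ℤ.∣ total (proj₂ p) ∣)
  divisible? p = proj₁ p ∣? ℤ.∣ total (proj₂ p) ∣

  divisiblePairs : List ℕ → List ℕ → ∀ J → List (ℕ × Vec ℤ (J ℕ.+ J))
  divisiblePairs 𝒬 A J = filter divisible? (cartesianProduct 𝒬 (vectors A J))

  popular-quotient : ∀ {A 𝒬} j {X Q₀ H c} → Unique A → 0 < length A → (∀ {x} → x ∈ A → x ≤ X) →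
    Unique 𝒬 → 0 < Q₀ → (∀ {q} → q ∈ 𝒬 → Q₀ ≤ q) → (suc j ℕ.+ suc j) ℕ.* X ≤ H ℕ.* Q₀ →
    (suc H ℕ.+ H) ℕ.* c ℕ.+ 2 ^ (suc j ℕ.+ suc j) ℕ.* (length 𝒬 ℕ.* length A ^ (j ℕ.+ suc j))
      < length (divisiblePairs 𝒬 A (suc j)) →
    Σ[ m ∈ ℤ ] m ≢ 0ℤ × ℤ.∣ m ∣ ≤ H × (Σ[ cs ∈ List (ℕ × Vec ℤ (suc j ℕ.+ suc j)) ] Unique cs × c < length cs ×
      (∀ {q y} → (q , y) ∈ cs → q ∈ 𝒬 × y ∈ vectors A (suc j) × total y ≡ + q ℤ.* m × Nondegenerate y))
  popular-quotient {A} {𝒬} j {X} {Q₀} {H} {c} uA 0<N A≤X u𝒬 0<Q₀ Q₀≤ dX≤HQ₀ big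
    = conclude (pigeonhole key? good (integers H) c good-key
      (subst (λ l → l ℕ.* c < length good) (sym (length-integers H)) good-big))
    where
    d = suc j ℕ.+ suc j
    Y = vectors A (suc j)
    G = divisiblePairs 𝒬 A (suc j)
    deg? : ∀ (p : ℕ × Vec ℤ d) T → Dec (Nonempty T × Σ∈ T (proj₂ p) ≡ 0ℤ)
    deg? p T = nonempty? T ×-dec (Σ∈ T (proj₂ p) ℤₚ.≟ 0ℤ)
    nondeg? : ∀ (p : ℕ × Vec ℤ d) → Dec (¬ Any (λ T → Nonempty T × Σ∈ T (proj₂ p) ≡ 0ℤ) (allSubsets d))
    nondeg? p = ¬? (any? (deg? p) (allSubsets d))
    good = filter nondeg? G
    key? : ∀ (p : ℕ × Vec ℤ d) m → Dec (total (proj₂ p) ≡ + proj₁ p ℤ.* m)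
    key? p m = total (proj₂ p) ℤₚ.≟ + proj₁ p ℤ.* m
    uG : Unique G
    uG = Uniq.filter⁺ divisible? (Uniq.cartesianProduct⁺ u𝒬 (vectors-unique (suc j) uA))
    G⁻ : ∀ {p} → p ∈ G → (proj₁ p ∈ 𝒬 × proj₂ p ∈ Y) × proj₁ p ∣ ℤ.∣ total (proj₂ p) ∣
    G⁻ p∈ with ∈-filter⁻ divisible? {xs = cartesianProduct 𝒬 Y} p∈
    ... | p∈′ , dv = ∈-cartesianProduct⁻ 𝒬 Y p∈′ , dv
    fiber : ∀ {T} → T ∈ allSubsets d → length (filter (λ p → deg? p T) G) ≤ length 𝒬 ℕ.* length A ^ (j ℕ.+ suc j)
    fiber {T} _ = at (nonempty? T)
      where
      at : Dec (Nonempty T) → length (filter (λ p → deg? p T) G) ≤ length 𝒬 ℕ.* length A ^ (j ℕ.+ suc j)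
      at (no ¬ne) = ℕₚ.≤-trans (unique-⊆⇒length-≤ {ys = []} (Uniq.filter⁺ (λ p → deg? p T) uG)
        (λ p∈ → contradiction (proj₁ (proj₂ (∈-filter⁻ (λ p → deg? p T) {xs = G} p∈))) ¬ne)) ℕ.z≤n
      at (yes ne) = ℕₚ.≤-trans (unique-⊆⇒length-≤ {ys = cartesianProduct 𝒬 (filter (λ y → Σ∈ T y ℤₚ.≟ 0ℤ) Y)}
        (Uniq.filter⁺ (λ p → deg? p T) uG) into)
        (length-cartesianProduct-≤ 𝒬 _ (degenerate-vectors j uA 0<N T ne))
        where
        into : ∀ {p} → p ∈ filter (λ p → deg? p T) G → p ∈ cartesianProduct 𝒬 (filter (λ y → Σ∈ T y ℤₚ.≟ 0ℤ) Y)
        into p∈ with ∈-filter⁻ (λ p → deg? p T) {xs = G} p∈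
        ... | p∈G , _ , eq with G⁻ p∈G
        ...   | (q∈ , y∈) , _ = ∈-cartesianProduct⁺ q∈ (∈-filter⁺ (λ y → Σ∈ T y ℤₚ.≟ 0ℤ) y∈ eq)
    good-big : (suc H ℕ.+ H) ℕ.* c < length good
    good-big = ℕₚ.+-cancelʳ-< _ _ _ (ℕₚ.<-≤-trans big (subst
      (λ l → length G ≤ length good ℕ.+ l ℕ.* (length 𝒬 ℕ.* length A ^ (j ℕ.+ suc j)))
      (length-allSubsets d) (length-filter-cover deg? G (allSubsets d) _ fiber)))
    good-key : ∀ {p} → p ∈ good → ∃[ m ] m ∈ integers H × total (proj₂ p) ≡ + proj₁ p ℤ.* m
    good-key {q , y} p∈ with G⁻ (proj₁ (∈-filter⁻ nondeg? {xs = G} p∈))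
    ... | (q∈ , y∈) , dv with ℤ∣.∣ᵤ⇒∣ {+ q} {total y} dv
    ...   | ℤ∣.divides m eq = m , ∈-integers {H} m (ℕₚ.*-cancelʳ-≤ _ _ Q₀ {{ℕ.>-nonZero 0<Q₀}} (begin
        ℤ.∣ m ∣ ℕ.* Q₀ ≤⟨ ℕₚ.*-monoʳ-≤ ℤ.∣ m ∣ (Q₀≤ q∈) ⟩
        ℤ.∣ m ∣ ℕ.* q ≡⟨ ℤₚ.abs-* m (+ q) ⟨
        ℤ.∣ m ℤ.* + q ∣ ≡⟨ cong ℤ.∣_∣ eq ⟨
        ℤ.∣ total y ∣ ≤⟨ ∣Σ∈∣≤ (⊤ {d}) (All.map A≤X (signedChoices-entries {J = suc j} y∈)) ⟩
        d ℕ.* X ≤⟨ dX≤HQ₀ ⟩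
        H ℕ.* Q₀ ∎)) , trans eq (ℤₚ.*-comm m (+ q))
      where open ℕₚ.≤-Reasoning
    conclude : ∃[ m ] m ∈ integers H × c < length (filter (λ p → key? p m) good) →
      Σ[ m ∈ ℤ ] m ≢ 0ℤ × ℤ.∣ m ∣ ≤ H × (Σ[ cs ∈ List (ℕ × Vec ℤ d) ] Unique cs × c < length cs ×
        (∀ {q y} → (q , y) ∈ cs → q ∈ 𝒬 × y ∈ Y × total y ≡ + q ℤ.* m × Nondegenerate y))
    conclude (m , m∈ , cs-big) = m , m≢0 , ∈-integers⁻ m m∈ , cs ,
      Uniq.filter⁺ (λ p → key? p m) (Uniq.filter⁺ nondeg? uG) , cs-big , cs⁻
      where
      cs = filter (λ p → key? p m) good
      cs⁻ : ∀ {q y} → (q , y) ∈ cs → q ∈ 𝒬 × y ∈ Y × total y ≡ + q ℤ.* m × Nondegenerate y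
      cs⁻ p∈ with ∈-filter⁻ (λ p → key? p m) {xs = good} p∈
      ... | p∈good , eq with ∈-filter⁻ nondeg? {xs = G} p∈good
      ...   | p∈G , nd with G⁻ p∈G
      ...     | (q∈ , y∈) , _ = q∈ , y∈ , eq , λ T ne eq₀ → nd (lose (∈-allSubsets T) (ne , eq₀))
      m≢0 : m ≢ 0ℤ
      m≢0 refl with 0<length⇒∈ {xs = cs} (ℕₚ.≤-<-trans ℕ.z≤n cs-big)
      ... | (q , y) , p∈ with cs⁻ p∈
      ...   | _ , _ , eq , nd = nd ⊤ (zero , ∈⊤) (trans eq (ℤₚ.*-zeroʳ (+ q)))

module TwoModuli where

  open import Data.Fin.Subset using (Subset; Nonempty; ⊤; ⊥; ∁)
  open import Data.Fin.Subset.Properties using (nonempty?)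
  open import Data.Integer.Base as ℤ using (ℤ; +_; 0ℤ)
  import Data.Integer.Properties as ℤₚ
  open import Data.Integer.Solver using (module +-*-Solver)
  open import Data.List.Base using (List; []; _∷_; length; map; filter; cartesianProduct; upTo)
  open import Data.List.Membership.Propositional using (_∈_; lose)
  open import Data.List.Membership.Propositional.Properties
  open import Data.List.Properties using (length-map; length-upTo)
  open import Data.List.Relation.Unary.Any using (Any; here; any?)
  open import Data.List.Relation.Unary.Unique.Propositional using (Unique)
  import Data.List.Relation.Unary.Unique.Propositional.Properties as Uniq
  open import Data.Nat.Base as ℕ using (ℕ; suc; _^_; _≤_; _<_)
  open import Data.Nat.Coprimality using (Coprime; coprime-divisor)
  open import Data.Nat.Divisibility using (_∣_; _∣?_; divides; ∣⇒≤)
  import Data.Nat.Properties as ℕₚ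
  open import Data.Product.Base using (Σ-syntax; _×_; _,_; ∃-syntax; proj₁; proj₂)
  open import Data.Product.Properties using (≡-dec)
  open import Data.Sum.Base using (_⊎_; inj₁; inj₂)
  open import Data.Vec.Base as Vec using (Vec; replicate)
  import Data.Vec.Properties as Vecₚ
  open import Relation.Binary.PropositionalEquality hiding (J)
  open import Relation.Nullary using (Dec; ¬_; yes; no; contradiction)
  open import Relation.Nullary.Decidable using (¬?; _×-dec_)
  open Counting
  open Vectors
  open Popular

  open import Algebra.Properties.AbelianGroup ℤₚ.+-0-abelianGroup using (∙-cancelˡ)

  Point : Set
  Point = ℕ × ℕ

  grid : ℕ → List Point
  grid M = cartesianProduct (upTo M) (upTo M)

  grid-unique : ∀ M → Unique (grid M)
  grid-unique M = Uniq.cartesianProduct⁺ (Uniq.upTo⁺ M) (Uniq.upTo⁺ M)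

  length-grid : ∀ M → length (grid M) ≡ M ℕ.* M
  length-grid M = trans (length-cartesianProduct (upTo M) (upTo M)) (cong₂ ℕ._*_ (length-upTo M) (length-upTo M))

  ∈-grid⁻ : ∀ {M a b} → (a , b) ∈ grid M → a < M × b < M
  ∈-grid⁻ {M} p∈ with ∈-cartesianProduct⁻ (upTo M) (upTo M) p∈
  ... | a∈ , b∈ = ∈-upTo⁻ a∈ , ∈-upTo⁻ b∈

  diff₁ diff₂ : Point × Point → ℤ
  diff₁ (m , n) = + proj₁ n ℤ.- + proj₁ m
  diff₂ (m , n) = + proj₂ n ℤ.- + proj₂ m

  _∙_ : ℕ × ℕ → Point × Point → ℤ
  (q₁ , q₂) ∙ mn = + q₁ ℤ.* diff₁ mn ℤ.+ + q₂ ℤ.* diff₂ mn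

  linear-injective : ∀ {q₁ q₂ M} → Coprime q₂ q₁ → M ≤ q₂ → ∀ {a b c e} → a < M → c < M →
                     + q₁ ℤ.* + a ℤ.+ + q₂ ℤ.* + b ≡ + q₁ ℤ.* + c ℤ.+ + q₂ ℤ.* + e → (a , b) ≡ (c , e)
  linear-injective {q₁} {q₂} {M} cop M≤q₂ {a} {b} {c} {e} a<M c<M eq with a≡c
    where
    open +-*-Solver
    moved : + q₁ ℤ.* (+ a ℤ.- + c) ≡ + q₂ ℤ.* (+ e ℤ.- + b)
    moved = begin
      + q₁ ℤ.* (+ a ℤ.- + c)
        ≡⟨ solve 5 (λ q a c r b → q :* (a :- c) := (q :* a :+ r :* b) :- (q :* c :+ r :* b)) refl (+ q₁) (+ a) (+ c) (+ q₂) (+ b) ⟩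
      (+ q₁ ℤ.* + a ℤ.+ + q₂ ℤ.* + b) ℤ.- (+ q₁ ℤ.* + c ℤ.+ + q₂ ℤ.* + b)
        ≡⟨ cong (ℤ._- (+ q₁ ℤ.* + c ℤ.+ + q₂ ℤ.* + b)) eq ⟩
      (+ q₁ ℤ.* + c ℤ.+ + q₂ ℤ.* + e) ℤ.- (+ q₁ ℤ.* + c ℤ.+ + q₂ ℤ.* + b)
        ≡⟨ solve 5 (λ q c r e b → (q :* c :+ r :* e) :- (q :* c :+ r :* b) := r :* (e :- b)) refl (+ q₁) (+ c) (+ q₂) (+ e) (+ b) ⟩
      + q₂ ℤ.* (+ e ℤ.- + b) ∎
      where open ≡-Reasoning
    q₂∣ : q₂ ∣ ℤ.∣ + a ℤ.- + c ∣
    q₂∣ = coprime-divisor cop (divides ℤ.∣ + e ℤ.- + b ∣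
      (trans (sym (ℤₚ.abs-* (+ q₁) (+ a ℤ.- + c))) (trans (cong ℤ.∣_∣ moved)
        (trans (ℤₚ.abs-* (+ q₂) (+ e ℤ.- + b)) (ℕₚ.*-comm q₂ ℤ.∣ + e ℤ.- + b ∣)))))
    small : ℤ.∣ + a ℤ.- + c ∣ < q₂
    small = ℕₚ.<-≤-trans (ℕₚ.≤-<-trans (subst (λ z → ℤ.∣ z ∣ ≤ a ℕ.⊔ c) (sym (ℤₚ.m-n≡m⊖n a c)) (ℤₚ.∣m⊝n∣≤m⊔n a c))
      (ℕₚ.⊔-lub a<M c<M)) M≤q₂
    a≡c : a ≡ c
    a≡c with ℤ.∣ + a ℤ.- + c ∣ in ∣∣≡
    ... | 0 = ℤₚ.+-injective (ℤₚ.i-j≡0⇒i≡j (+ a) (+ c) (ℤₚ.∣i∣≡0⇒i≡0 ∣∣≡))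
    ... | suc k = contradiction (∣⇒≤ (subst (q₂ ∣_) ∣∣≡ q₂∣)) (ℕₚ.<⇒≱ (subst (_< q₂) ∣∣≡ small))
  ... | refl = cong (a ,_) (ℤₚ.+-injective (ℤₚ.*-cancelˡ-≡ (+ q₂) (+ b) (+ e) {{ℕ.>-nonZero (ℕₚ.<-≤-trans (ℕₚ.≤-<-trans ℕ.z≤n a<M) M≤q₂)}}
    (∙-cancelˡ (+ q₁ ℤ.* + a) _ _ eq)))

  ∙-injective : ∀ {q₁ q₂ M} → Coprime q₂ q₁ → M ≤ q₂ → ∀ {m n n′} → n ∈ grid M → n′ ∈ grid M →
                (q₁ , q₂) ∙ (m , n) ≡ (q₁ , q₂) ∙ (m , n′) → n ≡ n′
  ∙-injective {q₁} {q₂} cop M≤q₂ {m = a , b} {c , e} {c′ , e′} n∈ n′∈ eq =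
    linear-injective cop M≤q₂ (proj₁ (∈-grid⁻ n∈)) (proj₁ (∈-grid⁻ n′∈)) (begin
      + q₁ ℤ.* + c ℤ.+ + q₂ ℤ.* + e ≡⟨ split c e ⟩
      (q₁ , q₂) ∙ ((a , b) , (c , e)) ℤ.+ (+ q₁ ℤ.* + a ℤ.+ + q₂ ℤ.* + b) ≡⟨ cong (ℤ._+ (+ q₁ ℤ.* + a ℤ.+ + q₂ ℤ.* + b)) eq ⟩
      (q₁ , q₂) ∙ ((a , b) , (c′ , e′)) ℤ.+ (+ q₁ ℤ.* + a ℤ.+ + q₂ ℤ.* + b) ≡⟨ split c′ e′ ⟨
      + q₁ ℤ.* + c′ ℤ.+ + q₂ ℤ.* + e′ ∎)
    where
    open ≡-Reasoning
    open +-*-Solver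
    split : ∀ c e → + q₁ ℤ.* + c ℤ.+ + q₂ ℤ.* + e ≡ (q₁ , q₂) ∙ ((a , b) , (c , e)) ℤ.+ (+ q₁ ℤ.* + a ℤ.+ + q₂ ℤ.* + b)
    split c e = solve 6 (λ q r a b c e → q :* c :+ r :* e := (q :* (c :- a) :+ r :* (e :- b)) :+ (q :* a :+ r :* b)) refl
      (+ q₁) (+ q₂) (+ a) (+ b) (+ c) (+ e)

  coincident? : ∀ {d} q (p : Vec ℤ d × (Point × Point)) → Dec (total (proj₁ p) ≡ q ∙ proj₂ p)
  coincident? q p = total (proj₁ p) ℤₚ.≟ q ∙ proj₂ p

  shifts : ℕ → List (Point × Point)
  shifts M = cartesianProduct (grid M) (grid M)

  balance : ∀ q₁ q₂ s t m n →
    t ℕ.+ (q₁ ℕ.* proj₁ n ℕ.+ q₂ ℕ.* proj₂ n) ≡ s ℕ.+ (q₁ ℕ.* proj₁ m ℕ.+ q₂ ℕ.* proj₂ m) →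
    + s ℤ.- + t ≡ (q₁ , q₂) ∙ (m , n)
  balance q₁ q₂ s t (a , b) (c , e) eq = begin
    + s ℤ.- + t
      ≡⟨ solve 8 (λ s t q r a b c e → s :- t := ((s :+ (q :* a :+ r :* b)) :- (t :+ (q :* c :+ r :* e))) :+ (q :* (c :- a) :+ r :* (e :- b)))
           refl (+ s) (+ t) (+ q₁) (+ q₂) (+ a) (+ b) (+ c) (+ e) ⟩
    ((+ s ℤ.+ (+ q₁ ℤ.* + a ℤ.+ + q₂ ℤ.* + b)) ℤ.- (+ t ℤ.+ (+ q₁ ℤ.* + c ℤ.+ + q₂ ℤ.* + e))) ℤ.+ (q₁ , q₂) ∙ ((a , b) , (c , e))
      ≡⟨ cong (ℤ._+ (q₁ , q₂) ∙ ((a , b) , (c , e))) (ℤₚ.i≡j⇒i-j≡0 (trans (sym (cast s a b)) (trans (cong +_ (sym eq)) (cast t c e)))) ⟩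
    0ℤ ℤ.+ (q₁ , q₂) ∙ ((a , b) , (c , e)) ≡⟨ ℤₚ.+-identityˡ _ ⟩
    (q₁ , q₂) ∙ ((a , b) , (c , e)) ∎
    where
    open +-*-Solver
    open ≡-Reasoning
    cast : ∀ s a b → + (s ℕ.+ (q₁ ℕ.* a ℕ.+ q₂ ℕ.* b)) ≡ + s ℤ.+ (+ q₁ ℤ.* + a ℤ.+ + q₂ ℤ.* + b)
    cast s a b = trans (ℤₚ.pos-+ s _) (cong (λ z → + s ℤ.+ z)
      (trans (ℤₚ.pos-+ (q₁ ℕ.* a) (q₂ ℕ.* b)) (cong₂ ℤ._+_ (ℤₚ.pos-* q₁ a) (ℤₚ.pos-* q₂ b))))

  many-coincidences : ∀ {A} J q₁ q₂ M R → Unique A →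
    (∀ {u m} → u ∈ choices (replicate J A) → m ∈ grid M → Vec.sum u ℕ.+ (q₁ ℕ.* proj₁ m ℕ.+ q₂ ℕ.* proj₂ m) < R) →
    (length A ^ J ℕ.* (M ℕ.* M)) ℕ.* (length A ^ J ℕ.* (M ℕ.* M))
      ≤ R ℕ.* length (filter (coincident? (q₁ , q₂)) (cartesianProduct (vectors A J) (shifts M)))
  many-coincidences {A} J q₁ q₂ M R uA bound = begin
    (length A ^ J ℕ.* (M ℕ.* M)) ℕ.* (length A ^ J ℕ.* (M ℕ.* M)) ≡⟨ cong₂ ℕ._*_ lenD lenD ⟨
    length D ℕ.* length D ≤⟨ collisions-≥ f R D (λ p∈ → let u∈ , m∈ = ∈-cartesianProduct⁻ U (grid M) p∈ in bound u∈ m∈) ⟩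
    R ℕ.* length (filter same? (cartesianProduct D D)) ≤⟨ ℕₚ.*-monoʳ-≤ R (injection⇒length-≤
        (λ ((u , m) , (v , n)) → signed u v , (m , n))
        (Uniq.filter⁺ same? (Uniq.cartesianProduct⁺ D-unique D-unique)) into
        inj) ⟩
    R ℕ.* length (filter (coincident? (q₁ , q₂)) (cartesianProduct (vectors A J) (shifts M))) ∎
    where
    open ℕₚ.≤-Reasoning
    U = choices (replicate J A)
    D = cartesianProduct U (grid M)
    D-unique : Unique D
    D-unique = Uniq.cartesianProduct⁺ (choices-unique (all-replicate J uA)) (grid-unique M)
    lenD : length D ≡ length A ^ J ℕ.* (M ℕ.* M)
    lenD = trans (length-cartesianProduct U (grid M))
      (cong₂ ℕ._*_ (length-choices (all-replicate J refl)) (length-grid M))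
    f : Vec ℕ J × Point → ℕ
    f (u , m) = Vec.sum u ℕ.+ (q₁ ℕ.* proj₁ m ℕ.+ q₂ ℕ.* proj₂ m)
    same? = λ (p : (Vec ℕ J × Point) × (Vec ℕ J × Point)) → f (proj₂ p) ℕₚ.≟ f (proj₁ p)
    inj : ∀ {p p′} → p ∈ filter same? (cartesianProduct D D) → p′ ∈ filter same? (cartesianProduct D D) →
          (signed (proj₁ (proj₁ p)) (proj₁ (proj₂ p)) , (proj₂ (proj₁ p) , proj₂ (proj₂ p)))
            ≡ (signed (proj₁ (proj₁ p′)) (proj₁ (proj₂ p′)) , (proj₂ (proj₁ p′) , proj₂ (proj₂ p′))) → p ≡ p′
    inj {(u , m) , (v , n)} {(u′ , m′) , (v′ , n′)} _ _ eq with signed-injective {u = u} {u′} (cong proj₁ eq) | cong proj₂ eq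
    ... | refl , refl | refl = refl
    into : ∀ {p} → p ∈ filter same? (cartesianProduct D D) →
           (signed (proj₁ (proj₁ p)) (proj₁ (proj₂ p)) , (proj₂ (proj₁ p) , proj₂ (proj₂ p)))
             ∈ filter (coincident? (q₁ , q₂)) (cartesianProduct (vectors A J) (shifts M))
    into {(u , m) , (v , n)} p∈ with ∈-filter⁻ same? {xs = cartesianProduct D D} p∈
    ... | p∈′ , eq with ∈-cartesianProduct⁻ D D p∈′
    ...   | um∈ , vn∈ with ∈-cartesianProduct⁻ U (grid M) um∈ | ∈-cartesianProduct⁻ U (grid M) vn∈
    ...     | u∈ , m∈ | v∈ , n∈ = ∈-filter⁺ (coincident? (q₁ , q₂))
      (∈-cartesianProduct⁺ (signed∈ u∈ v∈) (∈-cartesianProduct⁺ m∈ n∈))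
      (trans (total-signed u v) (balance q₁ q₂ (Vec.sum u) (Vec.sum v) m n eq))

  multiple⇒∣ : ∀ {q k z} → z ≡ + q ℤ.* k → q ∣ ℤ.∣ z ∣
  multiple⇒∣ {q} {k} eq = divides ℤ.∣ k ∣ (trans (cong ℤ.∣_∣ eq) (trans (ℤₚ.abs-* (+ q) k) (ℕₚ.*-comm q ℤ.∣ k ∣)))

  PopularShift : List ℕ → List ℕ → List ℕ → ℕ → ℕ → ℕ → Set
  PopularShift A 𝒬₁ 𝒬₂ j M c = Σ[ m₁ ∈ ℤ ] Σ[ m₂ ∈ ℤ ] ℤ.∣ m₁ ∣ ≤ M × ℤ.∣ m₂ ∣ ≤ M ×
    (Σ[ cs ∈ List ((ℕ × ℕ) × Vec ℤ (suc j ℕ.+ suc j)) ] Unique cs × c < length cs ×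
      (∀ {q₁ q₂ y} → ((q₁ , q₂) , y) ∈ cs → q₁ ∈ 𝒬₁ × q₂ ∈ 𝒬₂ × y ∈ vectors A (suc j) ×
        total y ≡ + q₁ ℤ.* m₁ ℤ.+ + q₂ ℤ.* m₂ × Nondegenerate y × (∀ T → Σ∈ T y ≢ + q₁ ℤ.* m₁)))

  module Coincidences (A : List ℕ) (𝒬₁ : List ℕ) (𝒬₂ : List ℕ) (j : ℕ) (M : ℕ) (Ψ : ℕ)
    (A-unique : Unique A) (0<N : 0 < length A) (𝒬₁-unique : Unique 𝒬₁) (𝒬₂-unique : Unique 𝒬₂)
    (Ψ₁ : length 𝒬₁ ≡ Ψ) (Ψ₂ : length 𝒬₂ ≡ Ψ)
    (coprime : ∀ {q₁ q₂} → q₁ ∈ 𝒬₁ → q₂ ∈ 𝒬₂ → Coprime q₂ q₁)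
    (M≤ : ∀ {q₂} → q₂ ∈ 𝒬₂ → M ≤ q₂) where

    J : ℕ
    J = suc j

    d : ℕ
    d = J ℕ.+ J

    Y : List (Vec ℤ d)
    Y = vectors A J

    Config : Set
    Config = (ℕ × ℕ) × (Vec ℤ d × (Point × Point))

    coincidence? : ∀ (p : Config) → Dec (total (proj₁ (proj₂ p)) ≡ proj₁ p ∙ proj₂ (proj₂ p))
    coincidence? p = coincident? (proj₁ p) (proj₂ p)

    candidates : List Config
    candidates = cartesianProduct (cartesianProduct 𝒬₁ 𝒬₂) (cartesianProduct Y (shifts M))

    coincidences : List Config
    coincidences = filter coincidence? candidates

    coincidences-unique : Unique coincidences
    coincidences-unique = Uniq.filter⁺ coincidence? (Uniq.cartesianProduct⁺
      (Uniq.cartesianProduct⁺ 𝒬₁-unique 𝒬₂-unique)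
      (Uniq.cartesianProduct⁺ (vectors-unique J A-unique) (Uniq.cartesianProduct⁺ (grid-unique M) (grid-unique M))))

    record Coincidence (q₁ q₂ : ℕ) (y : Vec ℤ d) (m n : Point) : Set where
      field
        q₁∈ : q₁ ∈ 𝒬₁
        q₂∈ : q₂ ∈ 𝒬₂
        y∈ : y ∈ Y
        m∈ : m ∈ grid M
        n∈ : n ∈ grid M
        balanced : total y ≡ (q₁ , q₂) ∙ (m , n)

    open Coincidence

    ∈-coincidences⁻ : ∀ {q₁ q₂ y m n} → ((q₁ , q₂) , (y , (m , n))) ∈ coincidences → Coincidence q₁ q₂ y m n
    ∈-coincidences⁻ p∈ with ∈-filter⁻ coincidence? {xs = candidates} p∈
    ... | p∈′ , eq with ∈-cartesianProduct⁻ (cartesianProduct 𝒬₁ 𝒬₂) (cartesianProduct Y (shifts M)) p∈′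
    ...   | q∈ , ymn∈ with ∈-cartesianProduct⁻ 𝒬₁ 𝒬₂ q∈ | ∈-cartesianProduct⁻ Y (shifts M) ymn∈
    ...     | q₁∈ , q₂∈ | y∈ , mn∈ with ∈-cartesianProduct⁻ (grid M) (grid M) mn∈
    ...       | m∈ , n∈ = record { q₁∈ = q₁∈ ; q₂∈ = q₂∈ ; y∈ = y∈ ; m∈ = m∈ ; n∈ = n∈ ; balanced = eq }

    determined : ∀ {q₁ q₂ y m n n′} → Coincidence q₁ q₂ y m n → Coincidence q₁ q₂ y m n′ → n ≡ n′
    determined {m = m} c c′ = ∙-injective (coprime (q₁∈ c) (q₂∈ c)) (M≤ (q₂∈ c)) {m = m} (n∈ c) (n∈ c′)
      (trans (sym (balanced c)) (balanced c′))

    length-coincidences : ∀ R →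
      (∀ {q₁ q₂ u m} → q₁ ∈ 𝒬₁ → q₂ ∈ 𝒬₂ → u ∈ choices (replicate J A) → m ∈ grid M →
        Vec.sum u ℕ.+ (q₁ ℕ.* proj₁ m ℕ.+ q₂ ℕ.* proj₂ m) < R) →
      (Ψ ℕ.* Ψ) ℕ.* ((length A ^ J ℕ.* (M ℕ.* M)) ℕ.* (length A ^ J ℕ.* (M ℕ.* M))) ≤ R ℕ.* length coincidences
    length-coincidences R bound = subst (λ l → l ℕ.* ((length A ^ J ℕ.* (M ℕ.* M)) ℕ.* (length A ^ J ℕ.* (M ℕ.* M))) ≤ R ℕ.* length coincidences)
      (trans (length-cartesianProduct 𝒬₁ 𝒬₂) (cong₂ ℕ._*_ Ψ₁ Ψ₂))
      (length-filter-product coincidence? (cartesianProduct 𝒬₁ 𝒬₂) (cartesianProduct Y (shifts M)) R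
        ((length A ^ J ℕ.* (M ℕ.* M)) ℕ.* (length A ^ J ℕ.* (M ℕ.* M)))
        (λ {q} q∈ → let q₁∈ , q₂∈ = ∈-cartesianProduct⁻ 𝒬₁ 𝒬₂ q∈ in
          many-coincidences J (proj₁ q) (proj₂ q) M R A-unique (bound q₁∈ q₂∈)))

    vec : Config → Vec ℤ d
    vec p = proj₁ (proj₂ p)

    shift : Config → Point × Point
    shift p = proj₂ (proj₂ p)

    degenerate? : ∀ (p : Config) T → Dec (Nonempty T × Σ∈ T (vec p) ≡ 0ℤ)
    degenerate? p T = nonempty? T ×-dec (Σ∈ T (vec p) ℤₚ.≟ 0ℤ)

    block? : ∀ (p : Config) T → Dec (Σ∈ T (vec p) ≡ + proj₁ (proj₁ p) ℤ.* diff₁ (shift p))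
    block? p T = Σ∈ T (vec p) ℤₚ.≟ + proj₁ (proj₁ p) ℤ.* diff₁ (shift p)

    nondegenerate? : ∀ (p : Config) → Dec (¬ Any (λ T → Nonempty T × Σ∈ T (vec p) ≡ 0ℤ) (allSubsets d))
    nondegenerate? p = ¬? (any? (degenerate? p) (allSubsets d))

    unblocked? : ∀ (p : Config) → Dec (¬ Any (λ T → Σ∈ T (vec p) ≡ + proj₁ (proj₁ p) ℤ.* diff₁ (shift p)) (allSubsets d))
    unblocked? p = ¬? (any? (block? p) (allSubsets d))

    nondegenerates : List Config
    nondegenerates = filter nondegenerate? coincidences

    goods : List Config
    goods = filter unblocked? nondegenerates

    D : ℕ
    D = length A ^ (j ℕ.+ suc j)

    few-degenerate : length coincidences ≤ length nondegenerates ℕ.+ 2 ^ d ℕ.* ((Ψ ℕ.* Ψ) ℕ.* (D ℕ.* (M ℕ.* M)))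
    few-degenerate = subst (λ l → length coincidences ≤ length nondegenerates ℕ.+ l ℕ.* ((Ψ ℕ.* Ψ) ℕ.* (D ℕ.* (M ℕ.* M)))) (length-allSubsets d)
      (length-filter-cover degenerate? coincidences (allSubsets d) ((Ψ ℕ.* Ψ) ℕ.* (D ℕ.* (M ℕ.* M))) (λ {T} _ → fiber T (nonempty? T)))
      where
      fiber : ∀ T → Dec (Nonempty T) → length (filter (λ p → degenerate? p T) coincidences) ≤ (Ψ ℕ.* Ψ) ℕ.* (D ℕ.* (M ℕ.* M))
      fiber T (no ¬ne) = ℕₚ.≤-trans (unique-⊆⇒length-≤ {ys = []} (Uniq.filter⁺ (λ p → degenerate? p T) coincidences-unique)
        (λ p∈ → contradiction (proj₁ (proj₂ (∈-filter⁻ (λ p → degenerate? p T) {xs = coincidences} p∈))) ¬ne)) ℕ.z≤n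
      fiber T (yes ne) = begin
        length F ≤⟨ injection⇒length-≤ (λ p → proj₁ p , (vec p , proj₁ (shift p)))
          (Uniq.filter⁺ (λ p → degenerate? p T) coincidences-unique) into inj ⟩
        length (cartesianProduct (cartesianProduct 𝒬₁ 𝒬₂) (cartesianProduct YT (grid M)))
          ≡⟨ length-cartesianProduct (cartesianProduct 𝒬₁ 𝒬₂) (cartesianProduct YT (grid M)) ⟩
        length (cartesianProduct 𝒬₁ 𝒬₂) ℕ.* length (cartesianProduct YT (grid M))
          ≡⟨ cong₂ ℕ._*_ (trans (length-cartesianProduct 𝒬₁ 𝒬₂) (cong₂ ℕ._*_ Ψ₁ Ψ₂))
               (trans (length-cartesianProduct YT (grid M)) (cong (length YT ℕ.*_) (length-grid M))) ⟩
        (Ψ ℕ.* Ψ) ℕ.* (length YT ℕ.* (M ℕ.* M))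
          ≤⟨ ℕₚ.*-monoʳ-≤ (Ψ ℕ.* Ψ) (ℕₚ.*-monoˡ-≤ (M ℕ.* M) (degenerate-vectors j A-unique 0<N T ne)) ⟩
        (Ψ ℕ.* Ψ) ℕ.* (D ℕ.* (M ℕ.* M)) ∎
        where
        open ℕₚ.≤-Reasoning
        F = filter (λ p → degenerate? p T) coincidences
        YT = filter (λ y → Σ∈ T y ℤₚ.≟ 0ℤ) Y
        into : ∀ {p} → p ∈ F → (proj₁ p , (vec p , proj₁ (shift p))) ∈ cartesianProduct (cartesianProduct 𝒬₁ 𝒬₂) (cartesianProduct YT (grid M))
        into p∈ with ∈-filter⁻ (λ p → degenerate? p T) {xs = coincidences} p∈
        ... | p∈′ , (_ , eq) with ∈-coincidences⁻ p∈′
        ...   | c = ∈-cartesianProduct⁺ (∈-cartesianProduct⁺ (q₁∈ c) (q₂∈ c))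
          (∈-cartesianProduct⁺ (∈-filter⁺ (λ y → Σ∈ T y ℤₚ.≟ 0ℤ) (y∈ c) eq) (m∈ c))
        inj : ∀ {p p′} → p ∈ F → p′ ∈ F → (proj₁ p , (vec p , proj₁ (shift p))) ≡ (proj₁ p′ , (vec p′ , proj₁ (shift p′))) → p ≡ p′
        inj {q , (y , (m , n))} {q′ , (y′ , (m′ , n′))} p∈ p′∈ refl = cong (λ n → q , (y , (m , n)))
          (determined (∈-coincidences⁻ (proj₁ (∈-filter⁻ (λ p → degenerate? p T) {xs = coincidences} p∈)))
                      (∈-coincidences⁻ (proj₁ (∈-filter⁻ (λ p → degenerate? p T) {xs = coincidences} p′∈))))

    nondegenerates-unique : Unique nondegenerates
    nondegenerates-unique = Uniq.filter⁺ nondegenerate? coincidences-unique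

    ∈-nondegenerates⁻ : ∀ {q₁ q₂ y m n} → ((q₁ , q₂) , (y , (m , n))) ∈ nondegenerates →
                        Coincidence q₁ q₂ y m n × Nondegenerate y
    ∈-nondegenerates⁻ p∈ with ∈-filter⁻ nondegenerate? {xs = coincidences} p∈
    ... | p∈′ , nd = ∈-coincidences⁻ p∈′ , λ T ne eq₀ → nd (lose (∈-allSubsets T) (ne , eq₀))

    blocks : Subset d → List Config
    blocks T = filter (λ p → block? p T) nondegenerates

    blocks-unique : ∀ T → Unique (blocks T)
    blocks-unique T = Uniq.filter⁺ (λ p → block? p T) nondegenerates-unique

    ∈-blocks⁻ : ∀ {T q₁ q₂ y m n} → ((q₁ , q₂) , (y , (m , n))) ∈ blocks T →
                Coincidence q₁ q₂ y m n × Nondegenerate y × Σ∈ T y ≡ + q₁ ℤ.* diff₁ (m , n)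
    ∈-blocks⁻ {T} p∈ with ∈-filter⁻ (λ p → block? p T) {xs = nondegenerates} p∈
    ... | p∈′ , eq with ∈-nondegenerates⁻ p∈′
    ...   | c , nd = c , nd , eq

    complement-block : ∀ {T q₁ q₂ y m n} → Coincidence q₁ q₂ y m n → Σ∈ T y ≡ + q₁ ℤ.* diff₁ (m , n) →
                       Σ∈ (∁ T) y ≡ + q₂ ℤ.* diff₂ (m , n)
    complement-block {T} {q₁} {q₂} {y} {m} {n} c eq = ∙-cancelˡ (Σ∈ T y) _ _ (begin
      Σ∈ T y ℤ.+ Σ∈ (∁ T) y ≡⟨ ∁-sum T y ⟨
      total y ≡⟨ balanced c ⟩
      + q₁ ℤ.* diff₁ (m , n) ℤ.+ + q₂ ℤ.* diff₂ (m , n) ≡⟨ cong (ℤ._+ + q₂ ℤ.* diff₂ (m , n)) eq ⟨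
      Σ∈ T y ℤ.+ + q₂ ℤ.* diff₂ (m , n) ∎)
      where open ≡-Reasoning

    module _ (Φ : ℕ) (W : ℕ)
      (Φ₁ : length (divisiblePairs 𝒬₁ A J) ≤ Φ) (Φ₂ : length (divisiblePairs 𝒬₂ A J) ≤ Φ)
      (W₁ : ∀ {y} T → y ∈ Y → Σ∈ T y ≢ 0ℤ → length (filter (_∣? ℤ.∣ Σ∈ T y ∣) 𝒬₁) ≤ W)
      (W₂ : ∀ {y} T → y ∈ Y → Σ∈ T y ≢ 0ℤ → length (filter (_∣? ℤ.∣ Σ∈ T y ∣) 𝒬₂) ≤ W) where

      β : ℕ
      β = Φ ℕ.* (Ψ ℕ.* (M ℕ.* M)) ℕ.+ (length A ^ d ℕ.* (M ℕ.* M)) ℕ.* (W ℕ.* W)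

      empty-block : length (blocks ⊥) ≤ β
      empty-block = begin
        length (blocks ⊥) ≤⟨ injection⇒length-≤
          (λ p → (proj₂ (proj₁ p) , vec p) , (proj₁ (proj₁ p) , proj₁ (shift p))) (blocks-unique ⊥) into inj ⟩
        length (cartesianProduct F₂ (cartesianProduct 𝒬₁ (grid M)))
          ≡⟨ length-cartesianProduct F₂ (cartesianProduct 𝒬₁ (grid M)) ⟩
        length F₂ ℕ.* length (cartesianProduct 𝒬₁ (grid M))
          ≤⟨ ℕₚ.*-mono-≤ Φ₂ (ℕₚ.≤-reflexive (trans (length-cartesianProduct 𝒬₁ (grid M)) (cong₂ ℕ._*_ Ψ₁ (length-grid M)))) ⟩
        Φ ℕ.* (Ψ ℕ.* (M ℕ.* M)) ≤⟨ ℕₚ.m≤m+n _ _ ⟩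
        β ∎
        where
        open ℕₚ.≤-Reasoning
        F₂ = divisiblePairs 𝒬₂ A J
        into : ∀ {p} → p ∈ blocks ⊥ → ((proj₂ (proj₁ p) , vec p) , (proj₁ (proj₁ p) , proj₁ (shift p))) ∈ cartesianProduct F₂ (cartesianProduct 𝒬₁ (grid M))
        into {(q₁ , q₂) , (y , (m , n))} p∈ with ∈-blocks⁻ {⊥} p∈
        ... | c , _ , eq = ∈-cartesianProduct⁺
          (∈-filter⁺ divisible? (∈-cartesianProduct⁺ (q₂∈ c) (y∈ c))
            (multiple⇒∣ (trans (trans (∁-sum ⊥ y) (trans (cong (ℤ._+ Σ∈ (∁ ⊥) y) (Σ∈-⊥ y)) (ℤₚ.+-identityˡ _))) (complement-block {⊥} c eq))))
          (∈-cartesianProduct⁺ (q₁∈ c) (m∈ c))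
        inj : ∀ {p p′} → p ∈ blocks ⊥ → p′ ∈ blocks ⊥ →
              ((proj₂ (proj₁ p) , vec p) , (proj₁ (proj₁ p) , proj₁ (shift p))) ≡ ((proj₂ (proj₁ p′) , vec p′) , (proj₁ (proj₁ p′) , proj₁ (shift p′))) → p ≡ p′
        inj {q , (y , (m , n))} {q′ , (y′ , (m′ , n′))} p∈ p′∈ refl = cong (λ n → q , (y , (m , n)))
          (determined (proj₁ (∈-blocks⁻ {⊥} p∈)) (proj₁ (∈-blocks⁻ {⊥} p′∈)))

      full-block : length (blocks ⊤) ≤ β
      full-block = begin
        length (blocks ⊤) ≤⟨ injection⇒length-≤
          (λ p → (proj₁ (proj₁ p) , vec p) , (proj₂ (proj₁ p) , proj₁ (shift p))) (blocks-unique ⊤) into inj ⟩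
        length (cartesianProduct F₁ (cartesianProduct 𝒬₂ (grid M)))
          ≡⟨ length-cartesianProduct F₁ (cartesianProduct 𝒬₂ (grid M)) ⟩
        length F₁ ℕ.* length (cartesianProduct 𝒬₂ (grid M))
          ≤⟨ ℕₚ.*-mono-≤ Φ₁ (ℕₚ.≤-reflexive (trans (length-cartesianProduct 𝒬₂ (grid M)) (cong₂ ℕ._*_ Ψ₂ (length-grid M)))) ⟩
        Φ ℕ.* (Ψ ℕ.* (M ℕ.* M)) ≤⟨ ℕₚ.m≤m+n _ _ ⟩
        β ∎
        where
        open ℕₚ.≤-Reasoning
        F₁ = divisiblePairs 𝒬₁ A J
        into : ∀ {p} → p ∈ blocks ⊤ → ((proj₁ (proj₁ p) , vec p) , (proj₂ (proj₁ p) , proj₁ (shift p))) ∈ cartesianProduct F₁ (cartesianProduct 𝒬₂ (grid M))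
        into {(q₁ , q₂) , (y , (m , n))} p∈ with ∈-blocks⁻ {⊤} p∈
        ... | c , _ , eq = ∈-cartesianProduct⁺
          (∈-filter⁺ divisible? (∈-cartesianProduct⁺ (q₁∈ c) (y∈ c)) (multiple⇒∣ eq))
          (∈-cartesianProduct⁺ (q₂∈ c) (m∈ c))
        inj : ∀ {p p′} → p ∈ blocks ⊤ → p′ ∈ blocks ⊤ →
              ((proj₁ (proj₁ p) , vec p) , (proj₂ (proj₁ p) , proj₁ (shift p))) ≡ ((proj₁ (proj₁ p′) , vec p′) , (proj₂ (proj₁ p′) , proj₁ (shift p′))) → p ≡ p′
        inj {q , (y , (m , n))} {q′ , (y′ , (m′ , n′))} p∈ p′∈ refl = cong (λ n → q , (y , (m , n)))
          (determined (proj₁ (∈-blocks⁻ {⊤} p∈)) (proj₁ (∈-blocks⁻ {⊤} p′∈)))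

      proper-block : ∀ T → Nonempty T → Nonempty (∁ T) → length (blocks T) ≤ β
      proper-block T ne ne′ = begin
        length (blocks T) ≤⟨ covering same? (blocks T) keys (W ℕ.* W)
          (λ {p} p∈ → let c = proj₁ (∈-blocks⁻ {T} p∈) in (vec p , proj₁ (shift p)) , ∈-cartesianProduct⁺ (y∈ c) (m∈ c) , (refl , refl))
          (λ {k} _ → fiber k) ⟩
        length keys ℕ.* (W ℕ.* W) ≡⟨ cong (ℕ._* (W ℕ.* W)) (trans (length-cartesianProduct Y (grid M)) (cong₂ ℕ._*_ (length-vectors A J) (length-grid M))) ⟩
        (length A ^ d ℕ.* (M ℕ.* M)) ℕ.* (W ℕ.* W) ≤⟨ ℕₚ.m≤n+m _ (Φ ℕ.* (Ψ ℕ.* (M ℕ.* M))) ⟩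
        β ∎
        where
        open ℕₚ.≤-Reasoning
        keys = cartesianProduct Y (grid M)
        same? : ∀ (p : Config) (k : Vec ℤ d × Point) → Dec (vec p ≡ proj₁ k × proj₁ (shift p) ≡ proj₂ k)
        same? p k = Vecₚ.≡-dec ℤₚ._≟_ (vec p) (proj₁ k) ×-dec ≡-dec ℕₚ._≟_ ℕₚ._≟_ (proj₁ (shift p)) (proj₂ k)
        fiber : ∀ k → length (filter (λ p → same? p k) (blocks T)) ≤ W ℕ.* W
        fiber (y , m) = bound (0<?)
          where
          F = filter (λ p → same? p (y , m)) (blocks T)
          Q₁ = filter (_∣? ℤ.∣ Σ∈ T y ∣) 𝒬₁
          Q₂ = filter (_∣? ℤ.∣ Σ∈ (∁ T) y ∣) 𝒬₂
          F⁻ : ∀ {q₁ q₂ y′ m′ n} → ((q₁ , q₂) , (y′ , (m′ , n))) ∈ F →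
               (y′ ≡ y × m′ ≡ m) × Coincidence q₁ q₂ y′ m′ n × Nondegenerate y′ × Σ∈ T y′ ≡ + q₁ ℤ.* diff₁ (m′ , n)
          F⁻ p∈ with ∈-filter⁻ (λ p → same? p (y , m)) {xs = blocks T} p∈
          ... | p∈′ , eqs = eqs , ∈-blocks⁻ {T} p∈′
          into : ∀ {p} → p ∈ F → proj₁ p ∈ cartesianProduct Q₁ Q₂
          into p∈ with F⁻ p∈
          ... | (refl , refl) , c , nd , eq = ∈-cartesianProduct⁺
            (∈-filter⁺ (_∣? ℤ.∣ Σ∈ T y ∣) (q₁∈ c) (multiple⇒∣ eq))
            (∈-filter⁺ (_∣? ℤ.∣ Σ∈ (∁ T) y ∣) (q₂∈ c) (multiple⇒∣ (complement-block {T} c eq)))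
          inj : ∀ {p p′} → p ∈ F → p′ ∈ F → proj₁ p ≡ proj₁ p′ → p ≡ p′
          inj {q , _} p∈ p′∈ refl with F⁻ p∈ | F⁻ p′∈
          ... | (refl , refl) , c , _ | (refl , refl) , c′ , _ = cong (λ n → q , (y , (m , n))) (determined c c′)
          0<? : F ≡ [] ⊎ ∃[ p ] p ∈ F
          0<? with F
          ... | [] = inj₁ refl
          ... | p ∷ _ = inj₂ (p , here refl)
          bound : F ≡ [] ⊎ (∃[ p ] p ∈ F) → length F ≤ W ℕ.* W
          bound (inj₁ eq) = subst (λ xs → length xs ≤ W ℕ.* W) (sym eq) ℕ.z≤n
          bound (inj₂ (p , p∈)) with F⁻ p∈
          ... | (refl , refl) , c , nd , _ = ℕₚ.≤-trans
            (injection⇒length-≤ {ys = cartesianProduct Q₁ Q₂} proj₁ (Uniq.filter⁺ (λ p → same? p (y , m)) (blocks-unique T)) into inj)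
            (ℕₚ.≤-trans (ℕₚ.≤-reflexive (length-cartesianProduct Q₁ Q₂))
              (ℕₚ.*-mono-≤ (W₁ T (y∈ c) (nd T ne)) (W₂ (∁ T) (y∈ c) (nd (∁ T) ne′))))

      few-blocked : length nondegenerates ≤ length goods ℕ.+ 2 ^ d ℕ.* β
      few-blocked = subst (λ l → length nondegenerates ≤ length goods ℕ.+ l ℕ.* β) (length-allSubsets d)
        (length-filter-cover block? nondegenerates (allSubsets d) β (λ {T} _ → fiber T (≡⊥⊎nonempty T) (≡⊥⊎nonempty (∁ T))))
        where
        fiber : ∀ T → T ≡ ⊥ ⊎ Nonempty T → ∁ T ≡ ⊥ ⊎ Nonempty (∁ T) → length (blocks T) ≤ β
        fiber T (inj₁ refl) _ = empty-block
        fiber T (inj₂ ne) (inj₁ eq) = subst (λ T → length (blocks T) ≤ β) (sym (∁-⊥ T eq)) full-block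
        fiber T (inj₂ ne) (inj₂ ne′) = proper-block T ne ne′

      popular-shift : ∀ {c} →
        ((M ℕ.* M) ℕ.* (M ℕ.* M)) ℕ.* c ℕ.+ (2 ^ d ℕ.* ((Ψ ℕ.* Ψ) ℕ.* (D ℕ.* (M ℕ.* M))) ℕ.+ 2 ^ d ℕ.* β) < length coincidences →
        PopularShift A 𝒬₁ 𝒬₂ j M c
      popular-shift {c} big = conclude (pigeonhole key? goods (shifts M) c
          (λ {p} p∈ → shift p , ∈-cartesianProduct⁺ (m∈ (proj₁ (goods⁻ p∈))) (n∈ (proj₁ (goods⁻ p∈))) , refl)
          (subst (λ l → l ℕ.* c < length goods)
            (sym (trans (length-cartesianProduct (grid M) (grid M)) (cong₂ ℕ._*_ (length-grid M) (length-grid M)))) enough))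
        where
        key? : ∀ (p : Config) (k : Point × Point) → Dec (shift p ≡ k)
        key? p k = ≡-dec (≡-dec ℕₚ._≟_ ℕₚ._≟_) (≡-dec ℕₚ._≟_ ℕₚ._≟_) (shift p) k
        goods⁻ : ∀ {q₁ q₂ y m n} → ((q₁ , q₂) , (y , (m , n))) ∈ goods →
                 Coincidence q₁ q₂ y m n × Nondegenerate y × (∀ T → Σ∈ T y ≢ + q₁ ℤ.* diff₁ (m , n))
        goods⁻ p∈ with ∈-filter⁻ unblocked? {xs = nondegenerates} p∈
        ... | p∈′ , ub with ∈-nondegenerates⁻ p∈′
        ...   | co , nd = co , nd , λ T eq → ub (lose (∈-allSubsets T) eq)
        enough : ((M ℕ.* M) ℕ.* (M ℕ.* M)) ℕ.* c < length goods
        enough = ℕₚ.+-cancelʳ-< _ _ _ (ℕₚ.<-≤-trans big (ℕₚ.≤-trans few-degenerate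
          (ℕₚ.≤-trans (ℕₚ.+-monoˡ-≤ _ few-blocked) (ℕₚ.≤-reflexive
            (trans (ℕₚ.+-assoc (length goods) _ _) (cong (length goods ℕ.+_) (ℕₚ.+-comm (2 ^ d ℕ.* β) _)))))))
        ∣diff∣≤ : ∀ {a b} → a < M → b < M → ℤ.∣ + b ℤ.- + a ∣ ≤ M
        ∣diff∣≤ {a} {b} a<M b<M = ℕₚ.≤-trans
          (subst (λ z → ℤ.∣ z ∣ ≤ b ℕ.⊔ a) (sym (ℤₚ.m-n≡m⊖n b a)) (ℤₚ.∣m⊝n∣≤m⊔n b a))
          (ℕₚ.<⇒≤ (ℕₚ.⊔-lub b<M a<M))
        conclude : ∃[ k ] k ∈ shifts M × c < length (filter (λ p → key? p k) goods) → PopularShift A 𝒬₁ 𝒬₂ j M c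
        conclude ((m , n) , k∈ , cs-big) with ∈-cartesianProduct⁻ (grid M) (grid M) k∈
        ... | m∈ , n∈ with ∈-grid⁻ {M} m∈ | ∈-grid⁻ {M} n∈
        ...   | a<M , b<M | a′<M , b′<M =
          diff₁ (m , n) , diff₂ (m , n) , ∣diff∣≤ a<M a′<M , ∣diff∣≤ b<M b′<M ,
          map (λ p → proj₁ p , vec p) F , map-unique (λ p → proj₁ p , vec p) F-unique inj ,
          subst (c <_) (sym (length-map (λ p → proj₁ p , vec p) F)) cs-big , F⁻
          where
          F = filter (λ p → key? p (m , n)) goods
          F-unique : Unique F
          F-unique = Uniq.filter⁺ (λ p → key? p (m , n)) (Uniq.filter⁺ unblocked? nondegenerates-unique)
          inj : ∀ {p p′} → p ∈ F → p′ ∈ F → (proj₁ p , vec p) ≡ (proj₁ p′ , vec p′) → p ≡ p′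
          inj p∈ p′∈ refl with ∈-filter⁻ (λ p → key? p (m , n)) {xs = goods} p∈ | ∈-filter⁻ (λ p → key? p (m , n)) {xs = goods} p′∈
          ... | _ , refl | _ , refl = refl
          F⁻ : ∀ {q₁ q₂ y} → ((q₁ , q₂) , y) ∈ map (λ p → proj₁ p , vec p) F → q₁ ∈ 𝒬₁ × q₂ ∈ 𝒬₂ × y ∈ Y ×
               total y ≡ + q₁ ℤ.* diff₁ (m , n) ℤ.+ + q₂ ℤ.* diff₂ (m , n) × Nondegenerate y × (∀ T → Σ∈ T y ≢ + q₁ ℤ.* diff₁ (m , n))
          F⁻ x∈ with ∈-map⁻ (λ p → proj₁ p , vec p) x∈
          ... | p , p∈ , refl with ∈-filter⁻ (λ p → key? p (m , n)) {xs = goods} p∈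
          ...   | p∈′ , refl with goods⁻ p∈′
          ...     | co , nd , ub = q₁∈ co , q₂∈ co , y∈ co , balanced co , nd , ub

module Solutions where

  open import Data.Bool.Base using (true; false; if_then_else_)
  open import Data.Fin.Base using (Fin; zero; suc)
  open import Data.Fin.Subset using (⊤; ⁅_⁆)
  open import Data.Fin.Subset.Properties using (∈⊤; x∈⁅x⁆)
  open import Data.Integer.Base as ℤ using (ℤ; +_; -[1+_]; 0ℤ)
  import Data.Integer.Properties as ℤₚ
  open import Data.List.Base using (List; []; _∷_; length; map)
  open import Data.List.Membership.Propositional using (_∈_)
  open import Data.List.Membership.Propositional.Properties
  open import Data.List.Properties using (length-map)
  import Data.List.Relation.Unary.All as ListAll
  open import Data.List.Relation.Unary.Unique.Propositional using (Unique)
  open import Data.Integer.GCD using (gcd)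
  open import Data.Nat.Base as ℕ using (ℕ; suc)
  open import Data.Nat.Coprimality as Coprimality using (1-coprimeTo)
  open import Data.Nat.Divisibility using (_∣_; ∣-trans; m∣m*n)
  open import Data.Nat.Primality using (Prime; euclidsLemma)
  open import Data.Product.Base using (Σ-syntax; _×_; _,_)
  open import Data.Rational using (ℚ; mkℚ; _+_; _*_; 1/_; 0ℚ; 1ℚ; ↥_; ↧_; ↧ₙ_; _/_; ≢-nonZero)
  open import Data.Rational.Properties
  open import Data.Rational.Solver using (module +-*-Solver)
  open import Data.Sum.Base using (_⊎_; inj₁; inj₂)
  open import Data.Vec.Base using (Vec; []; _∷_; lookup; tabulate)
  import Data.Vec.Properties as Vecₚ
  open import Function.Base using (_∘_; case_of_)
  open import Relation.Binary.PropositionalEquality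
  open import Relation.Nullary using (¬_; yes; no; contradiction)
  open Counting
  open Chebyshev
  open Vectors
  open Popular
  open import Defs

  open import Algebra.Properties.CommutativeMonoid.Sum +-0-commutativeMonoid using (sum)

  ι : ℤ → ℚ
  ι z = mkℚ z 0 (Coprimality.sym (1-coprimeTo ℤ.∣ z ∣))

  ι-/ : ∀ z → z / 1 ≡ ι z
  ι-/ z = ↥p/↧p≡p (ι z)

  ι-+ : ∀ a b → ι (a ℤ.+ b) ≡ ι a + ι b
  ι-+ a b = trans (sym (ι-/ (a ℤ.+ b))) (cong (_/ 1) (cong₂ ℤ._+_ (sym (ℤₚ.*-identityʳ a)) (sym (ℤₚ.*-identityʳ b))))

  ι-* : ∀ a b → ι (a ℤ.* b) ≡ ι a * ι b
  ι-* a b = sym (ι-/ (a ℤ.* b))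

  ι-injective : ∀ {a b} → ι a ≡ ι b → a ≡ b
  ι-injective = cong ↥_

  *-≢0 : ∀ {p q} → p ≢ 0ℚ → q ≢ 0ℚ → p * q ≢ 0ℚ
  *-≢0 {p} {q} p≢0 q≢0 pq≡0 = q≢0 (begin
    q ≡⟨ *-identityˡ q ⟨
    1ℚ * q ≡⟨ cong (_* q) (*-inverseˡ p) ⟨
    (1/ p) * p * q ≡⟨ *-assoc (1/ p) p q ⟩
    (1/ p) * (p * q) ≡⟨ cong ((1/ p) *_) pq≡0 ⟩
    (1/ p) * 0ℚ ≡⟨ *-zeroʳ (1/ p) ⟩
    0ℚ ∎)
    where
    open ≡-Reasoning
    instance _ = ≢-nonZero p≢0

  IsSUnit-* : ∀ {S p q} → IsSUnit S p → IsSUnit S q → IsSUnit S (p * q)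
  IsSUnit-* {S} {p} {q} (p≢0 , hp) (q≢0 , hq) = *-≢0 p≢0 q≢0 , λ r pr → λ where
      (inj₁ r∣) → factor pr inj₁ inj₁ (∣-trans r∣ num)
      (inj₂ r∣) → factor pr inj₂ inj₂ (∣-trans r∣ den)
    where
    nf = gcd (↥ p ℤ.* ↥ q) (↧ p ℤ.* ↧ q)
    num : ℤ.∣ ↥ (p * q) ∣ ∣ ℤ.∣ ↥ p ∣ ℕ.* ℤ.∣ ↥ q ∣
    num = subst (ℤ.∣ ↥ (p * q) ∣ ∣_)
      (trans (sym (ℤₚ.abs-* (↥ (p * q)) nf)) (trans (cong ℤ.∣_∣ (↥-* p q)) (ℤₚ.abs-* (↥ p) (↥ q)))) (m∣m*n ℤ.∣ nf ∣)
    den : ↧ₙ (p * q) ∣ ↧ₙ p ℕ.* ↧ₙ q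
    den = subst (↧ₙ (p * q) ∣_)
      (trans (sym (ℤₚ.abs-* (↧ (p * q)) nf)) (trans (cong ℤ.∣_∣ (↧-* p q)) (ℤₚ.abs-* (↧ p) (↧ q)))) (m∣m*n ℤ.∣ nf ∣)
    factor : ∀ {r m n} → Prime r → (r ∣ m → r ∣ ℤ.∣ ↥ p ∣ ⊎ r ∣ ↧ₙ p) → (r ∣ n → r ∣ ℤ.∣ ↥ q ∣ ⊎ r ∣ ↧ₙ q) →
             r ∣ m ℕ.* n → r ∈ S
    factor {r} {m} {n} pr f g r∣mn with euclidsLemma m n pr r∣mn
    ... | inj₁ r∣m = hp r pr (f r∣m)
    ... | inj₂ r∣n = hq r pr (g r∣n)

  IsSUnit-1/ : ∀ {S p} (p≢0 : p ≢ 0ℚ) → IsSUnit S p → IsSUnit S ((1/ p) {{≢-nonZero p≢0}})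
  IsSUnit-1/ {p = mkℚ (+ 0) d c} p≢0 _ = contradiction (↥p≡0⇒p≡0 (mkℚ (+ 0) d c) refl) p≢0
  IsSUnit-1/ {p = mkℚ ℤ.+[1+ n ] d c} p≢0 (_ , h) = (λ eq → case cong ↥_ eq of λ ()) , λ r pr → λ where
    (inj₁ r∣) → h r pr (inj₂ r∣)
    (inj₂ r∣) → h r pr (inj₁ r∣)
  IsSUnit-1/ {p = mkℚ -[1+ n ] d c} p≢0 (_ , h) = (λ eq → case cong ↥_ eq of λ ()) , λ r pr → λ where
    (inj₁ r∣) → h r pr (inj₂ r∣)
    (inj₂ r∣) → h r pr (inj₁ r∣)

  IsSUnit-ι : ∀ {S z} → z ≢ 0ℤ → (∀ r → Prime r → r ∣ ℤ.∣ z ∣ → r ∈ S) → IsSUnit S (ι z)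
  IsSUnit-ι z≢0 h = z≢0 ∘ ι-injective , λ r pr → λ where
    (inj₁ r∣) → h r pr r∣
    (inj₂ r∣) → contradiction r∣ (prime∤1 pr)

  Σ∈-⁅⁆ : ∀ {n} i (y : Vec ℤ n) → Σ∈ ⁅ i ⁆ y ≡ lookup y i
  Σ∈-⁅⁆ zero (z ∷ y) = trans (cong (λ w → z ℤ.+ w) (Σ∈-⊥ y)) (ℤₚ.+-identityʳ z)
  Σ∈-⁅⁆ (suc i) (z ∷ y) = trans (drop-zero z ⁅ i ⁆ y) (Σ∈-⁅⁆ i y)

  subsum-scaled : ∀ {n} (f : Fin n → ℚ) (y : Vec ℤ n) g T → (∀ i → f i ≡ ι (lookup y i) * g) →
                  sum (λ i → if lookup T i then f i else 0ℚ) ≡ ι (Σ∈ T y) * g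
  subsum-scaled f [] g [] h = sym (*-zeroˡ g)
  subsum-scaled f (z ∷ y) g (b ∷ T) h = trans
    (cong₂ _+_ (head b) (subsum-scaled (f ∘ suc) y g T (h ∘ suc)))
    (trans (sym (*-distribʳ-+ g (ι (if b then z else 0ℤ)) (ι (Σ∈ T y)))) (cong (_* g) (sym (ι-+ (if b then z else 0ℤ) (Σ∈ T y)))))
    where
    head : ∀ b → (if b then f zero else 0ℚ) ≡ ι (if b then z else 0ℤ) * g
    head true = h zero
    head false = sym (*-zeroˡ g)

  sum-scaled : ∀ {n} (f : Fin n → ℚ) (y : Vec ℤ n) g → (∀ i → f i ≡ ι (lookup y i) * g) → sum f ≡ ι (total y) * g
  sum-scaled f [] g h = sym (*-zeroˡ g)
  sum-scaled f (z ∷ y) g h = trans (cong₂ _+_ (h zero) (sum-scaled (f ∘ suc) y g (h ∘ suc)))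
    (trans (sym (*-distribʳ-+ g (ι z) (ι (total y)))) (cong (_* g) (sym (ι-+ z (total y)))))

  invℚ≡1/ : ∀ {p} (p≢0 : p ≢ 0ℚ) → invℚ p ≡ (1/ p) {{≢-nonZero p≢0}}
  invℚ≡1/ {p} p≢0 with p ≟ 0ℚ
  ... | yes p≡0 = contradiction p≡0 p≢0
  ... | no _ = refl

  total≢0 : ∀ {n} {y : Vec ℤ (suc n)} → Nondegenerate y → total y ≢ 0ℤ
  total≢0 nd = nd ⊤ (zero , ∈⊤)

  module _ {n : ℕ} (a : Vec ℚ (suc n)) (a≢0 : ∀ i → lookup a i ≢ 0ℚ) where

    1/a : Fin (suc n) → ℚ
    1/a i = (1/ lookup a i) {{≢-nonZero (a≢0 i)}}

    solution : Vec ℤ (suc n) → Vec ℚ (suc n)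
    solution y = tabulate λ i → (ι (lookup y i) * invℚ (ι (total y))) * 1/a i

    term : ∀ y i → lookup a i * lookup (solution y) i ≡ ι (lookup y i) * invℚ (ι (total y))
    term y i = begin
      lookup a i * lookup (solution y) i ≡⟨ cong (lookup a i *_) (Vecₚ.lookup∘tabulate (λ i → (ι (lookup y i) * invℚ (ι (total y))) * 1/a i) i) ⟩
      lookup a i * (z * 1/a i) ≡⟨ solve 3 (λ a z b → a :* (z :* b) := z :* (b :* a)) refl (lookup a i) z (1/a i) ⟩
      z * (1/a i * lookup a i) ≡⟨ cong (z *_) (*-inverseˡ (lookup a i) {{≢-nonZero (a≢0 i)}}) ⟩
      z * 1ℚ ≡⟨ *-identityʳ z ⟩
      z ∎
      where
      open ≡-Reasoning
      open +-*-Solver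
      z = ι (lookup y i) * invℚ (ι (total y))

    module _ (y : Vec ℤ (suc n)) (nd : Nondegenerate y) where

      ι-total≢0 : ι (total y) ≢ 0ℚ
      ι-total≢0 = total≢0 nd ∘ ι-injective

      total-inverse : ι (total y) * invℚ (ι (total y)) ≡ 1ℚ
      total-inverse = trans (cong (ι (total y) *_) (invℚ≡1/ ι-total≢0)) (*-inverseʳ (ι (total y)) {{≢-nonZero ι-total≢0}})

      inverse≢0 : invℚ (ι (total y)) ≢ 0ℚ
      inverse≢0 g≡0 = case trans (sym total-inverse) (trans (cong (ι (total y) *_) g≡0) (*-zeroʳ (ι (total y)))) of λ ()

      solution-correct : ∀ {S} → (∀ i → IsSUnit S (lookup a i)) →
                         (∀ i r → Prime r → r ∣ ℤ.∣ lookup y i ∣ → r ∈ S) →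
                         (∀ r → Prime r → r ∣ ℤ.∣ total y ∣ → r ∈ S) →
                         IsNonDegenerateSolution a (solution y) S
      solution-correct {S} aS yS tS = units ,
        trans (sum-scaled (λ i → lookup a i * lookup (solution y) i) y (invℚ (ι (total y))) (term y)) total-inverse ,
        nondegenerate
        where
        units : ∀ i → IsSUnit S (lookup (solution y) i)
        units i = subst (IsSUnit S) (sym (Vecₚ.lookup∘tabulate (λ i → (ι (lookup y i) * invℚ (ι (total y))) * 1/a i) i))
          (IsSUnit-* (IsSUnit-* (IsSUnit-ι (λ eq → nd ⁅ i ⁆ (i , x∈⁅x⁆ i) (trans (Σ∈-⁅⁆ i y) eq)) (yS i))
                                (subst (IsSUnit S) (sym (invℚ≡1/ ι-total≢0)) (IsSUnit-1/ ι-total≢0 (IsSUnit-ι (total≢0 nd) tS))))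
                     (IsSUnit-1/ (a≢0 i) (aS i)))
        nondegenerate : ¬ Degenerate a (solution y)
        nondegenerate (T , ne , _ , eq) = *-≢0 {ι (Σ∈ T y)} {invℚ (ι (total y))} (nd T ne ∘ ι-injective) inverse≢0
          (trans (sym (subsum-scaled (λ i → lookup a i * lookup (solution y) i) y (invℚ (ι (total y))) T (term y))) eq)

    solution-injective : ∀ {y y′} → Nondegenerate y → Nondegenerate y′ → solution y ≡ solution y′ →
                         ∀ i → lookup y i ℤ.* total y′ ≡ lookup y′ i ℤ.* total y
    solution-injective {y} {y′} nd nd′ eq i = ι-injective (begin
      ι (lookup y i ℤ.* total y′) ≡⟨ ι-* (lookup y i) (total y′) ⟩
      x * t′ ≡⟨ *-identityʳ _ ⟨
      x * t′ * 1ℚ ≡⟨ cong (x * t′ *_) (total-inverse y nd) ⟨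
      x * t′ * (t * invℚ t)
        ≡⟨ solve 4 (λ a b c e → a :* b :* (c :* e) := (a :* e) :* (b :* c)) refl x t′ t (invℚ t) ⟩
      (x * invℚ t) * (t′ * t)
        ≡⟨ cong (_* (t′ * t)) (trans (sym (term y i)) (trans (cong (λ x → lookup a i * lookup x i) eq) (term y′ i))) ⟩
      (x′ * invℚ t′) * (t′ * t)
        ≡⟨ solve 4 (λ a b c e → (a :* e) :* (b :* c) := a :* c :* (b :* e)) refl x′ t′ t (invℚ t′) ⟩
      x′ * t * (t′ * invℚ t′) ≡⟨ cong (x′ * t *_) (total-inverse y′ nd′) ⟩
      x′ * t * 1ℚ ≡⟨ *-identityʳ _ ⟩
      x′ * t ≡⟨ ι-* (lookup y′ i) (total y) ⟨
      ι (lookup y′ i ℤ.* total y) ∎)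
      where
      open ≡-Reasoning
      open +-*-Solver
      x = ι (lookup y i)
      x′ = ι (lookup y′ i)
      t = ι (total y)
      t′ = ι (total y′)

    realise : ∀ {C : Set} (S : List ℕ) (cs : List C) (y : C → Vec ℤ (suc n)) → Unique cs →
      (∀ i → IsSUnit S (lookup a i)) →
      (∀ {c} → c ∈ cs → Nondegenerate (y c)) →
      (∀ {c} → c ∈ cs → ∀ i r → Prime r → r ∣ ℤ.∣ lookup (y c) i ∣ → r ∈ S) →
      (∀ {c} → c ∈ cs → ∀ r → Prime r → r ∣ ℤ.∣ total (y c) ∣ → r ∈ S) →
      (∀ {c c′} → c ∈ cs → c′ ∈ cs → (∀ i → lookup (y c) i ℤ.* total (y c′) ≡ lookup (y c′) i ℤ.* total (y c)) → c ≡ c′) →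
      Σ[ xs ∈ List (Vec ℚ (suc n)) ] Unique xs × ListAll.All (λ x → IsNonDegenerateSolution a x S) xs × length xs ≡ length cs
    realise S cs y u aS nd yS tS inj = map (solution ∘ y) cs
      , map-unique (solution ∘ y) u (λ c∈ c′∈ eq → inj c∈ c′∈ (solution-injective (nd c∈) (nd c′∈) eq))
      , ListAll.tabulate (λ x∈ → let c , c∈ , eq = ∈-map⁻ (solution ∘ y) x∈ in
          subst (λ x → IsNonDegenerateSolution a x S) (sym eq) (solution-correct (y c) (nd c∈) aS (yS c∈) (tS c∈)))
      , length-map (solution ∘ y) cs

module Cases where

  open import Data.Bool.Base using (true; false)
  open import Data.Fin.Base using (zero; suc)
  open import Data.Fin.Subset using (Subset; Nonempty; ⊤; ⊥)
  open import Data.Integer.Base as ℤ using (ℤ; +_; 0ℤ)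
  import Data.Integer.Properties as ℤₚ
  open import Data.Integer.Solver using (module +-*-Solver)
  open import Data.List.Base using (List; []; _∷_; length)
  open import Data.List.Membership.Propositional using (_∈_)
  import Data.List.Relation.Unary.All as ListAll
  open import Data.List.Relation.Unary.Unique.Propositional using (Unique)
  open import Data.Nat.Base as ℕ using (ℕ; suc; _<_)
  open import Data.Nat.Coprimality using (Coprime; coprime-divisor)
  open import Data.Nat.Divisibility using (_∣_; divides; ∣-antisym)
  open import Data.Nat.Primality using (Prime; euclidsLemma)
  import Data.Nat.Properties as ℕₚ
  open import Data.Product.Base using (Σ-syntax; _×_; _,_; proj₁; proj₂)
  open import Data.Rational using (ℚ; 0ℚ)
  open import Data.Sum.Base using ([_,_]′)
  open import Data.Vec.Base as Vec using (Vec; []; _∷_; lookup; there)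
  import Data.Vec.Properties as Vecₚ
  open import Data.Vec.Relation.Unary.All as All using (All)
  open import Function.Base using (_∘_)
  open import Relation.Binary.PropositionalEquality hiding (J; [_])
  open import Relation.Nullary using (¬_; contradiction)
  open Chebyshev
  open Vectors
  open Popular
  open Solutions
  open import Defs

  Solutions : ∀ {n} → Vec ℚ n → List ℕ → ℕ → Set
  Solutions {n} a S c = Σ[ xs ∈ List (Vec ℚ n) ] Unique xs ×
    ListAll.All (λ x → IsNonDegenerateSolution a x S) xs × c < length xs

  repackage : ∀ {n} {a : Vec ℚ n} {S l c} → c < l →
    Σ[ xs ∈ List (Vec ℚ n) ] Unique xs × ListAll.All (λ x → IsNonDegenerateSolution a x S) xs × length xs ≡ l →
    Solutions a S c
  repackage {c = c} c<l (xs , u , all , len) = xs , u , all , subst (c <_) (sym len) c<l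

  PrimesIn : List ℕ → ℕ → Set
  PrimesIn S m = ∀ r → Prime r → r ∣ m → r ∈ S

  primesIn-* : ∀ {S m n} → PrimesIn S m → PrimesIn S n → PrimesIn S (m ℕ.* n)
  primesIn-* {m = m} {n} hm hn r pr r∣ = [ hm r pr , hn r pr ]′ (euclidsLemma m n pr r∣)

  primesIn-ℤ* : ∀ {S} y z → PrimesIn S ℤ.∣ y ∣ → PrimesIn S ℤ.∣ z ∣ → PrimesIn S ℤ.∣ y ℤ.* z ∣
  primesIn-ℤ* {S} y z hy hz = subst (PrimesIn S) (sym (ℤₚ.abs-* y z)) (primesIn-* hy hz)

  primesIn-neg : ∀ {S} z → PrimesIn S ℤ.∣ z ∣ → PrimesIn S ℤ.∣ ℤ.- z ∣
  primesIn-neg {S} z = subst (PrimesIn S) (sym (ℤₚ.∣-i∣≡∣i∣ z))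

  lookup-ext : ∀ {A : Set} {d} {u v : Vec A d} → (∀ i → lookup u i ≡ lookup v i) → u ≡ v
  lookup-ext {u = []} {[]} h = refl
  lookup-ext {u = _ ∷ _} {_ ∷ _} h = cong₂ _∷_ (h zero) (lookup-ext (h ∘ suc))

  proportional⇒≡ : ∀ {d q q′} {y y′ : Vec ℤ (suc d)} → 0 < q →
    (∀ i → Coprime q ℤ.∣ lookup y i ∣) → (∀ i → Coprime q′ ℤ.∣ lookup y′ i ∣) →
    (∀ i → lookup y i ℤ.* + q′ ≡ lookup y′ i ℤ.* + q) → q ≡ q′ × y ≡ y′
  proportional⇒≡ {q = q} {q′} {y} {y′} 0<q cop cop′ eq = q≡q′ ,
    lookup-ext (λ i → ℤₚ.*-cancelʳ-≡ _ _ (+ q) {{ℕ.>-nonZero 0<q}} (trans (cong (λ q → lookup y i ℤ.* + q) q≡q′) (eq i)))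
    where
    abs-eq : ∀ i → ℤ.∣ lookup y i ∣ ℕ.* q′ ≡ ℤ.∣ lookup y′ i ∣ ℕ.* q
    abs-eq i = trans (sym (ℤₚ.abs-* (lookup y i) (+ q′))) (trans (cong ℤ.∣_∣ (eq i)) (ℤₚ.abs-* (lookup y′ i) (+ q)))
    q≡q′ : q ≡ q′
    q≡q′ = ∣-antisym (coprime-divisor (cop zero) (divides ℤ.∣ lookup y′ zero ∣ (abs-eq zero)))
                     (coprime-divisor (cop′ zero) (divides ℤ.∣ lookup y zero ∣ (sym (abs-eq zero))))

  ∀-lookup : ∀ {P : ℤ → Set} {d} {y : Vec ℤ d} → All P y → ∀ i → P (lookup y i)
  ∀-lookup (p All.∷ ps) zero = p
  ∀-lookup (p All.∷ ps) (suc i) = ∀-lookup ps i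

  Σ∈-scale : ∀ {d} k (T : Subset d) y → Σ∈ T (Vec.map (k ℤ.*_) y) ≡ k ℤ.* Σ∈ T y
  Σ∈-scale k [] [] = sym (ℤₚ.*-zeroʳ k)
  Σ∈-scale k (true ∷ T) (z ∷ y) = trans (cong (λ w → k ℤ.* z ℤ.+ w) (Σ∈-scale k T y)) (sym (ℤₚ.*-distribˡ-+ k z (Σ∈ T y)))
  Σ∈-scale k (false ∷ T) (z ∷ y) = trans (drop-zero (k ℤ.* z) T _) (trans (Σ∈-scale k T y) (cong (k ℤ.*_) (sym (drop-zero z T y))))

  nonempty-tail : ∀ {d} {T : Subset d} → Nonempty (false ∷ T) → Nonempty T
  nonempty-tail (suc i , there i∈) = i , i∈

  *-≢0ℤ : ∀ {a b} → a ≢ 0ℤ → b ≢ 0ℤ → a ℤ.* b ≢ 0ℤ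
  *-≢0ℤ {a} {b} a≢0 b≢0 eq = [ a≢0 , b≢0 ]′ (ℤₚ.i*j≡0⇒i≡0∨j≡0 a eq)

  1≢2* : ∀ k → 1 ≢ 2 ℕ.* k
  1≢2* (suc k) eq = contradiction (trans (ℕₚ.suc-injective eq) (ℕₚ.+-suc k (k ℕ.+ 0))) λ ()

  module _ (A : List ℕ) (j : ℕ) (S : List ℕ) (A-primes : ∀ {x} → x ∈ A → PrimesIn S x) where

    entry-primes : ∀ {y} → y ∈ vectors A (suc j) → ∀ i → PrimesIn S ℤ.∣ lookup y i ∣
    entry-primes y∈ = ∀-lookup (All.map A-primes (signedChoices-entries {J = suc j} y∈))

    entry-coprime : ∀ {q y} → (∀ {x} → x ∈ A → Coprime q x) → y ∈ vectors A (suc j) → ∀ i → Coprime q ℤ.∣ lookup y i ∣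
    entry-coprime cop y∈ = ∀-lookup (All.map (λ {z} z∈ {i} → cop z∈ {i}) (signedChoices-entries {J = suc j} y∈))

    module _ (𝒬 : List ℕ) (𝒬-primes : ∀ {q} → q ∈ 𝒬 → PrimesIn S q) (𝒬-pos : ∀ {q} → q ∈ 𝒬 → 0 < q)
      (coprime : ∀ {q x} → q ∈ 𝒬 → x ∈ A → Coprime q x)
      (m : ℤ) (m≢0 : m ≢ 0ℤ) (m-primes : PrimesIn S ℤ.∣ m ∣) (c : ℕ)
      (cs : List (ℕ × Vec ℤ (suc j ℕ.+ suc j))) (cs-unique : Unique cs) (c< : c < length cs)
      (cs⁻ : ∀ {q y} → (q , y) ∈ cs → q ∈ 𝒬 × y ∈ vectors A (suc j) × total y ≡ + q ℤ.* m × Nondegenerate y) where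

      cs-proportional : ∀ {q y q′ y′} → (q , y) ∈ cs → (q′ , y′) ∈ cs →
                        (∀ i → lookup y i ℤ.* + q′ ≡ lookup y′ i ℤ.* + q) → (q , y) ≡ (q′ , y′)
      cs-proportional p∈ p′∈ eq with cs⁻ p∈ | cs⁻ p′∈
      ... | q∈ , y∈ , _ | q′∈ , y′∈ , _ with proportional⇒≡ (𝒬-pos q∈)
          (entry-coprime (λ {x} → coprime q∈) y∈) (entry-coprime (λ {x} → coprime q′∈) y′∈) eq
      ...   | q≡ , y≡ = cong₂ _,_ q≡ y≡

      even-solutions : ∀ a → (∀ i → lookup a i ≢ 0ℚ) → (∀ i → IsSUnit S (lookup a i)) → Solutions a S c
      even-solutions a a≢0 aS = repackage {a = a} c< (realise a a≢0 S cs proj₂ cs-unique aS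
        (λ p∈ → let _ , _ , _ , nd = cs⁻ p∈ in nd)
        (λ p∈ → let _ , y∈ , _ = cs⁻ p∈ in entry-primes y∈)
        (λ {(q , y)} p∈ → let q∈ , _ , eq , _ = cs⁻ p∈ in
          subst (λ z → PrimesIn S ℤ.∣ z ∣) (sym eq) (primesIn-ℤ* (+ q) m (𝒬-primes q∈) m-primes))
        inj)
        where
        open +-*-Solver
        inj : ∀ {p p′} → p ∈ cs → p′ ∈ cs →
              (∀ i → lookup (proj₂ p) i ℤ.* total (proj₂ p′) ≡ lookup (proj₂ p′) i ℤ.* total (proj₂ p)) → p ≡ p′
        inj {q , y} {q′ , y′} p∈ p′∈ h with cs⁻ p∈ | cs⁻ p′∈
        ... | _ , _ , eq , _ | _ , _ , eq′ , _ = cs-proportional p∈ p′∈ λ i →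
          ℤₚ.*-cancelʳ-≡ _ _ m {{ℤ.≢-nonZero m≢0}} (begin
            lookup y i ℤ.* + q′ ℤ.* m ≡⟨ ℤₚ.*-assoc (lookup y i) (+ q′) m ⟩
            lookup y i ℤ.* (+ q′ ℤ.* m) ≡⟨ cong (lookup y i ℤ.*_) eq′ ⟨
            lookup y i ℤ.* total y′ ≡⟨ h i ⟩
            lookup y′ i ℤ.* total y ≡⟨ cong (lookup y′ i ℤ.*_) eq ⟩
            lookup y′ i ℤ.* (+ q ℤ.* m) ≡⟨ ℤₚ.*-assoc (lookup y′ i) (+ q) m ⟨
            lookup y′ i ℤ.* + q ℤ.* m ∎)
          where open ≡-Reasoning

      -- A solution (yᵢ) of Σ yᵢ = q m in an even number of unknowns is padded to one with one more unknown:
      -- for L = 2 |m| the terms L yᵢ and - q m sum to (L - 1) q m.  A vanishing subsum containing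
      -- - q m would make q even.
      padded-solutions : ∀ L′ → suc L′ ≡ 2 ℕ.* ℤ.∣ m ∣ → (∀ {q} → q ∈ 𝒬 → ¬ 2 ∣ q) →
        PrimesIn S (suc L′) → PrimesIn S L′ →
        ∀ a → (∀ i → lookup a i ≢ 0ℚ) → (∀ i → IsSUnit S (lookup a i)) → Solutions a S c
      padded-solutions L′ L≡ odd L-primes L′-primes a a≢0 aS = repackage {a = a} c< (realise a a≢0 S cs pad cs-unique aS
        nondegenerate entries totals inj)
        where
        open +-*-Solver
        L : ℤ
        L = + suc L′
        pad : ℕ × Vec ℤ (suc j ℕ.+ suc j) → Vec ℤ (suc (suc j ℕ.+ suc j))
        pad (q , y) = ℤ.- (+ q ℤ.* m) ∷ Vec.map (L ℤ.*_) y
        L′≢0 : + L′ ≢ 0ℤ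
        L′≢0 eq = 1≢2* ℤ.∣ m ∣ (trans (cong suc (sym (ℤₚ.+-injective eq))) L≡)
        nondegenerate : ∀ {p} → p ∈ cs → Nondegenerate (pad p)
        nondegenerate {q , y} p∈ (false ∷ T) ne eq with cs⁻ p∈
        ... | _ , _ , _ , nd = *-≢0ℤ {L} (λ ()) (nd T (nonempty-tail ne))
          (trans (sym (Σ∈-scale L T y)) (trans (sym (drop-zero (ℤ.- (+ q ℤ.* m)) T (Vec.map (L ℤ.*_) y))) eq))
        nondegenerate {q , y} p∈ (true ∷ T) ne eq with cs⁻ p∈
        ... | q∈ , _ = odd q∈ (divides ℤ.∣ Σ∈ T y ∣ (ℕₚ.*-cancelʳ-≡ q _ ℤ.∣ m ∣ {{ℤ.≢-nonZero m≢0}} (begin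
          q ℕ.* ℤ.∣ m ∣ ≡⟨ ℤₚ.abs-* (+ q) m ⟨
          ℤ.∣ + q ℤ.* m ∣ ≡⟨ cong ℤ.∣_∣ (ℤₚ.i-j≡0⇒i≡j (L ℤ.* Σ∈ T y) (+ q ℤ.* m)
            (trans (ℤₚ.+-comm (L ℤ.* Σ∈ T y) (ℤ.- (+ q ℤ.* m))) (trans (cong (λ z → ℤ.- (+ q ℤ.* m) ℤ.+ z) (sym (Σ∈-scale L T y))) eq))) ⟨
          ℤ.∣ L ℤ.* Σ∈ T y ∣ ≡⟨ ℤₚ.abs-* L (Σ∈ T y) ⟩
          suc L′ ℕ.* ℤ.∣ Σ∈ T y ∣ ≡⟨ cong (ℕ._* ℤ.∣ Σ∈ T y ∣) L≡ ⟩
          2 ℕ.* ℤ.∣ m ∣ ℕ.* ℤ.∣ Σ∈ T y ∣ ≡⟨ ℕₚ.*-comm (2 ℕ.* ℤ.∣ m ∣) ℤ.∣ Σ∈ T y ∣ ⟩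
          ℤ.∣ Σ∈ T y ∣ ℕ.* (2 ℕ.* ℤ.∣ m ∣) ≡⟨ ℕₚ.*-assoc ℤ.∣ Σ∈ T y ∣ 2 ℤ.∣ m ∣ ⟨
          ℤ.∣ Σ∈ T y ∣ ℕ.* 2 ℕ.* ℤ.∣ m ∣ ∎)))
          where open ≡-Reasoning
        total-pad : ∀ {q y} → (q , y) ∈ cs → total (pad (q , y)) ≡ + L′ ℤ.* (+ q ℤ.* m)
        total-pad {q} {y} p∈ with cs⁻ p∈
        ... | _ , _ , eq , _ = begin
          ℤ.- (+ q ℤ.* m) ℤ.+ total (Vec.map (L ℤ.*_) y) ≡⟨ cong (λ z → ℤ.- (+ q ℤ.* m) ℤ.+ z) (trans (Σ∈-scale L ⊤ y) (cong (L ℤ.*_) eq)) ⟩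
          ℤ.- (+ q ℤ.* m) ℤ.+ L ℤ.* (+ q ℤ.* m) ≡⟨ solve 2 (λ l z → (:- z) :+ (con (+ 1) :+ l) :* z := l :* z) refl (+ L′) (+ q ℤ.* m) ⟩
          + L′ ℤ.* (+ q ℤ.* m) ∎
          where open ≡-Reasoning
        qm-primes : ∀ {q y} → (q , y) ∈ cs → PrimesIn S ℤ.∣ + q ℤ.* m ∣
        qm-primes {q} p∈ = primesIn-ℤ* (+ q) m (𝒬-primes (proj₁ (cs⁻ p∈))) m-primes
        entries : ∀ {p} → p ∈ cs → ∀ i → PrimesIn S ℤ.∣ lookup (pad p) i ∣
        entries {q , y} p∈ zero = primesIn-neg (+ q ℤ.* m) (qm-primes p∈)
        entries {q , y} p∈ (suc i) = subst (λ z → PrimesIn S ℤ.∣ z ∣) (sym (Vecₚ.lookup-map i (L ℤ.*_) y))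
          (primesIn-ℤ* L (lookup y i) L-primes (entry-primes (proj₁ (proj₂ (cs⁻ p∈))) i))
        totals : ∀ {p} → p ∈ cs → PrimesIn S ℤ.∣ total (pad p) ∣
        totals {q , y} p∈ = subst (λ z → PrimesIn S ℤ.∣ z ∣) (sym (total-pad p∈)) (primesIn-ℤ* (+ L′) (+ q ℤ.* m) L′-primes (qm-primes p∈))
        inj : ∀ {p p′} → p ∈ cs → p′ ∈ cs →
              (∀ i → lookup (pad p) i ℤ.* total (pad p′) ≡ lookup (pad p′) i ℤ.* total (pad p)) → p ≡ p′
        inj {q , y} {q′ , y′} p∈ p′∈ h = cs-proportional p∈ p′∈ λ i →
          ℤₚ.*-cancelʳ-≡ _ _ (L ℤ.* (+ L′ ℤ.* m)) {{ℤ.≢-nonZero (*-≢0ℤ {L} (λ ()) (*-≢0ℤ L′≢0 m≢0))}}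
            (trans (side y q′ i (total-pad p′∈)) (trans (h (suc i)) (sym (side y′ q i (total-pad p∈)))))
          where
          side : ∀ {t} (y : Vec ℤ (suc j ℕ.+ suc j)) q i → t ≡ + L′ ℤ.* (+ q ℤ.* m) →
                 lookup y i ℤ.* + q ℤ.* (L ℤ.* (+ L′ ℤ.* m)) ≡ lookup (Vec.map (L ℤ.*_) y) i ℤ.* t
          side y q i refl = trans
            (solve 5 (λ a q l k m → a :* q :* (l :* (k :* m)) := (l :* a) :* (k :* (q :* m))) refl (lookup y i) (+ q) L (+ L′) m)
            (cong (ℤ._* (+ L′ ℤ.* (+ q ℤ.* m))) (sym (Vecₚ.lookup-map i (L ℤ.*_) y)))

    module _ (𝒬₁ : List ℕ) (𝒬₂ : List ℕ) (𝒬₁-primes : ∀ {q} → q ∈ 𝒬₁ → PrimesIn S q)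
      (𝒬₂-primes : ∀ {q} → q ∈ 𝒬₂ → PrimesIn S q) (𝒬₂-pos : ∀ {q} → q ∈ 𝒬₂ → 0 < q)
      (coprime : ∀ {q x} → q ∈ 𝒬₂ → x ∈ A → Coprime q x)
      (m₁ : ℤ) (m₂ : ℤ) (m₁-primes : PrimesIn S ℤ.∣ m₁ ∣) (m₂-primes : PrimesIn S ℤ.∣ m₂ ∣) (c : ℕ)
      (cs : List ((ℕ × ℕ) × Vec ℤ (suc j ℕ.+ suc j))) (cs-unique : Unique cs) (c< : c < length cs)
      (cs⁻ : ∀ {q₁ q₂ y} → ((q₁ , q₂) , y) ∈ cs → q₁ ∈ 𝒬₁ × q₂ ∈ 𝒬₂ × y ∈ vectors A (suc j) ×
        total y ≡ + q₁ ℤ.* m₁ ℤ.+ + q₂ ℤ.* m₂ × Nondegenerate y × (∀ T → Σ∈ T y ≢ + q₁ ℤ.* m₁)) where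

      odd-solutions : ∀ a → (∀ i → lookup a i ≢ 0ℚ) → (∀ i → IsSUnit S (lookup a i)) → Solutions a S c
      odd-solutions a a≢0 aS = repackage {a = a} c< (realise a a≢0 S cs extend cs-unique aS nondegenerate entries totals inj)
        where
        open +-*-Solver
        extend : (ℕ × ℕ) × Vec ℤ (suc j ℕ.+ suc j) → Vec ℤ (suc (suc j ℕ.+ suc j))
        extend ((q₁ , _) , y) = ℤ.- (+ q₁ ℤ.* m₁) ∷ y
        nondegenerate : ∀ {p} → p ∈ cs → Nondegenerate (extend p)
        nondegenerate {(q₁ , q₂) , y} p∈ (false ∷ T) ne eq with cs⁻ p∈
        ... | _ , _ , _ , _ , nd , _ = nd T (nonempty-tail ne) (trans (sym (drop-zero (ℤ.- (+ q₁ ℤ.* m₁)) T y)) eq)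
        nondegenerate {(q₁ , q₂) , y} p∈ (true ∷ T) ne eq with cs⁻ p∈
        ... | _ , _ , _ , _ , _ , ub = ub T (ℤₚ.i-j≡0⇒i≡j (Σ∈ T y) (+ q₁ ℤ.* m₁)
          (trans (ℤₚ.+-comm (Σ∈ T y) (ℤ.- (+ q₁ ℤ.* m₁))) eq))
        total-extend : ∀ {q₁ q₂ y} → ((q₁ , q₂) , y) ∈ cs → total (extend ((q₁ , q₂) , y)) ≡ + q₂ ℤ.* m₂
        total-extend {q₁} {q₂} p∈ with cs⁻ p∈
        ... | _ , _ , _ , eq , _ = trans (cong (λ z → ℤ.- (+ q₁ ℤ.* m₁) ℤ.+ z) eq)
          (solve 2 (λ a b → (:- a) :+ (a :+ b) := b) refl (+ q₁ ℤ.* m₁) (+ q₂ ℤ.* m₂))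
        entries : ∀ {p} → p ∈ cs → ∀ i → PrimesIn S ℤ.∣ lookup (extend p) i ∣
        entries {(q₁ , q₂) , y} p∈ zero = primesIn-neg (+ q₁ ℤ.* m₁) (primesIn-ℤ* (+ q₁) m₁ (𝒬₁-primes (proj₁ (cs⁻ p∈))) m₁-primes)
        entries {(q₁ , q₂) , y} p∈ (suc i) = let _ , _ , y∈ , _ = cs⁻ p∈ in entry-primes y∈ i
        totals : ∀ {p} → p ∈ cs → PrimesIn S ℤ.∣ total (extend p) ∣
        totals {(q₁ , q₂) , y} p∈ = subst (λ z → PrimesIn S ℤ.∣ z ∣) (sym (total-extend p∈))
          (primesIn-ℤ* (+ q₂) m₂ (𝒬₂-primes (proj₁ (proj₂ (cs⁻ p∈)))) m₂-primes)
        inj : ∀ {p p′} → p ∈ cs → p′ ∈ cs →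
              (∀ i → lookup (extend p) i ℤ.* total (extend p′) ≡ lookup (extend p′) i ℤ.* total (extend p)) → p ≡ p′
        inj {(q₁ , q₂) , y} {(q₁′ , q₂′) , y′} p∈ p′∈ h with cs⁻ p∈ | cs⁻ p′∈
        ... | q₁∈ , q₂∈ , y∈ , eq , nd , ub | q₁′∈ , q₂′∈ , y′∈ , eq′ , nd′ , ub′
          with proportional⇒≡ {q = q₂} {q₂′} {y} {y′} (𝒬₂-pos q₂∈) (entry-coprime (λ {x} → coprime q₂∈) y∈) (entry-coprime (λ {x} → coprime q₂′∈) y′∈)
            (λ i → ℤₚ.*-cancelʳ-≡ _ _ m₂ {{ℤ.≢-nonZero m₂≢0}} (begin
              lookup y i ℤ.* + q₂′ ℤ.* m₂ ≡⟨ ℤₚ.*-assoc (lookup y i) (+ q₂′) m₂ ⟩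
              lookup y i ℤ.* (+ q₂′ ℤ.* m₂) ≡⟨ cong (lookup y i ℤ.*_) (total-extend p′∈) ⟨
              lookup y i ℤ.* total (extend ((q₁′ , q₂′) , y′)) ≡⟨ h (suc i) ⟩
              lookup y′ i ℤ.* total (extend ((q₁ , q₂) , y)) ≡⟨ cong (lookup y′ i ℤ.*_) (total-extend p∈) ⟩
              lookup y′ i ℤ.* (+ q₂ ℤ.* m₂) ≡⟨ ℤₚ.*-assoc (lookup y′ i) (+ q₂) m₂ ⟨
              lookup y′ i ℤ.* + q₂ ℤ.* m₂ ∎))
          where
          open ≡-Reasoning
          m₂≢0 : m₂ ≢ 0ℤ
          m₂≢0 refl = total≢0 (nondegenerate p∈) (trans (total-extend p∈) (ℤₚ.*-zeroʳ (+ q₂)))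
        ...   | refl , refl = cong (λ q₁ → (q₁ , q₂) , y) (ℤₚ.+-injective (ℤₚ.*-cancelʳ-≡ (+ q₁) (+ q₁′) m₁ {{ℤ.≢-nonZero m₁≢0}}
            (ℤₚ.neg-injective (ℤₚ.*-cancelʳ-≡ _ _ (+ q₂ ℤ.* m₂)
              {{ℤ.≢-nonZero (λ z → total≢0 (nondegenerate p∈) (trans (total-extend p∈) z))}}
              (trans (cong (ℤ.- (+ q₁ ℤ.* m₁) ℤ.*_) (sym (total-extend p′∈))) (trans (h zero) (cong (ℤ.- (+ q₁′ ℤ.* m₁) ℤ.*_) (total-extend p∈))))))))
          where
          m₁≢0 : m₁ ≢ 0ℤ
          m₁≢0 refl = ub ⊥ (trans (Σ∈-⊥ y) (sym (ℤₚ.*-zeroʳ (+ q₁))))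

module SmoothSets where

  open import Data.List.Base using (List; []; _∷_; _++_; length; map; filter; concat)
  open import Data.List.Membership.Propositional using (_∈_; _∉_)
  open import Data.List.Membership.Propositional.Properties
  open import Data.List.Properties using (length-++; ++-assoc)
  open import Data.List.Relation.Unary.All as All using (All; []; _∷_)
  import Data.List.Relation.Unary.All.Properties as AllP
  open import Data.List.Relation.Unary.Unique.Propositional using (Unique)
  open import Data.Nat.Base
  open import Data.Nat.Coprimality using (Coprime)
  open import Data.Nat.Divisibility
  open import Data.Nat.Primality
  open import Data.Nat.Properties
  open import Data.Nat.Solver using (module +-*-Solver)
  open import Data.Product.Base using (_×_; _,_; ∃-syntax)
  open import Relation.Binary.PropositionalEquality
  open Counting
  open Chebyshev
  open Smooth

  record SmoothSet (P : List ℕ) (b k lo hi : ℕ) : Set where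
    field
      elements : List ℕ
      unique   : Unique elements
      size     : length elements ≡ b ^ k
      upper    : ∀ {x} → x ∈ elements → x ≤ hi ^ k
      lower    : ∀ {x} → x ∈ elements → lo ^ k ≤ x
      primes   : ∀ {x} → x ∈ elements → ∀ r → Prime r → r ∣ x → r ∈ P
      divisors : ∀ {D} → 0 < D → ∃[ w ] lo ^ w ≤ D × length (filter (_∣? D) elements) ≤ 2 ^ w

    positive : 0 < lo → ∀ {x} → x ∈ elements → 0 < x
    positive 0<lo x∈ = <-≤-trans (m^n>0 lo {{>-nonZero 0<lo}} k) (lower x∈)

  smoothSet : ∀ b lo hi (Bs : List (List ℕ)) → All Prime (concat Bs) → Unique (concat Bs) → All (lo ≤_) (concat Bs) →
              All (_≤ hi) (concat Bs) → All (λ B → length B ≡ b) Bs → SmoothSet (concat Bs) b (length Bs) lo hi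
  smoothSet b lo hi Bs pr u lo≤ ≤hi len = record
    { elements = smooth Bs
    ; unique   = smooth-unique Bs pr u
    ; size     = length-smooth b Bs len
    ; upper    = smooth-≤ hi Bs ≤hi
    ; lower    = smooth-≥ lo Bs lo≤
    ; primes   = λ x∈ r → smooth-prime Bs pr x∈
    ; divisors = λ {D} 0<D → length (filter (_∣? D) (concat Bs)) , few-prime-divisors D 0<D pr u lo≤ , smooth-divisors D Bs pr u
    }

  length-concat : ∀ b (Bs : List (List ℕ)) → All (λ B → length B ≡ b) Bs → length (concat Bs) ≡ length Bs * b
  length-concat b [] [] = refl
  length-concat b (B ∷ Bs) (h ∷ hs) = trans (length-++ B) (cong₂ _+_ h (length-concat b Bs hs))

  coprime-smooth : ∀ {P P′ b b′ k k′ lo lo′ hi hi′} (X : SmoothSet P b k lo hi) (Y : SmoothSet P′ b′ k′ lo′ hi′) → 0 < lo →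
                   (∀ {r} → r ∈ P → r ∉ P′) →
                   ∀ {x y} → x ∈ SmoothSet.elements X → y ∈ SmoothSet.elements Y → Coprime y x
  coprime-smooth X Y 0<lo disj x∈ y∈ = no-common-prime⇒coprime (SmoothSet.positive X 0<lo x∈)
    (λ r pr r∣y r∣x → disj (SmoothSet.primes X x∈ r pr r∣x) (SmoothSet.primes Y y∈ r pr r∣y))

  record ThreeSmoothSets (b k l lo hi : ℕ) : Set where
    field
      P₀ P₁ P₂ : List ℕ
      all-unique : Unique (P₀ ++ P₁ ++ P₂)
      all-prime  : All Prime (P₀ ++ P₁ ++ P₂)
      all-large  : All (lo <_) (P₀ ++ P₁ ++ P₂)
      all-length : length (P₀ ++ P₁ ++ P₂) ≡ (k + l + l) * b
      X : SmoothSet P₀ b k lo hi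
      Q₁ : SmoothSet P₁ b l lo hi
      Q₂ : SmoothSet P₂ b l lo hi

  split₃ : ∀ k l b → k * b + l * b + l * b ≡ (k + l + l) * b
  split₃ = solve 3 (λ k l b → k :* b :+ l :* b :+ l :* b := (k :+ l :+ l) :* b) refl
    where open +-*-Solver

  threeSmoothSets : ∀ b k l lo hi (ps : List ℕ) → Unique ps → All Prime ps → All (lo <_) ps → All (_≤ hi) ps →
                    (k + l + l) * b ≤ length ps → ThreeSmoothSets b k l lo hi
  threeSmoothSets b k l lo hi ps u pr large small enough
    with Bs₀ , rest₀ , refl , len₀ , refl , eq₀ ← chunks b k ps (≤-trans (*-monoˡ-≤ b (≤-trans (m≤m+n k l) (m≤m+n (k + l) l))) enough)
    with Bs₁ , rest₁ , refl , len₁ , refl , eq₁ ← chunks b l rest₀ (+-cancelˡ-≤ (k * b) _ _ (≤-trans (≤-trans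
          (≤-reflexive (sym (*-distribʳ-+ b k l))) (*-monoˡ-≤ b (m≤m+n (k + l) l))) (subst ((k + l + l) * b ≤_) eq₀ enough)))
    with Bs₂ , rest₂ , lenBs₂ , len₂ , refl , eq₂ ← chunks b l rest₁ (+-cancelˡ-≤ (k * b + l * b) _ _ (≤-trans
          (≤-reflexive (split₃ k l b))
          (subst ((k + l + l) * b ≤_) (trans eq₀ (trans (cong (k * b +_) eq₁) (sym (+-assoc (k * b) (l * b) _)))) enough)))
    = record
      { P₀ = P₀ ; P₁ = P₁ ; P₂ = P₂
      ; all-unique = unique-++ˡ (P₀ ++ P₁ ++ P₂) (subst Unique assoc u)
      ; all-prime  = AllP.++⁻ˡ (P₀ ++ P₁ ++ P₂) (subst (All Prime) assoc pr)
      ; all-large  = AllP.++⁻ˡ (P₀ ++ P₁ ++ P₂) (subst (All (lo <_)) assoc large)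
      ; all-length = begin
          length (P₀ ++ P₁ ++ P₂) ≡⟨ trans (length-++ P₀) (cong (length P₀ +_) (length-++ P₁)) ⟩
          length P₀ + (length P₁ + length P₂) ≡⟨ cong₂ _+_ (length-concat b Bs₀ len₀) (cong₂ _+_ (length-concat b Bs₁ len₁)
              (trans (length-concat b Bs₂ len₂) (cong (_* b) lenBs₂))) ⟩
          k * b + (l * b + l * b) ≡⟨ trans (sym (+-assoc (k * b) (l * b) (l * b))) (split₃ k l b) ⟩
          (k + l + l) * b ∎
      ; X  = smoothSet b lo hi Bs₀ (AllP.++⁻ˡ P₀ pr) (unique-++ˡ P₀ u)
               (All.map <⇒≤ (AllP.++⁻ˡ P₀ large)) (AllP.++⁻ˡ P₀ small) len₀
      ; Q₁ = smoothSet b lo hi Bs₁ (AllP.++⁻ˡ P₁ (AllP.++⁻ʳ P₀ pr)) (unique-++ˡ P₁ (unique-++ʳ P₀ u))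
               (All.map <⇒≤ (AllP.++⁻ˡ P₁ (AllP.++⁻ʳ P₀ large))) (AllP.++⁻ˡ P₁ (AllP.++⁻ʳ P₀ small)) len₁
      ; Q₂ = subst (λ l → SmoothSet P₂ b l lo hi) lenBs₂ (smoothSet b lo hi Bs₂
               (AllP.++⁻ˡ P₂ (AllP.++⁻ʳ P₁ (AllP.++⁻ʳ P₀ pr))) (unique-++ˡ P₂ (unique-++ʳ P₁ (unique-++ʳ P₀ u)))
               (All.map <⇒≤ (AllP.++⁻ˡ P₂ (AllP.++⁻ʳ P₁ (AllP.++⁻ʳ P₀ large)))) (AllP.++⁻ˡ P₂ (AllP.++⁻ʳ P₁ (AllP.++⁻ʳ P₀ small))) len₂)
      }
    where
    open ≡-Reasoning
    P₀ = concat Bs₀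
    P₁ = concat Bs₁
    P₂ = concat Bs₂
    assoc : P₀ ++ P₁ ++ P₂ ++ rest₂ ≡ (P₀ ++ P₁ ++ P₂) ++ rest₂
    assoc = trans (cong (P₀ ++_) (sym (++-assoc P₁ P₂ rest₂))) (sym (++-assoc P₀ (P₁ ++ P₂) rest₂))

module Exponents where

  open import Data.Nat.Base
  open import Data.Nat.Properties
  open import Data.Nat.Solver using (module +-*-Solver)
  open import Relation.Binary.PropositionalEquality

  open +-*-Solver

  by-slack : ∀ {x s y} → x + s ≡ y → x ≤ y
  by-slack {x} {s} eq = ≤-trans (m≤m+n x s) (≤-reflexive eq)

  B : ℕ → ℕ
  B n = 4 + 3 * n

  a : ℕ → ℕ
  a n = 1 + n * B n

  A : ℕ → ℕ
  A n = suc (a n)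

  k : ℕ → ℕ → ℕ
  k n r = (A n + A n) * suc r

  -- lᵉ = 2 B (r + 1) - 1 and lᵒ = (A + B) (r + 1) - 1, while kᵒ = k - lᵒ
  lᵉ : ℕ → ℕ → ℕ
  lᵉ n r = (B n + B n) * r + (B n + (3 + 3 * n))

  lᵒ : ℕ → ℕ → ℕ
  lᵒ n r = (A n + B n) * r + (A n + (3 + 3 * n))

  kᵒ : ℕ → ℕ → ℕ
  kᵒ n r = (2 + pred n * B n) * r + (3 + pred n * B n)

  private

    B̂ â Â : ∀ {v} → Polynomial v → Polynomial v
    B̂ n = con 4 :+ con 3 :* n
    â n = con 1 :+ n :* B̂ n
    Â n = con 1 :+ â n

    k̂ l̂ᵉ l̂ᵒ : ∀ {v} → Polynomial v → Polynomial v → Polynomial v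
    k̂ n r = (Â n :+ Â n) :* (con 1 :+ r)
    l̂ᵉ n r = (B̂ n :+ B̂ n) :* r :+ (B̂ n :+ (con 3 :+ con 3 :* n))
    l̂ᵒ n r = (Â n :+ B̂ n) :* r :+ (Â n :+ (con 3 :+ con 3 :* n))

    k̂ᵒ : ∀ {v} → Polynomial v → Polynomial v → Polynomial v
    k̂ᵒ n r = (con 2 :+ (con 2 :+ n) :* B̂ (con 3 :+ n)) :* r :+ (con 3 :+ (con 2 :+ n) :* B̂ (con 3 :+ n))

  even-collision : ∀ n r → A (2 + n) * lᵉ (2 + n) r + A (2 + n) ≡ B (2 + n) * k (2 + n) r
  even-collision = solve 2 (λ n r → Â (con 2 :+ n) :* l̂ᵉ (con 2 :+ n) r :+ Â (con 2 :+ n) := B̂ (con 2 :+ n) :* k̂ (con 2 :+ n) r) refl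

  even-gain : ∀ n r → 1 + lᵉ (2 + n) r + 3 * k (2 + n) r ≤ B (2 + n) * lᵉ (2 + n) r
  even-gain n r = by-slack (solve 2 (λ n r →
        con 1 :+ l̂ᵉ (con 2 :+ n) r :+ con 3 :* k̂ (con 2 :+ n) r
        :+ (con 38 :+ con 15 :* n :+ con 48 :* r :+ con 18 :* n :* r)
        := B̂ (con 2 :+ n) :* l̂ᵉ (con 2 :+ n) r)
      refl n r)

  even-l≤k : ∀ n r → lᵉ (2 + n) r ≤ k (2 + n) r
  even-l≤k n r = by-slack (solve 2 (λ n r →
        l̂ᵉ (con 2 :+ n) r
        :+ (con 25 :+ con 26 :* n :+ con 6 :* n :* n :+ con 24 :* r :+ con 26 :* n :* r :+ con 6 :* n :* n :* r)
        := k̂ (con 2 :+ n) r)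
      refl n r)

  odd-k : ∀ n r → k (3 + n) r ≡ lᵒ (3 + n) r + kᵒ (3 + n) r
  odd-k = solve 2 (λ n r → k̂ (con 3 :+ n) r := l̂ᵒ (con 3 :+ n) r :+ k̂ᵒ n r) refl

  odd-collision : ∀ n r → A (3 + n) * k (3 + n) r + 2 * A (3 + n) ≡ B (3 + n) * k (3 + n) r + 2 * (A (3 + n) * kᵒ (3 + n) r)
  odd-collision = solve 2 (λ n r →
        Â (con 3 :+ n) :* k̂ (con 3 :+ n) r :+ con 2 :* Â (con 3 :+ n)
        := B̂ (con 3 :+ n) :* k̂ (con 3 :+ n) r :+ con 2 :* (Â (con 3 :+ n) :* k̂ᵒ n r)) refl

  odd-gain : ∀ n r → (B (3 + n) + 3) * k (3 + n) r + 1 ≤ 2 * (B (3 + n) * lᵒ (3 + n) r)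
  odd-gain n r = by-slack (solve 2 (λ n r →
        (B̂ (con 3 :+ n) :+ con 3) :* k̂ (con 3 :+ n) r :+ con 1
        :+ (con 65 :+ con 18 :* n :+ con 92 :* r :+ con 24 :* n :* r)
        := con 2 :* (B̂ (con 3 :+ n) :* l̂ᵒ (con 3 :+ n) r))
      refl n r)

  odd-divisors : ∀ n r → 1 + (2 + n) + A (3 + n) * k (3 + n) r + k (3 + n) r ≤ 2 * (B (3 + n) * lᵒ (3 + n) r) + 2 * (A (3 + n) * kᵒ (3 + n) r)
  odd-divisors n r = by-slack (solve 2 (λ n r →
        con 1 :+ (con 2 :+ n) :+ Â (con 3 :+ n) :* k̂ (con 3 :+ n) r :+ k̂ (con 3 :+ n) r
        :+ (con 309 :+ con 149 :* n :+ con 18 :* n :* n :+ con 256 :* r :+ con 112 :* n :* r :+ con 12 :* n :* n :* r)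
        := con 2 :* (B̂ (con 3 :+ n) :* l̂ᵒ (con 3 :+ n) r) :+ con 2 :* (Â (con 3 :+ n) :* k̂ᵒ n r))
      refl n r)

  odd-zero : ∀ n r → 1 + (2 + n) + 2 * (A (3 + n) * k (3 + n) r) + k (3 + n) r ≤ B (3 + n) * lᵒ (3 + n) r + B (3 + n) * k (3 + n) r * (2 + n) + 2 * (A (3 + n) * kᵒ (3 + n) r) + a (3 + n) * lᵒ (3 + n) r
  odd-zero n r = by-slack (solve 2 (λ n r →
        con 1 :+ (con 2 :+ n) :+ con 2 :* (Â (con 3 :+ n) :* k̂ (con 3 :+ n) r) :+ k̂ (con 3 :+ n) r
        :+ (con 510 :+ con 925 :* n :+ con 511 :* n :* n :+ con 114 :* n :* n :* n :+ con 9 :* n :* n :* n :* n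
            :+ con 484 :* r :+ con 907 :* n :* r :+ con 508 :* n :* n :* r :+ con 114 :* n :* n :* n :* r :+ con 9 :* n :* n :* n :* n :* r)
        := B̂ (con 3 :+ n) :* l̂ᵒ (con 3 :+ n) r :+ B̂ (con 3 :+ n) :* k̂ (con 3 :+ n) r :* (con 2 :+ n) :+ con 2 :* (Â (con 3 :+ n) :* k̂ᵒ n r) :+ â (con 3 :+ n) :* l̂ᵒ (con 3 :+ n) r)
      refl n r)

  odd-shift : ∀ n r → A (3 + n) * kᵒ (3 + n) r ≤ a (3 + n) * lᵒ (3 + n) r
  odd-shift n r = by-slack (solve 2 (λ n r →
        Â (con 3 :+ n) :* k̂ᵒ n r
        :+ (con 931 :+ con 749 :* n :+ con 201 :* n :* n :+ con 18 :* n :* n :* n :+ con 1012 :* r :+ con 793 :* n :* r :+ con 207 :* n :* n :* r :+ con 18 :* n :* n :* n :* r)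
        := â (con 3 :+ n) :* l̂ᵒ (con 3 :+ n) r)
      refl n r)

module Counts where

  open import Data.Integer.Base as ℤ using (ℤ; 0ℤ)
  open import Data.List.Base using (List; []; _∷_; length; map; filter)
  open import Data.List.Membership.Propositional using (_∈_)
  open import Data.List.Relation.Unary.Unique.Propositional using (Unique)
  open import Data.Nat.Base
  open import Data.Nat.Divisibility using (_∣_; _∣?_)
  open import Data.Nat.Properties
  open import Data.Nat.Solver using (module +-*-Solver)
  open import Data.Product.Base using (Σ-syntax; _×_; _,_; ∃-syntax; proj₁; proj₂)
  open import Data.Sum.Base using (_⊎_; inj₁; inj₂)
  open import Data.Nat.Coprimality using (Coprime)
  open import Data.Vec.Base as Vec using (Vec; []; _∷_; replicate)
  open import Data.Vec.Relation.Binary.Pointwise.Inductive using (Pointwise; []; _∷_)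
  open import Data.Vec.Relation.Unary.All as All using (All)
  import Data.Integer.Properties as ℤₚ
  open import Relation.Binary.PropositionalEquality hiding (J)
  open import Relation.Nullary using (Dec; yes; no)
  open Counting
  open Chebyshev
  open Vectors
  open Popular
  open SmoothSets
  open TwoModuli

  open +-*-Solver

  2^-mono : ∀ {m n} → m ≤ n → 2 ^ m ≤ 2 ^ n
  2^-mono = ^-monoʳ-≤ 2

  2^-* : ∀ m n → 2 ^ m * 2 ^ n ≡ 2 ^ (m + n)
  2^-* m n = sym (^-distribˡ-+-* 2 m n)

  2^-^ : ∀ {x m} n → x ≡ 2 ^ m → x ^ n ≡ 2 ^ (m * n)
  2^-^ {m = m} n refl = ^-*-assoc 2 m n

  two-terms : ∀ {x y G} q s t E → x ≤ 2 ^ s → y ≤ 2 ^ t → q + s + 2 ≤ E → q + t + 2 ≤ E →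
              2 ^ E ≤ 2 ^ q * G → x + y < G
  two-terms {x} {y} {G} q s t E x≤ y≤ hs ht h = *-cancelˡ-< (2 ^ q * 4) (x + y) G (begin-strict
    2 ^ q * 4 * (x + y) ≡⟨ solve 3 (λ q x y → q :* con 4 :* (x :+ y) := q :* x :* con 4 :+ q :* y :* con 4) refl (2 ^ q) x y ⟩
    2 ^ q * x * 4 + 2 ^ q * y * 4 ≤⟨ +-mono-≤ (term s x≤ hs) (term t y≤ ht) ⟩
    2 ^ E + 2 ^ E <⟨ +-monoʳ-< (2 ^ E) (m<m+n (2 ^ E) (≤-trans (m^n>0 2 E) (m≤m+n (2 ^ E) (2 ^ E)))) ⟩
    2 ^ E + (2 ^ E + (2 ^ E + 2 ^ E)) ≡⟨ solve 1 (λ e → e :+ (e :+ (e :+ e)) := e :* con 4) refl (2 ^ E) ⟩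
    2 ^ E * 4 ≤⟨ *-monoˡ-≤ 4 h ⟩
    2 ^ q * G * 4 ≡⟨ solve 2 (λ q g → q :* g :* con 4 := q :* con 4 :* g) refl (2 ^ q) G ⟩
    2 ^ q * 4 * G ∎)
    where
    open ≤-Reasoning
    term : ∀ {x} s → x ≤ 2 ^ s → q + s + 2 ≤ E → 2 ^ q * x * 4 ≤ 2 ^ E
    term s x≤ hs = ≤-trans (*-monoˡ-≤ 4 (*-monoʳ-≤ (2 ^ q) x≤))
      (≤-trans (≤-reflexive (trans (cong (_* 4) (2^-* q s)) (2^-* (q + s) 2))) (2^-mono hs))

  four-terms : ∀ {x y z w G} q s t u v E → x ≤ 2 ^ s → y ≤ 2 ^ t → z ≤ 2 ^ u → w ≤ 2 ^ v →
               q + s + 3 ≤ E → q + t + 3 ≤ E → q + u + 3 ≤ E → q + v + 3 ≤ E →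
               2 ^ E ≤ 2 ^ q * G → x + (y + (z + w)) < G
  four-terms {x} {y} {z} {w} {G} q s t u v E x≤ y≤ z≤ w≤ hs ht hu hv h = *-cancelˡ-< (2 ^ q * 8) _ G (begin-strict
    2 ^ q * 8 * (x + (y + (z + w)))
      ≡⟨ solve 5 (λ q x y z w → q :* con 8 :* (x :+ (y :+ (z :+ w))) := (q :* x :* con 8 :+ q :* y :* con 8) :+ (q :* z :* con 8 :+ q :* w :* con 8)) refl (2 ^ q) x y z w ⟩
    (2 ^ q * x * 8 + 2 ^ q * y * 8) + (2 ^ q * z * 8 + 2 ^ q * w * 8)
      ≤⟨ +-mono-≤ (+-mono-≤ (term s x≤ hs) (term t y≤ ht)) (+-mono-≤ (term u z≤ hu) (term v w≤ hv)) ⟩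
    (2 ^ E + 2 ^ E) + (2 ^ E + 2 ^ E) <⟨ m<m+n _ (≤-trans (m^n>0 2 E) (m≤m+n (2 ^ E) _)) ⟩
    ((2 ^ E + 2 ^ E) + (2 ^ E + 2 ^ E)) + (2 ^ E + (2 ^ E + (2 ^ E + 2 ^ E)))
      ≡⟨ solve 1 (λ e → ((e :+ e) :+ (e :+ e)) :+ (e :+ (e :+ (e :+ e))) := e :* con 8) refl (2 ^ E) ⟩
    2 ^ E * 8 ≤⟨ *-monoˡ-≤ 8 h ⟩
    2 ^ q * G * 8 ≡⟨ solve 2 (λ q g → q :* g :* con 8 := q :* con 8 :* g) refl (2 ^ q) G ⟩
    2 ^ q * 8 * G ∎)
    where
    open ≤-Reasoning
    term : ∀ {x} s → x ≤ 2 ^ s → q + s + 3 ≤ E → 2 ^ q * x * 8 ≤ 2 ^ E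
    term s x≤ hs = ≤-trans (*-monoˡ-≤ 8 (*-monoʳ-≤ (2 ^ q) x≤))
      (≤-trans (≤-reflexive (trans (cong (_* 8) (2^-* q s)) (2^-* (q + s) 3))) (2^-mono hs))

  odd-≤ : ∀ H → suc (2 ^ H) + 2 ^ H ≤ 2 ^ (H + 2)
  odd-≤ H = begin
    suc (2 ^ H) + 2 ^ H ≤⟨ +-monoˡ-≤ (2 ^ H) (+-monoˡ-≤ (2 ^ H) (m^n>0 2 H)) ⟩
    2 ^ H + 2 ^ H + 2 ^ H ≤⟨ m≤m+n _ (2 ^ H) ⟩
    2 ^ H + 2 ^ H + 2 ^ H + 2 ^ H ≡⟨ solve 1 (λ e → e :+ e :+ e :+ e := e :* con 4) refl (2 ^ H) ⟩
    2 ^ H * 4 ≡⟨ 2^-* H 2 ⟩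
    2 ^ (H + 2) ∎
    where open ≤-Reasoning

  PopularQuotient : List ℕ → List ℕ → ℕ → ℕ → ℕ → Set
  PopularQuotient A 𝒬 j H c = Σ[ m ∈ ℤ ] m ≢ 0ℤ × ℤ.∣ m ∣ ≤ H ×
    (Σ[ cs ∈ List (ℕ × Vec ℤ (suc j + suc j)) ] Unique cs × c < length cs ×
      (∀ {q y} → (q , y) ∈ cs → q ∈ 𝒬 × y ∈ vectors A (suc j) × total y ≡ ℤ.+ q ℤ.* m × Nondegenerate y))

  -- The parameters: X has 2^(τ B k) elements up to 2^(τ A k), and Q has 2^(τ B l) elements
  -- between 2^(τ a l) and 2^(τ A l), where A = a + 1.
  module _ (j τ g A B a k l : ℕ) (A≡ : A ≡ suc a) {P P′ : List ℕ}
    (X : SmoothSet P (2 ^ (τ * B)) k (2 ^ (τ * a)) (2 ^ (τ * A)))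
    (Q : SmoothSet P′ (2 ^ (τ * B)) l (2 ^ (τ * a)) (2 ^ (τ * A)))
    (d≤ : suc j + suc j ≤ 2 ^ g) where

    private
      module X = SmoothSet X
      module Q = SmoothSet Q

    d : ℕ
    d = suc j + suc j

    X-size : length X.elements ≡ 2 ^ (τ * B * k)
    X-size = trans X.size (2^-^ {m = τ * B} k refl)

    Q-size : length Q.elements ≡ 2 ^ (τ * B * l)
    Q-size = trans Q.size (2^-^ {m = τ * B} l refl)

    lo-positive : 0 < 2 ^ (τ * a)
    lo-positive = m^n>0 2 (τ * a)

    degenerate-size : 2 ^ d * (length Q.elements * length X.elements ^ (j + suc j)) ≡ 2 ^ (d + (τ * B * l + τ * B * k * (j + suc j)))
    degenerate-size = trans (cong (2 ^ d *_) (trans (cong₂ _*_ Q-size (2^-^ {m = τ * B * k} (j + suc j) X-size)) (2^-* (τ * B * l) (τ * B * k * (j + suc j)))))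
      (2^-* d (τ * B * l + τ * B * k * (j + suc j)))

    popular-from-many : ∀ ρ q E → τ * A * k ≡ τ * a * l + ρ →
      q + (g + ρ + 2 + k) + 2 ≤ E → q + (d + (τ * B * l + τ * B * k * (j + suc j))) + 2 ≤ E →
      2 ^ E ≤ 2 ^ q * length (divisiblePairs Q.elements X.elements (suc j)) →
      PopularQuotient X.elements Q.elements j (2 ^ (g + ρ)) (2 ^ k)
    popular-from-many ρ q E ρ≡ h₁ h₂ many = popular-quotient j {X = 2 ^ (τ * A * k)} {Q₀ = 2 ^ (τ * a * l)} {H = 2 ^ (g + ρ)} {c = 2 ^ k}
      X.unique (subst (0 <_) (sym X-size) (m^n>0 2 (τ * B * k)))
      (λ x∈ → ≤-trans (X.upper x∈) (≤-reflexive (2^-^ {m = τ * A} k refl))) Q.unique (m^n>0 2 (τ * a * l))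
      (λ q∈ → ≤-trans (≤-reflexive (sym (2^-^ {m = τ * a} l refl))) (Q.lower q∈))
      (begin
        d * 2 ^ (τ * A * k) ≤⟨ *-monoˡ-≤ (2 ^ (τ * A * k)) d≤ ⟩
        2 ^ g * 2 ^ (τ * A * k) ≡⟨ 2^-* g (τ * A * k) ⟩
        2 ^ (g + τ * A * k) ≡⟨ cong (2 ^_) (trans (cong (g +_) (trans ρ≡ (+-comm (τ * a * l) ρ))) (sym (+-assoc g ρ (τ * a * l)))) ⟩
        2 ^ (g + ρ + τ * a * l) ≡⟨ 2^-* (g + ρ) (τ * a * l) ⟨
        2 ^ (g + ρ) * 2 ^ (τ * a * l) ∎)
      (two-terms q (g + ρ + 2 + k) (d + (τ * B * l + τ * B * k * (j + suc j))) E
        (≤-trans (*-monoˡ-≤ (2 ^ k) (odd-≤ (g + ρ))) (≤-reflexive (2^-* (g + ρ + 2) k)))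
        (≤-reflexive degenerate-size) h₁ h₂ many)
      where open ≤-Reasoning

    many-divisible-pairs : 2 ^ (τ * B * l + τ * B * k * d)
      ≤ 2 ^ (τ * A * l) * length (divisiblePairs Q.elements X.elements (suc j))
    many-divisible-pairs = subst (_≤ 2 ^ (τ * A * l) * length (divisiblePairs Q.elements X.elements (suc j))) eq
      (length-filter-product divisible? Q.elements (vectors X.elements (suc j)) (2 ^ (τ * A * l))
        (length X.elements ^ suc j * length X.elements ^ suc j)
        (λ {q} q∈ → divisible-vectors (suc j) q (2 ^ (τ * A * l)) X.unique (Q.positive lo-positive q∈)
          (≤-trans (Q.upper q∈) (≤-reflexive (2^-^ {m = τ * A} l refl)))))
      where
      eq : length Q.elements * (length X.elements ^ suc j * length X.elements ^ suc j) ≡ 2 ^ (τ * B * l + τ * B * k * d)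
      eq = trans (cong₂ _*_ Q-size (trans (sym (^-distribˡ-+-* (length X.elements) (suc j) (suc j))) (2^-^ {m = τ * B * k} d X-size)))
        (2^-* (τ * B * l) (τ * B * k * d))

    even-count : B * k ≡ A * l + A → 1 + l + 3 * k ≤ B * l → A ≡ 2 + d * B → l ≤ k → 1 ≤ B → g + 4 ≤ τ →
      ∃[ ρ ] ρ ≤ τ * A * k × PopularQuotient X.elements Q.elements j (2 ^ (g + ρ)) (2 ^ k)
    even-count collision gain A≡′ l≤k 1≤B g≤τ with m≤n⇒∃[o]m+o≡n {τ * a * l} {τ * A * k}
        (*-mono-≤ (*-monoʳ-≤ τ (≤-trans (n≤1+n a) (≤-reflexive (sym A≡)))) l≤k)
    ... | ρ , ρ≡ = ρ , ≤-trans (m≤n+m ρ (τ * a * l)) (≤-reflexive ρ≡) ,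
        popular-from-many ρ (τ * A * l) (τ * B * l + τ * B * k * d) (sym ρ≡) first second many-divisible-pairs
      where
      open ≤-Reasoning
      1≤τ : 1 ≤ τ
      1≤τ = ≤-trans (≤-trans (s≤s z≤n) (m≤n+m 4 g)) g≤τ
      first : τ * A * l + (g + ρ + 2 + k) + 2 ≤ τ * B * l + τ * B * k * d
      first = begin
        τ * A * l + (g + ρ + 2 + k) + 2 ≡⟨ cong (λ A → τ * A * l + (g + ρ + 2 + k) + 2) A≡ ⟩
        τ * suc a * l + (g + ρ + 2 + k) + 2
          ≡⟨ solve 6 (λ τ a l g ρ k → τ :* (con 1 :+ a) :* l :+ (g :+ ρ :+ con 2 :+ k) :+ con 2 := τ :* l :+ (τ :* a :* l :+ ρ) :+ (g :+ con 4) :+ k) refl τ a l g ρ k ⟩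
        τ * l + (τ * a * l + ρ) + (g + 4) + k ≡⟨ cong (λ z → τ * l + z + (g + 4) + k) ρ≡ ⟩
        τ * l + τ * A * k + (g + 4) + k ≤⟨ +-mono-≤ (+-monoʳ-≤ (τ * l + τ * A * k) g≤τ) (m≤n*m k τ {{>-nonZero 1≤τ}}) ⟩
        τ * l + τ * A * k + τ + τ * k ≡⟨ cong (λ A → τ * l + τ * A * k + τ + τ * k) A≡′ ⟩
        τ * l + τ * (2 + d * B) * k + τ + τ * k
          ≡⟨ solve 5 (λ τ l d B k → τ :* l :+ τ :* (con 2 :+ d :* B) :* k :+ τ :+ τ :* k := τ :* (con 1 :+ l :+ con 3 :* k) :+ τ :* B :* k :* d) refl τ l d B k ⟩
        τ * (1 + l + 3 * k) + τ * B * k * d ≤⟨ +-monoˡ-≤ (τ * B * k * d) (*-monoʳ-≤ τ gain) ⟩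
        τ * (B * l) + τ * B * k * d ≡⟨ cong (_+ τ * B * k * d) (*-assoc τ B l) ⟨
        τ * B * l + τ * B * k * d ∎
      d+2≤τA : d + 2 ≤ τ * A
      d+2≤τA = begin
        d + 2 ≡⟨ +-comm d 2 ⟩
        2 + d ≤⟨ +-monoʳ-≤ 2 (m≤m*n d B {{>-nonZero 1≤B}}) ⟩
        2 + d * B ≡⟨ A≡′ ⟨
        A ≤⟨ m≤n*m A τ {{>-nonZero 1≤τ}} ⟩
        τ * A ∎
      second : τ * A * l + (d + (τ * B * l + τ * B * k * (j + suc j))) + 2 ≤ τ * B * l + τ * B * k * d
      second = begin
        τ * A * l + (d + (τ * B * l + τ * B * k * (j + suc j))) + 2
          ≡⟨ solve 4 (λ x d p v → x :+ (d :+ (p :+ v)) :+ con 2 := p :+ ((x :+ (d :+ con 2)) :+ v)) refl (τ * A * l) d (τ * B * l) (τ * B * k * (j + suc j)) ⟩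
        τ * B * l + ((τ * A * l + (d + 2)) + τ * B * k * (j + suc j))
          ≤⟨ +-monoʳ-≤ (τ * B * l) (+-monoˡ-≤ (τ * B * k * (j + suc j)) (+-monoʳ-≤ (τ * A * l) d+2≤τA)) ⟩
        τ * B * l + ((τ * A * l + τ * A) + τ * B * k * (j + suc j))
          ≡⟨ cong (λ z → τ * B * l + (z + τ * B * k * (j + suc j))) eq ⟩
        τ * B * l + (τ * B * k + τ * B * k * (j + suc j)) ≡⟨ cong (τ * B * l +_) (*-suc (τ * B * k) (j + suc j)) ⟨
        τ * B * l + τ * B * k * d ∎
        where
        eq : τ * A * l + τ * A ≡ τ * B * k
        eq = trans (solve 3 (λ τ A l → τ :* A :* l :+ τ :* A := τ :* (A :* l :+ A)) refl τ A l) (trans (cong (τ *_) (sym collision)) (sym (*-assoc τ B k)))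

  sum-bounded : ∀ {A X} J {u : Vec ℕ J} → (∀ {x} → x ∈ A → x ≤ X) → u ∈ choices (replicate J A) → Vec.sum u ≤ J * X
  sum-bounded {A} {X} J A≤ u∈ = go J (∈-choices⁻ (replicate J A) u∈)
    where
    go : ∀ J {u : Vec ℕ J} → Pointwise _∈_ u (replicate J A) → Vec.sum u ≤ J * X
    go zero [] = z≤n
    go (suc J) (x∈ ∷ u∈) = +-mono-≤ (A≤ x∈) (go J u∈)

  module _ (j τ g A B a k l k′ : ℕ) (A≡ : A ≡ suc a) (k≡ : k ≡ l + k′) {P P₁ P₂ : List ℕ}
    (X : SmoothSet P (2 ^ (τ * B)) k (2 ^ (τ * a)) (2 ^ (τ * A)))
    (Q₁ : SmoothSet P₁ (2 ^ (τ * B)) l (2 ^ (τ * a)) (2 ^ (τ * A)))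
    (Q₂ : SmoothSet P₂ (2 ^ (τ * B)) l (2 ^ (τ * a)) (2 ^ (τ * A)))
    (coprime : ∀ {q₁ q₂} → q₁ ∈ SmoothSet.elements Q₁ → q₂ ∈ SmoothSet.elements Q₂ → Coprime q₂ q₁)
    (d≤ : 3 + (suc j + suc j) ≤ 2 ^ g)
    (shift : A * k′ ≤ a * l) (1≤a : 1 ≤ a) (g≤τ : g + (g + 7) ≤ τ) where

    private
      module X = SmoothSet X
      module Q₁ = SmoothSet Q₁
      module Q₂ = SmoothSet Q₂

      e x y p v μ : ℕ
      e = suc j + suc j
      x = τ * A * k
      y = τ * A
      p = τ * B * l
      v = τ * B * k
      μ = τ * A * k′

      1≤τ : 1 ≤ τ
      1≤τ = ≤-trans (≤-trans (s≤s z≤n) (≤-trans (m≤n+m 7 g) (m≤n+m (g + 7) g))) g≤τ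

      X-size′ : length X.elements ≡ 2 ^ v
      X-size′ = X-size j τ g A B a k l A≡ X Q₁ (≤-trans (m≤n+m e 3) d≤)

      Q₁-size : length Q₁.elements ≡ 2 ^ p
      Q₁-size = Q-size j τ g A B a k l A≡ X Q₁ (≤-trans (m≤n+m e 3) d≤)

      Q₂-size : length Q₂.elements ≡ 2 ^ p
      Q₂-size = Q-size j τ g A B a k l A≡ X Q₂ (≤-trans (m≤n+m e 3) d≤)

      M≤ : ∀ {q₂} → q₂ ∈ Q₂.elements → 2 ^ μ ≤ q₂
      M≤ q₂∈ = ≤-trans (2^-mono (subst₂ _≤_ (sym (*-assoc τ A k′)) (sym (*-assoc τ a l)) (*-monoʳ-≤ τ shift)))
        (≤-trans (≤-reflexive (sym (2^-^ {m = τ * a} l refl))) (Q₂.lower q₂∈))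

      module C = Coincidences X.elements Q₁.elements Q₂.elements j (2 ^ μ) (2 ^ p) X.unique
        (subst (0 <_) (sym X-size′) (m^n>0 2 v)) Q₁.unique Q₂.unique Q₁-size Q₂-size coprime M≤

      values-bounded : ∀ {q₁ q₂ u m} → q₁ ∈ Q₁.elements → q₂ ∈ Q₂.elements →
        u ∈ choices (replicate (suc j) X.elements) → m ∈ grid (2 ^ μ) →
        Vec.sum u + (q₁ * proj₁ m + q₂ * proj₂ m) < 2 ^ (g + x)
      values-bounded {q₁} {q₂} {u} {m₁ , m₂} q₁∈ q₂∈ u∈ m∈ = begin-strict
        Vec.sum u + (q₁ * m₁ + q₂ * m₂)
          ≤⟨ +-mono-≤ (sum-bounded (suc j) (λ x∈ → ≤-trans (X.upper x∈) (≤-reflexive (2^-^ {m = τ * A} k refl))) u∈)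
               (+-mono-≤ (product-≤ (Q₁.upper q₁∈) (<⇒≤ (proj₁ (∈-grid⁻ m∈)))) (product-≤ (Q₂.upper q₂∈) (<⇒≤ (proj₂ (∈-grid⁻ m∈))))) ⟩
        suc j * 2 ^ x + (2 ^ x + 2 ^ x) ≡⟨ solve 2 (λ j x → j :* x :+ (x :+ x) := (con 2 :+ j) :* x) refl (suc j) (2 ^ x) ⟩
        (2 + suc j) * 2 ^ x <⟨ *-monoˡ-< (2 ^ x) {{m^n≢0 2 x}} (≤-trans (+-monoʳ-≤ 3 (m≤m+n (suc j) (suc j))) d≤) ⟩
        2 ^ g * 2 ^ x ≡⟨ 2^-* g x ⟩
        2 ^ (g + x) ∎
        where
        open ≤-Reasoning
        product-≤ : ∀ {q m} → q ≤ (2 ^ (τ * A)) ^ l → m ≤ 2 ^ μ → q * m ≤ 2 ^ x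
        product-≤ q≤ m≤ = ≤-trans (*-mono-≤ q≤ m≤) (≤-reflexive (trans (cong (_* 2 ^ μ) (2^-^ {m = τ * A} l refl))
          (trans (2^-* (τ * A * l) μ) (cong (2 ^_) (trans (sym (*-distribˡ-+ (τ * A) l k′)) (cong (τ * A *_) (sym k≡)))))))

      few-divisors : ∀ {P′} (Q : SmoothSet P′ (2 ^ (τ * B)) l (2 ^ (τ * a)) (2 ^ (τ * A))) →
        ∀ {z} T → z ∈ vectors X.elements (suc j) → Σ∈ T z ≢ 0ℤ →
        length (filter (_∣? ℤ.∣ Σ∈ T z ∣) (SmoothSet.elements Q)) ≤ 2 ^ (2 * k)
      few-divisors Q {z} T z∈ ≢0 with SmoothSet.divisors Q {ℤ.∣ Σ∈ T z ∣} (n≢0⇒n>0 (λ eq → ≢0 (ℤₚ.∣i∣≡0⇒i≡0 eq)))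
      ... | w , lo^w≤ , count≤ = ≤-trans count≤ (2^-mono (≮⇒≥ λ 2k<w → <⇒≱ (few 2k<w) (2^-cancel-≤ (bound lo^w≤))))
        where
        open ≤-Reasoning
        bound : (2 ^ (τ * a)) ^ w ≤ ℤ.∣ Σ∈ T z ∣ → 2 ^ (τ * a * w) ≤ 2 ^ (g + x)
        bound le = begin
          2 ^ (τ * a * w) ≡⟨ 2^-^ {m = τ * a} w refl ⟨
          (2 ^ (τ * a)) ^ w ≤⟨ le ⟩
          ℤ.∣ Σ∈ T z ∣ ≤⟨ ∣Σ∈∣≤ T (All.map (λ x∈ → ≤-trans (X.upper x∈) (≤-reflexive (2^-^ {m = τ * A} k refl))) (signedChoices-entries {J = suc j} z∈)) ⟩
          e * 2 ^ x ≤⟨ *-monoˡ-≤ (2 ^ x) (≤-trans (m≤n+m e 3) d≤) ⟩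
          2 ^ g * 2 ^ x ≡⟨ 2^-* g x ⟩
          2 ^ (g + x) ∎
        few : 2 * k < w → g + x < τ * a * w
        few 2k<w = begin-strict
          g + x <⟨ +-monoˡ-< x (≤-trans (m<m+n g (≤-trans (s≤s z≤n) (m≤n+m 7 g))) g≤τ) ⟩
          τ + x ≡⟨ cong (λ A → τ + τ * A * k) A≡ ⟩
          τ + τ * suc a * k ≡⟨ solve 3 (λ τ a k → τ :+ τ :* (con 1 :+ a) :* k := τ :* (con 1 :+ (k :+ a :* k))) refl τ a k ⟩
          τ * (1 + (k + a * k)) ≤⟨ *-monoʳ-≤ τ (+-mono-≤ 1≤a (+-monoˡ-≤ (a * k) (m≤n*m k a {{>-nonZero 1≤a}}))) ⟩
          τ * (a + (a * k + a * k)) ≡⟨ solve 3 (λ τ a k → τ :* (a :+ (a :* k :+ a :* k)) := τ :* a :* (con 1 :+ con 2 :* k)) refl τ a k ⟩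
          τ * a * (1 + 2 * k) ≤⟨ *-monoʳ-≤ (τ * a) 2k<w ⟩
          τ * a * w ∎

      size : ℕ
      size = (p + p) + ((v * suc j + (μ + μ)) + (v * suc j + (μ + μ)))

      size≡ : size ≡ p + p + (v * e + 4 * μ)
      size≡ = solve 4 (λ p v j μ → (p :+ p) :+ ((v :* j :+ (μ :+ μ)) :+ (v :* j :+ (μ :+ μ))) := p :+ p :+ (v :* (j :+ j) :+ con 4 :* μ)) refl p v (suc j) μ

      many : 2 ^ size ≤ 2 ^ (g + x) * length C.coincidences
      many = subst (_≤ 2 ^ (g + x) * length C.coincidences) eq (C.length-coincidences (2 ^ (g + x)) values-bounded)
        where
        half : length X.elements ^ suc j * (2 ^ μ * 2 ^ μ) ≡ 2 ^ (v * suc j + (μ + μ))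
        half = trans (cong₂ _*_ (2^-^ {m = v} (suc j) X-size′) (2^-* μ μ)) (2^-* (v * suc j) (μ + μ))
        eq : 2 ^ p * 2 ^ p * ((length X.elements ^ suc j * (2 ^ μ * 2 ^ μ)) * (length X.elements ^ suc j * (2 ^ μ * 2 ^ μ))) ≡ 2 ^ size
        eq = trans (cong₂ _*_ (2^-* p p) (trans (cong₂ _*_ half half) (2^-* (v * suc j + (μ + μ)) (v * suc j + (μ + μ)))))
          (2^-* (p + p) ((v * suc j + (μ + μ)) + (v * suc j + (μ + μ))))

      shifted : A * k + 2 * A ≡ B * k + 2 * (A * k′) → v + (μ + μ) ≡ x + (y + y)
      shifted collision = trans
        (solve 5 (λ τ B k A k′ → τ :* B :* k :+ (τ :* A :* k′ :+ τ :* A :* k′) := τ :* (B :* k :+ con 2 :* (A :* k′))) refl τ B k A k′)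
        (trans (cong (τ *_) (sym collision))
          (solve 3 (λ τ A k → τ :* (A :* k :+ con 2 :* A) := τ :* A :* k :+ (τ :* A :+ τ :* A)) refl τ A k))

    odd-count : A * k + 2 * A ≡ B * k + 2 * (A * k′) → (B + 3) * k + 1 ≤ 2 * (B * l) →
      1 + e + A * k + k ≤ 2 * (B * l) + 2 * (A * k′) →
      1 + e + 2 * (A * k) + k ≤ B * l + B * k * e + 2 * (A * k′) + a * l →
      A ≡ 2 + suc e * B → 1 ≤ B →
      (∃[ ρ ] ρ ≤ x × PopularQuotient X.elements Q₁.elements j (2 ^ (g + ρ)) (2 ^ k))
        ⊎ (∃[ ρ ] ρ ≤ x × PopularQuotient X.elements Q₂.elements j (2 ^ (g + ρ)) (2 ^ k))
        ⊎ PopularShift X.elements Q₁.elements Q₂.elements j (2 ^ μ) (2 ^ k)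
    odd-count collision gain divisors-gain zero-gain A≡′ 1≤B = decide (2 ^ φ <? length (divisiblePairs Q₁.elements X.elements (suc j)))
        (2 ^ φ <? length (divisiblePairs Q₂.elements X.elements (suc j)))
      where
      open ≤-Reasoning
      1+e≤A : 1 + e ≤ A
      1+e≤A = begin
        1 + e ≤⟨ m≤m*n (suc e) B {{>-nonZero 1≤B}} ⟩
        suc e * B ≤⟨ m≤n+m (suc e * B) 2 ⟩
        2 + suc e * B ≡⟨ A≡′ ⟨
        A ∎
      τ+e≤y : τ + e ≤ y
      τ+e≤y = begin
        τ + e ≤⟨ +-monoʳ-≤ τ (m≤n*m e τ {{>-nonZero 1≤τ}}) ⟩
        τ + τ * e ≡⟨ *-suc τ e ⟨
        τ * (1 + e) ≤⟨ *-monoʳ-≤ τ 1+e≤A ⟩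
        y ∎
      g+7≤τ : g + 7 ≤ τ
      g+7≤τ = ≤-trans (m≤n+m (g + 7) g) g≤τ
      g+3≤τ : g + 3 ≤ τ
      g+3≤τ = ≤-trans (+-monoʳ-≤ g (s≤s (s≤s (s≤s z≤n)))) g+7≤τ
      space : g + x + e + 3 ≤ v + (μ + μ)
      space = begin
        g + x + e + 3 ≡⟨ solve 3 (λ g x e → g :+ x :+ e :+ con 3 := x :+ (g :+ con 3 :+ e)) refl g x e ⟩
        x + (g + 3 + e) ≤⟨ +-monoʳ-≤ x (≤-trans (+-monoˡ-≤ e g+3≤τ) (≤-trans τ+e≤y (m≤m+n y y))) ⟩
        x + (y + y) ≡⟨ shifted collision ⟨
        v + (μ + μ) ∎
      φ∃ : ∃[ φ ] g + x + e + 3 + φ ≡ p + v * e + (μ + μ)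
      φ∃ = m≤n⇒∃[o]m+o≡n (≤-trans space (+-monoˡ-≤ (μ + μ) (≤-trans (m≤m*n v e) (m≤n+m (v * e) p))))
      φ : ℕ
      φ = proj₁ φ∃
      φ≡ : g + x + e + 3 + φ ≡ p + v * e + (μ + μ)
      φ≡ = proj₂ φ∃
      ρ∃ : ∃[ ρ ] τ * a * l + ρ ≡ x
      ρ∃ = m≤n⇒∃[o]m+o≡n (*-mono-≤ (*-monoʳ-≤ τ (≤-trans (n≤1+n a) (≤-reflexive (sym A≡))))
        (≤-trans (m≤m+n l k′) (≤-reflexive (sym k≡))))
      ρ : ℕ
      ρ = proj₁ ρ∃
      from-many : ∀ {P′} (Q : SmoothSet P′ (2 ^ (τ * B)) l (2 ^ (τ * a)) (2 ^ (τ * A))) →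
        2 ^ φ < length (divisiblePairs (SmoothSet.elements Q) X.elements (suc j)) →
        ∃[ ρ ] ρ ≤ x × PopularQuotient X.elements (SmoothSet.elements Q) j (2 ^ (g + ρ)) (2 ^ k)
      from-many Q big = ρ , ≤-trans (m≤n+m ρ (τ * a * l)) (≤-reflexive (proj₂ ρ∃)) ,
        popular-from-many j τ g A B a k l A≡ X Q (≤-trans (m≤n+m e 3) d≤) ρ 0 φ (sym (proj₂ ρ∃)) first second
          (≤-trans (<⇒≤ big) (≤-reflexive (sym (+-identityʳ _))))
        where
        first : g + ρ + 2 + k + 2 ≤ φ
        first = +-cancelˡ-≤ (g + x + e + 3 + τ * a * l) _ _ (begin
          g + x + e + 3 + τ * a * l + (g + ρ + 2 + k + 2)
            ≡⟨ solve 6 (λ g x e t ρ k → g :+ x :+ e :+ con 3 :+ t :+ (g :+ ρ :+ con 2 :+ k :+ con 2) := (g :+ (g :+ con 7)) :+ (e :+ (x :+ (t :+ ρ)) :+ k)) refl g x e (τ * a * l) ρ k ⟩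
          (g + (g + 7)) + (e + (x + (τ * a * l + ρ)) + k) ≡⟨ cong (λ z → (g + (g + 7)) + (e + (x + z) + k)) (proj₂ ρ∃) ⟩
          (g + (g + 7)) + (e + (x + x) + k) ≤⟨ +-mono-≤ g≤τ (+-mono-≤ (+-monoˡ-≤ (x + x) (m≤n*m e τ {{>-nonZero 1≤τ}})) (m≤n*m k τ {{>-nonZero 1≤τ}})) ⟩
          τ + (τ * e + (x + x) + τ * k)
            ≡⟨ solve 4 (λ τ e A k → τ :+ (τ :* e :+ (τ :* A :* k :+ τ :* A :* k) :+ τ :* k) := τ :* (con 1 :+ e :+ con 2 :* (A :* k) :+ k)) refl τ e A k ⟩
          τ * (1 + e + 2 * (A * k) + k) ≤⟨ *-monoʳ-≤ τ zero-gain ⟩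
          τ * (B * l + B * k * e + 2 * (A * k′) + a * l)
            ≡⟨ solve 8 (λ τ B l k e A k′ a → τ :* (B :* l :+ B :* k :* e :+ con 2 :* (A :* k′) :+ a :* l) := (τ :* B :* l :+ τ :* B :* k :* e :+ (τ :* A :* k′ :+ τ :* A :* k′)) :+ τ :* a :* l) refl τ B l k e A k′ a ⟩
          (p + v * e + (μ + μ)) + τ * a * l ≡⟨ cong (_+ τ * a * l) φ≡ ⟨
          (g + x + e + 3 + φ) + τ * a * l ≡⟨ solve 3 (λ s φ t → s :+ φ :+ t := s :+ t :+ φ) refl (g + x + e + 3) φ (τ * a * l) ⟩
          g + x + e + 3 + τ * a * l + φ ∎)
        second : e + (p + v * (j + suc j)) + 2 ≤ φ
        second = +-cancelˡ-≤ (g + x + e + 3) _ _ (begin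
          g + x + e + 3 + (e + (p + v * (j + suc j)) + 2)
            ≡⟨ solve 5 (λ g x e p w → g :+ x :+ e :+ con 3 :+ (e :+ (p :+ w) :+ con 2) := p :+ w :+ (x :+ ((g :+ con 5 :+ e) :+ e))) refl g x e p (v * (j + suc j)) ⟩
          p + v * (j + suc j) + (x + ((g + 5 + e) + e))
            ≤⟨ +-monoʳ-≤ (p + v * (j + suc j)) (+-monoʳ-≤ x (+-mono-≤ (≤-trans (+-monoˡ-≤ e (≤-trans (+-monoʳ-≤ g (s≤s (s≤s (s≤s (s≤s (s≤s z≤n)))))) g+7≤τ)) τ+e≤y) (≤-trans (m≤n+m e τ) τ+e≤y))) ⟩
          p + v * (j + suc j) + (x + (y + y)) ≡⟨ cong (p + v * (j + suc j) +_) (shifted collision) ⟨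
          p + v * (j + suc j) + (v + (μ + μ)) ≡⟨ solve 4 (λ p v w μ → p :+ w :+ (v :+ μ) := p :+ (v :+ w) :+ μ) refl p v (v * (j + suc j)) (μ + μ) ⟩
          p + (v + v * (j + suc j)) + (μ + μ) ≡⟨ cong (λ z → p + z + (μ + μ)) (*-suc v (j + suc j)) ⟨
          p + v * e + (μ + μ) ≡⟨ φ≡ ⟨
          g + x + e + 3 + φ ∎)
      W² : 2 ^ (2 * k) * 2 ^ (2 * k) ≡ 2 ^ (4 * k)
      W² = trans (2^-* (2 * k) (2 * k)) (cong (2 ^_) (solve 1 (λ k → con 2 :* k :+ con 2 :* k := con 4 :* k) refl k))
      h₁ : g + x + ((μ + μ) + (μ + μ) + k) + 3 ≤ size
      h₁ = begin
        g + x + ((μ + μ) + (μ + μ) + k) + 3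
          ≡⟨ solve 4 (λ g x μ k → g :+ x :+ ((μ :+ μ) :+ (μ :+ μ) :+ k) :+ con 3 := ((g :+ con 3) :+ k :+ x) :+ con 4 :* μ) refl g x μ k ⟩
        ((g + 3) + k + x) + 4 * μ ≤⟨ +-monoˡ-≤ (4 * μ) (+-monoˡ-≤ x (+-mono-≤ g+3≤τ (m≤n*m k τ {{>-nonZero 1≤τ}}))) ⟩
        (τ + τ * k + x) + 4 * μ ≡⟨ cong (λ A → (τ + τ * k + τ * A * k) + 4 * μ) A≡′ ⟩
        (τ + τ * k + τ * (2 + suc e * B) * k) + 4 * μ
          ≡⟨ solve 5 (λ τ k e B μ → (τ :+ τ :* k :+ τ :* (con 2 :+ (con 1 :+ e) :* B) :* k) :+ con 4 :* μ := τ :* ((B :+ con 3) :* k :+ con 1) :+ (τ :* B :* k :* e :+ con 4 :* μ)) refl τ k e B μ ⟩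
        τ * ((B + 3) * k + 1) + (v * e + 4 * μ) ≤⟨ +-monoˡ-≤ (v * e + 4 * μ) (*-monoʳ-≤ τ gain) ⟩
        τ * (2 * (B * l)) + (v * e + 4 * μ) ≡⟨ cong (_+ (v * e + 4 * μ)) (solve 3 (λ τ B l → τ :* (con 2 :* (B :* l)) := τ :* B :* l :+ τ :* B :* l) refl τ B l) ⟩
        p + p + (v * e + 4 * μ) ≡⟨ size≡ ⟨
        size ∎
      h₂ : g + x + (e + (p + p + (v * (j + suc j) + (μ + μ)))) + 3 ≤ size
      h₂ = begin
        g + x + (e + (p + p + (v * (j + suc j) + (μ + μ)))) + 3
          ≡⟨ solve 6 (λ g x e p w μ → g :+ x :+ (e :+ (p :+ p :+ (w :+ (μ :+ μ)))) :+ con 3 := (g :+ x :+ e :+ con 3) :+ (p :+ p :+ w :+ (μ :+ μ))) refl g x e p (v * (j + suc j)) μ ⟩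
        (g + x + e + 3) + (p + p + v * (j + suc j) + (μ + μ)) ≤⟨ +-monoˡ-≤ (p + p + v * (j + suc j) + (μ + μ)) space ⟩
        (v + (μ + μ)) + (p + p + v * (j + suc j) + (μ + μ))
          ≡⟨ solve 4 (λ v μ p w → (v :+ (μ :+ μ)) :+ (p :+ p :+ w :+ (μ :+ μ)) := p :+ p :+ ((v :+ w) :+ con 4 :* μ)) refl v μ p (v * (j + suc j)) ⟩
        p + p + ((v + v * (j + suc j)) + 4 * μ) ≡⟨ cong (λ z → p + p + (z + 4 * μ)) (*-suc v (j + suc j)) ⟨
        p + p + (v * e + 4 * μ) ≡⟨ size≡ ⟨
        size ∎
      h₃ : g + x + (e + (φ + (p + (μ + μ)))) + 3 ≤ size
      h₃ = ≤-reflexive (begin-equality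
        g + x + (e + (φ + (p + (μ + μ)))) + 3
          ≡⟨ solve 6 (λ g x e φ p μ → g :+ x :+ (e :+ (φ :+ (p :+ (μ :+ μ)))) :+ con 3 := (g :+ x :+ e :+ con 3 :+ φ) :+ (p :+ (μ :+ μ))) refl g x e φ p μ ⟩
        (g + x + e + 3 + φ) + (p + (μ + μ)) ≡⟨ cong (_+ (p + (μ + μ))) φ≡ ⟩
        (p + v * e + (μ + μ)) + (p + (μ + μ)) ≡⟨ solve 3 (λ p w μ → (p :+ w :+ (μ :+ μ)) :+ (p :+ (μ :+ μ)) := p :+ p :+ (w :+ con 4 :* μ)) refl p (v * e) μ ⟩
        p + p + (v * e + 4 * μ) ≡⟨ size≡ ⟨
        size ∎)
      h₄ : g + x + (e + (v * e + (μ + μ) + 4 * k)) + 3 ≤ size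
      h₄ = begin
        g + x + (e + (v * e + (μ + μ) + 4 * k)) + 3
          ≡⟨ solve 6 (λ g x e w μ k → g :+ x :+ (e :+ (w :+ (μ :+ μ) :+ con 4 :* k)) :+ con 3 := ((g :+ con 3) :+ e :+ x :+ con 4 :* k) :+ (w :+ (μ :+ μ))) refl g x e (v * e) μ k ⟩
        ((g + 3) + e + x + 4 * k) + (v * e + (μ + μ))
          ≤⟨ +-monoˡ-≤ (v * e + (μ + μ)) (+-mono-≤ (+-monoˡ-≤ x (+-mono-≤ g+3≤τ (m≤n*m e τ {{>-nonZero 1≤τ}})))
               (*-monoˡ-≤ k (≤-trans (≤-trans (s≤s (s≤s (s≤s (s≤s z≤n)))) (m≤n+m 7 g)) g+7≤τ))) ⟩
        (τ + τ * e + x + τ * k) + (v * e + (μ + μ))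
          ≡⟨ cong (_+ (v * e + (μ + μ))) (solve 4 (λ τ e A k → τ :+ τ :* e :+ τ :* A :* k :+ τ :* k := τ :* (con 1 :+ e :+ A :* k :+ k)) refl τ e A k) ⟩
        τ * (1 + e + A * k + k) + (v * e + (μ + μ)) ≤⟨ +-monoˡ-≤ (v * e + (μ + μ)) (*-monoʳ-≤ τ divisors-gain) ⟩
        τ * (2 * (B * l) + 2 * (A * k′)) + (v * e + (μ + μ))
          ≡⟨ solve 6 (λ τ B l A k′ w → τ :* (con 2 :* (B :* l) :+ con 2 :* (A :* k′)) :+ (w :+ (τ :* A :* k′ :+ τ :* A :* k′)) := τ :* B :* l :+ τ :* B :* l :+ (w :+ con 4 :* (τ :* A :* k′))) refl τ B l A k′ (v * e) ⟩
        p + p + (v * e + 4 * μ) ≡⟨ size≡ ⟨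
        size ∎
      main : length (divisiblePairs Q₁.elements X.elements (suc j)) ≤ 2 ^ φ → length (divisiblePairs Q₂.elements X.elements (suc j)) ≤ 2 ^ φ →
             PopularShift X.elements Q₁.elements Q₂.elements j (2 ^ μ) (2 ^ k)
      main Φ₁ Φ₂ = C.popular-shift (2 ^ φ) (2 ^ (2 * k)) Φ₁ Φ₂ (few-divisors Q₁) (few-divisors Q₂) (subst (_< length C.coincidences)
        (cong (λ z → ((2 ^ μ * 2 ^ μ) * (2 ^ μ * 2 ^ μ)) * 2 ^ k + (2 ^ e * ((2 ^ p * 2 ^ p) * (length X.elements ^ (j + suc j) * (2 ^ μ * 2 ^ μ))) + z)) (sym (*-distribˡ-+ (2 ^ e) (2 ^ φ * (2 ^ p * (2 ^ μ * 2 ^ μ))) ((length X.elements ^ e * (2 ^ μ * 2 ^ μ)) * (2 ^ (2 * k) * 2 ^ (2 * k))))))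
        (four-terms (g + x) ((μ + μ) + (μ + μ) + k) (e + (p + p + (v * (j + suc j) + (μ + μ)))) (e + (φ + (p + (μ + μ)))) (e + (v * e + (μ + μ) + 4 * k)) size
          (≤-reflexive (trans (cong (_* 2 ^ k) (trans (cong₂ _*_ (2^-* μ μ) (2^-* μ μ)) (2^-* (μ + μ) (μ + μ)))) (2^-* ((μ + μ) + (μ + μ)) k)))
          (≤-reflexive (trans (cong (2 ^ e *_) (trans (cong₂ _*_ (2^-* p p) (trans (cong₂ _*_ (2^-^ {m = v} (j + suc j) X-size′) (2^-* μ μ)) (2^-* (v * (j + suc j)) (μ + μ)))) (2^-* (p + p) (v * (j + suc j) + (μ + μ))))) (2^-* e (p + p + (v * (j + suc j) + (μ + μ))))))
          (≤-reflexive (trans (cong (2 ^ e *_) (trans (cong (2 ^ φ *_) (trans (cong (2 ^ p *_) (2^-* μ μ)) (2^-* p (μ + μ)))) (2^-* φ (p + (μ + μ))))) (2^-* e (φ + (p + (μ + μ))))))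
          (≤-reflexive (trans (cong (2 ^ e *_) (trans (cong₂ _*_ (trans (cong₂ _*_ (2^-^ {m = v} e X-size′) (2^-* μ μ)) (2^-* (v * e) (μ + μ))) W²) (2^-* (v * e + (μ + μ)) (4 * k)))) (2^-* e (v * e + (μ + μ) + 4 * k))))
          h₁ h₂ h₃ h₄ many))
      decide : Dec (2 ^ φ < length (divisiblePairs Q₁.elements X.elements (suc j))) → Dec (2 ^ φ < length (divisiblePairs Q₂.elements X.elements (suc j))) →
        (∃[ ρ ] ρ ≤ x × PopularQuotient X.elements Q₁.elements j (2 ^ (g + ρ)) (2 ^ k))
          ⊎ (∃[ ρ ] ρ ≤ x × PopularQuotient X.elements Q₂.elements j (2 ^ (g + ρ)) (2 ^ k))
          ⊎ PopularShift X.elements Q₁.elements Q₂.elements j (2 ^ μ) (2 ^ k)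
      decide (yes big) _ = inj₁ (from-many Q₁ big)
      decide (no _) (yes big) = inj₂ (inj₁ (from-many Q₂ big))
      decide (no small₁) (no small₂) = inj₂ (inj₂ (main (≮⇒≥ small₁) (≮⇒≥ small₂)))

module Assembly where

  open import Data.Fin.Base using (zero; suc)
  open import Data.Fin.Subset using (⊤; ⊥)
  open import Data.Integer.Base as ℤ using (ℤ; 0ℤ)
  import Data.Integer.Properties as ℤₚ
  open import Data.List.Base using (List; []; _∷_; _++_; length; deduplicate)
  open import Data.List.Membership.Propositional using (_∈_)
  open import Data.List.Membership.Propositional.Properties
  open import Data.List.Properties using (length-++; length-deduplicate)
  open import Data.List.Relation.Unary.All as All using (All; []; _∷_)
  import Data.List.Relation.Unary.All.Properties as AllP
  open import Data.List.Relation.Unary.Unique.Propositional using (Unique)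
  open import Data.List.Relation.Unary.Unique.DecPropositional.Properties using (deduplicate-!)
  open import Data.List.Relation.Unary.Any using (here; there)
  open import Data.Nat.Base
  open import Data.Nat.Coprimality using (Coprime)
  open import Data.Nat.Divisibility using (_∣_)
  open import Data.Nat.Primality using (Prime; prime[2])
  open import Data.Nat.Properties
  open import Data.Nat.Solver using (module +-*-Solver)
  open import Data.Product.Base using (Σ-syntax; _×_; _,_; ∃-syntax; proj₁; proj₂)
  open import Data.Rational using (ℚ; 0ℚ; ↥_; ↧ₙ_)
  import Data.Rational.Properties as ℚₚ
  open import Data.Sum.Base using (_⊎_; inj₁; inj₂)
  open import Data.Vec.Base using (Vec; []; _∷_; lookup)
  open import Function.Base using (_∘_)
  open import Relation.Binary.PropositionalEquality hiding (J)
  open import Relation.Nullary using (¬_)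
  open Counting
  open Chebyshev
  open Smooth
  open Vectors
  open Popular
  open TwoModuli
  open Cases
  open SmoothSets
  open Exponents
  open Counts
  open import Defs

  primesOf : ∀ {n} → Vec ℚ n → List ℕ
  primesOf [] = []
  primesOf (q ∷ a) = primeDivisors ℤ.∣ ↥ q ∣ ++ primeDivisors (↧ₙ q) ++ primesOf a

  all-primesOf : ∀ {n} (a : Vec ℚ n) → All Prime (primesOf a)
  all-primesOf [] = []
  all-primesOf (q ∷ a) = AllP.++⁺ (all-primeDivisors ℤ.∣ ↥ q ∣) (AllP.++⁺ (all-primeDivisors (↧ₙ q)) (all-primesOf a))

  primesOf-units : ∀ {n S} (a : Vec ℚ n) → (∀ i → lookup a i ≢ 0ℚ) → (∀ {r} → r ∈ primesOf a → r ∈ S) →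
                   ∀ i → IsSUnit S (lookup a i)
  primesOf-units (q ∷ a) a≢0 h zero = a≢0 zero , λ r pr → λ where
    (inj₁ r∣) → h (∈-++⁺ˡ (∈-primeDivisors⁺ (n≢0⇒n>0 (λ eq → a≢0 zero (ℚₚ.↥p≡0⇒p≡0 q (ℤₚ.∣i∣≡0⇒i≡0 eq)))) pr r∣))
    (inj₂ r∣) → h (∈-++⁺ʳ (primeDivisors ℤ.∣ ↥ q ∣) (∈-++⁺ˡ (∈-primeDivisors⁺ z<s pr r∣)))
  primesOf-units (q ∷ a) a≢0 h (suc i) = primesOf-units a (a≢0 ∘ suc)
    (h ∘ ∈-++⁺ʳ (primeDivisors ℤ.∣ ↥ q ∣) ∘ ∈-++⁺ʳ (primeDivisors (↧ₙ q))) i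

  ∣∣>0 : ∀ {m} → m ≢ 0ℤ → 0 < ℤ.∣ m ∣
  ∣∣>0 m≢0 = n≢0⇒n>0 (m≢0 ∘ ℤₚ.∣i∣≡0⇒i≡0)

  allPrimeDivisors : List ℕ → List ℕ
  allPrimeDivisors [] = []
  allPrimeDivisors (m ∷ ms) = primeDivisors m ++ allPrimeDivisors ms

  ∈-allPrimeDivisors : ∀ {m r ms} → m ∈ ms → r ∈ primeDivisors m → r ∈ allPrimeDivisors ms
  ∈-allPrimeDivisors (here refl) r∈ = ∈-++⁺ˡ r∈
  ∈-allPrimeDivisors {ms = m ∷ ms} (there m∈) r∈ = ∈-++⁺ʳ (primeDivisors m) (∈-allPrimeDivisors m∈ r∈)

  all-allPrimeDivisors : ∀ ms → All Prime (allPrimeDivisors ms)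
  all-allPrimeDivisors [] = []
  all-allPrimeDivisors (m ∷ ms) = AllP.++⁺ (all-primeDivisors m) (all-allPrimeDivisors ms)

  length-allPrimeDivisors : ∀ {t ms} → All (λ m → 0 < m × m ≤ 2 ^ t) ms → length (allPrimeDivisors ms) ≤ length ms * t
  length-allPrimeDivisors [] = z≤n
  length-allPrimeDivisors {t} {m ∷ ms} ((0<m , m≤) ∷ h) = begin
    length (primeDivisors m ++ allPrimeDivisors ms) ≡⟨ length-++ (primeDivisors m) ⟩
    length (primeDivisors m) + length (allPrimeDivisors ms) ≤⟨ +-mono-≤ (length-primeDivisors 0<m m≤) (length-allPrimeDivisors h) ⟩
    t + length ms * t ∎
    where open ≤-Reasoning

  module PrimeSet {n : ℕ} (v : Vec ℚ n) (v≢0 : ∀ i → lookup v i ≢ 0ℚ) (P : List ℕ) (P-primes : All Prime P) where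

    raw : List ℕ → List ℕ
    raw ms = P ++ primesOf v ++ allPrimeDivisors ms

    primeSet : List ℕ → List ℕ
    primeSet ms = deduplicate _≟_ (raw ms)

    primeSet-unique : ∀ ms → Unique (primeSet ms)
    primeSet-unique ms = deduplicate-! _≟_ (raw ms)

    primeSet-prime : ∀ ms → All Prime (primeSet ms)
    primeSet-prime ms = AllP.deduplicate⁺ _≟_ (AllP.++⁺ P-primes (AllP.++⁺ (all-primesOf v) (all-allPrimeDivisors ms)))

    P⊆ : ∀ {r} ms → r ∈ P → r ∈ primeSet ms
    P⊆ ms r∈ = ∈-deduplicate⁺ _≟_ (∈-++⁺ˡ r∈)

    coefficients : ∀ ms i → IsSUnit (primeSet ms) (lookup v i)
    coefficients ms = primesOf-units v v≢0 (λ r∈ → ∈-deduplicate⁺ _≟_ (∈-++⁺ʳ P (∈-++⁺ˡ r∈)))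

    ms-primes : ∀ {m} ms → m ∈ ms → 0 < m → PrimesIn (primeSet ms) m
    ms-primes ms m∈ 0<m r pr r∣ = ∈-deduplicate⁺ _≟_ (∈-++⁺ʳ P (∈-++⁺ʳ (primesOf v)
      (∈-allPrimeDivisors m∈ (∈-primeDivisors⁺ 0<m pr r∣))))

    length-primeSet : ∀ {t ms} → All (λ m → 0 < m × m ≤ 2 ^ t) ms → length ms ≤ 3 →
                      length (primeSet ms) ≤ length P + (length (primesOf v) + 3 * t)
    length-primeSet {t} {ms} h ms≤3 = begin
      length (primeSet ms) ≤⟨ length-deduplicate _≟_ (raw ms) ⟩
      length (raw ms) ≡⟨ trans (length-++ P) (cong (length P +_) (length-++ (primesOf v))) ⟩
      length P + (length (primesOf v) + length (allPrimeDivisors ms))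
        ≤⟨ +-monoʳ-≤ (length P) (+-monoʳ-≤ (length (primesOf v)) (≤-trans (length-allPrimeDivisors h) (*-monoˡ-≤ t ms≤3))) ⟩
      length P + (length (primesOf v) + 3 * t) ∎
      where open ≤-Reasoning

  e : ℕ → ℕ
  e n = suc (pred n * B n)

  B+e≡a : ∀ m → B (suc m) + e (suc m) ≡ a (suc m)
  B+e≡a m = +-suc (B (suc m)) (m * B (suc m))

  r : ℕ → ℕ → ℕ
  r n τ = pred (2 ^ (τ * e n))

  suc-r : ∀ n τ → suc (r n τ) ≡ 2 ^ (τ * e n)
  suc-r n τ = suc-pred (2 ^ (τ * e n)) {{m^n≢0 2 (τ * e n)}}

  density : ℕ → ℕ
  density n = 2 * (suc (a n) * suc (6 * A n))

  threshold : ℕ → ℕ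
  threshold n = density n * density n + (3 + n + (3 + n + 7))

  2^B*2^e : ∀ m τ → 2 ^ (τ * B (suc m)) * 2 ^ (τ * e (suc m)) ≡ 2 ^ (τ * a (suc m))
  2^B*2^e m τ = trans (2^-* (τ * B (suc m)) (τ * e (suc m)))
    (cong (2 ^_) (trans (sym (*-distribˡ-+ τ (B (suc m)) (e (suc m)))) (cong (τ *_) (B+e≡a m))))

  k*b : ∀ m τ c → c * suc (r (suc m) τ) * 2 ^ (τ * B (suc m)) ≡ c * 2 ^ (τ * a (suc m))
  k*b m τ c = begin
    c * suc (r (suc m) τ) * b ≡⟨ cong (λ z → c * z * b) (suc-r (suc m) τ) ⟩
    c * 2 ^ (τ * e (suc m)) * b ≡⟨ solve 3 (λ c x b → c :* x :* b := c :* (b :* x)) refl c (2 ^ (τ * e (suc m))) b ⟩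
    c * (b * 2 ^ (τ * e (suc m))) ≡⟨ cong (c *_) (2^B*2^e m τ) ⟩
    c * 2 ^ (τ * a (suc m)) ∎
    where
    open ≡-Reasoning
    open +-*-Solver
    b = 2 ^ (τ * B (suc m))

  three-k : ∀ n τ {l} → l ≤ k n (r n τ) → k n (r n τ) + l + l ≤ 6 * A n * suc (r n τ)
  three-k n τ {l} l≤k = ≤-trans (+-mono-≤ (+-monoʳ-≤ (k n (r n τ)) l≤k) l≤k)
    (≤-reflexive (solve 2 (λ A r → (A :+ A) :* r :+ (A :+ A) :* r :+ (A :+ A) :* r := con 6 :* A :* r) refl (A n) (suc (r n τ))))
    where open +-*-Solver

  buildSets : ∀ m τ l → threshold (suc m) ≤ τ → l ≤ k (suc m) (r (suc m) τ) →
              ThreeSmoothSets (2 ^ (τ * B (suc m))) (k (suc m) (r (suc m) τ)) l (2 ^ (τ * a (suc m))) (2 ^ (τ * A (suc m)))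
  buildSets m τ l τ₀≤τ l≤k = subst (λ h → ThreeSmoothSets (2 ^ (τ * B n)) (k n (r n τ)) l lo (2 ^ h)) (sym (*-suc τ (a n)))
    (threeSmoothSets (2 ^ (τ * B n)) (k n (r n τ)) l lo hi (primesBetween lo hi)
      (primesBetween-unique lo hi)
      (All.tabulate (proj₁ ∘ ∈-primesBetween⁻ {lo} {hi}))
      (All.tabulate (λ p∈ → proj₁ (proj₂ (∈-primesBetween⁻ {lo} {hi} p∈))))
      (All.tabulate (λ p∈ → proj₂ (proj₂ (∈-primesBetween⁻ {lo} {hi} p∈))))
      (begin
        (k n (r n τ) + l + l) * 2 ^ (τ * B n) ≤⟨ *-monoˡ-≤ (2 ^ (τ * B n)) (three-k n τ l≤k) ⟩
        6 * A n * suc (r n τ) * 2 ^ (τ * B n) ≡⟨ k*b m τ (6 * A n) ⟩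
        6 * A n * lo ≤⟨ many-primes (a n) (6 * A n) τ 0<τ C*τ≤ ⟩
        length (primesBetween lo hi) ∎))
    where
    open ≤-Reasoning
    n = suc m
    C = density n
    lo = 2 ^ (τ * a n)
    hi = 2 ^ (τ + τ * a n)
    0<τ : 0 < τ
    0<τ = ≤-trans (≤-trans (s≤s z≤n) (m≤n+m (3 + n + (3 + n + 7)) (C * C))) τ₀≤τ
    C*τ≤ : 2 * ((τ + τ * a n) * suc (6 * A n)) ≤ 2 ^ τ
    C*τ≤ = subst (_≤ 2 ^ τ)
      (solve 3 (λ τ a c → con 2 :* ((con 1 :+ a) :* c) :* τ := con 2 :* ((τ :+ τ :* a) :* c)) refl τ (a n) (suc (6 * A n)))
      (c*n≤2^n C τ (≤-trans (m≤m+n (C * C) _) τ₀≤τ))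
      where open +-*-Solver

  SmallSet : ∀ {n} → Vec ℚ n → ℕ → ℕ → Set
  SmallSet {n} v c τ = Σ[ S ∈ List ℕ ] Unique S × All Prime S × length S ≤ c * 2 ^ (τ * a n) × Solutions v S (2 ^ 2 ^ (τ * e n))

  height : ℕ → ℕ → ℕ
  height n τ = 3 + n + τ * A n * k n (r n τ) + 1

  constant : ∀ {n} → Vec ℚ n → ℕ
  constant {n} v = 6 * A n + (length (primesOf v) + 3 * (3 + n + A n * (A n + A n) + 1))

  height-bound : ∀ m τ → height (suc m) τ ≤ (3 + suc m + A (suc m) * (A (suc m) + A (suc m)) + 1) * 2 ^ (τ * a (suc m))
  height-bound m τ = begin
    3 + n + τ * A n * k n (r n τ) + 1
      ≡⟨ solve 5 (λ n τ A K r → con 3 :+ n :+ τ :* A :* (K :* r) :+ con 1 := (con 3 :+ n :+ con 1) :+ A :* K :* r :* τ) refl n τ (A n) (A n + A n) (suc (r n τ)) ⟩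
    (3 + n + 1) + A n * (A n + A n) * suc (r n τ) * τ
      ≤⟨ +-mono-≤ (m≤m*n (3 + n + 1) (2 ^ (τ * a n)) {{m^n≢0 2 (τ * a n)}})
           (*-monoʳ-≤ (A n * (A n + A n) * suc (r n τ)) (≤-trans (<⇒≤ (n<2^n τ)) (2^-mono (m≤m*n τ (B n))))) ⟩
    (3 + n + 1) * 2 ^ (τ * a n) + A n * (A n + A n) * suc (r n τ) * 2 ^ (τ * B n)
      ≡⟨ cong ((3 + n + 1) * 2 ^ (τ * a n) +_) (k*b m τ (A n * (A n + A n))) ⟩
    (3 + n + 1) * 2 ^ (τ * a n) + A n * (A n + A n) * 2 ^ (τ * a n)
      ≡⟨ solve 3 (λ n A x → (con 3 :+ n :+ con 1) :* x :+ A :* x := (con 3 :+ n :+ A :+ con 1) :* x) refl n (A n * (A n + A n)) (2 ^ (τ * a n)) ⟩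
    (3 + n + A n * (A n + A n) + 1) * 2 ^ (τ * a n) ∎
    where
    open ≤-Reasoning
    open +-*-Solver
    n = suc m

  finish : ∀ {m} (v : Vec ℚ (suc m)) (v≢0 : ∀ i → lookup v i ≢ 0ℚ) τ {l P} (P-primes : All Prime P) →
           l ≤ k (suc m) (r (suc m) τ) → length P ≡ (k (suc m) (r (suc m) τ) + l + l) * 2 ^ (τ * B (suc m)) →
           ∀ ms → length ms ≤ 3 → All (λ x → 0 < x × x ≤ 2 ^ height (suc m) τ) ms →
           Solutions v (PrimeSet.primeSet v v≢0 P P-primes ms) (2 ^ k (suc m) (r (suc m) τ)) →
           SmallSet v (constant v) τ
  finish {m} v v≢0 τ {l} {P} P-primes l≤k lenP ms ms≤3 bounds (xs , u , sol , len) =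
    primeSet ms , primeSet-unique ms , primeSet-prime ms , small , xs , u , sol ,
    ≤-<-trans (2^-mono (≤-trans (≤-reflexive (sym (suc-r n τ))) (m≤n*m (suc (r n τ)) (A n + A n)))) len
    where
    open PrimeSet v v≢0 P P-primes
    open ≤-Reasoning
    n = suc m
    lo = 2 ^ (τ * a n)
    h = 3 + n + A n * (A n + A n) + 1
    small : length (primeSet ms) ≤ constant v * lo
    small = begin
      length (primeSet ms) ≤⟨ length-primeSet {height n τ} {ms} bounds ms≤3 ⟩
      length P + (length (primesOf v) + 3 * height n τ)
        ≤⟨ +-mono-≤ (≤-trans (≤-reflexive lenP) (≤-trans (*-monoˡ-≤ (2 ^ (τ * B n)) (three-k n τ l≤k)) (≤-reflexive (k*b m τ (6 * A n)))))
             (+-mono-≤ (m≤m*n (length (primesOf v)) lo {{m^n≢0 2 (τ * a n)}}) (*-monoʳ-≤ 3 (height-bound m τ))) ⟩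
      6 * A n * lo + (length (primesOf v) * lo + 3 * (h * lo))
        ≡⟨ solve 4 (λ A p h x → A :* x :+ (p :* x :+ con 3 :* (h :* x)) := (A :+ (p :+ con 3 :* h)) :* x) refl (6 * A n) (length (primesOf v)) h lo ⟩
      constant v * lo ∎
      where open +-*-Solver

  module Disjoint {b k l lo hi : ℕ} (T : ThreeSmoothSets b k l lo hi) (0<lo : 0 < lo) where

    open ThreeSmoothSets T public

    P : List ℕ
    P = P₀ ++ P₁ ++ P₂

    module X = SmoothSet X
    module Q₁ = SmoothSet Q₁
    module Q₂ = SmoothSet Q₂

    Q₁-X-coprime : ∀ {q x} → q ∈ Q₁.elements → x ∈ X.elements → Coprime q x
    Q₁-X-coprime q∈ x∈ = coprime-smooth X Q₁ 0<lo (λ r∈ r∈′ → unique-++-disjoint P₀ all-unique r∈ (∈-++⁺ˡ r∈′)) x∈ q∈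

    Q₂-X-coprime : ∀ {q x} → q ∈ Q₂.elements → x ∈ X.elements → Coprime q x
    Q₂-X-coprime q∈ x∈ = coprime-smooth X Q₂ 0<lo (λ r∈ r∈′ → unique-++-disjoint P₀ all-unique r∈ (∈-++⁺ʳ P₁ r∈′)) x∈ q∈

    Q₂-Q₁-coprime : ∀ {q₁ q₂} → q₁ ∈ Q₁.elements → q₂ ∈ Q₂.elements → Coprime q₂ q₁
    Q₂-Q₁-coprime q₁∈ q₂∈ = coprime-smooth Q₁ Q₂ 0<lo (unique-++-disjoint P₁ (unique-++ʳ P₀ all-unique)) q₁∈ q₂∈

    X-primes : ∀ {x} → x ∈ X.elements → ∀ r → Prime r → r ∣ x → r ∈ P
    X-primes x∈ r pr r∣ = ∈-++⁺ˡ (X.primes x∈ r pr r∣)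

    Q₁-primes : ∀ {q} → q ∈ Q₁.elements → ∀ r → Prime r → r ∣ q → r ∈ P
    Q₁-primes q∈ r pr r∣ = ∈-++⁺ʳ P₀ (∈-++⁺ˡ (Q₁.primes q∈ r pr r∣))

    Q₂-primes : ∀ {q} → q ∈ Q₂.elements → ∀ r → Prime r → r ∣ q → r ∈ P
    Q₂-primes q∈ r pr r∣ = ∈-++⁺ʳ P₀ (∈-++⁺ʳ P₁ (Q₂.primes q∈ r pr r∣))

  Outcome : ∀ {n} (v : Vec ℚ n) (v≢0 : ∀ i → lookup v i ≢ 0ℚ) (P : List ℕ) (P-primes : All Prime P) → ℕ → ℕ → Set
  Outcome v v≢0 P P-primes h c = Σ[ ms ∈ List ℕ ] length ms ≤ 3 × All (λ x → 0 < x × x ≤ 2 ^ h) ms ×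
    Solutions v (PrimeSet.primeSet v v≢0 P P-primes ms) c

  module _ {b k l lo hi : ℕ} (T : ThreeSmoothSets b k l lo hi) (0<lo : 0 < lo) (j h H c : ℕ) (2*H≤ : 2 * H ≤ 2 ^ h) where

    private
      module D = Disjoint T 0<lo

    even-outcome : (v : Vec ℚ (suc j + suc j)) (v≢0 : ∀ i → lookup v i ≢ 0ℚ) →
                   PopularQuotient D.X.elements D.Q₁.elements j H c → Outcome v v≢0 D.P D.all-prime h c
    even-outcome v v≢0 (m , m≢0 , m≤ , cs , u , c< , cs⁻) = ms , s≤s z≤n ,
      (∣∣>0 m≢0 , ≤-trans m≤ (≤-trans (m≤m+n H _) 2*H≤)) ∷ [] ,
      even-solutions D.X.elements j (primeSet ms) (λ x∈ r pr r∣ → P⊆ ms (D.X-primes x∈ r pr r∣))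
        D.Q₁.elements (λ q∈ r pr r∣ → P⊆ ms (D.Q₁-primes q∈ r pr r∣)) (D.Q₁.positive 0<lo)
        (λ {q} {x} → D.Q₁-X-coprime {q} {x}) m m≢0 (ms-primes ms (here refl) (∣∣>0 m≢0)) c cs u c< cs⁻ v v≢0 (coefficients ms)
      where
      open PrimeSet v v≢0 D.P D.all-prime
      ms = ℤ.∣ m ∣ ∷ []

    odd-elements : 2 ≤ lo → ∀ {P′} (Q : SmoothSet P′ b l lo hi) → (∀ {p} → p ∈ P′ → p ∈ D.P) →
                   ∀ {q} → q ∈ SmoothSet.elements Q → ¬ 2 ∣ q
    odd-elements 2≤lo Q P′⊆ q∈ 2∣q = <⇒≱ (All.lookup D.all-large (P′⊆ (SmoothSet.primes Q q∈ 2 prime[2] 2∣q))) 2≤lo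

    padded-outcome : (v : Vec ℚ (suc (suc j + suc j))) (v≢0 : ∀ i → lookup v i ≢ 0ℚ) → 2 ≤ lo →
      ∀ {P′} (Q : SmoothSet P′ b l lo hi) → (∀ {p} → p ∈ P′ → p ∈ D.P) →
      (∀ {q x} → q ∈ SmoothSet.elements Q → x ∈ D.X.elements → Coprime q x) →
      PopularQuotient D.X.elements (SmoothSet.elements Q) j H c → Outcome v v≢0 D.P D.all-prime h c
    padded-outcome v v≢0 2≤lo Q P′⊆ cop (m , m≢0 , m≤ , cs , u , c< , cs⁻) = ms , ≤-refl ,
      (∣∣>0 m≢0 , ≤-trans (m≤m+n ℤ.∣ m ∣ _) 2m≤) ∷ (z<s , L≤) ∷ (0<L′ , ≤-trans (n≤1+n L′) L≤) ∷ [] ,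
      padded-solutions D.X.elements j (primeSet ms) (λ x∈ r pr r∣ → P⊆ ms (D.X-primes x∈ r pr r∣))
        (SmoothSet.elements Q) (λ q∈ r pr r∣ → P⊆ ms (P′⊆ (SmoothSet.primes Q q∈ r pr r∣))) (SmoothSet.positive Q 0<lo)
        (λ {q} {x} → cop {q} {x}) m m≢0 (ms-primes ms (here refl) (∣∣>0 m≢0)) c cs u c< cs⁻
        L′ L≡ (odd-elements 2≤lo Q P′⊆) (ms-primes ms (there (here refl)) z<s) (ms-primes ms (there (there (here refl))) 0<L′)
        v v≢0 (coefficients ms)
      where
      open PrimeSet v v≢0 D.P D.all-prime
      L′ = pred (2 * ℤ.∣ m ∣)
      2≤2m : 2 ≤ 2 * ℤ.∣ m ∣
      2≤2m = *-monoʳ-≤ 2 (∣∣>0 m≢0)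
      L≡ : suc L′ ≡ 2 * ℤ.∣ m ∣
      L≡ = suc-pred (2 * ℤ.∣ m ∣) {{>-nonZero (<⇒≤ 2≤2m)}}
      0<L′ : 0 < L′
      0<L′ = s≤s⁻¹ (subst (2 ≤_) (sym L≡) 2≤2m)
      ms = ℤ.∣ m ∣ ∷ suc L′ ∷ L′ ∷ []
      2m≤ : 2 * ℤ.∣ m ∣ ≤ 2 ^ h
      2m≤ = ≤-trans (*-monoʳ-≤ 2 m≤) 2*H≤
      L≤ : suc L′ ≤ 2 ^ h
      L≤ = ≤-trans (≤-reflexive L≡) 2m≤

    shifted-outcome : (v : Vec ℚ (suc (suc j + suc j))) (v≢0 : ∀ i → lookup v i ≢ 0ℚ) → ∀ {M} → M ≤ 2 ^ h →
      PopularShift D.X.elements D.Q₁.elements D.Q₂.elements j M c → Outcome v v≢0 D.P D.all-prime h c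
    shifted-outcome v v≢0 M≤ (m₁ , m₂ , m₁≤ , m₂≤ , cs , u , c< , cs⁻) = ms , s≤s (s≤s z≤n) ,
      (∣∣>0 m₁≢0 , ≤-trans m₁≤ M≤) ∷ (∣∣>0 m₂≢0 , ≤-trans m₂≤ M≤) ∷ [] ,
      odd-solutions D.X.elements j (primeSet ms) (λ x∈ r pr r∣ → P⊆ ms (D.X-primes x∈ r pr r∣))
        D.Q₁.elements D.Q₂.elements (λ q∈ r pr r∣ → P⊆ ms (D.Q₁-primes q∈ r pr r∣)) (λ q∈ r pr r∣ → P⊆ ms (D.Q₂-primes q∈ r pr r∣))
        (D.Q₂.positive 0<lo) (λ {q} {x} → D.Q₂-X-coprime {q} {x}) m₁ m₂
        (ms-primes ms (here refl) (∣∣>0 m₁≢0)) (ms-primes ms (there (here refl)) (∣∣>0 m₂≢0)) c cs u c< cs⁻ v v≢0 (coefficients ms)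
      where
      open PrimeSet v v≢0 D.P D.all-prime
      ms = ℤ.∣ m₁ ∣ ∷ ℤ.∣ m₂ ∣ ∷ []
      member : ∃[ p ] p ∈ cs
      member = 0<length⇒∈ (≤-<-trans z≤n c<)
      m₁≢0 : m₁ ≢ 0ℤ
      m₁≢0 eq with member
      ... | ((q₁ , q₂) , y) , p∈ with cs⁻ p∈
      ...   | _ , _ , _ , _ , _ , ub = ub ⊥ (trans (Σ∈-⊥ y) (sym (trans (cong (ℤ.+ q₁ ℤ.*_) eq) (ℤₚ.*-zeroʳ (ℤ.+ q₁)))))
      m₂≢0 : m₂ ≢ 0ℤ
      m₂≢0 eq with member
      ... | ((q₁ , q₂) , y) , p∈ with cs⁻ p∈
      ...   | _ , _ , _ , tot , _ , ub = ub ⊤ (trans tot (trans (cong (λ z → ℤ.+ q₁ ℤ.* m₁ ℤ.+ z) (trans (cong (ℤ.+ q₂ ℤ.*_) eq) (ℤₚ.*-zeroʳ (ℤ.+ q₂)))) (ℤₚ.+-identityʳ _)))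

  2^-double : ∀ {g x ρ} → ρ ≤ x → 2 * 2 ^ (g + ρ) ≤ 2 ^ (g + x + 1)
  2^-double {g} {x} {ρ} ρ≤x = ≤-trans (*-monoʳ-≤ 2 (2^-mono (+-monoʳ-≤ g ρ≤x))) (≤-reflexive (cong (2 ^_) (+-comm 1 (g + x))))

  module _ (j τ g A B a k l : ℕ) (A≡ : A ≡ suc a) (T : ThreeSmoothSets (2 ^ (τ * B)) k l (2 ^ (τ * a)) (2 ^ (τ * A))) where

    private
      open module T = ThreeSmoothSets T
      0<lo : 0 < 2 ^ (τ * a)
      0<lo = m^n>0 2 (τ * a)
      x = τ * A * k
      P = P₀ ++ P₁ ++ P₂

    even-case : (v : Vec ℚ (suc j + suc j)) (v≢0 : ∀ i → lookup v i ≢ 0ℚ) → suc j + suc j ≤ 2 ^ g →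
      B * k ≡ A * l + A → 1 + l + 3 * k ≤ B * l → A ≡ 2 + (suc j + suc j) * B → l ≤ k → 1 ≤ B → g + 4 ≤ τ →
      Outcome v v≢0 P all-prime (g + x + 1) (2 ^ k)
    even-case v v≢0 d≤ h₁ h₂ h₃ h₄ h₅ h₆ = go (even-count j τ g A B a k l A≡ X Q₁ d≤ h₁ h₂ h₃ h₄ h₅ h₆)
      where
      go : ∃[ ρ ] ρ ≤ x × PopularQuotient (SmoothSet.elements X) (SmoothSet.elements Q₁) j (2 ^ (g + ρ)) (2 ^ k) →
           Outcome v v≢0 P all-prime (g + x + 1) (2 ^ k)
      go (ρ , ρ≤ , pq) = even-outcome T 0<lo j (g + x + 1) (2 ^ (g + ρ)) (2 ^ k) (2^-double {g} ρ≤) v v≢0 pq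

    odd-case : (v : Vec ℚ (suc (suc j + suc j))) (v≢0 : ∀ i → lookup v i ≢ 0ℚ) → ∀ k′ → k ≡ l + k′ → 3 + (suc j + suc j) ≤ 2 ^ g →
      A * k′ ≤ a * l → 1 ≤ a → g + (g + 7) ≤ τ →
      A * k + 2 * A ≡ B * k + 2 * (A * k′) → (B + 3) * k + 1 ≤ 2 * (B * l) →
      1 + (suc j + suc j) + A * k + k ≤ 2 * (B * l) + 2 * (A * k′) →
      1 + (suc j + suc j) + 2 * (A * k) + k ≤ B * l + B * k * (suc j + suc j) + 2 * (A * k′) + a * l →
      A ≡ 2 + suc (suc j + suc j) * B → 1 ≤ B →
      Outcome v v≢0 P all-prime (g + x + 1) (2 ^ k)
    odd-case v v≢0 k′ k≡ d≤ shift 1≤a g≤τ h₁ h₂ h₃ h₄ h₅ h₆ =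
      go (odd-count j τ g A B a k l k′ A≡ k≡ X Q₁ Q₂ (Disjoint.Q₂-Q₁-coprime T 0<lo) d≤ shift 1≤a g≤τ h₁ h₂ h₃ h₄ h₅ h₆)
      where
      2≤lo : 2 ≤ 2 ^ (τ * a)
      2≤lo = 2^-mono {1} (*-mono-≤ (≤-trans (≤-trans (s≤s z≤n) (≤-trans (m≤n+m 7 g) (m≤n+m (g + 7) g))) g≤τ) 1≤a)
      μ≤ : τ * A * k′ ≤ g + x + 1
      μ≤ = ≤-trans (*-monoʳ-≤ (τ * A) (≤-trans (m≤n+m k′ l) (≤-reflexive (sym k≡)))) (≤-trans (m≤n+m x g) (m≤m+n (g + x) 1))
      go : (∃[ ρ ] ρ ≤ x × PopularQuotient (SmoothSet.elements X) (SmoothSet.elements Q₁) j (2 ^ (g + ρ)) (2 ^ k))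
            ⊎ (∃[ ρ ] ρ ≤ x × PopularQuotient (SmoothSet.elements X) (SmoothSet.elements Q₂) j (2 ^ (g + ρ)) (2 ^ k))
            ⊎ PopularShift (SmoothSet.elements X) (SmoothSet.elements Q₁) (SmoothSet.elements Q₂) j (2 ^ (τ * A * k′)) (2 ^ k) →
           Outcome v v≢0 P all-prime (g + x + 1) (2 ^ k)
      go (inj₁ (ρ , ρ≤ , pq)) = padded-outcome T 0<lo j (g + x + 1) (2 ^ (g + ρ)) (2 ^ k) (2^-double {g} ρ≤) v v≢0 2≤lo
        Q₁ (λ p∈ → ∈-++⁺ʳ P₀ (∈-++⁺ˡ p∈)) (λ {q} {x} → Disjoint.Q₁-X-coprime T 0<lo {q} {x}) pq
      go (inj₂ (inj₁ (ρ , ρ≤ , pq))) = padded-outcome T 0<lo j (g + x + 1) (2 ^ (g + ρ)) (2 ^ k) (2^-double {g} ρ≤) v v≢0 2≤lo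
        Q₂ (λ p∈ → ∈-++⁺ʳ P₀ (∈-++⁺ʳ P₁ p∈)) (λ {q} {x} → Disjoint.Q₂-X-coprime T 0<lo {q} {x}) pq
      go (inj₂ (inj₂ ps)) = shifted-outcome T 0<lo j (g + x + 1) (2 ^ (g + 0)) (2 ^ k) (2^-double {g} z≤n) v v≢0 (2^-mono μ≤) ps

  finish-outcome : ∀ {m} (v : Vec ℚ (suc m)) (v≢0 : ∀ i → lookup v i ≢ 0ℚ) τ {l P} (P-primes : All Prime P) →
    l ≤ k (suc m) (r (suc m) τ) → length P ≡ (k (suc m) (r (suc m) τ) + l + l) * 2 ^ (τ * B (suc m)) →
    Outcome v v≢0 P P-primes (height (suc m) τ) (2 ^ k (suc m) (r (suc m) τ)) → SmallSet v (constant v) τ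
  finish-outcome v v≢0 τ P-primes l≤k lenP (ms , ms≤3 , bounds , sols) = finish v v≢0 τ P-primes l≤k lenP ms ms≤3 bounds sols

  A≡ : ∀ n → A n ≡ 2 + n * B n
  A≡ n = refl

  threshold-g : ∀ n τ → threshold n ≤ τ → 3 + n + (3 + n + 7) ≤ τ
  threshold-g n τ h = ≤-trans (m≤n+m (3 + n + (3 + n + 7)) (density n * density n)) h

  even-sets : ∀ j (v : Vec ℚ (suc j + suc j)) → (∀ i → lookup v i ≢ 0ℚ) → ∀ τ → threshold (suc j + suc j) ≤ τ →
              SmallSet v (constant v) τ
  even-sets j v v≢0 τ τ₀≤τ = finish-outcome v v≢0 τ (ThreeSmoothSets.all-prime T) l≤k (ThreeSmoothSets.all-length T)
    (even-case j τ (3 + n) (A n) (B n) (a n) (k n R) (lᵉ n R) refl T v v≢0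
      (≤-trans (m≤n+m n 3) (<⇒≤ (n<2^n (3 + n))))
      (sym (subst (λ n → A n * lᵉ n R + A n ≡ B n * k n R) n≡ (even-collision (j + j) R)))
      (subst (λ n → 1 + lᵉ n R + 3 * k n R ≤ B n * lᵉ n R) n≡ (even-gain (j + j) R))
      (A≡ n) l≤k (s≤s z≤n) g≤τ)
    where
    n = suc j + suc j
    R = r n τ
    n≡ : 2 + (j + j) ≡ n
    n≡ = cong suc (sym (+-suc j j))
    l≤k : lᵉ n R ≤ k n R
    l≤k = subst (λ n → lᵉ n R ≤ k n R) n≡ (even-l≤k (j + j) R)
    g≤τ : 3 + n + 4 ≤ τ
    g≤τ = ≤-trans (+-monoʳ-≤ (3 + n) (≤-trans (m≤n+m 4 3) (m≤n+m 7 (3 + n)))) (threshold-g n τ τ₀≤τ)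
    T : ThreeSmoothSets (2 ^ (τ * B n)) (k n R) (lᵉ n R) (2 ^ (τ * a n)) (2 ^ (τ * A n))
    T = buildSets (j + suc j) τ (lᵉ n R) τ₀≤τ l≤k

  odd-sets : ∀ j (v : Vec ℚ (suc (suc j + suc j))) → (∀ i → lookup v i ≢ 0ℚ) → ∀ τ → threshold (suc (suc j + suc j)) ≤ τ →
             SmallSet v (constant v) τ
  odd-sets j v v≢0 τ τ₀≤τ = finish-outcome v v≢0 τ (ThreeSmoothSets.all-prime T) l≤k (ThreeSmoothSets.all-length T)
    (odd-case j τ (3 + n) (A n) (B n) (a n) (k n R) (lᵒ n R) refl T v v≢0 (kᵒ n R) k≡
      (≤-trans (n≤1+n (2 + n)) (<⇒≤ (n<2^n (3 + n))))
      (subst (λ n → A n * kᵒ n R ≤ a n * lᵒ n R) n≡ (odd-shift (j + j) R)) (s≤s z≤n)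
      (threshold-g n τ τ₀≤τ)
      (subst (λ n → A n * k n R + 2 * A n ≡ B n * k n R + 2 * (A n * kᵒ n R)) n≡ (odd-collision (j + j) R))
      (subst (λ n → (B n + 3) * k n R + 1 ≤ 2 * (B n * lᵒ n R)) n≡ (odd-gain (j + j) R))
      (subst (λ n → 1 + pred n + A n * k n R + k n R ≤ 2 * (B n * lᵒ n R) + 2 * (A n * kᵒ n R)) n≡ (odd-divisors (j + j) R))
      (subst (λ n → 1 + pred n + 2 * (A n * k n R) + k n R ≤ B n * lᵒ n R + B n * k n R * pred n + 2 * (A n * kᵒ n R) + a n * lᵒ n R) n≡ (odd-zero (j + j) R))
      (A≡ n) (s≤s z≤n))
    where
    n = suc (suc j + suc j)
    R = r n τ
    n≡ : 3 + (j + j) ≡ n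
    n≡ = cong (2 +_) (sym (+-suc j j))
    k≡ : k n R ≡ lᵒ n R + kᵒ n R
    k≡ = subst (λ n → k n R ≡ lᵒ n R + kᵒ n R) n≡ (odd-k (j + j) R)
    l≤k : lᵒ n R ≤ k n R
    l≤k = ≤-trans (m≤m+n (lᵒ n R) (kᵒ n R)) (≤-reflexive (sym k≡))
    T : ThreeSmoothSets (2 ^ (τ * B n)) (k n R) (lᵒ n R) (2 ^ (τ * a n)) (2 ^ (τ * A n))
    T = buildSets (suc j + suc j) τ (lᵒ n R) τ₀≤τ l≤k

  halve : ∀ n → 2 ≤ n → ∃[ j ] (n ≡ suc j + suc j ⊎ n ≡ suc (suc j + suc j))
  halve 1 (s≤s ())
  halve 2 _ = 0 , inj₁ refl
  halve 3 _ = 0 , inj₂ refl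
  halve (suc (suc n@(suc (suc _)))) _ with halve n (s≤s (s≤s z≤n))
  ... | j , inj₁ eq = suc j , inj₁ (trans (cong (2 +_) eq) (cong (2 +_) (sym (+-suc j (suc j)))))
  ... | j , inj₂ eq = suc j , inj₂ (trans (cong (2 +_) eq) (cong (3 +_) (sym (+-suc j (suc j)))))

  small-sets : ∀ n → 2 ≤ n → (v : Vec ℚ n) → (∀ i → lookup v i ≢ 0ℚ) → ∀ τ → threshold n ≤ τ → SmallSet v (constant v) τ
  small-sets n 2≤n v v≢0 τ = by-parity (halve n 2≤n) v v≢0 τ
    where
    by-parity : ∀ {n} → ∃[ j ] (n ≡ suc j + suc j ⊎ n ≡ suc (suc j + suc j)) →
                (v : Vec ℚ n) → (∀ i → lookup v i ≢ 0ℚ) → ∀ τ → threshold n ≤ τ → SmallSet v (constant v) τ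
    by-parity (j , inj₁ refl) = even-sets j
    by-parity (j , inj₂ refl) = odd-sets j

module RealBound where

  open import Data.Integer.Base as ℤ using (+_)
  open import Data.Bool.Base using (true; false; if_then_else_)
  open import Data.Nat.Base as ℕ using (ℕ; zero; suc; s≤s; z≤n)
  import Data.Nat.Properties as ℕₚ
  import Data.Nat.Divisibility as ℕ∣
  import Data.Integer.Properties as ℤₚ
  open import Data.Product.Base using (_,_; ∃-syntax; proj₁; proj₂)
  open import Data.Rational using (ℚ; mkℚ; _+_; _*_; _-_; -_; _/_; 1/_; ∣_∣; _≤_; _<_; 0ℚ; 1ℚ; ½; *≤*; *<*; nonNegative; positive; ≢-nonZero; +-*-rawSemiring)
  open import Data.Rational.Properties
  import Data.Nat.Solver
  open import Data.Rational.Solver using (module +-*-Solver)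
  open import Data.Sum.Base using (inj₁; inj₂)
  open import Function.Base using (_∘_)
  open import Relation.Binary.PropositionalEquality
  open import Relation.Nullary using (¬_; does; contradiction)
  open import Relation.Nullary.Decidable using (dec-true; dec-false)
  open Solutions using (ι; ι-/; ι-+; ι-*; invℚ≡1/)
  open import Defs

  open import Algebra.Definitions.RawSemiring +-*-rawSemiring using (_^_)
  module ℕSolver = Data.Nat.Solver.+-*-Solver

  open +-*-Solver using (solve; _:=_; _:+_; _:*_; _:-_; :-_; con)

  ≤-by : ∀ p q r → 0ℚ ≤ r → p + r ≡ q → p ≤ q
  ≤-by p q r 0≤r eq = subst₂ _≤_ (+-identityʳ p) eq (+-monoʳ-≤ p 0≤r)

  0≤-diff : ∀ p q → p ≤ q → 0ℚ ≤ q - p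
  0≤-diff p q p≤q = subst (_≤ q - p) (+-inverseʳ p) (+-monoˡ-≤ (- p) p≤q)

  *-nonNeg : ∀ p q → 0ℚ ≤ p → 0ℚ ≤ q → 0ℚ ≤ p * q
  *-nonNeg p q 0≤p 0≤q = nonNegative⁻¹ (p * q) {{nonNeg*nonNeg⇒nonNeg p {{nonNegative 0≤p}} q {{nonNegative 0≤q}}}}

  *-mono-≤ : ∀ p q r s → 0ℚ ≤ q → 0ℚ ≤ r → p ≤ q → r ≤ s → p * r ≤ q * s
  *-mono-≤ p q r s 0≤q 0≤r p≤q r≤s = ≤-trans (*-monoʳ-≤-nonNeg r {{nonNegative 0≤r}} p≤q) (*-monoˡ-≤-nonNeg q {{nonNegative 0≤q}} r≤s)

  0≤1 : 0ℚ ≤ 1ℚ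
  0≤1 = *≤* (ℤ.+≤+ z≤n)

  0≤½ : 0ℚ ≤ ½
  0≤½ = *≤* (ℤ.+≤+ z≤n)

  0<1 : 0ℚ < 1ℚ
  0<1 = *<* (ℤ.+<+ (s≤s z≤n))

  ^-nonNeg : ∀ p k → 0ℚ ≤ p → 0ℚ ≤ p ^ k
  ^-nonNeg p zero 0≤p = 0≤1
  ^-nonNeg p (suc k) 0≤p = *-nonNeg p (p ^ k) 0≤p (^-nonNeg p k 0≤p)

  ^-mono : ∀ p q k → 0ℚ ≤ p → p ≤ q → p ^ k ≤ q ^ k
  ^-mono p q zero 0≤p p≤q = ≤-refl
  ^-mono p q (suc k) 0≤p p≤q = *-mono-≤ p q (p ^ k) (q ^ k) (≤-trans 0≤p p≤q) (^-nonNeg p k 0≤p) p≤q (^-mono p q k 0≤p p≤q)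

  ∣^∣ : ∀ p k → ∣ p ^ k ∣ ≡ ∣ p ∣ ^ k
  ∣^∣ p zero = refl
  ∣^∣ p (suc k) = trans (∣p*q∣≡∣p∣*∣q∣ p (p ^ k)) (cong (∣ p ∣ *_) (∣^∣ p k))

  fromℕ≡ι : ∀ n → fromℕ n ≡ ι (+ n)
  fromℕ≡ι n = ι-/ (+ n)

  fromℕ-+ : ∀ m n → fromℕ (m ℕ.+ n) ≡ fromℕ m + fromℕ n
  fromℕ-+ m n = trans (fromℕ≡ι (m ℕ.+ n)) (trans (ι-+ (+ m) (+ n)) (sym (cong₂ _+_ (fromℕ≡ι m) (fromℕ≡ι n))))

  fromℕ-* : ∀ m n → fromℕ (m ℕ.* n) ≡ fromℕ m * fromℕ n
  fromℕ-* m n = trans (fromℕ≡ι (m ℕ.* n)) (trans (cong ι (ℤₚ.pos-* m n)) (trans (ι-* (+ m) (+ n)) (sym (cong₂ _*_ (fromℕ≡ι m) (fromℕ≡ι n)))))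

  fromℕ-mono : ∀ {m n} → m ℕ.≤ n → fromℕ m ≤ fromℕ n
  fromℕ-mono {m} {n} m≤n = subst₂ _≤_ (sym (fromℕ≡ι m)) (sym (fromℕ≡ι n))
    (*≤* (ℤₚ.*-monoʳ-≤-nonNeg (+ 1) (ℤ.+≤+ m≤n)))

  fromℕ-nonNeg : ∀ n → 0ℚ ≤ fromℕ n
  fromℕ-nonNeg n = fromℕ-mono {0} {n} z≤n

  fromℕ-pos : ∀ n → 0ℚ < fromℕ (suc n)
  fromℕ-pos n = <-≤-trans 0<1 (fromℕ-mono {1} {suc n} (s≤s z≤n))

  invℚ-inverse : ∀ p → 0ℚ < p → invℚ p * p ≡ 1ℚ
  invℚ-inverse p 0<p = trans (cong (_* p) (invℚ≡1/ p≢0)) (*-inverseˡ p {{≢-nonZero p≢0}})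
    where
    p≢0 : p ≢ 0ℚ
    p≢0 eq = <⇒≢ 0<p (sym eq)

  inverse-nonNeg : ∀ p i → 0ℚ < p → i * p ≡ 1ℚ → 0ℚ ≤ i
  inverse-nonNeg p i 0<p eq = *-cancelʳ-≤-pos p {{positive 0<p}} (subst₂ _≤_ (sym (*-zeroˡ p)) (sym eq) 0≤1)

  recip : ℕ → ℚ
  recip n = invℚ (fromℕ n)

  recip-inverse : ∀ n → recip (suc n) * fromℕ (suc n) ≡ 1ℚ
  recip-inverse n = invℚ-inverse (fromℕ (suc n)) (fromℕ-pos n)

  recip-nonNeg : ∀ n → 0ℚ ≤ recip (suc n)
  recip-nonNeg n = inverse-nonNeg (fromℕ (suc n)) (recip (suc n)) (fromℕ-pos n) (recip-inverse n)

  inverse-unique : ∀ p i j → i * p ≡ 1ℚ → j * p ≡ 1ℚ → i ≡ j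
  inverse-unique p i j ip jp = begin
    i ≡⟨ *-identityʳ i ⟨
    i * 1ℚ ≡⟨ cong (i *_) jp ⟨
    i * (j * p) ≡⟨ solve 3 (λ i j p → i :* (j :* p) := j :* (i :* p)) refl i j p ⟩
    j * (i * p) ≡⟨ cong (j *_) ip ⟩
    j * 1ℚ ≡⟨ *-identityʳ j ⟩
    j ∎
    where open ≡-Reasoning

  1/n*n≡1 : ∀ n → (+ 1 / suc n) * fromℕ (suc n) ≡ 1ℚ
  1/n*n≡1 n = trans (cong₂ _*_ (↥p/↧p≡p (1/ ι (+ suc n))) (fromℕ≡ι (suc n))) (*-inverseˡ (ι (+ suc n)))

  1/n-nonNeg : ∀ n → 0ℚ ≤ + 1 / suc n
  1/n-nonNeg n = inverse-nonNeg (fromℕ (suc n)) (+ 1 / suc n) (fromℕ-pos n) (1/n*n≡1 n)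

  module Series (c : ℕ → ℚ) (0≤c : ∀ k → 0ℚ ≤ c k) where

    partialSum-nonNeg : ∀ t m → 0ℚ ≤ t → 0ℚ ≤ partialSum c t m
    partialSum-nonNeg t zero 0≤t = ≤-refl
    partialSum-nonNeg t (suc m) 0≤t = +-mono-≤ (partialSum-nonNeg t m 0≤t) (*-nonNeg (c m) (t ^ m) (0≤c m) (^-nonNeg t m 0≤t))

    ∣partialSum∣≤ : ∀ t m → ∣ partialSum c t m ∣ ≤ partialSum c ∣ t ∣ m
    ∣partialSum∣≤ t zero = ≤-refl
    ∣partialSum∣≤ t (suc m) = ≤-trans (∣p+q∣≤∣p∣+∣q∣ (partialSum c t m) (c m * t ^ m))
      (+-mono-≤ (∣partialSum∣≤ t m) (≤-reflexive (trans (∣p*q∣≡∣p∣*∣q∣ (c m) (t ^ m))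
        (cong₂ _*_ (0≤p⇒∣p∣≡p (0≤c m)) (∣^∣ t m)))))

    partialSum-mono : ∀ t u m → 0ℚ ≤ t → t ≤ u → partialSum c t m ≤ partialSum c u m
    partialSum-mono t u zero 0≤t t≤u = ≤-refl
    partialSum-mono t u (suc m) 0≤t t≤u = +-mono-≤ (partialSum-mono t u m 0≤t t≤u)
      (*-monoˡ-≤-nonNeg (c m) {{nonNegative (0≤c m)}} (^-mono t u m 0≤t t≤u))

    partialSum-extend : ∀ t m j → 0ℚ ≤ t → partialSum c t m ≤ partialSum c t (j ℕ.+ m)
    partialSum-extend t m zero 0≤t = ≤-refl
    partialSum-extend t m (suc j) 0≤t = ≤-trans (partialSum-extend t m j 0≤t)
      (≤-by (partialSum c t (j ℕ.+ m)) (partialSum c t (suc j ℕ.+ m)) (c (j ℕ.+ m) * t ^ (j ℕ.+ m)) (*-nonNeg (c (j ℕ.+ m)) (t ^ (j ℕ.+ m)) (0≤c (j ℕ.+ m)) (^-nonNeg t (j ℕ.+ m) 0≤t)) refl)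

  power-difference : ∀ x h k → 0ℚ ≤ x → 0ℚ ≤ h → (x + h) ^ suc k ≤ x ^ suc k + fromℕ (suc k) * (h * (x + h) ^ k)
  power-difference x h zero 0≤x 0≤h = ≤-reflexive (solve 2 (λ x h → (x :+ h) :* con 1ℚ := x :* con 1ℚ :+ con 1ℚ :* (h :* con 1ℚ)) refl x h)
  power-difference x h (suc k) 0≤x 0≤h = begin
    (x + h) * y^ ≤⟨ +-mono-≤-lemma ⟩
    x * (x ^ suc k + fromℕ (suc k) * (h * y)) + h * y^
      ≤⟨ +-monoˡ-≤ (h * y^) (≤-by (x * (x ^ suc k + fromℕ (suc k) * (h * y))) (x * (x ^ suc k + fromℕ (suc k) * (h * y)) + fromℕ (suc k) * (h * (h * y))) (fromℕ (suc k) * (h * (h * y))) (*-nonNeg (fromℕ (suc k)) (h * (h * y)) (fromℕ-nonNeg (suc k)) (*-nonNeg h (h * y) 0≤h (*-nonNeg h y 0≤h 0≤y))) refl) ⟩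
    x * (x ^ suc k + fromℕ (suc k) * (h * y)) + fromℕ (suc k) * (h * (h * y)) + h * y^
      ≡⟨ solve 5 (λ x h z n y → x :* (z :+ n :* (h :* y)) :+ n :* (h :* (h :* y)) :+ h :* ((x :+ h) :* y) := x :* z :+ (con 1ℚ :+ n) :* (h :* ((x :+ h) :* y))) refl x h (x ^ suc k) (fromℕ (suc k)) y ⟩
    x * x ^ suc k + (1ℚ + fromℕ (suc k)) * (h * y^) ≡⟨ cong (λ n → x * x ^ suc k + n * (h * y^)) (fromℕ-+ 1 (suc k)) ⟨
    x ^ suc (suc k) + fromℕ (suc (suc k)) * (h * y^) ∎
    where
    open ≤-Reasoning
    y = (x + h) ^ k
    y^ = (x + h) ^ suc k
    0≤y : 0ℚ ≤ y
    0≤y = ^-nonNeg (x + h) k (+-mono-≤ 0≤x 0≤h)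
    +-mono-≤-lemma : (x + h) * y^ ≤ x * (x ^ suc k + fromℕ (suc k) * (h * y)) + h * y^
    +-mono-≤-lemma = ≤-trans (≤-reflexive (*-distribʳ-+ y^ x h))
      (+-monoˡ-≤ (h * y^) (*-monoˡ-≤-nonNeg x {{nonNegative 0≤x}} (power-difference x h k 0≤x 0≤h)))

  invFactorial-inverse : ∀ k → invFactorial k * fromℕ (k ℕ.!) ≡ 1ℚ
  invFactorial-inverse k = at (k ℕ.!) (ℕₚ._!≢0 k)
    where
    at : ∀ f (nz : ℕ.NonZero f) → (+ 1 / f) {{nz}} * fromℕ f ≡ 1ℚ
    at (suc f) _ = 1/n*n≡1 f

  invFactorial-nonNeg : ∀ k → 0ℚ ≤ invFactorial k
  invFactorial-nonNeg k = at (k ℕ.!) (ℕₚ._!≢0 k)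
    where
    at : ∀ f (nz : ℕ.NonZero f) → 0ℚ ≤ (+ 1 / f) {{nz}}
    at (suc f) _ = 1/n-nonNeg f

  invFactorial-suc : ∀ k → invFactorial (suc k) * fromℕ (suc k) ≡ invFactorial k
  invFactorial-suc k = inverse-unique (fromℕ (k ℕ.!)) _ (invFactorial k) (begin
    invFactorial (suc k) * fromℕ (suc k) * fromℕ (k ℕ.!) ≡⟨ *-assoc (invFactorial (suc k)) (fromℕ (suc k)) (fromℕ (k ℕ.!)) ⟩
    invFactorial (suc k) * (fromℕ (suc k) * fromℕ (k ℕ.!)) ≡⟨ cong (invFactorial (suc k) *_) (fromℕ-* (suc k) (k ℕ.!)) ⟨
    invFactorial (suc k) * fromℕ (suc k ℕ.* k ℕ.!) ≡⟨ invFactorial-inverse (suc k) ⟩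
    1ℚ ∎) (invFactorial-inverse k)
    where open ≡-Reasoning

  expSum : ℚ → ℕ → ℚ
  expSum = partialSum invFactorial

  module ExpSeries = Series invFactorial invFactorial-nonNeg

  expSum-nonNeg : ∀ t m → 0ℚ ≤ t → 0ℚ ≤ expSum t m
  expSum-nonNeg = ExpSeries.partialSum-nonNeg

  -- The partial sums of exp satisfy the mean value inequality E(x + h) - E(x) ≤ h E(x + h) termwise.
  expSum-difference : ∀ x h m → 0ℚ ≤ x → 0ℚ ≤ h → expSum (x + h) (suc m) ≤ expSum x (suc m) + h * expSum (x + h) m
  expSum-difference x h zero 0≤x 0≤h = ≤-reflexive (solve 1 (λ h → con 0ℚ :+ con 1ℚ :* con 1ℚ := con 0ℚ :+ con 1ℚ :* con 1ℚ :+ h :* con 0ℚ) refl h)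
  expSum-difference x h (suc m) 0≤x 0≤h = begin
    expSum (x + h) (suc m) + f * (x + h) ^ suc m
      ≤⟨ +-mono-≤ (expSum-difference x h m 0≤x 0≤h) (*-monoˡ-≤-nonNeg f {{nonNegative (invFactorial-nonNeg (suc m))}} (power-difference x h m 0≤x 0≤h)) ⟩
    (expSum x (suc m) + h * expSum (x + h) m) + f * (x ^ suc m + fromℕ (suc m) * (h * y))
      ≡⟨ solve 7 (λ a h b f z n y → (a :+ h :* b) :+ f :* (z :+ n :* (h :* y)) := a :+ f :* z :+ h :* (b :+ (f :* n) :* y)) refl
           (expSum x (suc m)) h (expSum (x + h) m) f (x ^ suc m) (fromℕ (suc m)) y ⟩
    expSum x (suc (suc m)) + h * (expSum (x + h) m + (f * fromℕ (suc m)) * y)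
      ≡⟨ cong (λ z → expSum x (suc (suc m)) + h * (expSum (x + h) m + z * y)) (invFactorial-suc m) ⟩
    expSum x (suc (suc m)) + h * expSum (x + h) (suc m) ∎
    where
    open ≤-Reasoning
    f = invFactorial (suc m)
    y = (x + h) ^ m

  expSum-step : ∀ x h m → 0ℚ ≤ x → 0ℚ ≤ h → expSum (x + h) m ≤ expSum x m + h * expSum (x + h) m
  expSum-step x h zero 0≤x 0≤h = ≤-reflexive (sym (trans (+-identityˡ (h * 0ℚ)) (*-zeroʳ h)))
  expSum-step x h (suc m) 0≤x 0≤h = ≤-trans (expSum-difference x h m 0≤x 0≤h)
    (+-monoʳ-≤ (expSum x (suc m)) (*-monoˡ-≤-nonNeg h {{nonNegative 0≤h}} (ExpSeries.partialSum-extend (x + h) m 1 (+-mono-≤ 0≤x 0≤h))))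

  expSum-½ : ∀ x m → 0ℚ ≤ x → expSum (x + ½) m ≤ fromℕ 2 * expSum x m
  expSum-½ x m 0≤x = ≤-by E₂ (fromℕ 2 * E₁) (fromℕ 2 * ((E₁ + ½ * E₂) - E₂))
    (*-nonNeg (fromℕ 2) ((E₁ + ½ * E₂) - E₂) (fromℕ-nonNeg 2) (0≤-diff E₂ (E₁ + ½ * E₂) (expSum-step x ½ m 0≤x 0≤½)))
    (solve 2 (λ a b → b :+ con (fromℕ 2) :* ((a :+ con ½ :* b) :- b) := con (fromℕ 2) :* a) refl E₁ E₂)
    where
    E₁ = expSum x m
    E₂ = expSum (x + ½) m

  expSum-1 : ∀ x m → 0ℚ ≤ x → expSum (x + 1ℚ) m ≤ fromℕ 4 * expSum x m
  expSum-1 x m 0≤x = begin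
    expSum (x + 1ℚ) m ≡⟨ cong (λ t → expSum t m) (+-assoc x ½ ½) ⟨
    expSum (x + ½ + ½) m ≤⟨ expSum-½ (x + ½) m (+-mono-≤ 0≤x 0≤½) ⟩
    fromℕ 2 * expSum (x + ½) m ≤⟨ *-monoˡ-≤-nonNeg (fromℕ 2) {{nonNegative (fromℕ-nonNeg 2)}} (expSum-½ x m 0≤x) ⟩
    fromℕ 2 * (fromℕ 2 * expSum x m) ≡⟨ *-assoc (fromℕ 2) (fromℕ 2) (expSum x m) ⟨
    fromℕ 4 * expSum x m ∎
    where open ≤-Reasoning

  expSum-0 : ∀ m → expSum 0ℚ m ≤ 1ℚ
  expSum-0 zero = 0≤1
  expSum-0 (suc zero) = ≤-refl
  expSum-0 (suc (suc m)) = ≤-trans (≤-reflexive (trans (cong (λ z → expSum 0ℚ (suc m) + z) (trans (cong (invFactorial (suc m) *_) (*-zeroˡ (0ℚ ^ m))) (*-zeroʳ (invFactorial (suc m)))))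
    (+-identityʳ (expSum 0ℚ (suc m))))) (expSum-0 (suc m))

  harmonic : ℕ → ℚ
  harmonic zero = 0ℚ
  harmonic (suc n) = harmonic n + recip (suc n)

  harmonic-nonNeg : ∀ n → 0ℚ ≤ harmonic n
  harmonic-nonNeg zero = ≤-refl
  harmonic-nonNeg (suc n) = +-mono-≤ (harmonic-nonNeg n) (recip-nonNeg n)

  expSum-harmonic : ∀ x m n → 0ℚ ≤ x → expSum (x + harmonic (suc n)) m ≤ fromℕ (4 ℕ.* suc n) * expSum x m
  expSum-harmonic x m zero 0≤x = expSum-1 x m 0≤x
  expSum-harmonic x m (suc n) 0≤x = begin
    E₂ ≤⟨ ≤-by E₂ (u * (s * E₁)) (u * (s * ((E₁ + h * E₂) - E₂)) )
      (*-nonNeg u _ (recip-nonNeg n) (*-nonNeg s ((E₁ + h * E₂) - E₂) (fromℕ-nonNeg (suc (suc n))) (0≤-diff E₂ (E₁ + h * E₂) step))) cancel ⟩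
    u * (s * E₁) ≤⟨ *-monoˡ-≤-nonNeg u {{nonNegative (recip-nonNeg n)}} (*-monoˡ-≤-nonNeg s {{nonNegative (fromℕ-nonNeg (suc (suc n)))}} (expSum-harmonic x m n 0≤x)) ⟩
    u * (s * (fromℕ (4 ℕ.* suc n) * expSum x m)) ≡⟨ cong (λ z → u * (s * (z * expSum x m))) (fromℕ-* 4 (suc n)) ⟩
    u * (s * (fromℕ 4 * r * expSum x m)) ≡⟨ solve 4 (λ u s r e → u :* (s :* (con (fromℕ 4) :* r :* e)) := (u :* r) :* (con (fromℕ 4) :* s :* e)) refl u s r (expSum x m) ⟩
    (u * r) * (fromℕ 4 * s * expSum x m) ≡⟨ trans (cong (_* (fromℕ 4 * s * expSum x m)) (recip-inverse n)) (*-identityˡ _) ⟩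
    fromℕ 4 * s * expSum x m ≡⟨ cong (_* expSum x m) (fromℕ-* 4 (suc (suc n))) ⟨
    fromℕ (4 ℕ.* suc (suc n)) * expSum x m ∎
    where
    open ≤-Reasoning
    h = recip (suc (suc n))
    u = recip (suc n)
    s = fromℕ (suc (suc n))
    r = fromℕ (suc n)
    E₁ = expSum (x + harmonic (suc n)) m
    E₂ = expSum (x + harmonic (suc (suc n))) m
    step : E₂ ≤ E₁ + h * E₂
    step = subst (λ t → expSum t m ≤ E₁ + h * expSum t m) (+-assoc x (harmonic (suc n)) h)
      (expSum-step (x + harmonic (suc n)) h m (+-mono-≤ 0≤x (harmonic-nonNeg (suc n))) (recip-nonNeg (suc n)))
    -- s h = 1 and s = 1 + r with u r = 1
    cancel : E₂ + u * (s * ((E₁ + h * E₂) - E₂)) ≡ u * (s * E₁)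
    cancel = begin-equality
      E₂ + u * (s * ((E₁ + h * E₂) - E₂))
        ≡⟨ solve 5 (λ a b u s h → b :+ u :* (s :* ((a :+ h :* b) :- b)) := u :* (s :* a) :+ (b :+ u :* ((h :* s) :* b :- s :* b))) refl E₁ E₂ u s h ⟩
      u * (s * E₁) + (E₂ + u * ((h * s) * E₂ - s * E₂))
        ≡⟨ cong₂ (λ p q → u * (s * E₁) + (E₂ + u * (p * E₂ - q * E₂))) (recip-inverse (suc n)) (fromℕ-+ 1 (suc n)) ⟩
      u * (s * E₁) + (E₂ + u * (1ℚ * E₂ - (1ℚ + r) * E₂))
        ≡⟨ solve 4 (λ c b u r → c :+ (b :+ u :* (con 1ℚ :* b :- (con 1ℚ :+ r) :* b)) := c :+ (b :- (u :* r) :* b)) refl (u * (s * E₁)) E₂ u r ⟩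
      u * (s * E₁) + (E₂ - (u * r) * E₂) ≡⟨ cong (λ p → u * (s * E₁) + (E₂ - p * E₂)) (recip-inverse n) ⟩
      u * (s * E₁) + (E₂ - 1ℚ * E₂) ≡⟨ solve 2 (λ c b → c :+ (b :- con 1ℚ :* b) := c) refl (u * (s * E₁)) E₂ ⟩
      u * (s * E₁) ∎

  expSum-fromℕ : ∀ Z m → expSum (fromℕ Z) m ≤ fromℕ (4 ℕ.^ Z)
  expSum-fromℕ zero m = expSum-0 m
  expSum-fromℕ (suc Z) m = begin
    expSum (fromℕ (suc Z)) m ≡⟨ cong (λ t → expSum t m) (trans (fromℕ-+ 1 Z) (+-comm 1ℚ (fromℕ Z))) ⟩
    expSum (fromℕ Z + 1ℚ) m ≤⟨ expSum-1 (fromℕ Z) m (fromℕ-nonNeg Z) ⟩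
    fromℕ 4 * expSum (fromℕ Z) m ≤⟨ *-monoˡ-≤-nonNeg (fromℕ 4) {{nonNegative (fromℕ-nonNeg 4)}} (expSum-fromℕ Z m) ⟩
    fromℕ 4 * fromℕ (4 ℕ.^ Z) ≡⟨ fromℕ-* 4 (4 ℕ.^ Z) ⟨
    fromℕ (4 ℕ.^ suc Z) ∎
    where open ≤-Reasoning

  expSum-harmonics : ∀ x m w k → 0ℚ ≤ x → expSum (x + fromℕ k * harmonic (suc w)) m ≤ fromℕ ((4 ℕ.* suc w) ℕ.^ k) * expSum x m
  expSum-harmonics x m w zero 0≤x = ≤-reflexive (trans (cong (λ t → expSum t m) (trans (cong (λ z → x + z) (*-zeroˡ (harmonic (suc w)))) (+-identityʳ x)))
    (sym (*-identityˡ (expSum x m))))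
  expSum-harmonics x m w (suc k) 0≤x = begin
    expSum (x + fromℕ (suc k) * H) m
      ≡⟨ cong (λ t → expSum t m) (trans (cong (λ z → x + z * H) (fromℕ-+ 1 k)) (solve 3 (λ x k h → x :+ (con 1ℚ :+ k) :* h := x :+ k :* h :+ h) refl x (fromℕ k) H)) ⟩
    expSum (x + fromℕ k * H + H) m ≤⟨ expSum-harmonic (x + fromℕ k * H) m w (+-mono-≤ 0≤x (*-nonNeg (fromℕ k) H (fromℕ-nonNeg k) (harmonic-nonNeg (suc w)))) ⟩
    fromℕ (4 ℕ.* suc w) * expSum (x + fromℕ k * H) m
      ≤⟨ *-monoˡ-≤-nonNeg (fromℕ (4 ℕ.* suc w)) {{nonNegative (fromℕ-nonNeg (4 ℕ.* suc w))}} (expSum-harmonics x m w k 0≤x) ⟩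
    fromℕ (4 ℕ.* suc w) * (fromℕ ((4 ℕ.* suc w) ℕ.^ k) * expSum x m) ≡⟨ *-assoc (fromℕ (4 ℕ.* suc w)) (fromℕ ((4 ℕ.* suc w) ℕ.^ k)) (expSum x m) ⟨
    fromℕ (4 ℕ.* suc w) * fromℕ ((4 ℕ.* suc w) ℕ.^ k) * expSum x m ≡⟨ cong (_* expSum x m) (fromℕ-* (4 ℕ.* suc w) ((4 ℕ.* suc w) ℕ.^ k)) ⟨
    fromℕ ((4 ℕ.* suc w) ℕ.^ suc k) * expSum x m ∎
    where
    open ≤-Reasoning
    H = harmonic (suc w)

  recip-antitone : ∀ c i → recip (i ℕ.+ suc c) ≤ recip (suc c)
  recip-antitone c i = subst (λ n → recip n ≤ recip (suc c)) (sym (ℕₚ.+-suc i c)) (≤-by q p (p * q * fromℕ i)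
    (*-nonNeg (p * q) (fromℕ i) (*-nonNeg p q (recip-nonNeg c) (recip-nonNeg (i ℕ.+ c))) (fromℕ-nonNeg i)) (begin
    q + p * q * fromℕ i ≡⟨ cong (_+ p * q * fromℕ i) (trans (sym (*-identityˡ q)) (cong (_* q) (sym (recip-inverse c)))) ⟩
    p * fromℕ (suc c) * q + p * q * fromℕ i
      ≡⟨ solve 4 (λ p q c i → p :* c :* q :+ p :* q :* i := p :* (q :* (i :+ c))) refl p q (fromℕ (suc c)) (fromℕ i) ⟩
    p * (q * (fromℕ i + fromℕ (suc c))) ≡⟨ cong (λ z → p * (q * z)) (trans (sym (fromℕ-+ i (suc c))) (cong fromℕ (ℕₚ.+-suc i c))) ⟩
    p * (q * fromℕ (suc (i ℕ.+ c))) ≡⟨ trans (cong (p *_) (recip-inverse (i ℕ.+ c))) (*-identityʳ p) ⟩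
    p ∎))
    where
    open ≡-Reasoning
    p = recip (suc c)
    q = recip (suc (i ℕ.+ c))

  harmonic-mono : ∀ {m n} → m ℕ.≤ n → harmonic m ≤ harmonic n
  harmonic-mono {m} {n} m≤n = subst (λ n → harmonic m ≤ harmonic n) (ℕₚ.m∸n+n≡m m≤n) (go (n ℕ.∸ m))
    where
    go : ∀ i → harmonic m ≤ harmonic (i ℕ.+ m)
    go zero = ≤-refl
    go (suc i) = ≤-trans (go i) (≤-by (harmonic (i ℕ.+ m)) (harmonic (suc i ℕ.+ m)) (recip (suc (i ℕ.+ m))) (recip-nonNeg (i ℕ.+ m)) refl)

  harmonic-block : ∀ i c → harmonic (i ℕ.+ suc c) ≤ harmonic (suc c) + fromℕ i * recip (suc c)
  harmonic-block zero c = ≤-reflexive (sym (trans (cong (λ z → harmonic (suc c) + z) (*-zeroˡ (recip (suc c)))) (+-identityʳ (harmonic (suc c)))))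
  harmonic-block (suc i) c = begin
    harmonic (i ℕ.+ suc c) + recip (suc i ℕ.+ suc c) ≤⟨ +-mono-≤ (harmonic-block i c) (recip-antitone c (suc i)) ⟩
    harmonic (suc c) + fromℕ i * recip (suc c) + recip (suc c)
      ≡⟨ solve 3 (λ h i r → h :+ i :* r :+ r := h :+ (con 1ℚ :+ i) :* r) refl (harmonic (suc c)) (fromℕ i) (recip (suc c)) ⟩
    harmonic (suc c) + (1ℚ + fromℕ i) * recip (suc c) ≡⟨ cong (λ z → harmonic (suc c) + z * recip (suc c)) (fromℕ-+ 1 i) ⟨
    harmonic (suc c) + fromℕ (suc i) * recip (suc c) ∎
    where open ≤-Reasoning

  harmonic-* : ∀ a b → harmonic (suc b ℕ.* suc a) ≤ harmonic (suc a) + harmonic b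
  harmonic-* a zero = ≤-reflexive (trans (cong (λ n → harmonic (suc n)) (ℕₚ.+-identityʳ a)) (sym (+-identityʳ (harmonic (suc a)))))
  harmonic-* a (suc b) = begin
    harmonic (suc a ℕ.+ suc b ℕ.* suc a) ≤⟨ harmonic-block (suc a) (a ℕ.+ b ℕ.* suc a) ⟩
    harmonic (suc b ℕ.* suc a) + fromℕ (suc a) * recip (suc b ℕ.* suc a) ≤⟨ +-mono-≤ (harmonic-* a b) (≤-reflexive scale) ⟩
    harmonic (suc a) + harmonic b + recip (suc b) ≡⟨ +-assoc (harmonic (suc a)) (harmonic b) (recip (suc b)) ⟩
    harmonic (suc a) + harmonic (suc b) ∎
    where
    open ≤-Reasoning
    scale : fromℕ (suc a) * recip (suc b ℕ.* suc a) ≡ recip (suc b)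
    scale = inverse-unique (fromℕ (suc b)) _ (recip (suc b)) (begin-equality
      fromℕ (suc a) * recip (suc b ℕ.* suc a) * fromℕ (suc b)
        ≡⟨ solve 3 (λ a r b → a :* r :* b := r :* (b :* a)) refl (fromℕ (suc a)) (recip (suc b ℕ.* suc a)) (fromℕ (suc b)) ⟩
      recip (suc b ℕ.* suc a) * (fromℕ (suc b) * fromℕ (suc a)) ≡⟨ cong (recip (suc b ℕ.* suc a) *_) (fromℕ-* (suc b) (suc a)) ⟨
      recip (suc b ℕ.* suc a) * fromℕ (suc b ℕ.* suc a) ≡⟨ recip-inverse (a ℕ.+ b ℕ.* suc a) ⟩
      1ℚ ∎) (recip-inverse b)

  harmonic-^ : ∀ w n → harmonic (suc w ℕ.^ suc n) ≤ fromℕ (suc n) * harmonic (suc w)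
  harmonic-^ w zero = ≤-reflexive (trans (cong harmonic (ℕₚ.*-identityʳ (suc w))) (sym (*-identityˡ (harmonic (suc w)))))
  harmonic-^ w (suc n) = go (suc w ℕ.^ suc n) (ℕₚ.m^n>0 (suc w) (suc n)) (harmonic-^ w n)
    where
    open ≤-Reasoning
    go : ∀ a → 0 ℕ.< a → harmonic a ≤ fromℕ (suc n) * harmonic (suc w) → harmonic (suc w ℕ.* a) ≤ fromℕ (suc (suc n)) * harmonic (suc w)
    go (suc a) _ ih = begin
      harmonic (suc w ℕ.* suc a) ≤⟨ harmonic-* a w ⟩
      harmonic (suc a) + harmonic w ≤⟨ +-mono-≤ ih (harmonic-mono (ℕₚ.n≤1+n w)) ⟩
      fromℕ (suc n) * harmonic (suc w) + harmonic (suc w)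
        ≡⟨ solve 2 (λ n h → n :* h :+ h := (con 1ℚ :+ n) :* h) refl (fromℕ (suc n)) (harmonic (suc w)) ⟩
      (1ℚ + fromℕ (suc n)) * harmonic (suc w) ≡⟨ cong (_* harmonic (suc w)) (fromℕ-+ 1 (suc n)) ⟨
      fromℕ (suc (suc n)) * harmonic (suc w) ∎

  artanhCoeff-even : ∀ i → artanhCoeff (i ℕ.+ i) ≡ 0ℚ
  artanhCoeff-even zero = refl
  artanhCoeff-even (suc i) = cong (λ b → if b then + 1 / suc (i ℕ.+ suc i) else 0ℚ) (dec-false (2 ℕ∣.∣? (i ℕ.+ suc i)) odd)
    where
    odd : ¬ 2 ℕ∣.∣ i ℕ.+ suc i
    odd d = contradiction (ℕ∣.∣1⇒≡1 (ℕ∣.∣m+n∣m⇒∣n (subst (2 ℕ∣.∣_) (trans (ℕₚ.+-suc i i) (ℕₚ.+-comm 1 (i ℕ.+ i))) d)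
      (ℕ∣.divides i (trans (cong (i ℕ.+_) (sym (ℕₚ.+-identityʳ i))) (ℕₚ.*-comm 2 i))))) λ ()

  artanhCoeff-odd : ∀ i → artanhCoeff (suc (i ℕ.+ i)) ≡ + 1 / suc (i ℕ.+ i)
  artanhCoeff-odd i = cong (λ b → if b then + 1 / suc (i ℕ.+ i) else 0ℚ) (dec-true (2 ℕ∣.∣? (i ℕ.+ i))
    (ℕ∣.divides i (trans (cong (i ℕ.+_) (sym (ℕₚ.+-identityʳ i))) (ℕₚ.*-comm 2 i))))

  artanhCoeff-nonNeg : ∀ k → 0ℚ ≤ artanhCoeff k
  artanhCoeff-nonNeg zero = ≤-refl
  artanhCoeff-nonNeg (suc k) with does (2 ℕ∣.∣? k)
  ... | true = 1/n-nonNeg k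
  ... | false = ≤-refl

  artanhSum : ℚ → ℕ → ℚ
  artanhSum = partialSum artanhCoeff

  module ArtanhSeries = Series artanhCoeff artanhCoeff-nonNeg

  oddSum : ℕ → ℚ → ℚ
  oddSum zero t = 0ℚ
  oddSum (suc i) t = oddSum i t + (+ 1 / suc (i ℕ.+ i)) * t ^ suc (i ℕ.+ i)

  artanhSum≡oddSum : ∀ i t → artanhSum t (i ℕ.+ i) ≡ oddSum i t
  artanhSum≡oddSum zero t = refl
  artanhSum≡oddSum (suc i) t = trans (cong (artanhSum t ∘ suc) (ℕₚ.+-suc i i)) (begin
    artanhSum t (i ℕ.+ i) + artanhCoeff (i ℕ.+ i) * t ^ (i ℕ.+ i) + artanhCoeff (suc (i ℕ.+ i)) * t ^ suc (i ℕ.+ i)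
      ≡⟨ cong₂ (λ c c′ → artanhSum t (i ℕ.+ i) + c * t ^ (i ℕ.+ i) + c′ * t ^ suc (i ℕ.+ i)) (artanhCoeff-even i) (artanhCoeff-odd i) ⟩
    artanhSum t (i ℕ.+ i) + 0ℚ * t ^ (i ℕ.+ i) + last
      ≡⟨ solve 3 (λ a y l → a :+ con 0ℚ :* y :+ l := a :+ l) refl (artanhSum t (i ℕ.+ i)) (t ^ (i ℕ.+ i)) last ⟩
    artanhSum t (i ℕ.+ i) + last ≡⟨ cong (_+ last) (artanhSum≡oddSum i t) ⟩
    oddSum i t + last ∎)
    where
    open ≡-Reasoning
    last = (+ 1 / suc (i ℕ.+ i)) * t ^ suc (i ℕ.+ i)

  evenPowers : ℕ → ℚ → ℚ
  evenPowers zero t = 0ℚ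
  evenPowers (suc i) t = evenPowers i t + t ^ (i ℕ.+ i)

  geometric : ∀ i t → (1ℚ - t * t) * evenPowers i t + t ^ (i ℕ.+ i) ≡ 1ℚ
  geometric zero t = solve 1 (λ t → (con 1ℚ :- t :* t) :* con 0ℚ :+ con 1ℚ := con 1ℚ) refl t
  geometric (suc i) t = begin
    (1ℚ - t * t) * (evenPowers i t + y) + t * t ^ (i ℕ.+ suc i) ≡⟨ cong (λ k → (1ℚ - t * t) * (evenPowers i t + y) + t * t ^ k) (ℕₚ.+-suc i i) ⟩
    (1ℚ - t * t) * (evenPowers i t + y) + t * (t * y)
      ≡⟨ solve 3 (λ t g y → (con 1ℚ :- t :* t) :* (g :+ y) :+ t :* (t :* y) := (con 1ℚ :- t :* t) :* g :+ y) refl t (evenPowers i t) y ⟩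
    (1ℚ - t * t) * evenPowers i t + y ≡⟨ geometric i t ⟩
    1ℚ ∎
    where
    open ≡-Reasoning
    y = t ^ (i ℕ.+ i)

  oddSum-difference : ∀ x h i → 0ℚ ≤ x → 0ℚ ≤ h → oddSum i (x + h) ≤ oddSum i x + h * evenPowers i (x + h)
  oddSum-difference x h zero 0≤x 0≤h = ≤-reflexive (sym (trans (+-identityˡ (h * 0ℚ)) (*-zeroʳ h)))
  oddSum-difference x h (suc i) 0≤x 0≤h = begin
    oddSum i (x + h) + f * (x + h) ^ suc k
      ≤⟨ +-mono-≤ (oddSum-difference x h i 0≤x 0≤h) (*-monoˡ-≤-nonNeg f {{nonNegative (1/n-nonNeg k)}} (power-difference x h k 0≤x 0≤h)) ⟩
    (oddSum i x + h * evenPowers i (x + h)) + f * (x ^ suc k + fromℕ (suc k) * (h * y))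
      ≡⟨ solve 7 (λ o h g f z n y → (o :+ h :* g) :+ f :* (z :+ n :* (h :* y)) := o :+ f :* z :+ h :* (g :+ (f :* n) :* y)) refl
           (oddSum i x) h (evenPowers i (x + h)) f (x ^ suc k) (fromℕ (suc k)) y ⟩
    oddSum (suc i) x + h * (evenPowers i (x + h) + (f * fromℕ (suc k)) * y)
      ≡⟨ cong (λ z → oddSum (suc i) x + h * (evenPowers i (x + h) + z)) (trans (cong (_* y) (1/n*n≡1 k)) (*-identityˡ y)) ⟩
    oddSum (suc i) x + h * evenPowers (suc i) (x + h) ∎
    where
    open ≤-Reasoning
    k = i ℕ.+ i
    f = + 1 / suc k
    y = (x + h) ^ k

  -- With u = 1/(S+1), v = 1/(S+2), the numbers (S-1)u and Sv are the arguments (x-1)/(x+1) of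
  -- log S and log (S+1), and their difference is 2uv.
  artanh-step : ∀ S u v i → 1ℚ ≤ S → 0ℚ ≤ u → 0ℚ ≤ v → u * (1ℚ + S) ≡ 1ℚ → v * (1ℚ + (1ℚ + S)) ≡ 1ℚ →
                fromℕ 2 * oddSum i (S * v) ≤ fromℕ 2 * oddSum i ((S - 1ℚ) * u) + (u + u * u)
  artanh-step S u v i 1≤S 0≤u 0≤v uS vS = begin
    fromℕ 2 * oddSum i (S * v) ≤⟨ *-monoˡ-≤-nonNeg (fromℕ 2) {{nonNegative (fromℕ-nonNeg 2)}} difference ⟩
    fromℕ 2 * (oddSum i x + h * g) ≡⟨ solve 4 (λ o u v g → con (fromℕ 2) :* (o :+ con (fromℕ 2) :* (u :* v) :* g) := con (fromℕ 2) :* o :+ con (fromℕ 4) :* (u :* v) :* g) refl (oddSum i x) u v g ⟩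
    fromℕ 2 * oddSum i x + fromℕ 4 * (u * v) * g ≡⟨ cong (λ z → fromℕ 2 * oddSum i x + z) gap ⟨
    fromℕ 2 * oddSum i x + (1ℚ - b * b) * g * w ≤⟨ +-monoʳ-≤ (fromℕ 2 * oddSum i x) (*-monoʳ-≤-nonNeg w {{nonNegative 0≤w}} geometric-≤) ⟩
    fromℕ 2 * oddSum i x + 1ℚ * w ≡⟨ cong (λ z → fromℕ 2 * oddSum i x + z) (*-identityˡ w) ⟩
    fromℕ 2 * oddSum i x + w ∎
    where
    open ≤-Reasoning
    x = (S - 1ℚ) * u
    h = fromℕ 2 * (u * v)
    b = S * v
    g = evenPowers i b
    w = u + u * u
    0≤w : 0ℚ ≤ w
    0≤w = +-mono-≤ 0≤u (*-nonNeg u u 0≤u 0≤u)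
    0≤b : 0ℚ ≤ b
    0≤b = *-nonNeg S v (≤-trans 0≤1 1≤S) 0≤v
    x+h≡b : x + h ≡ b
    x+h≡b = begin-equality
      (S - 1ℚ) * u + h ≡⟨ cong (_+ h) (trans (sym (*-identityʳ x)) (cong (x *_) (sym vS))) ⟩
      (S - 1ℚ) * u * (v * (1ℚ + (1ℚ + S))) + h
        ≡⟨ solve 3 (λ S u v → (S :- con 1ℚ) :* u :* (v :* (con 1ℚ :+ (con 1ℚ :+ S))) :+ con (fromℕ 2) :* (u :* v) := S :* v :* (u :* (con 1ℚ :+ S))) refl S u v ⟩
      S * v * (u * (1ℚ + S)) ≡⟨ trans (cong (S * v *_) uS) (*-identityʳ (S * v)) ⟩
      S * v ∎
    difference : oddSum i b ≤ oddSum i x + h * g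
    difference = subst (λ t → oddSum i t ≤ oddSum i x + h * evenPowers i t) x+h≡b
      (oddSum-difference x h i (*-nonNeg (S - 1ℚ) u (0≤-diff 1ℚ S 1≤S) 0≤u) (*-nonNeg (fromℕ 2) (u * v) (fromℕ-nonNeg 2) (*-nonNeg u v 0≤u 0≤v)))
    geometric-≤ : (1ℚ - b * b) * g ≤ 1ℚ
    geometric-≤ = ≤-by ((1ℚ - b * b) * g) 1ℚ (b ^ (i ℕ.+ i)) (^-nonNeg b (i ℕ.+ i) 0≤b) (geometric i b)
    gap : (1ℚ - b * b) * g * w ≡ fromℕ 4 * (u * v) * g
    gap = begin-equality
      (1ℚ - b * b) * g * (u + u * u) ≡⟨ solve 3 (λ b g u → (con 1ℚ :- b :* b) :* g :* (u :+ u :* u) := (con 1ℚ :* con 1ℚ :- b :* b) :* g :* (u :* con 1ℚ :+ u :* u)) refl b g u ⟩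
      (1ℚ * 1ℚ - b * b) * g * (u * 1ℚ + u * u) ≡⟨ cong₂ (λ p q → (p * p - b * b) * g * (u * q + u * u)) vS uS ⟨
      (v * (1ℚ + (1ℚ + S)) * (v * (1ℚ + (1ℚ + S))) - S * v * (S * v)) * g * (u * (u * (1ℚ + S)) + u * u)
        ≡⟨ solve 4 (λ S u v g → let c = con 1ℚ :+ (con 1ℚ :+ S) in (v :* c :* (v :* c) :- S :* v :* (S :* v)) :* g :* (u :* (u :* (con 1ℚ :+ S)) :+ u :* u)
             := con (fromℕ 4) :* (u :* v) :* g :* (u :* (con 1ℚ :+ S)) :* (v :* c)) refl S u v g ⟩
      fromℕ 4 * (u * v) * g * (u * (1ℚ + S)) * (v * (1ℚ + (1ℚ + S))) ≡⟨ cong₂ (λ p q → fromℕ 4 * (u * v) * g * p * q) uS vS ⟩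
      fromℕ 4 * (u * v) * g * 1ℚ * 1ℚ ≡⟨ trans (*-identityʳ _) (*-identityʳ _) ⟩
      fromℕ 4 * (u * v) * g ∎

  logArg : ℚ → ℚ
  logArg x = (x - 1ℚ) * invℚ (x + 1ℚ)

  logArg-suc : ∀ n → logArg (fromℕ n) ≡ (fromℕ n - 1ℚ) * recip (suc n)
  logArg-suc n = cong (λ z → (fromℕ n - 1ℚ) * invℚ z) (trans (+-comm (fromℕ n) 1ℚ) (sym (fromℕ-+ 1 n)))

  logArg-nonNeg : ∀ n → 0ℚ ≤ logArg (fromℕ (suc n))
  logArg-nonNeg n = subst (0ℚ ≤_) (sym (logArg-suc (suc n)))
    (*-nonNeg (fromℕ (suc n) - 1ℚ) (recip (suc (suc n))) (0≤-diff 1ℚ (fromℕ (suc n)) (fromℕ-mono {1} {suc n} (s≤s z≤n))) (recip-nonNeg (suc n)))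

  oddSum-zero : ∀ i → oddSum i 0ℚ ≡ 0ℚ
  oddSum-zero zero = refl
  oddSum-zero (suc i) = trans (cong₂ _+_ (oddSum-zero i) (trans (cong ((+ 1 / suc (i ℕ.+ i)) *_) (*-zeroˡ (0ℚ ^ (i ℕ.+ i)))) (*-zeroʳ (+ 1 / suc (i ℕ.+ i))))) (+-identityˡ 0ℚ)

  oddSum-harmonic : ∀ i n → fromℕ 2 * oddSum i (logArg (fromℕ (suc n))) + recip (suc n) ≤ harmonic (suc n)
  oddSum-harmonic i zero = ≤-reflexive (trans (cong (λ t → fromℕ 2 * oddSum i t + 1ℚ) (trans (logArg-suc 1) (*-zeroˡ (recip 2))))
    (trans (cong (λ z → fromℕ 2 * z + 1ℚ) (oddSum-zero i)) refl))
  oddSum-harmonic i (suc n) = begin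
    fromℕ 2 * oddSum i (logArg (fromℕ (suc (suc n)))) + u ≡⟨ cong (λ t → fromℕ 2 * oddSum i t + u) arg ⟩
    fromℕ 2 * oddSum i (S * v) + u ≤⟨ +-monoˡ-≤ u (artanh-step S u v i (fromℕ-mono {1} {suc n} (s≤s z≤n)) (recip-nonNeg (suc n)) (recip-nonNeg (suc (suc n))) uS vS) ⟩
    fromℕ 2 * oddSum i ((S - 1ℚ) * u) + (u + u * u) + u ≡⟨ cong (λ t → fromℕ 2 * oddSum i t + (u + u * u) + u) (logArg-suc (suc n)) ⟨
    o + (u + u * u) + u ≤⟨ +-monoˡ-≤ u (+-monoʳ-≤ o telescoping) ⟩
    o + r + u ≤⟨ +-monoˡ-≤ u (oddSum-harmonic i n) ⟩
    harmonic (suc n) + u ∎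
    where
    open ≤-Reasoning
    S = fromℕ (suc n)
    r = recip (suc n)
    u = recip (suc (suc n))
    v = recip (suc (suc (suc n)))
    o = fromℕ 2 * oddSum i (logArg S)
    uS : u * (1ℚ + S) ≡ 1ℚ
    uS = trans (cong (u *_) (sym (fromℕ-+ 1 (suc n)))) (recip-inverse (suc n))
    vS : v * (1ℚ + (1ℚ + S)) ≡ 1ℚ
    vS = trans (cong (v *_) (trans (cong (λ z → 1ℚ + z) (sym (fromℕ-+ 1 (suc n)))) (sym (fromℕ-+ 1 (suc (suc n)))))) (recip-inverse (suc (suc n)))
    arg : logArg (fromℕ (suc (suc n))) ≡ S * v
    arg = trans (logArg-suc (suc (suc n))) (cong (_* v) (trans (cong (_- 1ℚ) (fromℕ-+ 1 (suc n))) (solve 1 (λ S → con 1ℚ :+ S :- con 1ℚ := S) refl S)))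
    -- u + u² = u² (S + 2) = r u² S (S + 2) = r (1 - u²)
    telescoping : u + u * u ≤ r
    telescoping = ≤-by (u + u * u) r (r * (u * u)) (*-nonNeg r (u * u) (recip-nonNeg n) (*-nonNeg u u (recip-nonNeg (suc n)) (recip-nonNeg (suc n)))) (begin-equality
      u + u * u + r * (u * u) ≡⟨ solve 2 (λ u r → u :+ u :* u :+ r :* (u :* u) := con 1ℚ :* (u :* con 1ℚ :+ u :* u) :+ r :* (u :* u)) refl u r ⟩
      1ℚ * (u * 1ℚ + u * u) + r * (u * u) ≡⟨ cong₂ (λ p q → p * (u * q + u * u) + r * (u * u)) (recip-inverse n) uS ⟨
      r * S * (u * (u * (1ℚ + S)) + u * u) + r * (u * u)
        ≡⟨ solve 3 (λ S u r → r :* S :* (u :* (u :* (con 1ℚ :+ S)) :+ u :* u) :+ r :* (u :* u) := r :* ((u :* (con 1ℚ :+ S)) :* (u :* (con 1ℚ :+ S)))) refl S u r ⟩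
      r * ((u * (1ℚ + S)) * (u * (1ℚ + S))) ≡⟨ cong (λ p → r * (p * p)) uS ⟩
      r * (1ℚ * 1ℚ) ≡⟨ *-identityʳ r ⟩
      r ∎)

  log-≤-harmonic : ∀ n m → fromℕ 2 * artanhSum (logArg (fromℕ (suc n))) m ≤ harmonic (suc n)
  log-≤-harmonic n m = begin
    fromℕ 2 * artanhSum t m ≤⟨ *-monoˡ-≤-nonNeg (fromℕ 2) {{nonNegative (fromℕ-nonNeg 2)}} (ArtanhSeries.partialSum-extend t m m (logArg-nonNeg n)) ⟩
    fromℕ 2 * artanhSum t (m ℕ.+ m) ≡⟨ cong (fromℕ 2 *_) (artanhSum≡oddSum m t) ⟩
    fromℕ 2 * oddSum m t ≤⟨ ≤-by (fromℕ 2 * oddSum m t) (fromℕ 2 * oddSum m t + recip (suc n)) (recip (suc n)) (recip-nonNeg n) refl ⟩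
    fromℕ 2 * oddSum m t + recip (suc n) ≤⟨ oddSum-harmonic m n ⟩
    harmonic (suc n) ∎
    where
    open ≤-Reasoning
    t = logArg (fromℕ (suc n))

  ∣∣≤ : ∀ p r → p ≤ r → - p ≤ r → ∣ p ∣ ≤ r
  ∣∣≤ p r p≤r -p≤r with ∣p∣≡p∨∣p∣≡-p p
  ... | inj₁ eq = subst (_≤ r) (sym eq) p≤r
  ... | inj₂ eq = subst (_≤ r) (sym eq) -p≤r

  ∣logArg∣≤ : ∀ ℓ b → 0ℚ ≤ ℓ → ℓ ≤ fromℕ b → 1ℚ ≤ fromℕ b * ℓ → ∣ logArg ℓ ∣ ≤ logArg (fromℕ b)
  ∣logArg∣≤ ℓ b 0≤ℓ ℓ≤b 1≤bℓ = ∣∣≤ (logArg ℓ) (logArg B)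
    (≤-by (logArg ℓ) (logArg B) (i * k * (fromℕ 2 * (B - ℓ))) (*-nonNeg (i * k) (fromℕ 2 * (B - ℓ)) 0≤ik (*-nonNeg (fromℕ 2) (B - ℓ) (fromℕ-nonNeg 2) (0≤-diff ℓ B ℓ≤b)))
      (begin
        (ℓ - 1ℚ) * i + i * k * (fromℕ 2 * (B - ℓ)) ≡⟨ cong (_+ i * k * (fromℕ 2 * (B - ℓ))) expandℓ ⟩
        (ℓ - 1ℚ) * i * (k * (B + 1ℚ)) + i * k * (fromℕ 2 * (B - ℓ))
          ≡⟨ solve 4 (λ ℓ B i k → (ℓ :- con 1ℚ) :* i :* (k :* (B :+ con 1ℚ)) :+ i :* k :* (con (fromℕ 2) :* (B :- ℓ))
               := (B :- con 1ℚ) :* k :* (i :* (ℓ :+ con 1ℚ))) refl ℓ B i k ⟩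
        (B - 1ℚ) * k * (i * (ℓ + 1ℚ)) ≡⟨ trans (cong ((B - 1ℚ) * k *_) iℓ) (*-identityʳ ((B - 1ℚ) * k)) ⟩
        (B - 1ℚ) * k ∎))
    (≤-by (- logArg ℓ) (logArg B) (i * k * (fromℕ 2 * (B * ℓ - 1ℚ))) (*-nonNeg (i * k) (fromℕ 2 * (B * ℓ - 1ℚ)) 0≤ik (*-nonNeg (fromℕ 2) (B * ℓ - 1ℚ) (fromℕ-nonNeg 2) (0≤-diff 1ℚ (B * ℓ) 1≤bℓ)))
      (begin
        - ((ℓ - 1ℚ) * i) + i * k * (fromℕ 2 * (B * ℓ - 1ℚ)) ≡⟨ cong (λ z → - z + i * k * (fromℕ 2 * (B * ℓ - 1ℚ))) expandℓ ⟩
        - ((ℓ - 1ℚ) * i * (k * (B + 1ℚ))) + i * k * (fromℕ 2 * (B * ℓ - 1ℚ))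
          ≡⟨ solve 4 (λ ℓ B i k → :- ((ℓ :- con 1ℚ) :* i :* (k :* (B :+ con 1ℚ))) :+ i :* k :* (con (fromℕ 2) :* (B :* ℓ :- con 1ℚ))
               := (B :- con 1ℚ) :* k :* (i :* (ℓ :+ con 1ℚ))) refl ℓ B i k ⟩
        (B - 1ℚ) * k * (i * (ℓ + 1ℚ)) ≡⟨ trans (cong ((B - 1ℚ) * k *_) iℓ) (*-identityʳ ((B - 1ℚ) * k)) ⟩
        (B - 1ℚ) * k ∎))
    where
    open ≡-Reasoning
    B = fromℕ b
    i = invℚ (ℓ + 1ℚ)
    k = invℚ (B + 1ℚ)
    positive-suc : ∀ {p} → 0ℚ ≤ p → 0ℚ < p + 1ℚ
    positive-suc = λ 0≤p → +-mono-≤-< 0≤p 0<1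
    iℓ : i * (ℓ + 1ℚ) ≡ 1ℚ
    iℓ = invℚ-inverse (ℓ + 1ℚ) (positive-suc 0≤ℓ)
    kB : k * (B + 1ℚ) ≡ 1ℚ
    kB = invℚ-inverse (B + 1ℚ) (positive-suc (fromℕ-nonNeg b))
    0≤ik : 0ℚ ≤ i * k
    0≤ik = *-nonNeg i k (inverse-nonNeg (ℓ + 1ℚ) i (positive-suc 0≤ℓ) iℓ) (inverse-nonNeg (B + 1ℚ) k (positive-suc (fromℕ-nonNeg b)) kB)
    expandℓ : (ℓ - 1ℚ) * i ≡ (ℓ - 1ℚ) * i * (k * (B + 1ℚ))
    expandℓ = trans (sym (*-identityʳ ((ℓ - 1ℚ) * i))) (cong ((ℓ - 1ℚ) * i *_) (sym kB))

  ∣∣≤fromℕ : ∀ p → ∃[ n ] ∣ p ∣ ≤ fromℕ n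
  ∣∣≤fromℕ p with ∣ p ∣ in eq
  ... | q@(mkℚ (+ k) d _) = k , subst (q ≤_) (sym (fromℕ≡ι k)) (*≤* (ℤₚ.*-monoˡ-≤-nonNeg (+ k) (ℤ.+≤+ (s≤s z≤n))))
  ... | q@(mkℚ ℤ.-[1+ k ] d _) = 0 , nonPositive⁻¹ q

  ¼ : ℚ
  ¼ = ½ * ½

  logArg-≥¼ : ∀ s → 2 ℕ.≤ s → ¼ ≤ logArg (fromℕ s)
  logArg-≥¼ s 2≤s = subst (¼ ≤_) (sym (logArg-suc s)) (≤-by ¼ ((S - 1ℚ) * u) (((1ℚ - ¼) * (S - fromℕ 2) + ¼) * u)
    (*-nonNeg ((1ℚ - ¼) * (S - fromℕ 2) + ¼) u (+-mono-≤ {0ℚ} {(1ℚ - ¼) * (S - fromℕ 2)} {0ℚ} {¼} (*-nonNeg (1ℚ - ¼) (S - fromℕ 2) (*≤* (ℤ.+≤+ z≤n)) (0≤-diff (fromℕ 2) S (fromℕ-mono 2≤s))) (*≤* (ℤ.+≤+ z≤n))) (recip-nonNeg s))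
    (begin
      ¼ + ((1ℚ - ¼) * (S - fromℕ 2) + ¼) * u ≡⟨ cong (_+ ((1ℚ - ¼) * (S - fromℕ 2) + ¼) * u) (trans (sym (*-identityʳ ¼)) (cong (¼ *_) (sym uS))) ⟩
      ¼ * (u * (1ℚ + S)) + ((1ℚ - ¼) * (S - fromℕ 2) + ¼) * u
        ≡⟨ solve 2 (λ S u → con ¼ :* (u :* (con 1ℚ :+ S)) :+ ((con (1ℚ - ¼)) :* (S :- con (fromℕ 2)) :+ con ¼) :* u := (S :- con 1ℚ) :* u) refl S u ⟩
      (S - 1ℚ) * u ∎))
    where
    open ≡-Reasoning
    S = fromℕ s
    u = recip (suc s)
    uS : u * (1ℚ + S) ≡ 1ℚ
    uS = trans (cong (u *_) (sym (fromℕ-+ 1 s))) (recip-inverse s)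

  logSeq : ℕ → ℕ → ℚ
  logSeq s m = fromℕ 2 * artanhSum (logArg (fromℕ s)) m

  logSeq-nonNeg : ∀ s m → 1 ℕ.≤ s → 0ℚ ≤ logSeq s m
  logSeq-nonNeg (suc s) m _ = *-nonNeg (fromℕ 2) (artanhSum (logArg (fromℕ (suc s))) m) (fromℕ-nonNeg 2)
    (ArtanhSeries.partialSum-nonNeg (logArg (fromℕ (suc s))) m (logArg-nonNeg s))

  logSeq-≤ : ∀ s m → 1 ℕ.≤ s → logSeq s m ≤ harmonic s
  logSeq-≤ (suc s) m _ = log-≤-harmonic s m

  logSeq-≥ : ∀ s m → 2 ℕ.≤ s → 2 ℕ.≤ m → ½ ≤ logSeq s m
  logSeq-≥ (suc s) m 2≤s 2≤m = begin
    ½ ≤⟨ *-monoˡ-≤-nonNeg (fromℕ 2) {{nonNegative (fromℕ-nonNeg 2)}} (logArg-≥¼ (suc s) 2≤s) ⟩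
    fromℕ 2 * t ≡⟨ cong (fromℕ 2 *_) (solve 1 (λ t → t := con 0ℚ :+ con 0ℚ :* con 1ℚ :+ con 1ℚ :* (t :* con 1ℚ)) refl t) ⟩
    fromℕ 2 * artanhSum t 2 ≤⟨ *-monoˡ-≤-nonNeg (fromℕ 2) {{nonNegative (fromℕ-nonNeg 2)}}
      (subst (λ m → artanhSum t 2 ≤ artanhSum t m) (ℕₚ.m∸n+n≡m 2≤m) (ArtanhSeries.partialSum-extend t 2 (m ℕ.∸ 2) (logArg-nonNeg s))) ⟩
    fromℕ 2 * artanhSum t m ∎
    where
    open ≤-Reasoning
    t = logArg (fromℕ (suc s))

  -- s^(1-1/n) ≤ (4w)^(n-1) if s ≤ wⁿ
  power-factor : ∀ n s w m → 1 ℕ.≤ s → s ℕ.≤ suc w ℕ.^ suc n →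
                 expSum ((1ℚ - + 1 / suc n) * logSeq s m) m ≤ fromℕ ((4 ℕ.* suc w) ℕ.^ n)
  power-factor n s w m 1≤s s≤ = begin
    expSum (y * logSeq s m) m ≤⟨ ExpSeries.partialSum-mono (y * logSeq s m) (fromℕ n * H) m (*-nonNeg y (logSeq s m) 0≤y (logSeq-nonNeg s m 1≤s)) bound ⟩
    expSum (fromℕ n * H) m ≡⟨ cong (λ t → expSum t m) (+-identityˡ (fromℕ n * H)) ⟨
    expSum (0ℚ + fromℕ n * H) m ≤⟨ expSum-harmonics 0ℚ m w n ≤-refl ⟩
    fromℕ ((4 ℕ.* suc w) ℕ.^ n) * expSum 0ℚ m ≤⟨ *-monoˡ-≤-nonNeg (fromℕ ((4 ℕ.* suc w) ℕ.^ n)) {{nonNegative (fromℕ-nonNeg ((4 ℕ.* suc w) ℕ.^ n))}} (expSum-0 m) ⟩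
    fromℕ ((4 ℕ.* suc w) ℕ.^ n) * 1ℚ ≡⟨ *-identityʳ (fromℕ ((4 ℕ.* suc w) ℕ.^ n)) ⟩
    fromℕ ((4 ℕ.* suc w) ℕ.^ n) ∎
    where
    open ≤-Reasoning
    y = 1ℚ - + 1 / suc n
    H = harmonic (suc w)
    y*n : y * fromℕ (suc n) ≡ fromℕ n
    y*n = begin-equality
      (1ℚ - + 1 / suc n) * fromℕ (suc n) ≡⟨ solve 2 (λ i S → (con 1ℚ :- i) :* S := S :- i :* S) refl (+ 1 / suc n) (fromℕ (suc n)) ⟩
      fromℕ (suc n) - (+ 1 / suc n) * fromℕ (suc n) ≡⟨ cong₂ _-_ (fromℕ-+ 1 n) (1/n*n≡1 n) ⟩
      1ℚ + fromℕ n - 1ℚ ≡⟨ solve 1 (λ S → con 1ℚ :+ S :- con 1ℚ := S) refl (fromℕ n) ⟩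
      fromℕ n ∎
    0≤y : 0ℚ ≤ y
    0≤y = *-cancelʳ-≤-pos (fromℕ (suc n)) {{positive (fromℕ-pos n)}} (subst₂ _≤_ (sym (*-zeroˡ (fromℕ (suc n)))) (sym y*n) (fromℕ-nonNeg n))
    bound : y * logSeq s m ≤ fromℕ n * H
    bound = begin
      y * logSeq s m ≤⟨ *-monoˡ-≤-nonNeg y {{nonNegative 0≤y}} (≤-trans (logSeq-≤ s m 1≤s) (≤-trans (harmonic-mono s≤) (harmonic-^ w n))) ⟩
      y * (fromℕ (suc n) * H) ≡⟨ *-assoc y (fromℕ (suc n)) H ⟨
      y * fromℕ (suc n) * H ≡⟨ cong (_* H) y*n ⟩
      fromℕ n * H ∎

  -- (log s)^(-1/n) is estimated by its absolute value, that is by a power of max (log s, 1 / log s).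
  log-factor : ∀ n s h m → 2 ℕ.≤ s → s ℕ.≤ 2 ℕ.^ suc h → 2 ℕ.≤ m →
               ∣ expSum (- (+ 1 / suc n) * (fromℕ 2 * artanhSum (logArg (logSeq s m)) m)) m ∣ ≤ fromℕ (4 ℕ.* (2 ℕ.* suc h))
  log-factor n s h m 2≤s s≤ 2≤m = begin
    ∣ expSum z m ∣ ≤⟨ ExpSeries.∣partialSum∣≤ z m ⟩
    expSum ∣ z ∣ m ≤⟨ ExpSeries.partialSum-mono (∣ z ∣) (0ℚ + harmonic b) m (0≤∣p∣ z) bound ⟩
    expSum (0ℚ + harmonic b) m ≤⟨ expSum-harmonic 0ℚ m (h ℕ.+ suc (h ℕ.+ 0)) ≤-refl ⟩
    fromℕ (4 ℕ.* b) * expSum 0ℚ m ≤⟨ *-monoˡ-≤-nonNeg (fromℕ (4 ℕ.* b)) {{nonNegative (fromℕ-nonNeg (4 ℕ.* b))}} (expSum-0 m) ⟩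
    fromℕ (4 ℕ.* b) * 1ℚ ≡⟨ *-identityʳ (fromℕ (4 ℕ.* b)) ⟩
    fromℕ (4 ℕ.* b) ∎
    where
    open ≤-Reasoning
    b = 2 ℕ.* suc h
    ℓ = logSeq s m
    i = + 1 / suc n
    A = fromℕ 2 * artanhSum (logArg ℓ) m
    z = - i * A
    1≤s = ℕₚ.<⇒≤ 2≤s
    i≤1 : i ≤ 1ℚ
    i≤1 = ≤-trans (≤-reflexive (sym (*-identityʳ i))) (≤-trans (*-monoˡ-≤-nonNeg i {{nonNegative (1/n-nonNeg n)}} (fromℕ-mono {1} {suc n} (s≤s z≤n))) (≤-reflexive (1/n*n≡1 n)))
    ℓ≤b : ℓ ≤ fromℕ b
    ℓ≤b = begin
      ℓ ≤⟨ logSeq-≤ s m 1≤s ⟩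
      harmonic s ≤⟨ harmonic-mono s≤ ⟩
      harmonic (2 ℕ.^ suc h) ≤⟨ harmonic-^ 1 h ⟩
      fromℕ (suc h) * harmonic 2 ≤⟨ *-monoˡ-≤-nonNeg (fromℕ (suc h)) {{nonNegative (fromℕ-nonNeg (suc h))}} (*≤* (ℤ.+≤+ (ℕₚ.m≤m+n 3 1))) ⟩
      fromℕ (suc h) * fromℕ 2 ≡⟨ *-comm (fromℕ (suc h)) (fromℕ 2) ⟩
      fromℕ 2 * fromℕ (suc h) ≡⟨ fromℕ-* 2 (suc h) ⟨
      fromℕ b ∎
    1≤bℓ : 1ℚ ≤ fromℕ b * ℓ
    1≤bℓ = *-mono-≤ (fromℕ 2) (fromℕ b) ½ ℓ (fromℕ-nonNeg b) 0≤½ (fromℕ-mono {2} {b} (ℕₚ.*-monoʳ-≤ 2 {1} {suc h} (s≤s z≤n))) (logSeq-≥ s m 2≤s 2≤m)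
    ∣A∣≤ : ∣ A ∣ ≤ harmonic b
    ∣A∣≤ = begin
      ∣ A ∣ ≡⟨ ∣p*q∣≡∣p∣*∣q∣ (fromℕ 2) (artanhSum (logArg ℓ) m) ⟩
      fromℕ 2 * ∣ artanhSum (logArg ℓ) m ∣ ≤⟨ *-monoˡ-≤-nonNeg (fromℕ 2) {{nonNegative (fromℕ-nonNeg 2)}} (≤-trans (ArtanhSeries.∣partialSum∣≤ (logArg ℓ) m)
        (ArtanhSeries.partialSum-mono (∣ logArg ℓ ∣) (logArg (fromℕ b)) m (0≤∣p∣ (logArg ℓ)) (∣logArg∣≤ ℓ b (logSeq-nonNeg s m 1≤s) ℓ≤b 1≤bℓ))) ⟩
      fromℕ 2 * artanhSum (logArg (fromℕ b)) m ≤⟨ log-≤-harmonic (h ℕ.+ suc (h ℕ.+ 0)) m ⟩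
      harmonic b ∎
    bound : ∣ z ∣ ≤ 0ℚ + harmonic b
    bound = begin
      ∣ - i * A ∣ ≡⟨ ∣p*q∣≡∣p∣*∣q∣ (- i) A ⟩
      ∣ - i ∣ * ∣ A ∣ ≡⟨ cong (_* ∣ A ∣) (trans (∣-p∣≡∣p∣ i) (0≤p⇒∣p∣≡p (1/n-nonNeg n))) ⟩
      i * ∣ A ∣ ≤⟨ *-monoʳ-≤-nonNeg ∣ A ∣ {{nonNegative (0≤∣p∣ A)}} i≤1 ⟩
      1ℚ * ∣ A ∣ ≡⟨ *-identityˡ ∣ A ∣ ⟩
      ∣ A ∣ ≤⟨ ∣A∣≤ ⟩
      harmonic b ≡⟨ +-identityˡ (harmonic b) ⟨
      0ℚ + harmonic b ∎

  ℕ-^-* : ∀ m n k → (m ℕ.* n) ℕ.^ k ≡ m ℕ.^ k ℕ.* n ℕ.^ k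
  ℕ-^-* m n zero = refl
  ℕ-^-* m n (suc k) = trans (cong (m ℕ.* n ℕ.*_) (ℕ-^-* m n k)) (ℕₚ.[m*n]*[o*p]≡[m*o]*[n*p] m n (m ℕ.^ k) (n ℕ.^ k))

  real-bound : ∀ n (2≤n : 2 ℕ.≤ n) ε → ∃[ K ] (∀ s (2≤s : 2 ℕ.≤ s) w h L → s ℕ.≤ suc w ℕ.^ n → s ℕ.≤ 2 ℕ.^ suc h →
               4 ℕ.^ (K ℕ.* suc w ℕ.^ ℕ.pred n ℕ.* suc h) ℕ.≤ L → solutionBound n s 2≤n 2≤s ε ≤ᴿ fromNat L)
  real-bound n@(suc n′) 2≤n ε = K , bound
    where
    open ≤-Reasoning
    c : ℚ
    c = (+ (n ℕ.* n) / (n ℕ.∸ 1)) {{ℕ.>-nonZero (ℕₚ.∸-monoˡ-≤ 1 2≤n)}}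
    N : ℕ
    N = proj₁ (cauchy ε 1ℚ 0<1)
    κ γ : ℕ
    κ = proj₁ (∣∣≤fromℕ (1ℚ + - seq ε N))
    γ = proj₁ (∣∣≤fromℕ c)
    K : ℕ
    K = suc κ ℕ.* γ ℕ.* 4 ℕ.^ n′ ℕ.* 8
    ε-bound : ∀ m → N ℕ.≤ m → ∣ 1ℚ + - seq ε m ∣ ≤ fromℕ (suc κ)
    ε-bound m N≤m = begin
      ∣ 1ℚ + - seq ε m ∣ ≡⟨ cong ∣_∣ (solve 2 (λ x y → con 1ℚ :+ :- x := (con 1ℚ :+ :- y) :+ (y :- x)) refl (seq ε m) (seq ε N)) ⟩
      ∣ (1ℚ + - seq ε N) + (seq ε N - seq ε m) ∣ ≤⟨ ∣p+q∣≤∣p∣+∣q∣ (1ℚ + - seq ε N) (seq ε N - seq ε m) ⟩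
      ∣ 1ℚ + - seq ε N ∣ + ∣ seq ε N - seq ε m ∣ ≤⟨ +-mono-≤ (proj₂ (∣∣≤fromℕ (1ℚ + - seq ε N))) (proj₂ (cauchy ε 1ℚ 0<1) N m ℕₚ.≤-refl N≤m) ⟩
      fromℕ κ + 1ℚ ≡⟨ trans (+-comm (fromℕ κ) 1ℚ) (sym (fromℕ-+ 1 κ)) ⟩
      fromℕ (suc κ) ∎
    module _ (s : ℕ) (2≤s : 2 ℕ.≤ s) (w h : ℕ) (s≤ : s ℕ.≤ suc w ℕ.^ n) (s≤2^ : s ℕ.≤ 2 ℕ.^ suc h) where
      Z : ℕ
      Z = suc κ ℕ.* γ ℕ.* (4 ℕ.* suc w) ℕ.^ n′ ℕ.* (4 ℕ.* (2 ℕ.* suc h))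
      P R z : ℕ → ℚ
      P m = expSum ((1ℚ - + 1 / n) * logSeq s m) m
      R m = expSum (- (+ 1 / n) * (fromℕ 2 * artanhSum (logArg (logSeq s m)) m)) m
      z m = (1ℚ + - seq ε m) * c * P m * R m
      P-nonNeg : ∀ m → 0ℚ ≤ P m
      P-nonNeg m = expSum-nonNeg ((1ℚ - + 1 / n) * logSeq s m) m (*-nonNeg (1ℚ - + 1 / n) (logSeq s m)
        (0≤-diff (+ 1 / n) 1ℚ (≤-trans (≤-reflexive (sym (*-identityʳ (+ 1 / n)))) (≤-trans (*-monoˡ-≤-nonNeg (+ 1 / n) {{nonNegative (1/n-nonNeg n′)}} (fromℕ-mono {1} {n} (s≤s z≤n))) (≤-reflexive (1/n*n≡1 n′)))))
        (logSeq-nonNeg s m (ℕₚ.<⇒≤ 2≤s)))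
      z-bound : ∀ m → N ℕ.≤ m → 2 ℕ.≤ m → ∣ z m ∣ ≤ fromℕ Z
      z-bound m N≤m 2≤m = begin
        ∣ z m ∣ ≡⟨ trans (∣p*q∣≡∣p∣*∣q∣ ((1ℚ + - seq ε m) * c * P m) (R m)) (cong (_* ∣ R m ∣)
          (trans (∣p*q∣≡∣p∣*∣q∣ ((1ℚ + - seq ε m) * c) (P m)) (cong₂ _*_ (∣p*q∣≡∣p∣*∣q∣ (1ℚ + - seq ε m) c) (0≤p⇒∣p∣≡p (P-nonNeg m))))) ⟩
        ∣ 1ℚ + - seq ε m ∣ * ∣ c ∣ * P m * ∣ R m ∣
          ≤⟨ *-mono-≤ (∣ 1ℚ + - seq ε m ∣ * ∣ c ∣ * P m) (fromℕ (suc κ ℕ.* γ ℕ.* (4 ℕ.* suc w) ℕ.^ n′)) (∣ R m ∣) (fromℕ (4 ℕ.* (2 ℕ.* suc h)))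
               (fromℕ-nonNeg (suc κ ℕ.* γ ℕ.* (4 ℕ.* suc w) ℕ.^ n′)) (0≤∣p∣ (R m)) first (log-factor n′ s h m 2≤s s≤2^ 2≤m) ⟩
        fromℕ (suc κ ℕ.* γ ℕ.* (4 ℕ.* suc w) ℕ.^ n′) * fromℕ (4 ℕ.* (2 ℕ.* suc h)) ≡⟨ fromℕ-* (suc κ ℕ.* γ ℕ.* (4 ℕ.* suc w) ℕ.^ n′) (4 ℕ.* (2 ℕ.* suc h)) ⟨
        fromℕ Z ∎
        where
        second : ∣ 1ℚ + - seq ε m ∣ * ∣ c ∣ ≤ fromℕ (suc κ ℕ.* γ)
        second = ≤-trans (*-mono-≤ (∣ 1ℚ + - seq ε m ∣) (fromℕ (suc κ)) (∣ c ∣) (fromℕ γ) (fromℕ-nonNeg (suc κ)) (0≤∣p∣ c) (ε-bound m N≤m) (proj₂ (∣∣≤fromℕ c)))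
          (≤-reflexive (sym (fromℕ-* (suc κ) γ)))
        first : ∣ 1ℚ + - seq ε m ∣ * ∣ c ∣ * P m ≤ fromℕ (suc κ ℕ.* γ ℕ.* (4 ℕ.* suc w) ℕ.^ n′)
        first = ≤-trans (*-mono-≤ (∣ 1ℚ + - seq ε m ∣ * ∣ c ∣) (fromℕ (suc κ ℕ.* γ)) (P m) (fromℕ ((4 ℕ.* suc w) ℕ.^ n′))
          (fromℕ-nonNeg (suc κ ℕ.* γ)) (P-nonNeg m) second (power-factor n′ s w m (ℕₚ.<⇒≤ 2≤s) s≤))
          (≤-reflexive (sym (fromℕ-* (suc κ ℕ.* γ) ((4 ℕ.* suc w) ℕ.^ n′))))
      exp-bound : ∀ m → N ℕ.≤ m → 2 ℕ.≤ m → expSum (z m) m ≤ fromℕ (4 ℕ.^ Z)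
      exp-bound m N≤m 2≤m = begin
        expSum (z m) m ≤⟨ p≤∣p∣ (expSum (z m) m) ⟩
        ∣ expSum (z m) m ∣ ≤⟨ ExpSeries.∣partialSum∣≤ (z m) m ⟩
        expSum ∣ z m ∣ m ≤⟨ ExpSeries.partialSum-mono (∣ z m ∣) (fromℕ Z) m (0≤∣p∣ (z m)) (z-bound m N≤m 2≤m) ⟩
        expSum (fromℕ Z) m ≤⟨ expSum-fromℕ Z m ⟩
        fromℕ (4 ℕ.^ Z) ∎
        where
        p≤∣p∣ : ∀ p → p ≤ ∣ p ∣
        p≤∣p∣ p with ≤-total 0ℚ p
        ... | inj₁ 0≤p = ≤-reflexive (sym (0≤p⇒∣p∣≡p 0≤p))
        ... | inj₂ p≤0 = ≤-trans p≤0 (0≤∣p∣ p)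
      Z≡ : Z ≡ K ℕ.* suc w ℕ.^ n′ ℕ.* suc h
      Z≡ = trans (cong (λ x → suc κ ℕ.* γ ℕ.* x ℕ.* (4 ℕ.* (2 ℕ.* suc h))) (ℕ-^-* 4 (suc w) n′))
        (ℕSolver.solve 4 (λ a x y h → a ℕSolver.:* (x ℕSolver.:* y) ℕSolver.:* (ℕSolver.con 4 ℕSolver.:* (ℕSolver.con 2 ℕSolver.:* h)) ℕSolver.:= a ℕSolver.:* x ℕSolver.:* ℕSolver.con 8 ℕSolver.:* y ℕSolver.:* h)
          refl (suc κ ℕ.* γ) (4 ℕ.^ n′) (suc w ℕ.^ n′) (suc h))
    bound : ∀ s (2≤s : 2 ℕ.≤ s) w h L → s ℕ.≤ suc w ℕ.^ n → s ℕ.≤ 2 ℕ.^ suc h →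
            4 ℕ.^ (K ℕ.* suc w ℕ.^ n′ ℕ.* suc h) ℕ.≤ L → solutionBound n s 2≤n 2≤s ε ≤ᴿ fromNat L
    bound s 2≤s w h L s≤ s≤2^ 4^≤L (δ , 0<δ , M , p) = contradiction (begin-strict
      fromℕ L ≡⟨ +-identityʳ (fromℕ L) ⟨
      fromℕ L + 0ℚ <⟨ +-monoʳ-< (fromℕ L) 0<δ ⟩
      fromℕ L + δ ≤⟨ p m (ℕₚ.m≤m⊔n M (N ℕ.⊔ 2)) ⟩
      expSum (z s 2≤s w h s≤ s≤2^ m) m ≤⟨ exp-bound s 2≤s w h s≤ s≤2^ m (ℕₚ.≤-trans (ℕₚ.m≤m⊔n N 2) (ℕₚ.m≤n⊔m M (N ℕ.⊔ 2))) (ℕₚ.≤-trans (ℕₚ.m≤n⊔m N 2) (ℕₚ.m≤n⊔m M (N ℕ.⊔ 2))) ⟩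
      fromℕ (4 ℕ.^ Z s 2≤s w h s≤ s≤2^) ≤⟨ fromℕ-mono (subst (λ x → 4 ℕ.^ x ℕ.≤ L) (sym (Z≡ s 2≤s w h s≤ s≤2^)) 4^≤L) ⟩
      fromℕ L ∎) (<-irrefl refl)
      where
      m = M ℕ.⊔ (N ℕ.⊔ 2)

open import Defs
open import Data.List.Base using (List; _∷_; length)
open import Data.List.Membership.Propositional using (_∈_; _∉_)
open import Data.List.Relation.Unary.All as All using (All; _∷_)
open import Data.List.Relation.Unary.AllPairs using (_∷_)
open import Data.List.Relation.Unary.Any using (here; there)
open import Data.List.Relation.Unary.Unique.Propositional using (Unique)
open import Data.Nat.Base hiding (less)
open import Data.Nat.Divisibility using (_∣_; ∣m+n∣m⇒∣n; m∣m*n; ∣n⇒∣m*n)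
open import Data.Nat.ListAction using (product)
open import Data.Nat.Primality using (Prime; productOfPrimes≥1)
open import Data.Nat.Properties
open import Data.Nat.Solver using (module +-*-Solver)
open import Data.Product using (Σ-syntax; _×_; _,_; ∃-syntax; proj₁; proj₂)
open import Data.Rational using (ℚ; 0ℚ)
open import Data.Vec.Base using (Vec; lookup)
open import Relation.Binary.PropositionalEquality
open import Relation.Nullary using (yes; no)
open import Function.Base using (_∘_)
open Chebyshev
open Exponents using (a; B)
open Counts using (2^-mono; 2^-*)
open Assembly
open RealBound using (real-bound)

∈⇒∣product : ∀ {p ps} → p ∈ ps → p ∣ product ps
∈⇒∣product {ps = p ∷ ps} (here refl) = m∣m*n (product ps)
∈⇒∣product {ps = q ∷ ps} (there p∈) = ∣n⇒∣m*n q (∈⇒∣product p∈)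

new-prime : ∀ {ps} → All Prime ps → ∃[ p ] Prime p × p ∉ ps
new-prime {ps} pps with ∃-prime-divisor (suc (product ps)) (s≤s (productOfPrimes≥1 pps))
... | p , pp , p∣ = p , pp , λ p∈ → prime∤1 pp (∣m+n∣m⇒∣n (subst (p ∣_) (+-comm 1 (product ps)) p∣) (∈⇒∣product p∈))

extend : ∀ i {S} → All Prime S → Unique S →
         Σ[ S′ ∈ List ℕ ] All Prime S′ × Unique S′ × length S′ ≡ i + length S × (∀ {p} → p ∈ S → p ∈ S′)
extend zero {S} pS uS = S , pS , uS , refl , λ p∈ → p∈
extend (suc i) pS uS with extend i pS uS
... | S′ , pS′ , uS′ , len , S⊆ with new-prime pS′
...   | p , pp , p∉ = p ∷ S′ , pp ∷ pS′ , All.tabulate (λ q∈ eq → p∉ (subst (_∈ S′) (sym eq) q∈)) ∷ uS′ , cong suc len , there ∘ S⊆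

solution-mono : ∀ {n} {v x : Vec ℚ n} {S S′} → (∀ {p} → p ∈ S → p ∈ S′) → IsNonDegenerateSolution v x S → IsNonDegenerateSolution v x S′
solution-mono S⊆ (units , sum≡1 , nd) = (λ i → proj₁ (units i) , λ p pp h → S⊆ (proj₂ (units i) p pp h)) , sum≡1 , nd

between : ∀ (f : ℕ → ℕ) → (∀ t → t < f t) → ∀ t₀ s → f t₀ ≤ s → ∃[ t ] t₀ ≤ t × f t ≤ s × s < f (suc t)
between f t<f t₀ s h = search s t₀ (m≤n+m s t₀) h
  where
  search : ∀ fuel t → s ≤ t + fuel → f t ≤ s → ∃[ u ] t ≤ u × f u ≤ s × s < f (suc u)
  search zero t s≤ h = t , ≤-refl , h , ≤-<-trans (≤-trans s≤ (≤-reflexive (+-identityʳ t))) (<-trans (n<1+n t) (t<f (suc t)))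
  search (suc fuel) t s≤ h with f (suc t) ≤? s
  ... | no ≰ = t , ≤-refl , h , ≰⇒> ≰
  ... | yes ≤s with search fuel (suc t) (≤-trans s≤ (≤-reflexive (+-suc t fuel))) ≤s
  ...   | u , t<u , h₁ , h₂ = u , <⇒≤ t<u , h₁ , h₂

module Growth (m K c : ℕ) where

  private
    n α : ℕ
    n = suc m
    α = a n

  E : ℕ → ℕ
  E t = c + suc t * α

  rate : ℕ
  rate = 2 * K * 2 ^ (c * m + α * m) * n * (c + 2 * α)

  n*e : n * e n ≡ m * α + 1
  n*e = solve 2 (λ m B → (con 1 :+ m) :* (con 1 :+ m :* B) := m :* (con 1 :+ (con 1 :+ m) :* B) :+ con 1) refl m (B n)
    where open +-*-Solver

  growth : ∀ t → 1 ≤ t → rate * rate ≤ t → 4 ^ (K * (2 ^ E t) ^ m * (n * E t)) ≤ 2 ^ 2 ^ (n * t * e n)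
  growth t 1≤t h = begin
    4 ^ (K * (2 ^ E t) ^ m * (n * E t)) ≡⟨ ^-*-assoc 2 2 (K * (2 ^ E t) ^ m * (n * E t)) ⟩
    2 ^ (2 * (K * (2 ^ E t) ^ m * (n * E t))) ≤⟨ 2^-mono exponents ⟩
    2 ^ 2 ^ (n * t * e n) ∎
    where
    open ≤-Reasoning
    open +-*-Solver
    split : (2 ^ E t) ^ m ≡ 2 ^ (c * m + α * m) * 2 ^ (t * (m * α))
    split = trans (^-*-assoc 2 (E t) m) (trans (cong (2 ^_)
      (solve 4 (λ c t α m → (c :+ (con 1 :+ t) :* α) :* m := (c :* m :+ α :* m) :+ t :* (m :* α)) refl c t α m))
      (^-distribˡ-+-* 2 (c * m + α * m) (t * (m * α))))
    E≤ : E t ≤ (c + 2 * α) * t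
    E≤ = begin
      c + (α + t * α) ≤⟨ +-mono-≤ (m≤m*n c t {{>-nonZero 1≤t}}) (+-monoˡ-≤ (t * α) (m≤n*m α t {{>-nonZero 1≤t}})) ⟩
      c * t + (t * α + t * α) ≡⟨ solve 3 (λ c t α → c :* t :+ (t :* α :+ t :* α) := (c :+ con 2 :* α) :* t) refl c t α ⟩
      (c + 2 * α) * t ∎
    exponents : 2 * (K * (2 ^ E t) ^ m * (n * E t)) ≤ 2 ^ (n * t * e n)
    exponents = begin
      2 * (K * (2 ^ E t) ^ m * (n * E t)) ≡⟨ cong (λ z → 2 * (K * z * (n * E t))) split ⟩
      2 * (K * (x * y) * (n * E t)) ≤⟨ *-monoʳ-≤ 2 (*-monoʳ-≤ (K * (x * y)) (*-monoʳ-≤ n E≤)) ⟩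
      2 * (K * (x * y) * (n * ((c + 2 * α) * t)))
        ≡⟨ solve 6 (λ K x y n d t → con 2 :* (K :* (x :* y) :* (n :* (d :* t))) := y :* (con 2 :* K :* x :* n :* d :* t)) refl K x y n (c + 2 * α) t ⟩
      y * (rate * t) ≤⟨ *-monoʳ-≤ y (c*n≤2^n rate t h) ⟩
      y * 2 ^ t ≡⟨ 2^-* (t * (m * α)) t ⟩
      2 ^ (t * (m * α) + t) ≡⟨ cong (2 ^_) (solve 2 (λ t x → t :* x :+ t := t :* (x :+ con 1)) refl t (m * α)) ⟩
      2 ^ (t * (m * α + 1)) ≡⟨ cong (λ z → 2 ^ (t * z)) n*e ⟨
      2 ^ (t * (n * e n)) ≡⟨ cong (2 ^_) (solve 3 (λ t n e → t :* (n :* e) := n :* t :* e) refl t n (e n)) ⟩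
      2 ^ (n * t * e n) ∎
      where
      x = 2 ^ (c * m + α * m)
      y = 2 ^ (t * (m * α))

  bound-s : ∀ t s → s < c * 2 ^ (n * suc t * α) → s ≤ (2 ^ E t) ^ n × s ≤ 2 ^ (n * E t)
  bound-s t s s< = ≤-trans s≤ (≤-reflexive (trans (cong (2 ^_) (*-comm n (E t))) (sym (^-*-assoc 2 (E t) n)))) , s≤
    where
    open ≤-Reasoning
    open +-*-Solver
    s≤ : s ≤ 2 ^ (n * E t)
    s≤ = begin
      s ≤⟨ <⇒≤ s< ⟩
      c * 2 ^ (n * suc t * α) ≤⟨ *-monoˡ-≤ (2 ^ (n * suc t * α)) (≤-trans (<⇒≤ (n<2^n c)) (2^-mono (m≤n*m c n))) ⟩
      2 ^ (n * c) * 2 ^ (n * suc t * α) ≡⟨ 2^-* (n * c) (n * suc t * α) ⟩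
      2 ^ (n * c + n * suc t * α) ≡⟨ cong (2 ^_) (solve 4 (λ n c t α → n :* c :+ n :* t :* α := n :* (c :+ t :* α)) refl n c (suc t) α) ⟩
      2 ^ (n * E t) ∎

module _ (m : ℕ) (2≤n : 2 ≤ suc m) (ε : ℝ) (v : Vec ℚ (suc m)) (K c T : ℕ) (1≤c : 1 ≤ c)
  (upper : ∀ s (2≤s : 2 ≤ s) w h L → s ≤ suc w ^ suc m → s ≤ 2 ^ suc h → 4 ^ (K * suc w ^ m * suc h) ≤ L →
           solutionBound (suc m) s 2≤n 2≤s ε ≤ᴿ fromNat L)
  (lower : ∀ τ → T ≤ τ → SmallSet v c τ) where

  private
    n : ℕ
    n = suc m
    module G = Growth m K c

  f : ℕ → ℕ
  f t = c * 2 ^ (n * t * a n)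

  t<f : ∀ t → t < f t
  t<f t = <-≤-trans (n<2^n t) (≤-trans (2^-mono (≤-trans (m≤n*m t n) (m≤m*n (n * t) (a n)))) (m≤n*m (2 ^ (n * t * a n)) c {{>-nonZero 1≤c}}))

  Result : (s : ℕ) → 2 ≤ s → Set
  Result s 2≤s = Σ[ S ∈ List ℕ ] IsPrimeSetOfSize s S ×
    (Σ[ xs ∈ List (Vec ℚ n) ] Unique xs × All (λ x → IsNonDegenerateSolution v x S) xs ×
      solutionBound n s 2≤n 2≤s ε ≤ᴿ fromNat (length xs))

  at-scale : ∀ s (2≤s : 2 ≤ s) t → 1 ≤ t → G.rate * G.rate ≤ t → T ≤ n * t → f t ≤ s → s < f (suc t) → Result s 2≤s
  at-scale s 2≤s t 1≤t rate≤t T≤ ft≤s s<f with lower (n * t) T≤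
  ... | S , uS , pS , lenS , xs , uxs , sol , many with extend (s ∸ length S) pS uS
  ...   | S′ , pS′ , uS′ , lenS′ , S⊆ = S′ , (pS′ , uS′ , trans lenS′ (m∸n+n≡m (≤-trans lenS ft≤s))) , xs , uxs ,
    All.map (λ {x} → solution-mono {v = v} {x} S⊆) sol , real
    where
    w h : ℕ
    w = pred (2 ^ G.E t)
    h = pred (n * G.E t)
    suc-w : suc w ≡ 2 ^ G.E t
    suc-w = suc-pred (2 ^ G.E t) {{m^n≢0 2 (G.E t)}}
    suc-h : suc h ≡ n * G.E t
    suc-h = suc-pred (n * G.E t) {{>-nonZero (≤-trans (≤-trans 1≤c (m≤m+n c (suc t * a n))) (m≤n*m (G.E t) n))}}
    real : solutionBound n s 2≤n 2≤s ε ≤ᴿ fromNat (length xs)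
    real = upper s 2≤s w h (length xs)
      (subst (λ z → s ≤ z ^ n) (sym suc-w) (proj₁ (G.bound-s t s s<f)))
      (subst (λ z → s ≤ 2 ^ z) (sym suc-h) (proj₂ (G.bound-s t s s<f)))
      (≤-trans (≤-reflexive (cong₂ (λ x y → 4 ^ (K * x ^ m * y)) suc-w suc-h)) (≤-trans (G.growth t 1≤t rate≤t) (<⇒≤ many)))

  many-solutions : Σ[ s₀ ∈ ℕ ] Σ[ 2≤s₀ ∈ 2 ≤ s₀ ] ((s : ℕ) (s₀≤s : s₀ ≤ s) → Result s (≤-trans 2≤s₀ s₀≤s))
  many-solutions = 2 + f t₀ , s≤s (s≤s z≤n) , λ s s₀≤s →
    let t , t₀≤t , ft≤s , s<f = between f t<f t₀ s (≤-trans (m≤n+m (f t₀) 2) s₀≤s) in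
    at-scale s (≤-trans (s≤s (s≤s z≤n)) s₀≤s) t (≤-trans (s≤s z≤n) t₀≤t)
      (≤-trans (≤-trans (m≤n+m (G.rate * G.rate) T) (n≤1+n (T + G.rate * G.rate))) t₀≤t)
      (≤-trans (≤-trans (≤-trans (m≤m+n T (G.rate * G.rate)) (n≤1+n (T + G.rate * G.rate))) t₀≤t) (m≤n*m t n)) ft≤s s<f
    where
    t₀ : ℕ
    t₀ = suc (T + G.rate * G.rate)

theorem1 : (n : ℕ) (2≤n : 2 ≤ n) (ε : ℝ) → 0ᴿ <ᴿ ε →
    (a : Vec ℚ n) → (∀ i → lookup a i ≢ 0ℚ) →
    Σ[ s₀ ∈ ℕ ] Σ[ 2≤s₀ ∈ 2 ≤ s₀ ]
    ((s : ℕ) (s₀≤s : s₀ ≤ s) →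
    Σ[ S ∈ List ℕ ] IsPrimeSetOfSize s S ×
    (Σ[ xs ∈ List (Vec ℚ n) ] Unique xs ×
    All (λ x → IsNonDegenerateSolution a x S) xs ×
    solutionBound n s 2≤n (≤-trans 2≤s₀ s₀≤s) ε ≤ᴿ fromNat (length xs)))
theorem1 zero ()
theorem1 (suc m) 2≤n ε _ v v≢0 = many-solutions m 2≤n ε v (proj₁ (real-bound (suc m) 2≤n ε)) (constant v) (threshold (suc m))
  (s≤s z≤n) (proj₂ (real-bound (suc m) 2≤n ε)) (small-sets (suc m) 2≤n v v≢0)
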